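{- There is a pre-model-structure on the category of fibrant cubical sets, formed by the two factorization systems described in the context: with $\mathcal{W}$ the class of equivalences, $\mathcal{C}$ the class of maps with the left lifting property with respect to $\mathcal{TF}_0$, and $\mathcal{F}$ the class of maps with the right lifting property with respect to all maps that have the left lifting property with respect to $\mathcal{F}_0$, the triple $(\mathcal{C},\mathcal{F},\mathcal{W})$ is a pre-model-structure. The factorizations are defined in the cubical type theory, so they are uniform and functorial.
   Context: A pre-model-structure on a category $C$ consists of three classes $(\mathcal{C},\mathcal{F},\mathcal{W})$ of maps of $C$ such that $\mathcal{W}$ satisfies 3-for-2 (if two of $f,g,gf$ are in $\mathcal{W}$ so is the third), and $(\mathcal{C},\mathcal{F}\cap\mathcal{W})$ and $(\mathcal{C}\cap\mathcal{W},\mathcal{F})$ are weak factorization systems on $C$. (No completeness or cocompleteness of $C$ is assumed.) Cubical sets (the model of Cohen, Coquand, Huber and Mörtberg): let $dM(J)$ be the free De Morgan algebra on a finite set $J$ of names. A cubical set $X$ is a covariant functor to sets on the category of finite sets of names, in which a map $f:I\to J$ is a function $I\to dM(J)$ (Kleisli composition); write $xf\in X(J)$ for the action of $f$ on $x\in X(I)$. The interval is $\mathbb{I}(J)=dM(J)$. The face lattice $\mathbb{F}(I)$ is the bounded distributive lattice generated by the symbols $(i=0),(i=1)$, $i\in I$, with relations $(i=0)\wedge(i=1)=0$; it is a cubical set $\mathbb{F}$. A family $A$ over a cubical set $\Gamma$ consists of sets $A\rho$ for $\rho\in\Gamma(I)$ with functorial restriction maps $A\rho\to A(\rho f)$. For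 $\phi\in\mathbb{F}(I)$ and $\rho\in\Gamma(I)$, a partial element of $A\rho$ of extent $\phi$ is a family $u_f\in A(\rho f)$, for all $f:I\to J$ with $\phi f=1$, with $u_f g=u_{fg}$, where $fg:I\to K$ is the composite of $f:I\to J$ followed by $g:J\to K$. A composition structure on $A$ assigns to every $I$, every name $i\notin I$, $\rho\in\Gamma(I\cup\{i\})$, $\phi\in\mathbb{F}(I)$, partial element $u$ of $A\rho$ of extent $\phi$, and $a_0\in A\rho(i0)$ that agrees with $u(i0)$ on $\phi$, an element $\mathrm{comp}(I,i,\rho,\phi,u,a_0)\in A\rho(i1)$ that agrees with $u(i1)$ on $\phi$, uniformly: for $f:I\to J$ and $j\notin J$, $\mathrm{comp}(I,i,\rho,\phi,u,a_0)f=\mathrm{comp}(J,j,\rho(f,i=j),\phi f,u(f,i=j),a_0f)$. Here $(i0),(i1)$ denote substitution of $0,1$ for $i$, and $(f,i=j)$ extends $f$ by $i\mapsto j$. A fibrant cubical set is a cubical set with a composition structure (as a family over the terminal object). The category of fibrant cubical sets has these as objects and all maps of cubical sets as morphisms. Fibrant families over fibrant cubical sets are the types of cubical type theory, and equality of maps below is strict equality (judgemental equality), not equality up to a path. $\mathrm{Path}_A\,a\,b$ is the type of maps $p:\mathbb{I}\to A$ with $p(0)=a$, $p(1)=b$. $\mathrm{Id}_A\,a\,b$ is the type of pairs $(p,\phi)$ with $p:\mathrm{Path}_A\,a\,b$ and $\phi:\mathbb{F}$ such that $p$ is constant at $a$ on $\phi$; write $1_a$ for the pair of the constant path and $\phi=1$.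 A type is Path-contractible if it has a center and a path from the center to every element, internally in the type theory. A map $f:A\to B$ is an equivalence if all its fibres $\Sigma_{x:A}\mathrm{Path}_B(f x)\,b$, $b:B$, are Path-contractible. $\mathcal{F}_0$ is the class of display maps $\pi_1:\Sigma AB\to A$, with $A$ a fibrant cubical set and $B$ a family over $A$ with a composition structure. $\mathcal{TF}_0$ is the class of display maps that are equivalences. Lifting properties refer to strictly commuting squares. The two factorizations of a map $f:A\to B$ are: (1) through $\Sigma_{(y;x)}\mathrm{Id}_B(f(x),y)$ ($y:B$, $x:A$), with first map $tc_f(a)=(f(a);a;1_{f(a)})$ and second map $\pi_1$, giving the weak factorization system $(\mathcal{C}\cap\mathcal{W},\mathcal{F})$; (2) through $C_f=\Sigma_{b:B}T_f(b)$, where $T_f(b)$ is the type of partial elements $[\phi\mapsto a]$ of $A$ of extent $\phi:\mathbb{F}$ with $f(a)=b$ on $\phi$, with first map $a\mapsto(f(a),[1\mapsto a])$ and second map $\pi_1$, giving the weak factorization system $(\mathcal{C},\mathcal{F}\cap\mathcal{W})$. Functorial means that the factorization extends to a functor on the arrow category; uniform means that the constructions are carried out in the type theory, and so are compatible with substitution. -}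

module Defs where

open import Level using (Level; 0ℓ) renaming (suc to lsuc; _⊔_ to _⊔ˡ_)
open import Data.Nat.Base using (ℕ; suc)
open import Data.Fin.Base using (Fin; zero; suc)
open import Data.Product.Base using (Σ; _×_; _,_; proj₁; proj₂; Σ-syntax)
open import Data.Unit.Polymorphic.Base using (⊤; tt)
open import Function.Bundles using (_⇔_)
open import Relation.Binary.Bundles using (Setoid)
open import Relation.Binary.Structures using (IsEquivalence)
open import Relation.Binary.PropositionalEquality.Core as ≡ using (_≡_)

private
  variable
    ℓ : Level
    I J K : ℕ

------------------------------------------------------------------------
-- Free De Morgan algebras and the category of names

-- A finite set of names is represented by its cardinality I, its names being
-- the elements of Fin I; I ∪ {i} with i fresh is suc I, with i = zero.

infixr 7 _∧_
infixr 6 _∨_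
infix  8 ~_
infix  4 _≈ᴵ_ _≈ᶠ_ _≈ʰ_ _⇒_

data dM (I : ℕ) : Set where
  name    : Fin I → dM I
  0ᴵ 1ᴵ   : dM I
  _∧_ _∨_ : dM I → dM I → dM I
  ~_      : dM I → dM I

data _≈ᴵ_ {I : ℕ} : dM I → dM I → Set where
  refl       : ∀ {r} → r ≈ᴵ r
  sym        : ∀ {r s} → r ≈ᴵ s → s ≈ᴵ r
  trans      : ∀ {r s t} → r ≈ᴵ s → s ≈ᴵ t → r ≈ᴵ t
  ∧-cong     : ∀ {r r′ s s′} → r ≈ᴵ r′ → s ≈ᴵ s′ → r ∧ s ≈ᴵ r′ ∧ s′
  ∨-cong     : ∀ {r r′ s s′} → r ≈ᴵ r′ → s ≈ᴵ s′ → r ∨ s ≈ᴵ r′ ∨ s′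
  ~-cong     : ∀ {r s} → r ≈ᴵ s → ~ r ≈ᴵ ~ s
  ∧-comm     : ∀ r s → r ∧ s ≈ᴵ s ∧ r
  ∨-comm     : ∀ r s → r ∨ s ≈ᴵ s ∨ r
  ∧-assoc    : ∀ r s t → (r ∧ s) ∧ t ≈ᴵ r ∧ (s ∧ t)
  ∨-assoc    : ∀ r s t → (r ∨ s) ∨ t ≈ᴵ r ∨ (s ∨ t)
  ∧-absorb-∨ : ∀ r s → r ∧ (r ∨ s) ≈ᴵ r
  ∨-absorb-∧ : ∀ r s → r ∨ (r ∧ s) ≈ᴵ r
  ∧-distr-∨  : ∀ r s t → r ∧ (s ∨ t) ≈ᴵ (r ∧ s) ∨ (r ∧ t)
  ∨-distr-∧  : ∀ r s t → r ∨ (s ∧ t) ≈ᴵ (r ∨ s) ∧ (r ∨ t)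
  ∧-1        : ∀ r → r ∧ 1ᴵ ≈ᴵ r
  ∨-0        : ∀ r → r ∨ 0ᴵ ≈ᴵ r
  ~-~        : ∀ r → ~ ~ r ≈ᴵ r
  ~-∧        : ∀ r s → ~ (r ∧ s) ≈ᴵ ~ r ∨ ~ s

_⇒_ : ℕ → ℕ → Set
I ⇒ J = Fin I → dM J

_≈ʰ_ : I ⇒ J → I ⇒ J → Set
f ≈ʰ g = ∀ i → f i ≈ᴵ g i

_⟨_⟩ : dM I → I ⇒ J → dM J
name i  ⟨ f ⟩ = f i
0ᴵ      ⟨ f ⟩ = 0ᴵ
1ᴵ      ⟨ f ⟩ = 1ᴵ
(r ∧ s) ⟨ f ⟩ = r ⟨ f ⟩ ∧ s ⟨ f ⟩
(r ∨ s) ⟨ f ⟩ = r ⟨ f ⟩ ∨ s ⟨ f ⟩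
(~ r)   ⟨ f ⟩ = ~ (r ⟨ f ⟩)

idʰ : I ⇒ I
idʰ = name

infixl 9 _⨟_

_⨟_ : I ⇒ J → J ⇒ K → I ⇒ K
(f ⨟ g) i = f i ⟨ g ⟩

weaken : I ⇒ suc I
weaken i = name (suc i)

-- The substitutions (i0) and (i1).
ι₀ ι₁ : suc I ⇒ I
ι₀ zero    = 0ᴵ
ι₀ (suc i) = name i
ι₁ zero    = 1ᴵ
ι₁ (suc i) = name i

-- The extension (f, i = j).
infix 10 _⁺

_⁺ : I ⇒ J → suc I ⇒ suc J
(f ⁺) zero    = name zero
(f ⁺) (suc i) = f i ⟨ weaken ⟩

⟨⟩-cong : ∀ {r s : dM I} {f g : I ⇒ J} → r ≈ᴵ s → f ≈ʰ g → r ⟨ f ⟩ ≈ᴵ s ⟨ g ⟩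
⟨⟩-cong {r = r} {f = f} {g} p q = trans (homs r) (eqs p)
  where
  homs : ∀ r → r ⟨ f ⟩ ≈ᴵ r ⟨ g ⟩
  homs (name i) = q i
  homs 0ᴵ       = refl
  homs 1ᴵ       = refl
  homs (r ∧ s)  = ∧-cong (homs r) (homs s)
  homs (r ∨ s)  = ∨-cong (homs r) (homs s)
  homs (~ r)    = ~-cong (homs r)

  eqs : ∀ {r s} → r ≈ᴵ s → r ⟨ g ⟩ ≈ᴵ s ⟨ g ⟩
  eqs refl               = refl
  eqs (sym p)            = sym (eqs p)
  eqs (trans p q)        = trans (eqs p) (eqs q)
  eqs (∧-cong p q)       = ∧-cong (eqs p) (eqs q)
  eqs (∨-cong p q)       = ∨-cong (eqs p) (eqs q)
  eqs (~-cong p)         = ~-cong (eqs p)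
  eqs (∧-comm r s)       = ∧-comm _ _
  eqs (∨-comm r s)       = ∨-comm _ _
  eqs (∧-assoc r s t)    = ∧-assoc _ _ _
  eqs (∨-assoc r s t)    = ∨-assoc _ _ _
  eqs (∧-absorb-∨ r s)   = ∧-absorb-∨ _ _
  eqs (∨-absorb-∧ r s)   = ∨-absorb-∧ _ _
  eqs (∧-distr-∨ r s t)  = ∧-distr-∨ _ _ _
  eqs (∨-distr-∧ r s t)  = ∨-distr-∧ _ _ _
  eqs (∧-1 r)            = ∧-1 _
  eqs (∨-0 r)            = ∨-0 _
  eqs (~-~ r)            = ~-~ _
  eqs (~-∧ r s)          = ~-∧ _ _

⟨⟩-id : ∀ (r : dM I) → r ⟨ idʰ ⟩ ≡ r
⟨⟩-id (name i) = ≡.refl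
⟨⟩-id 0ᴵ       = ≡.refl
⟨⟩-id 1ᴵ       = ≡.refl
⟨⟩-id (r ∧ s)  = ≡.cong₂ _∧_ (⟨⟩-id r) (⟨⟩-id s)
⟨⟩-id (r ∨ s)  = ≡.cong₂ _∨_ (⟨⟩-id r) (⟨⟩-id s)
⟨⟩-id (~ r)    = ≡.cong ~_ (⟨⟩-id r)

⟨⟩-⨟ : ∀ (r : dM I) (f : I ⇒ J) (g : J ⇒ K) → r ⟨ f ⟩ ⟨ g ⟩ ≡ r ⟨ f ⨟ g ⟩
⟨⟩-⨟ (name i) f g = ≡.refl
⟨⟩-⨟ 0ᴵ       f g = ≡.refl
⟨⟩-⨟ 1ᴵ       f g = ≡.refl
⟨⟩-⨟ (r ∧ s)  f g = ≡.cong₂ _∧_ (⟨⟩-⨟ r f g) (⟨⟩-⨟ s f g)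
⟨⟩-⨟ (r ∨ s)  f g = ≡.cong₂ _∨_ (⟨⟩-⨟ r f g) (⟨⟩-⨟ s f g)
⟨⟩-⨟ (~ r)    f g = ≡.cong ~_ (⟨⟩-⨟ r f g)

≡⇒≈ᴵ : ∀ {r s : dM I} → r ≡ s → r ≈ᴵ s
≡⇒≈ᴵ ≡.refl = refl

reflʰ : {f : I ⇒ J} → f ≈ʰ f
reflʰ i = refl

symʰ : {f g : I ⇒ J} → f ≈ʰ g → g ≈ʰ f
symʰ p i = sym (p i)

transʰ : {f g h : I ⇒ J} → f ≈ʰ g → g ≈ʰ h → f ≈ʰ h
transʰ p q i = trans (p i) (q i)

⨟-cong : {f f′ : I ⇒ J} {g g′ : J ⇒ K} → f ≈ʰ f′ → g ≈ʰ g′ → f ⨟ g ≈ʰ f′ ⨟ g′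
⨟-cong p q i = ⟨⟩-cong (p i) q

⨟-identityʳ : (f : I ⇒ J) → f ⨟ idʰ ≈ʰ f
⨟-identityʳ f i = ≡⇒≈ᴵ (⟨⟩-id (f i))

⨟-assoc : ∀ {L} (f : I ⇒ J) (g : J ⇒ K) (h : K ⇒ L) → (f ⨟ g) ⨟ h ≈ʰ f ⨟ (g ⨟ h)
⨟-assoc f g h i = ≡⇒≈ᴵ (⟨⟩-⨟ (f i) g h)

⁺-ι₀ : (f : I ⇒ J) → f ⁺ ⨟ ι₀ ≈ʰ ι₀ ⨟ f
⁺-ι₀ f zero    = refl
⁺-ι₀ f (suc i) = trans (≡⇒≈ᴵ (⟨⟩-⨟ (f i) weaken ι₀)) (≡⇒≈ᴵ (⟨⟩-id (f i)))

⁺-ι₁ : (f : I ⇒ J) → f ⁺ ⨟ ι₁ ≈ʰ ι₁ ⨟ f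
⁺-ι₁ f zero    = refl
⁺-ι₁ f (suc i) = trans (≡⇒≈ᴵ (⟨⟩-⨟ (f i) weaken ι₁)) (≡⇒≈ᴵ (⟨⟩-id (f i)))

------------------------------------------------------------------------
-- The face lattice

data Face (I : ℕ) : Set where
  _=0 _=1 : Fin I → Face I
  0ᶠ 1ᶠ   : Face I
  _∧_ _∨_ : Face I → Face I → Face I

data _≈ᶠ_ {I : ℕ} : Face I → Face I → Set where
  refl       : ∀ {φ} → φ ≈ᶠ φ
  sym        : ∀ {φ ψ} → φ ≈ᶠ ψ → ψ ≈ᶠ φ
  trans      : ∀ {φ ψ χ} → φ ≈ᶠ ψ → ψ ≈ᶠ χ → φ ≈ᶠ χ
  ∧-cong     : ∀ {φ φ′ ψ ψ′} → φ ≈ᶠ φ′ → ψ ≈ᶠ ψ′ → φ ∧ ψ ≈ᶠ φ′ ∧ ψ′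
  ∨-cong     : ∀ {φ φ′ ψ ψ′} → φ ≈ᶠ φ′ → ψ ≈ᶠ ψ′ → φ ∨ ψ ≈ᶠ φ′ ∨ ψ′
  ∧-comm     : ∀ φ ψ → φ ∧ ψ ≈ᶠ ψ ∧ φ
  ∨-comm     : ∀ φ ψ → φ ∨ ψ ≈ᶠ ψ ∨ φ
  ∧-assoc    : ∀ φ ψ χ → (φ ∧ ψ) ∧ χ ≈ᶠ φ ∧ (ψ ∧ χ)
  ∨-assoc    : ∀ φ ψ χ → (φ ∨ ψ) ∨ χ ≈ᶠ φ ∨ (ψ ∨ χ)
  ∧-absorb-∨ : ∀ φ ψ → φ ∧ (φ ∨ ψ) ≈ᶠ φ
  ∨-absorb-∧ : ∀ φ ψ → φ ∨ (φ ∧ ψ) ≈ᶠ φ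
  ∧-distr-∨  : ∀ φ ψ χ → φ ∧ (ψ ∨ χ) ≈ᶠ (φ ∧ ψ) ∨ (φ ∧ χ)
  ∨-distr-∧  : ∀ φ ψ χ → φ ∨ (ψ ∧ χ) ≈ᶠ (φ ∨ ψ) ∧ (φ ∨ χ)
  ∧-1        : ∀ φ → φ ∧ 1ᶠ ≈ᶠ φ
  ∨-0        : ∀ φ → φ ∨ 0ᶠ ≈ᶠ φ
  =0∧=1      : ∀ i → (i =0) ∧ (i =1) ≈ᶠ 0ᶠ

-- The faces (r = 0) and (r = 1) for r in the interval: the bounded lattice
-- maps dM(I)ᵒᵖ → 𝔽(I) and dM(I) → 𝔽(I) extending i ↦ (i = 0) and i ↦ (i = 1).
_=0ᶠ _=1ᶠ : dM I → Face I
name i  =0ᶠ = i =0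
0ᴵ      =0ᶠ = 1ᶠ
1ᴵ      =0ᶠ = 0ᶠ
(r ∧ s) =0ᶠ = (r =0ᶠ) ∨ (s =0ᶠ)
(r ∨ s) =0ᶠ = (r =0ᶠ) ∧ (s =0ᶠ)
(~ r)   =0ᶠ = r =1ᶠ
name i  =1ᶠ = i =1
0ᴵ      =1ᶠ = 0ᶠ
1ᴵ      =1ᶠ = 1ᶠ
(r ∧ s) =1ᶠ = (r =1ᶠ) ∧ (s =1ᶠ)
(r ∨ s) =1ᶠ = (r =1ᶠ) ∨ (s =1ᶠ)
(~ r)   =1ᶠ = r =0ᶠ

=0-cong : ∀ {r s : dM I} → r ≈ᴵ s → r =0ᶠ ≈ᶠ s =0ᶠ
=1-cong : ∀ {r s : dM I} → r ≈ᴵ s → r =1ᶠ ≈ᶠ s =1ᶠ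
=0-cong refl              = refl
=0-cong (sym p)           = sym (=0-cong p)
=0-cong (trans p q)       = trans (=0-cong p) (=0-cong q)
=0-cong (∧-cong p q)      = ∨-cong (=0-cong p) (=0-cong q)
=0-cong (∨-cong p q)      = ∧-cong (=0-cong p) (=0-cong q)
=0-cong (~-cong p)        = =1-cong p
=0-cong (∧-comm r s)      = ∨-comm _ _
=0-cong (∨-comm r s)      = ∧-comm _ _
=0-cong (∧-assoc r s t)   = ∨-assoc _ _ _
=0-cong (∨-assoc r s t)   = ∧-assoc _ _ _
=0-cong (∧-absorb-∨ r s)  = ∨-absorb-∧ _ _
=0-cong (∨-absorb-∧ r s)  = ∧-absorb-∨ _ _
=0-cong (∧-distr-∨ r s t) = ∨-distr-∧ _ _ _
=0-cong (∨-distr-∧ r s t) = ∧-distr-∨ _ _ _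
=0-cong (∧-1 r)           = ∨-0 _
=0-cong (∨-0 r)           = ∧-1 _
=0-cong (~-~ r)           = refl
=0-cong (~-∧ r s)         = refl
=1-cong refl              = refl
=1-cong (sym p)           = sym (=1-cong p)
=1-cong (trans p q)       = trans (=1-cong p) (=1-cong q)
=1-cong (∧-cong p q)      = ∧-cong (=1-cong p) (=1-cong q)
=1-cong (∨-cong p q)      = ∨-cong (=1-cong p) (=1-cong q)
=1-cong (~-cong p)        = =0-cong p
=1-cong (∧-comm r s)      = ∧-comm _ _
=1-cong (∨-comm r s)      = ∨-comm _ _
=1-cong (∧-assoc r s t)   = ∧-assoc _ _ _
=1-cong (∨-assoc r s t)   = ∨-assoc _ _ _
=1-cong (∧-absorb-∨ r s)  = ∧-absorb-∨ _ _
=1-cong (∨-absorb-∧ r s)  = ∨-absorb-∧ _ _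
=1-cong (∧-distr-∨ r s t) = ∧-distr-∨ _ _ _
=1-cong (∨-distr-∧ r s t) = ∨-distr-∧ _ _ _
=1-cong (∧-1 r)           = ∧-1 _
=1-cong (∨-0 r)           = ∨-0 _
=1-cong (~-~ r)           = refl
=1-cong (~-∧ r s)         = refl

0∧ : ∀ (φ : Face I) → 0ᶠ ∧ φ ≈ᶠ 0ᶠ
0∧ φ = trans (∧-cong refl (sym (trans (∨-comm _ _) (∨-0 φ)))) (∧-absorb-∨ 0ᶠ φ)

0∧∨0∧ : ∀ {α β γ δ : Face I} → α ∧ γ ≈ᶠ 0ᶠ → β ∧ δ ≈ᶠ 0ᶠ → (γ ∧ δ) ∧ (α ∨ β) ≈ᶠ 0ᶠ
0∧∨0∧ {α = α} {β} {γ} {δ} p q =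
  trans (∧-distr-∨ _ _ _) (trans (∨-cong left right) (∨-0 _))
  where
  left : (γ ∧ δ) ∧ α ≈ᶠ 0ᶠ
  left = trans (∧-comm _ _) (trans (sym (∧-assoc _ _ _)) (trans (∧-cong p refl) (0∧ _)))

  right : (γ ∧ δ) ∧ β ≈ᶠ 0ᶠ
  right = trans (∧-assoc _ _ _)
    (trans (∧-cong refl (trans (∧-comm _ _) q)) (trans (∧-comm _ _) (0∧ _)))

=0ᶠ∧=1ᶠ : ∀ (r : dM I) → (r =0ᶠ) ∧ (r =1ᶠ) ≈ᶠ 0ᶠ
=0ᶠ∧=1ᶠ (name i) = =0∧=1 i
=0ᶠ∧=1ᶠ 0ᴵ       = trans (∧-comm _ _) (∧-1 _)
=0ᶠ∧=1ᶠ 1ᴵ       = ∧-1 _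
=0ᶠ∧=1ᶠ (r ∧ s)  = trans (∧-comm _ _) (0∧∨0∧ (=0ᶠ∧=1ᶠ r) (=0ᶠ∧=1ᶠ s))
=0ᶠ∧=1ᶠ (r ∨ s)  =
  0∧∨0∧ (trans (∧-comm _ _) (=0ᶠ∧=1ᶠ r)) (trans (∧-comm _ _) (=0ᶠ∧=1ᶠ s))
=0ᶠ∧=1ᶠ (~ r)    = trans (∧-comm _ _) (=0ᶠ∧=1ᶠ r)

_⟨_⟩ᶠ : Face I → I ⇒ J → Face J
(i =0)  ⟨ f ⟩ᶠ = f i =0ᶠ
(i =1)  ⟨ f ⟩ᶠ = f i =1ᶠ
0ᶠ      ⟨ f ⟩ᶠ = 0ᶠ
1ᶠ      ⟨ f ⟩ᶠ = 1ᶠ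
(φ ∧ ψ) ⟨ f ⟩ᶠ = φ ⟨ f ⟩ᶠ ∧ ψ ⟨ f ⟩ᶠ
(φ ∨ ψ) ⟨ f ⟩ᶠ = φ ⟨ f ⟩ᶠ ∨ ψ ⟨ f ⟩ᶠ

⟨⟩ᶠ-cong : ∀ {φ ψ : Face I} {f g : I ⇒ J} → φ ≈ᶠ ψ → f ≈ʰ g → φ ⟨ f ⟩ᶠ ≈ᶠ ψ ⟨ g ⟩ᶠ
⟨⟩ᶠ-cong {φ = φ} {f = f} {g} p q = trans (homs φ) (eqs p)
  where
  homs : ∀ φ → φ ⟨ f ⟩ᶠ ≈ᶠ φ ⟨ g ⟩ᶠ
  homs (i =0)  = =0-cong (q i)
  homs (i =1)  = =1-cong (q i)
  homs 0ᶠ      = refl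
  homs 1ᶠ      = refl
  homs (φ ∧ ψ) = ∧-cong (homs φ) (homs ψ)
  homs (φ ∨ ψ) = ∨-cong (homs φ) (homs ψ)

  eqs : ∀ {φ ψ} → φ ≈ᶠ ψ → φ ⟨ g ⟩ᶠ ≈ᶠ ψ ⟨ g ⟩ᶠ
  eqs refl              = refl
  eqs (sym p)           = sym (eqs p)
  eqs (trans p q)       = trans (eqs p) (eqs q)
  eqs (∧-cong p q)      = ∧-cong (eqs p) (eqs q)
  eqs (∨-cong p q)      = ∨-cong (eqs p) (eqs q)
  eqs (∧-comm _ _)      = ∧-comm _ _
  eqs (∨-comm _ _)      = ∨-comm _ _
  eqs (∧-assoc _ _ _)   = ∧-assoc _ _ _
  eqs (∨-assoc _ _ _)   = ∨-assoc _ _ _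
  eqs (∧-absorb-∨ _ _)  = ∧-absorb-∨ _ _
  eqs (∨-absorb-∧ _ _)  = ∨-absorb-∧ _ _
  eqs (∧-distr-∨ _ _ _) = ∧-distr-∨ _ _ _
  eqs (∨-distr-∧ _ _ _) = ∨-distr-∧ _ _ _
  eqs (∧-1 _)           = ∧-1 _
  eqs (∨-0 _)           = ∨-0 _
  eqs (=0∧=1 i)         = =0ᶠ∧=1ᶠ (g i)

⟨⟩ᶠ-id : ∀ (φ : Face I) → φ ⟨ idʰ ⟩ᶠ ≈ᶠ φ
⟨⟩ᶠ-id (i =0)  = refl
⟨⟩ᶠ-id (i =1)  = refl
⟨⟩ᶠ-id 0ᶠ      = refl
⟨⟩ᶠ-id 1ᶠ      = refl
⟨⟩ᶠ-id (φ ∧ ψ) = ∧-cong (⟨⟩ᶠ-id φ) (⟨⟩ᶠ-id ψ)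
⟨⟩ᶠ-id (φ ∨ ψ) = ∨-cong (⟨⟩ᶠ-id φ) (⟨⟩ᶠ-id ψ)

=0ᶠ-⟨⟩ : ∀ (r : dM I) (g : I ⇒ J) → (r =0ᶠ) ⟨ g ⟩ᶠ ≈ᶠ r ⟨ g ⟩ =0ᶠ
=1ᶠ-⟨⟩ : ∀ (r : dM I) (g : I ⇒ J) → (r =1ᶠ) ⟨ g ⟩ᶠ ≈ᶠ r ⟨ g ⟩ =1ᶠ
=0ᶠ-⟨⟩ (name i) g = refl
=0ᶠ-⟨⟩ 0ᴵ       g = refl
=0ᶠ-⟨⟩ 1ᴵ       g = refl
=0ᶠ-⟨⟩ (r ∧ s)  g = ∨-cong (=0ᶠ-⟨⟩ r g) (=0ᶠ-⟨⟩ s g)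
=0ᶠ-⟨⟩ (r ∨ s)  g = ∧-cong (=0ᶠ-⟨⟩ r g) (=0ᶠ-⟨⟩ s g)
=0ᶠ-⟨⟩ (~ r)    g = =1ᶠ-⟨⟩ r g
=1ᶠ-⟨⟩ (name i) g = refl
=1ᶠ-⟨⟩ 0ᴵ       g = refl
=1ᶠ-⟨⟩ 1ᴵ       g = refl
=1ᶠ-⟨⟩ (r ∧ s)  g = ∧-cong (=1ᶠ-⟨⟩ r g) (=1ᶠ-⟨⟩ s g)
=1ᶠ-⟨⟩ (r ∨ s)  g = ∨-cong (=1ᶠ-⟨⟩ r g) (=1ᶠ-⟨⟩ s g)
=1ᶠ-⟨⟩ (~ r)    g = =0ᶠ-⟨⟩ r g

⟨⟩ᶠ-⨟ : ∀ (φ : Face I) (f : I ⇒ J) (g : J ⇒ K) → φ ⟨ f ⟩ᶠ ⟨ g ⟩ᶠ ≈ᶠ φ ⟨ f ⨟ g ⟩ᶠ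
⟨⟩ᶠ-⨟ (i =0)  f g = =0ᶠ-⟨⟩ (f i) g
⟨⟩ᶠ-⨟ (i =1)  f g = =1ᶠ-⟨⟩ (f i) g
⟨⟩ᶠ-⨟ 0ᶠ      f g = refl
⟨⟩ᶠ-⨟ 1ᶠ      f g = refl
⟨⟩ᶠ-⨟ (φ ∧ ψ) f g = ∧-cong (⟨⟩ᶠ-⨟ φ f g) (⟨⟩ᶠ-⨟ ψ f g)
⟨⟩ᶠ-⨟ (φ ∨ ψ) f g = ∨-cong (⟨⟩ᶠ-⨟ φ f g) (⟨⟩ᶠ-⨟ ψ f g)

extent-⁺ : ∀ (φ : Face I) {ψ : Face J} (f : I ⇒ J) → φ ⟨ f ⟩ᶠ ≈ᶠ ψ →
           φ ⟨ weaken ⟩ᶠ ⟨ f ⁺ ⟩ᶠ ≈ᶠ ψ ⟨ weaken ⟩ᶠ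
extent-⁺ φ f c = trans (⟨⟩ᶠ-⨟ φ weaken (f ⁺))
  (trans (sym (⟨⟩ᶠ-⨟ φ f weaken)) (⟨⟩ᶠ-cong c (reflʰ {f = weaken})))

------------------------------------------------------------------------
-- Cubical sets

-- Sets are setoids, so that quotients and function sets are available.

record CubicalSet (ℓ : Level) : Set (lsuc ℓ) where
  no-eta-equality
  infixl 9 _·_
  infix  4 _≈_
  field
    cells : ℕ → Setoid ℓ ℓ

  Cell : ℕ → Set ℓ
  Cell I = Setoid.Carrier (cells I)

  _≈_ : Cell I → Cell I → Set ℓ
  _≈_ {I} = Setoid._≈_ (cells I)

  field
    _·_    : Cell I → I ⇒ J → Cell J
    ·-cong : ∀ {x y : Cell I} {f g : I ⇒ J} → x ≈ y → f ≈ʰ g → x · f ≈ y · g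
    ·-id   : ∀ {x : Cell I} → x · idʰ ≈ x
    ·-⨟    : ∀ {x : Cell I} {f : I ⇒ J} {g : J ⇒ K} → x · f · g ≈ x · (f ⨟ g)

  reflˣ : ∀ {x : Cell I} → x ≈ x
  reflˣ {I} = Setoid.refl (cells I)

  symˣ : ∀ {x y : Cell I} → x ≈ y → y ≈ x
  symˣ {I} = Setoid.sym (cells I)

  transˣ : ∀ {x y z : Cell I} → x ≈ y → y ≈ z → x ≈ z
  transˣ {I} = Setoid.trans (cells I)

  ·-via : ∀ {x : Cell I} {f : I ⇒ J} {g : J ⇒ K} {h : I ⇒ K} → f ⨟ g ≈ʰ h → x · f · g ≈ x · h
  ·-via p = transˣ ·-⨟ (·-cong reflˣ p)

  ·-shift : ∀ {x : Cell I} {y : Cell J} {f : I ⇒ J} {g : J ⇒ K} → x · f ≈ y → x · (f ⨟ g) ≈ y · g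
  ·-shift e = transˣ (symˣ ·-⨟) (·-cong e reflʰ)

  ⁺-at : (ι : ∀ {I} → suc I ⇒ I) {ρ : Cell (suc I)} {ρ′ : Cell (suc J)} {f : I ⇒ J} →
         f ⁺ ⨟ ι ≈ʰ ι ⨟ f → ρ · f ⁺ ≈ ρ′ → ρ · ι · f ≈ ρ′ · ι
  ⁺-at ι p e = transˣ ·-⨟ (transˣ (symˣ (·-via p)) (·-cong e reflʰ))

module _ where
  open CubicalSet

  𝕀 𝔽 : CubicalSet 0ℓ
  𝕀 .cells I = record
    { Carrier = dM I ; _≈_ = _≈ᴵ_
    ; isEquivalence = record { refl = refl ; sym = sym ; trans = trans } }
  𝕀 ._·_    = _⟨_⟩
  𝕀 .·-cong = ⟨⟩-cong
  𝕀 .·-id {x = r} = ≡⇒≈ᴵ (⟨⟩-id r)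
  𝕀 .·-⨟ {x = r} {f} {g} = ≡⇒≈ᴵ (⟨⟩-⨟ r f g)
  𝔽 .cells I = record
    { Carrier = Face I ; _≈_ = _≈ᶠ_
    ; isEquivalence = record { refl = refl ; sym = sym ; trans = trans } }
  𝔽 ._·_    = _⟨_⟩ᶠ
  𝔽 .·-cong = ⟨⟩ᶠ-cong
  𝔽 .·-id {x = φ} = ⟨⟩ᶠ-id φ
  𝔽 .·-⨟ {x = φ} {f} {g} = ⟨⟩ᶠ-⨟ φ f g

  𝟙 : CubicalSet ℓ
  𝟙 .cells I = record
    { Carrier = ⊤ ; _≈_ = λ _ _ → ⊤
    ; isEquivalence = record { refl = tt ; sym = λ _ → tt ; trans = λ _ _ → tt } }
  𝟙 ._·_    = λ _ _ → tt
  𝟙 .·-cong = λ _ _ → tt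
  𝟙 .·-id   = tt
  𝟙 .·-⨟    = tt

record CubicalMap (Δ Γ : CubicalSet ℓ) : Set ℓ where
  no-eta-equality
  private
    module Δ = CubicalSet Δ
    module Γ = CubicalSet Γ
  field
    map     : Δ.Cell I → Γ.Cell I
    cong    : ∀ {δ δ′ : Δ.Cell I} → δ Δ.≈ δ′ → map δ Γ.≈ map δ′
    natural : ∀ {δ : Δ.Cell I} {f : I ⇒ J} → map δ Γ.· f Γ.≈ map (δ Δ.· f)

  natural′ : ∀ {δ : Δ.Cell I} {δ′ : Δ.Cell J} {f : I ⇒ J} → δ Δ.· f Δ.≈ δ′ → map δ Γ.· f Γ.≈ map δ′
  natural′ e = Γ.transˣ natural (cong e)

  natural² : ∀ {δ : Δ.Cell I} {f : I ⇒ J} {g : J ⇒ K} → map δ Γ.· f Γ.· g Γ.≈ map (δ Δ.· f Δ.· g)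
  natural² = Γ.transˣ (Γ.·-cong natural reflʰ) natural

------------------------------------------------------------------------
-- Families

-- A restriction map Aρ → Aρ′ is given for every f and every proof that
-- ρf = ρ′: besides the maps Aρ → A(ρf), these are the identifications of Aρ
-- with Aρ′ for equal ρ and ρ′, which are needed because equality in Γ is a
-- setoid equality.

record Family {ℓ} (Γ : CubicalSet ℓ) : Set (lsuc ℓ) where
  no-eta-equality
  open CubicalSet Γ
  infix 4 _≋_
  field
    fibre : Cell I → Setoid ℓ ℓ

  Elem : Cell I → Set ℓ
  Elem ρ = Setoid.Carrier (fibre ρ)

  _≋_ : {ρ : Cell I} → Elem ρ → Elem ρ → Set ℓ
  _≋_ {ρ = ρ} = Setoid._≈_ (fibre ρ)

  field
    restrict      : {ρ : Cell I} {ρ′ : Cell J} (f : I ⇒ J) → ρ · f ≈ ρ′ → Elem ρ → Elem ρ′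
    restrict-cong : {ρ : Cell I} {ρ′ : Cell J} {f g : I ⇒ J} {e : ρ · f ≈ ρ′} {e′ : ρ · g ≈ ρ′}
                    {x y : Elem ρ} → f ≈ʰ g → x ≋ y → restrict f e x ≋ restrict g e′ y
    restrict-id   : {ρ : Cell I} {e : ρ · idʰ ≈ ρ} {x : Elem ρ} → restrict idʰ e x ≋ x
    restrict-⨟    : {ρ : Cell I} {ρ′ : Cell J} {ρ″ : Cell K} {f : I ⇒ J} {g : J ⇒ K}
                    {e : ρ · f ≈ ρ′} {e′ : ρ′ · g ≈ ρ″} {e″ : ρ · (f ⨟ g) ≈ ρ″} {x : Elem ρ} →
                    restrict g e′ (restrict f e x) ≋ restrict (f ⨟ g) e″ x

  reflᵃ : {ρ : Cell I} {x : Elem ρ} → x ≋ x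
  reflᵃ {ρ = ρ} = Setoid.refl (fibre ρ)

  symᵃ : {ρ : Cell I} {x y : Elem ρ} → x ≋ y → y ≋ x
  symᵃ {ρ = ρ} = Setoid.sym (fibre ρ)

  transᵃ : {ρ : Cell I} {x y z : Elem ρ} → x ≋ y → y ≋ z → x ≋ z
  transᵃ {ρ = ρ} = Setoid.trans (fibre ρ)

  cast : {ρ ρ′ : Cell I} → ρ ≈ ρ′ → Elem ρ → Elem ρ′
  cast e = restrict idʰ (transˣ ·-id e)

  restrict-≋ : {ρ : Cell I} {ρ′ : Cell J} {f : I ⇒ J} {e e′ : ρ · f ≈ ρ′} {x y : Elem ρ} →
               x ≋ y → restrict f e x ≋ restrict f e′ y
  restrict-≋ = restrict-cong reflʰ

  restrict-resp : {ρ : Cell I} {ρ′ : Cell J} {f : I ⇒ J} {e : ρ · f ≈ ρ′} {x y : Elem ρ} →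
                  x ≋ y → restrict f e x ≋ restrict f e y
  restrict-resp = restrict-≋

  restrict-via : {ρ : Cell I} {ρ′ : Cell J} {ρ″ : Cell K} {f : I ⇒ J} {g : J ⇒ K} {h : I ⇒ K}
                 {e : ρ · f ≈ ρ′} {e′ : ρ′ · g ≈ ρ″} {e″ : ρ · h ≈ ρ″} {x : Elem ρ} → f ⨟ g ≈ʰ h →
                 restrict g e′ (restrict f e x) ≋ restrict h e″ x
  restrict-via {e″ = e″} p =
    transᵃ (restrict-⨟ {e″ = transˣ (·-cong reflˣ p) e″}) (restrict-cong p reflᵃ)

  restrict-square : ∀ {L} {ρ : Cell I} {ρ₁ : Cell J} {ρ₂ : Cell K} {ρ₃ : Cell L}
                    {f : I ⇒ J} {g : J ⇒ L} {f′ : I ⇒ K} {g′ : K ⇒ L}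
                    {e : ρ · f ≈ ρ₁} {d : ρ₁ · g ≈ ρ₃} {e′ : ρ · f′ ≈ ρ₂} {d′ : ρ₂ · g′ ≈ ρ₃}
                    {x : Elem ρ} → f ⨟ g ≈ʰ f′ ⨟ g′ →
                    restrict g d (restrict f e x) ≋ restrict g′ d′ (restrict f′ e′ x)
  restrict-square {e′ = e′} {d′} p =
    transᵃ (restrict-via {e″ = transˣ (transˣ (symˣ ·-⨟) (·-cong e′ reflʰ)) d′} p) (symᵃ restrict-⨟)

  cast-restrict : {ρ : Cell I} {ρ₁ ρ′ : Cell J} {f : I ⇒ J}
                  {e : ρ · f ≈ ρ₁} {d : ρ₁ ≈ ρ′} {e′ : ρ · f ≈ ρ′} {x : Elem ρ} →
                  cast d (restrict f e x) ≋ restrict f e′ x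
  cast-restrict = restrict-via (⨟-identityʳ _)

  restrict-cast : {ρ ρ₁ : Cell I} {ρ′ : Cell J} {f : I ⇒ J}
                  {d : ρ ≈ ρ₁} {e : ρ₁ · f ≈ ρ′} {e′ : ρ · f ≈ ρ′} {x : Elem ρ} →
                  restrict f e (cast d x) ≋ restrict f e′ x
  restrict-cast = restrict-via reflʰ

module _ {Δ Γ : CubicalSet ℓ} where
  open Family

  infixl 10 _[_]

  _[_] : Family Γ → CubicalMap Δ Γ → Family Δ
  (A [ σ ]) .fibre ρ       = fibre A (CubicalMap.map σ ρ)
  (A [ σ ]) .restrict f e  = restrict A f (CubicalMap.natural′ σ e)
  (A [ σ ]) .restrict-cong = restrict-cong A
  (A [ σ ]) .restrict-id   = restrict-id A
  (A [ σ ]) .restrict-⨟    = restrict-⨟ A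

module _ (Γ : CubicalSet ℓ) (A : Family Γ) where
  open CubicalSet Γ
  open Family A

  infixl 6 _▷_

  _▷_ : CubicalSet ℓ
  CubicalSet.cells _▷_ I = record
    { Carrier       = Σ (Cell I) Elem
    ; _≈_           = λ (ρ , x) (ρ′ , x′) → Σ[ e ∈ ρ ≈ ρ′ ] cast e x ≋ x′
    ; isEquivalence = record
      { refl  = reflˣ , restrict-id
      ; sym   = λ (e , p) → symˣ e ,
          transᵃ (restrict-≋ {e′ = transˣ ·-id (symˣ e)} (symᵃ p))
            (transᵃ (restrict-cast {e′ = ·-id}) restrict-id)
      ; trans = λ (e , p) (e′ , p′) → transˣ e e′ ,
          transᵃ (transᵃ (symᵃ (restrict-cast {e = transˣ ·-id e′})) (restrict-≋ p)) p′
      }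
    }
  CubicalSet._·_ _▷_ (ρ , x) f = ρ · f , restrict f reflˣ x
  CubicalSet.·-cong _▷_ {f = f} {g} (e , p) q = ·-cong e q ,
    transᵃ (restrict-via {e″ = ·-cong e reflʰ} λ i → trans (⨟-identityʳ f i) (q i))
      (transᵃ (symᵃ (restrict-cast {f = g} {e = reflˣ})) (restrict-≋ p))
  CubicalSet.·-id _▷_ = ·-id , transᵃ (cast-restrict {e′ = ·-id}) restrict-id
  CubicalSet.·-⨟  _▷_ = ·-⨟ , transᵃ (cast-restrict {e′ = ·-⨟}) restrict-⨟

π : {Γ : CubicalSet ℓ} (A : Family Γ) → CubicalMap (Γ ▷ A) Γ
CubicalMap.map     (π A)         = proj₁
CubicalMap.cong    (π A)         = proj₁
CubicalMap.natural (π {Γ = Γ} A) = CubicalSet.reflˣ Γ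

record Section {Γ : CubicalSet ℓ} (A : Family Γ) : Set ℓ where
  no-eta-equality
  open CubicalSet Γ
  open Family A
  field
    sec     : (ρ : Cell I) → Elem ρ
    natural : ∀ {ρ : Cell I} {ρ′ : Cell J} {f : I ⇒ J} {e : ρ · f ≈ ρ′} →
              restrict f e (sec ρ) ≋ sec ρ′

infix 3 _⟶_

record _⟶_ {Γ : CubicalSet ℓ} (A B : Family Γ) : Set ℓ where
  no-eta-equality
  open CubicalSet Γ
  private
    module A = Family A
    module B = Family B
  field
    map     : {ρ : Cell I} → A.Elem ρ → B.Elem ρ
    cong    : {ρ : Cell I} {x y : A.Elem ρ} → x A.≋ y → map x B.≋ map y
    natural : {ρ : Cell I} {ρ′ : Cell J} {f : I ⇒ J} {e : ρ · f ≈ ρ′} {x : A.Elem ρ} →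
              B.restrict f e (map x) B.≋ map (A.restrict f e x)

module _ {Δ Γ : CubicalSet ℓ} where

  infixl 10 _[_]ˢ _[_]ᵐ

  _[_]ˢ : {A : Family Γ} → Section A → (σ : CubicalMap Δ Γ) → Section (A [ σ ])
  Section.sec     (s [ σ ]ˢ) ρ = Section.sec s (CubicalMap.map σ ρ)
  Section.natural (s [ σ ]ˢ)   = Section.natural s

  _[_]ᵐ : {A B : Family Γ} → A ⟶ B → (σ : CubicalMap Δ Γ) → A [ σ ] ⟶ B [ σ ]
  _⟶_.map     (F [ σ ]ᵐ) = _⟶_.map F
  _⟶_.cong    (F [ σ ]ᵐ) = _⟶_.cong F
  _⟶_.natural (F [ σ ]ᵐ) = _⟶_.natural F

module _ {Γ : CubicalSet ℓ} where
  open CubicalSet Γ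

  infix 4 _≈ᵐ_

  _≈ᵐ_ : {A B : Family Γ} → A ⟶ B → A ⟶ B → Set ℓ
  _≈ᵐ_ {A} {B} F G =
    ∀ {I} {ρ : Cell I} (x : Family.Elem A ρ) → Family._≋_ B (_⟶_.map F x) (_⟶_.map G x)

  idᵐ : {A : Family Γ} → A ⟶ A
  _⟶_.map     idᵐ x   = x
  _⟶_.cong    idᵐ p   = p
  _⟶_.natural (idᵐ {A}) = Family.reflᵃ A

  infixr 9 _∘ᵐ_

  _∘ᵐ_ : {A B C : Family Γ} → B ⟶ C → A ⟶ B → A ⟶ C
  _⟶_.map     (G ∘ᵐ F) x = _⟶_.map G (_⟶_.map F x)
  _⟶_.cong    (G ∘ᵐ F) p = _⟶_.cong G (_⟶_.cong F p)
  _⟶_.natural (_∘ᵐ_ {C = C} G F) =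
    Family.transᵃ C (_⟶_.natural G) (_⟶_.cong G (_⟶_.natural F))

  infixr 9 _$ˢ_

  _$ˢ_ : {A B : Family Γ} → A ⟶ B → Section A → Section B
  Section.sec     (F $ˢ s) ρ = _⟶_.map F (Section.sec s ρ)
  Section.natural (_$ˢ_ {B = B} F s) =
    Family.transᵃ B (_⟶_.natural F) (_⟶_.cong F (Section.natural s))

  -- The generic element of A.
  var : (A : Family Γ) → Section (A [ π A ])
  Section.sec     (var A) = proj₂
  Section.natural (var A) {e = e , p} = transᵃ (symᵃ cast-restrict) p
    where open Family A

module _ {Δ Γ : CubicalSet ℓ} (σ : CubicalMap Δ Γ) (A : Family Γ) {A′ : Family Δ} (F : A′ ⟶ A [ σ ]) where
  open CubicalMap σ
  open Family A
  private
    module F = _⟶_ F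

  infixl 6 _▷⟨_⟩_

  _▷⟨_⟩_ : CubicalMap (Δ ▷ A′) (Γ ▷ A)
  CubicalMap.map     _▷⟨_⟩_ (δ , x) = map δ , F.map x
  CubicalMap.cong    _▷⟨_⟩_ (e , p) = cong e , transᵃ (restrict-≋ reflᵃ) (transᵃ F.natural (F.cong p))
  CubicalMap.natural _▷⟨_⟩_         = natural , transᵃ cast-restrict F.natural

------------------------------------------------------------------------
-- Partial elements and composition structures

record Partial {Γ : CubicalSet ℓ} (A : Family Γ) (ρ : CubicalSet.Cell Γ I) (φ : Face I) : Set ℓ where
  no-eta-equality
  open CubicalSet Γ
  open Family A
  field
    at         : (f : I ⇒ J) → φ ⟨ f ⟩ᶠ ≈ᶠ 1ᶠ → Elem (ρ · f)
    compatible : {f : I ⇒ J} {g : J ⇒ K} {h : I ⇒ K} {p : φ ⟨ f ⟩ᶠ ≈ᶠ 1ᶠ} {q : φ ⟨ h ⟩ᶠ ≈ᶠ 1ᶠ}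
                 (c : f ⨟ g ≈ʰ h) → restrict g (·-via c) (at f p) ≋ at h q

  at-≈ : {f h : I ⇒ J} {p : φ ⟨ f ⟩ᶠ ≈ᶠ 1ᶠ} {q : φ ⟨ h ⟩ᶠ ≈ᶠ 1ᶠ} {ρ′ : Cell J}
         {e : ρ · f ≈ ρ′} {d : ρ · h ≈ ρ′} → f ≈ʰ h → cast e (at f p) ≋ cast d (at h q)
  at-≈ {f = f} {h} {d = d} c = transᵃ
    (symᵃ (restrict-via {f = idʰ} {g = idʰ} {e = ·-via c′} {e′ = transˣ ·-id d} reflʰ))
    (restrict-≋ (compatible c′))
    where
    c′ : f ⨟ idʰ ≈ʰ h
    c′ = transʰ {g = f} (⨟-identityʳ f) c

  at-irrelevant : (f : I ⇒ J) (p q : φ ⟨ f ⟩ᶠ ≈ᶠ 1ᶠ) → at f p ≋ at f q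
  at-irrelevant f p q = transᵃ (symᵃ restrict-id) (compatible (⨟-identityʳ f))

module _ {Γ : CubicalSet ℓ} {A : Family Γ} where
  open CubicalSet Γ
  open Family A

  infix 4 _≋ₚ_

  _≋ₚ_ : {ρ : Cell I} {φ ψ : Face I} → Partial A ρ φ → Partial A ρ ψ → Set ℓ
  _≋ₚ_ {I} u v = ∀ {J} (f : I ⇒ J) p q → Partial.at u f p ≋ Partial.at v f q

  reindex : {ρ : Cell I} {ρ′ : Cell J} {φ : Face I} {ψ : Face J} (f : I ⇒ J) →
            ρ · f ≈ ρ′ → φ ⟨ f ⟩ᶠ ≈ᶠ ψ → Partial A ρ φ → Partial A ρ′ ψ
  Partial.at (reindex {φ = φ} f e c u) g p =
    cast (·-shift e) (Partial.at u (f ⨟ g) (trans (sym (⟨⟩ᶠ-⨟ φ f g)) (trans (⟨⟩ᶠ-cong c (reflʰ {f = g})) p)))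
  Partial.compatible (reindex f e c u) {f = g} {g = h} {h = k} d =
    transᵃ (restrict-square {e′ = ·-via d′} {d′ = transˣ ·-id (·-shift e)} (symʰ (⨟-identityʳ h)))
      (restrict-≋ (Partial.compatible u d′))
    where
    d′ : f ⨟ g ⨟ h ≈ʰ f ⨟ k
    d′ i = trans (⨟-assoc f g h i) (⟨⟩-cong (refl {r = f i}) d)

  AgreesOn : {ρ : Cell I} (φ : Face I) → Partial A ρ φ → Elem ρ → Set ℓ
  AgreesOn {I} φ u a = ∀ {J} (f : I ⇒ J) (p : φ ⟨ f ⟩ᶠ ≈ᶠ 1ᶠ) → restrict f reflˣ a ≋ Partial.at u f p

  -- An extent φ ∈ 𝔽(I) is regarded as an element of 𝔽(I ∪ {i}) through weaken.
  _at₀ : {ρ : Cell (suc I)} {φ : Face I} → Partial A ρ (φ ⟨ weaken ⟩ᶠ) → Partial A (ρ · ι₀) φ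
  _at₀ {φ = φ} = reindex ι₀ reflˣ (trans (⟨⟩ᶠ-⨟ φ weaken ι₀) (⟨⟩ᶠ-id φ))

  _at₁ : {ρ : Cell (suc I)} {φ : Face I} → Partial A ρ (φ ⟨ weaken ⟩ᶠ) → Partial A (ρ · ι₁) φ
  _at₁ {φ = φ} = reindex ι₁ reflˣ (trans (⟨⟩ᶠ-⨟ φ weaken ι₁) (⟨⟩ᶠ-id φ))

-- The law comp-uniform contains both the uniformity condition (take
-- ρ′ = ρ(f, i = j), φ′ = φf, u′ = u(f, i = j), a′ = a₀f) and the
-- condition that comp respects equality (take f = id).

record Composition {Γ : CubicalSet ℓ} (A : Family Γ) : Set ℓ where
  no-eta-equality
  open CubicalSet Γ
  open Family A
  field
    comp         : (ρ : Cell (suc I)) (φ : Face I) (u : Partial A ρ (φ ⟨ weaken ⟩ᶠ)) (a₀ : Elem (ρ · ι₀)) →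
                   AgreesOn φ (u at₀) a₀ → Elem (ρ · ι₁)
    comp-agrees  : {ρ : Cell (suc I)} {φ : Face I} {u : Partial A ρ (φ ⟨ weaken ⟩ᶠ)} {a₀ : Elem (ρ · ι₀)}
                   (α : AgreesOn φ (u at₀) a₀) → AgreesOn φ (u at₁) (comp ρ φ u a₀ α)
    comp-uniform : {ρ : Cell (suc I)} {φ : Face I} {u : Partial A ρ (φ ⟨ weaken ⟩ᶠ)} {a₀ : Elem (ρ · ι₀)}
                   {α : AgreesOn φ (u at₀) a₀}
                   {ρ′ : Cell (suc J)} {φ′ : Face J} {u′ : Partial A ρ′ (φ′ ⟨ weaken ⟩ᶠ)} {a′ : Elem (ρ′ · ι₀)}
                   {α′ : AgreesOn φ′ (u′ at₀) a′}
                   (f : I ⇒ J) (e : ρ · f ⁺ ≈ ρ′) (c : φ ⟨ f ⟩ᶠ ≈ᶠ φ′) →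
                   reindex (f ⁺) e (extent-⁺ φ f c) u ≋ₚ u′ →
                   restrict f (⁺-at ι₀ (⁺-ι₀ f) e) a₀ ≋ a′ →
                   restrict f (⁺-at ι₁ (⁺-ι₁ f) e) (comp ρ φ u a₀ α) ≋ comp ρ′ φ′ u′ a′ α′

module _ {Δ Γ : CubicalSet ℓ} (σ : CubicalMap Δ Γ) {A : Family Γ} where
  private
    module Δ = CubicalSet Δ
  open CubicalSet Γ
  open Family A
  open CubicalMap σ

  private
    natural⁻ : {δ : Δ.Cell I} {f : I ⇒ J} → map (δ Δ.· f) ≈ map δ · f
    natural⁻ = symˣ natural

  push : {δ : Δ.Cell I} {φ : Face I} → Partial (A [ σ ]) δ φ → Partial A (map δ) φ
  Partial.at         (push u) f p = cast natural⁻ (Partial.at u f p)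
  Partial.compatible (push u) {g = g} c = transᵃ
    (restrict-square {e′ = natural′ (Δ.·-via c)} {d′ = transˣ ·-id natural⁻} (symʰ (⨟-identityʳ g)))
    (restrict-≋ (Partial.compatible u c))

  push-agrees : {δ : Δ.Cell (suc I)} {φ : Face I} {u : Partial (A [ σ ]) δ (φ ⟨ weaken ⟩ᶠ)}
                {a₀ : Elem (map (δ Δ.· ι₀))} → AgreesOn φ (u at₀) a₀ →
                AgreesOn φ (push u at₀) (cast natural⁻ a₀)
  push-agrees α f p = transᵃ
    (restrict-square {e = transˣ ·-id natural⁻} {e′ = natural′ Δ.reflˣ} {d′ = transˣ ·-id (symˣ natural²)}
      (symʰ (⨟-identityʳ f)))
    (transᵃ (restrict-≋ {e′ = transˣ ·-id (symˣ natural²)} (α f p)) (restrict-square reflʰ))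

module _ {Δ Γ : CubicalSet ℓ} {A : Family Γ} (c : Composition A) (σ : CubicalMap Δ Γ) where
  private
    module Δ = CubicalSet Δ
    module c = Composition c
  open CubicalSet Γ
  open Family A
  open CubicalMap σ

  infixl 10 _[_]ᶜ

  _[_]ᶜ : Composition (A [ σ ])
  Composition.comp _[_]ᶜ δ φ u a₀ α = cast natural
    (c.comp (map δ) φ (push σ u) (cast (symˣ natural) a₀) (push-agrees σ {A = A} {φ = φ} {u} {a₀} α))
  Composition.comp-agrees _[_]ᶜ {ρ = δ} {φ} {u} {a₀} α f p =
    transᵃ (restrict-square {e = transˣ ·-id natural} {e′ = reflˣ} {d′ = transˣ ·-id (natural² {δ = δ})}
             (symʰ (⨟-identityʳ f)))
      (transᵃ (restrict-≋ {e′ = transˣ ·-id (natural² {δ = δ})}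
                (c.comp-agrees {u = push σ u} (push-agrees σ {A = A} {φ = φ} {u} {a₀} α) f p))
        (transᵃ (restrict-via {e″ = transˣ ·-id (natural′ (Δ.symˣ Δ.·-⨟))} reflʰ) (restrict-via reflʰ)))
  Composition.comp-uniform _[_]ᶜ {ρ = δ} {φ} {u} {a₀} {α} {δ′} {φ′} {u′} {a′} {α′} f e k p q = transᵃ
    (restrict-square {e = transˣ ·-id natural} {e′ = ⁺-at ι₁ (⁺-ι₁ f) (natural′ e)}
      {d′ = transˣ ·-id natural} (symʰ (⨟-identityʳ f)))
    (restrict-≋ (c.comp-uniform {u = push σ u} {α = push-agrees σ {A = A} {φ = φ} {u} {a₀} α}
      {u′ = push σ u′} {α′ = push-agrees σ {A = A} {φ = φ′} {u′} {a′} α′} f (natural′ e) k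
      (λ g r s → transᵃ
        (restrict-square {e = transˣ ·-id (symˣ natural)} {d′ = transˣ ·-id (symˣ natural)} reflʰ)
        (restrict-≋ (p g r s)))
      (transᵃ
        (restrict-square {e′ = natural′ (Δ.⁺-at ι₀ (⁺-ι₀ f) e)} {d′ = transˣ ·-id (symˣ natural)}
          (symʰ (⨟-identityʳ f)))
        (restrict-≋ q))))

module _ {Γ : CubicalSet ℓ} {A B : Family Γ} (F : A ⟶ B) where
  open CubicalSet Γ
  open Family B
  open _⟶_ F
  private
    module A = Family A

  mapₚ : {ρ : Cell I} {φ : Face I} → Partial A ρ φ → Partial B ρ φ
  Partial.at         (mapₚ u) f p = map (Partial.at u f p)
  Partial.compatible (mapₚ u) c   = transᵃ natural (cong (Partial.compatible u c))

  mapₚ-agrees : {ρ : Cell (suc I)} (φ : Face I) (u : Partial A ρ (φ ⟨ weaken ⟩ᶠ)) (a₀ : A.Elem (ρ · ι₀)) →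
                AgreesOn φ (u at₀) a₀ → AgreesOn φ (mapₚ u at₀) (map a₀)
  mapₚ-agrees φ u a₀ α f p = transᵃ natural (transᵃ (cong (α f p)) (symᵃ natural))

  record Preserves (c : Composition A) (d : Composition B) : Set ℓ where
    field
      preserves : (ρ : Cell (suc I)) (φ : Face I) (u : Partial A ρ (φ ⟨ weaken ⟩ᶠ)) (a₀ : A.Elem (ρ · ι₀))
                  (α : AgreesOn φ (u at₀) a₀) →
                  map (Composition.comp c ρ φ u a₀ α) ≋
                  Composition.comp d ρ φ (mapₚ u) (map a₀) (mapₚ-agrees φ u a₀ α)

record FibrantFamily {ℓ} (Γ : CubicalSet ℓ) : Set (lsuc ℓ) where
  constructor fibrant
  field
    family      : Family Γ
    composition : Composition family

open FibrantFamily public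

infixl 10 _[_]ᶠ

_[_]ᶠ : {Δ Γ : CubicalSet ℓ} → FibrantFamily Γ → CubicalMap Δ Γ → FibrantFamily Δ
A [ σ ]ᶠ = fibrant (family A [ σ ]) (composition A [ σ ]ᶜ)

------------------------------------------------------------------------
-- Type formers

module _ {Γ : CubicalSet ℓ} where
  open CubicalSet Γ

  module _ (A : Family Γ) (B : Family (Γ ▷ A)) where
    private
      module A = Family A
      module B = Family B
      module ΓA = CubicalSet (Γ ▷ A)

      fibre-≈ : {ρ : Cell I} {x x′ : A.Elem ρ} → x A.≋ x′ → (ρ , x) ΓA.≈ (ρ , x′)
      fibre-≈ p = reflˣ , A.transᵃ A.restrict-id p

      pair-≈ : {ρ : Cell I} {ρ′ : Cell J} {f : I ⇒ J} {x : A.Elem ρ} (e : ρ · f ≈ ρ′) →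
               (ρ , x) ΓA.· f ΓA.≈ (ρ′ , A.restrict f e x)
      pair-≈ e = e , A.cast-restrict

    Sigma : Family Γ
    Family.fibre Sigma ρ = record
      { Carrier       = Σ[ x ∈ A.Elem ρ ] B.Elem (ρ , x)
      ; _≈_           = λ (x , y) (x′ , y′) → Σ[ p ∈ x A.≋ x′ ] B.cast (fibre-≈ p) y B.≋ y′
      ; isEquivalence = record
        { refl  = A.reflᵃ , B.restrict-id
        ; sym   = λ (p , q) → A.symᵃ p ,
            B.transᵃ (B.restrict-≋ {e′ = ΓA.transˣ ΓA.·-id (ΓA.symˣ (fibre-≈ p))} (B.symᵃ q))
              (B.transᵃ (B.restrict-cast {e′ = ΓA.·-id}) B.restrict-id)
        ; trans = λ (p , q) (p′ , q′) → A.transᵃ p p′ ,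
            B.transᵃ (B.transᵃ (B.symᵃ (B.restrict-cast {e = ΓA.transˣ ΓA.·-id (fibre-≈ p′)}))
              (B.restrict-≋ q)) q′
        }
      }
    Family.restrict Sigma f e (x , y) = A.restrict f e x , B.restrict f (pair-≈ e) y
    Family.restrict-cong Sigma {f = f} {g} {e} {e′} c (p , q) = A.restrict-cong c p ,
      B.transᵃ (B.restrict-via {e″ = e′ , A.transᵃ (A.cast-restrict {e′ = e′}) (A.restrict-≋ p)}
                 λ i → trans (⨟-identityʳ f i) (c i))
        (B.transᵃ (B.symᵃ (B.restrict-cast {f = g} {e = pair-≈ e′})) (B.restrict-≋ q))
    Family.restrict-id Sigma = A.restrict-id , B.transᵃ (B.cast-restrict {e′ = ΓA.·-id}) B.restrict-id
    Family.restrict-⨟  Sigma {e′ = e′} = A.restrict-⨟ ,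
      B.transᵃ (B.cast-restrict {e′ = e′ , A.transᵃ (A.cast-restrict {e′ = e′}) A.restrict-⨟}) B.restrict-⨟

    π₁ : Sigma ⟶ A
    _⟶_.map     π₁ = proj₁
    _⟶_.cong    π₁ = proj₁
    _⟶_.natural π₁ = A.reflᵃ

  module _ (A : Family Γ) (a b : Section A) where
    open Family A
    private
      module a = Section a
      module b = Section b

    -- Maps 𝕀 → A in context ρ: elements of the exponential of A by 𝕀 over the
    -- restrictions of ρ.
    record PathElem (ρ : Cell I) : Set ℓ where
      field
        at         : (f : I ⇒ J) → dM J → Elem (ρ · f)
        compatible : {f : I ⇒ J} {g : J ⇒ K} {h : I ⇒ K} {r : dM J} {s : dM K}
                     (c : f ⨟ g ≈ʰ h) → r ⟨ g ⟩ ≈ᴵ s → restrict g (·-via c) (at f r) ≋ at h s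
        at-0       : (f : I ⇒ J) → at f 0ᴵ ≋ a.sec (ρ · f)
        at-1       : (f : I ⇒ J) → at f 1ᴵ ≋ b.sec (ρ · f)

      at-≈ : {f h : I ⇒ J} {r : dM J} {ρ′ : Cell J} {e : ρ · f ≈ ρ′} {d : ρ · h ≈ ρ′} →
             f ≈ʰ h → cast e (at f r) ≋ cast d (at h r)
      at-≈ {f = f} {h} {r} {d = d} c = transᵃ
        (symᵃ (restrict-via {f = idʰ} {g = idʰ} {e = ·-via c′} {e′ = transˣ ·-id d} reflʰ))
        (restrict-≋ (compatible c′ (≡⇒≈ᴵ (⟨⟩-id r))))
        where
        c′ : f ⨟ idʰ ≈ʰ h
        c′ = transʰ {g = f} (⨟-identityʳ f) c

    open PathElem

    infix 4 _≋ₗ_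

    _≋ₗ_ : {ρ : Cell I} → PathElem ρ → PathElem ρ → Set ℓ
    _≋ₗ_ {I} p q = ∀ {J} (f : I ⇒ J) (r : dM J) → at p f r ≋ at q f r

    restrictₗ : {ρ : Cell I} {ρ′ : Cell J} (f : I ⇒ J) → ρ · f ≈ ρ′ → PathElem ρ → PathElem ρ′
    restrictₗ f e p = record
      { at         = λ g r → cast (·-shift e) (at p (f ⨟ g) r)
      ; compatible = λ {_} {_} {g} {h} {k} d m →
          let d′ = λ i → trans (⨟-assoc f g h i) (⟨⟩-cong (refl {r = f i}) d) in
          transᵃ
            (restrict-square {e′ = ·-via d′} {d′ = transˣ ·-id (·-shift e)}
              (symʰ (⨟-identityʳ h)))
            (restrict-≋ (compatible p d′ m))
      ; at-0       = λ g → transᵃ (restrict-≋ {e′ = transˣ ·-id (·-shift e)} (at-0 p (f ⨟ g))) a.natural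
      ; at-1       = λ g → transᵃ (restrict-≋ {e′ = transˣ ·-id (·-shift e)} (at-1 p (f ⨟ g))) b.natural
      }

    Path : Family Γ
    Family.fibre Path ρ = record
      { Carrier       = PathElem ρ
      ; _≈_           = _≋ₗ_
      ; isEquivalence = record
        { refl  = λ f r → reflᵃ
        ; sym   = λ p f r → symᵃ (p f r)
        ; trans = λ p q f r → transᵃ (p f r) (q f r)
        }
      }
    Family.restrict Path = restrictₗ
    Family.restrict-cong Path {f = f} {f′} {e′ = e′} {p} c m g r =
      transᵃ (at-≈ p {d = ·-shift e′} (⨟-cong c (reflʰ {f = g}))) (restrict-≋ (m (f′ ⨟ g) r))
    Family.restrict-id Path {x = p} g r = transᵃ (at-≈ p {d = reflˣ} (reflʰ {f = g})) restrict-id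
    Family.restrict-⨟ Path {f = f} {g} {e} {e′} {x = p} h r = transᵃ
      (restrict-via {f = idʰ} {g = idʰ} {e″ = transˣ ·-id (transˣ (·-shift e)
        (·-shift e′))} reflʰ)
      (at-≈ p λ i → sym (⨟-assoc f g h i))

    -- The witness in constant says that p is the constant path at a on φ.
    record IdElem (ρ : Cell I) : Set ℓ where
      field
        path     : PathElem ρ
        extent   : Face I
        constant : (f : I ⇒ J) → extent ⟨ f ⟩ᶠ ≈ᶠ 1ᶠ → (r : dM J) → at path f r ≋ a.sec (ρ · f)

    open IdElem

    Id : Family Γ
    Family.fibre Id ρ = record
      { Carrier       = IdElem ρ
      ; _≈_           = λ p q → path p ≋ₗ path q × extent p ≈ᶠ extent q
      ; isEquivalence = record
        { refl  = (λ f r → reflᵃ) , refl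
        ; sym   = λ (p , c) → (λ f r → symᵃ (p f r)) , sym c
        ; trans = λ (p , c) (q , d) → (λ f r → transᵃ (p f r) (q f r)) , trans c d
        }
      }
    Family.restrict Id f e p = record
      { path     = restrictₗ f e (path p)
      ; extent   = extent p ⟨ f ⟩ᶠ
      ; constant = λ g m r → transᵃ
          (restrict-≋ {e′ = transˣ ·-id (·-shift e)} (constant p (f ⨟ g) (trans (sym (⟨⟩ᶠ-⨟ (extent p) f g)) m) r)) a.natural
      }
    Family.restrict-cong Id {e = e} {e′} {p} {q} c (m , n) =
      (λ {J} → Family.restrict-cong Path {e = e} {e′} {path p} {path q} c m {J}) , ⟨⟩ᶠ-cong n c
    Family.restrict-id Id {e = e} {p} =
      (λ {J} → Family.restrict-id Path {e = e} {path p} {J}) , ⟨⟩ᶠ-id (extent p)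
    Family.restrict-⨟ Id {f = f} {g} {e} {e′} {e″} {p} =
      (λ {J} → Family.restrict-⨟ Path {e = e} {e′} {e″} {path p} {J}) , ⟨⟩ᶠ-⨟ (extent p) f g

    constₗ : {ρ : Cell I} → a.sec ρ ≋ b.sec ρ → PathElem ρ
    constₗ {ρ = ρ} m = record
      { at         = λ f r → a.sec (ρ · f)
      ; compatible = λ c m → a.natural
      ; at-0       = λ f → reflᵃ
      ; at-1       = λ f → transᵃ (symᵃ (a.natural {e = reflˣ})) (transᵃ (restrict-≋ {e′ = reflˣ} m) b.natural)
      }

    -- The element 1ₐ, at those ρ where the endpoints agree.
    1ᵢ : {ρ : Cell I} → a.sec ρ ≋ b.sec ρ → IdElem ρ
    1ᵢ m = record
      { path     = constₗ m
      ; extent   = 1ᶠ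
      ; constant = λ f p r → reflᵃ
      }

-- Path-contractibility of A in context Γ: a section of Σ (c : A) Π (x : A) Path A c x,
-- with the Π-type replaced by an extension of the context.
record Contractible {Γ : CubicalSet ℓ} (A : Family Γ) : Set ℓ where
  field
    center      : Section A
    contraction : Section (Path (A [ π A ]) (center [ π A ]ˢ) (var A))

module _ {Γ : CubicalSet ℓ} {A B : Family Γ} (F : A ⟶ B) where
  open CubicalSet Γ
  private
    module A = Family A
    module B = Family B
    module F = _⟶_ F

    A′ : Family (Γ ▷ B)
    A′ = A [ π B ]

    B″ : Family (Γ ▷ B ▷ A′)
    B″ = B [ π B ] [ π A′ ]

  -- The sections y : B , x : A ⊢ f x : B and y : B , x : A ⊢ y : B.
  image point : Section B″
  image = (F [ π B ]ᵐ) [ π A′ ]ᵐ $ˢ var A′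
  point = var B [ π A′ ]ˢ

  Fibre : Family (Γ ▷ B)
  Fibre = Sigma A′ (Path B″ image point)

  IsEquivalenceᵐ : Set ℓ
  IsEquivalenceᵐ = Contractible Fibre

  IdFibre : Family (Γ ▷ B)
  IdFibre = Sigma A′ (Id B″ image point)

  -- a ↦ (f(a); a; 1)
  tc : A ⟶ Sigma B IdFibre
  _⟶_.map     tc a = F.map a , a , 1ᵢ B″ image point B.reflᵃ
  _⟶_.cong    tc p = F.cong p , A.transᵃ A.restrict-id p ,
    (λ f r → B.transᵃ (B.restrict-resp F.natural) (B.transᵃ F.natural (F.cong
      (A.transᵃ (A.restrict-resp (A.restrict-via {e″ = reflˣ} (⨟-identityʳ f)))
        (A.transᵃ (A.restrict-via {e″ = reflˣ} (⨟-identityʳ f)) (A.restrict-≋ p)))))) ,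
    refl
  _⟶_.natural tc {f = f} {e} = F.natural , A.restrict-via (⨟-identityʳ f) ,
    (λ g r → B.transᵃ (B.restrict-resp (B.restrict-resp F.natural))
      (B.transᵃ (B.restrict-resp F.natural) (B.transᵃ F.natural (F.cong
        (A.transᵃ (A.restrict-resp (A.restrict-resp (A.restrict-via {e″ = ·-shift e} (⨟-identityʳ (f ⨟ g)))))
          (A.transᵃ (A.restrict-resp (A.restrict-via {e″ = ·-shift e} (⨟-identityʳ (f ⨟ g))))
            (A.transᵃ (A.restrict-via {e″ = ·-shift e} (⨟-identityʳ (f ⨟ g))) (A.symᵃ A.restrict-⨟)))))))) ,
    refl

  -- The elements [φ ↦ a] with f(a) = b on φ.
  record PartialPreimage (ρ : Cell I) (b : B.Elem ρ) : Set ℓ where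
    field
      extent  : Face I
      element : Partial A ρ extent
      over    : (f : I ⇒ J) (p : extent ⟨ f ⟩ᶠ ≈ᶠ 1ᶠ) →
                F.map (Partial.at element f p) B.≋ B.restrict f reflˣ b

  open PartialPreimage

  PartialFibre : Family (Γ ▷ B)
  Family.fibre PartialFibre (ρ , b) = record
    { Carrier       = PartialPreimage ρ b
    ; _≈_           = λ t t′ → extent t ≈ᶠ extent t′ × element t ≋ₚ element t′
    ; isEquivalence = record
      { refl  = λ {t} → refl , Partial.at-irrelevant (element t)
      ; sym   = λ (c , m) → sym c , λ f p q → A.symᵃ (m f q p)
      ; trans = λ {_} {t} (c , m) (d , n) → trans c d , λ f p q →
          let r = trans (⟨⟩ᶠ-cong (sym c) (reflʰ {f = f})) p in A.transᵃ (m f p r) (n f r q)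
      }
    }
  Family.restrict PartialFibre f (e , m) t = record
    { extent  = extent t ⟨ f ⟩ᶠ
    ; element = reindex f e refl (element t)
    ; over    = λ g p → B.transᵃ (B.symᵃ F.natural)
        (B.transᵃ (B.restrict-resp (over t (f ⨟ g) _))
          (B.transᵃ (B.cast-restrict {e′ = ·-shift e})
            (B.transᵃ (B.symᵃ (B.restrict-⨟ {e′ = ·-cong e reflʰ}))
              (B.transᵃ (B.symᵃ (B.restrict-cast {d = e} {e = reflˣ})) (B.restrict-≋ m)))))
    }
  Family.restrict-cong PartialFibre {f = f} {f′} {e′ = e′ , _} {x = t} {t′} c (d , m) =
    ⟨⟩ᶠ-cong d c , λ g p q →
      let r = trans (⟨⟩ᶠ-cong (refl {φ = extent t}) (⨟-cong (symʰ c) (reflʰ {f = g})))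
                (trans (sym (⟨⟩ᶠ-⨟ (extent t) f g)) p)
      in A.transᵃ (Partial.at-≈ (element t) {q = r} {d = ·-shift e′} (⨟-cong c (reflʰ {f = g})))
           (A.restrict-≋ (m (f′ ⨟ g) r _))
  Family.restrict-id PartialFibre {x = t} = ⟨⟩ᶠ-id (extent t) , λ f p q →
    A.transᵃ (Partial.at-≈ (element t) {q = q} {d = reflˣ} (reflʰ {f = f})) A.restrict-id
  Family.restrict-⨟ PartialFibre {f = f} {g} {e , _} {e′ , _} {x = t} = ⟨⟩ᶠ-⨟ (extent t) f g , λ h p q →
    A.transᵃ
      (A.restrict-via {f = idʰ} {g = idʰ} {e″ = transˣ ·-id (transˣ (·-shift e)
        (·-shift e′))} reflʰ)
      (Partial.at-≈ (element t) λ i → sym (⨟-assoc f g h i))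

  total : {ρ : Cell I} → A.Elem ρ → Partial A ρ 1ᶠ
  Partial.at         (total a) f p = A.restrict f reflˣ a
  Partial.compatible (total a) c   = A.restrict-via c

  -- a ↦ (f(a), [1 ↦ a])
  pc : A ⟶ Sigma B PartialFibre
  _⟶_.map     pc a = F.map a , record
    { extent  = 1ᶠ
    ; element = total a
    ; over    = λ f p → B.symᵃ F.natural
    }
  _⟶_.cong    pc p = F.cong p , refl , λ f q r →
    A.transᵃ (A.restrict-via {e″ = reflˣ} (⨟-identityʳ f)) (A.restrict-≋ p)
  _⟶_.natural pc {f = f} {e} = F.natural , refl , λ g q r →
    A.transᵃ (A.restrict-resp (A.cast-restrict {e′ = ·-shift e}))
      (A.transᵃ (A.restrict-via {e″ = ·-shift e} (⨟-identityʳ (f ⨟ g))) (A.symᵃ A.restrict-⨟))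

------------------------------------------------------------------------
-- Substitution in the factorizations

module _ {Δ Γ : CubicalSet ℓ} (σ : CubicalMap Δ Γ) where
  open CubicalSet Γ
  open CubicalMap σ
  private
    module Δ = CubicalSet Δ

  module _ {A : Family Γ} {B : Family (Γ ▷ A)} {A′ : Family Δ} {B′ : Family (Δ ▷ A′)} where
    private
      module B = Family B

    Sigma-map : (F : A′ ⟶ A [ σ ]) → B′ ⟶ B [ σ ▷⟨ A ⟩ F ] → Sigma A′ B′ ⟶ Sigma A B [ σ ]
    _⟶_.map     (Sigma-map F G) (x , y) = _⟶_.map F x , _⟶_.map G y
    _⟶_.cong    (Sigma-map F G) (p , q) = _⟶_.cong F p ,
      B.transᵃ (B.restrict-≋ B.reflᵃ) (B.transᵃ (_⟶_.natural G) (_⟶_.cong G q))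
    _⟶_.natural (Sigma-map F G)         = _⟶_.natural F , B.transᵃ B.cast-restrict (_⟶_.natural G)

  module _ {A : Family Γ} {a b : Section A} {A′ : Family Δ} {a′ b′ : Section A′} (F : A′ ⟶ A [ σ ])
           (k : ∀ {I} (δ : Δ.Cell I) →
                Family._≋_ A (_⟶_.map F (Section.sec a′ δ)) (Section.sec a (map δ)))
           (l : ∀ {I} (δ : Δ.Cell I) →
                Family._≋_ A (_⟶_.map F (Section.sec b′ δ)) (Section.sec b (map δ))) where
    open Family A
    open PathElem
    open IdElem
    private
      module F = _⟶_ F
      module a = Section a
      module b = Section b

    Path-map : {δ : Δ.Cell I} → PathElem A′ a′ b′ δ → PathElem A a b (map δ)
    Path-map p = record
      { at         = λ f r → cast (symˣ natural) (F.map (at p f r))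
      ; compatible = λ {_} {_} {_} {g} c m → transᵃ
          (restrict-square {e′ = natural′ (Δ.·-via c)} {d′ = transˣ ·-id (symˣ natural)} (symʰ (⨟-identityʳ g)))
          (restrict-≋ (transᵃ F.natural (F.cong (compatible p c m))))
      ; at-0       = λ f → transᵃ (restrict-resp (transᵃ (F.cong (at-0 p f)) (k _))) a.natural
      ; at-1       = λ f → transᵃ (restrict-resp (transᵃ (F.cong (at-1 p f)) (l _))) b.natural
      }

    Id-map : Id A′ a′ b′ ⟶ Id A a b [ σ ]
    _⟶_.map     Id-map p = record
      { path     = Path-map (path p)
      ; extent   = extent p
      ; constant = λ f m r → transᵃ (restrict-resp (transᵃ (F.cong (constant p f m r)) (k _))) a.natural
      }
    _⟶_.cong    Id-map (p , c) = (λ f r → restrict-≋ (F.cong (p f r))) , c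
    _⟶_.natural Id-map {e = e} =
      (λ g r → transᵃ
        (restrict-square {e′ = natural′ (Δ.transˣ Δ.·-id (Δ.·-shift e))} {d′ = transˣ ·-id (symˣ natural)} reflʰ)
        (restrict-≋ F.natural)) ,
      refl

module _ {Δ Γ : CubicalSet ℓ} (σ : CubicalMap Δ Γ) {A B : Family Γ}
         (F : A ⟶ B) (F′ : A [ σ ] ⟶ B [ σ ]) (e : F′ ≈ᵐ F [ σ ]ᵐ) where
  open CubicalSet Γ
  open CubicalMap σ
  private
    module Δ = CubicalSet Δ
    module A = Family A
    module B = Family B
    module F = _⟶_ F
    module F′ = _⟶_ F′

    σᴮ : CubicalMap (Δ ▷ B [ σ ]) (Γ ▷ B)
    σᴮ = σ ▷⟨ B ⟩ idᵐ

    swap : A [ σ ] [ π (B [ σ ]) ] ⟶ A [ π B ] [ σᴮ ]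
    _⟶_.map     swap x = x
    _⟶_.cong    swap p = p
    _⟶_.natural swap   = A.restrict-≋ A.reflᵃ

    swap² : B [ σ ] [ π (B [ σ ]) ] [ π (A [ σ ] [ π (B [ σ ]) ]) ] ⟶ B [ π B ] [ π (A [ π B ]) ] [ σᴮ ▷⟨ A [ π B ] ⟩ swap ]
    _⟶_.map     swap² y = y
    _⟶_.cong    swap² p = p
    _⟶_.natural swap²   = B.restrict-≋ B.reflᵃ

  IdFibre-substitute : IdFibre F′ ⟶ IdFibre F [ σᴮ ]
  IdFibre-substitute = Sigma-map σᴮ
    {A = A [ π B ]} {B = Id (B [ π B ] [ π (A [ π B ]) ]) (image F) (point F)}
    {A′ = A [ σ ] [ π (B [ σ ]) ]}
    {B′ = Id (B [ σ ] [ π (B [ σ ]) ] [ π (A [ σ ] [ π (B [ σ ]) ]) ]) (image F′) (point F′)}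
    swap
    (Id-map (σᴮ ▷⟨ A [ π B ] ⟩ swap)
      {A = B [ π B ] [ π (A [ π B ]) ]} {a = image F} {b = point F}
      {A′ = B [ σ ] [ π (B [ σ ]) ] [ π (A [ σ ] [ π (B [ σ ]) ]) ]} {a′ = image F′} {b′ = point F′}
      swap² (λ (_ , x) → e x) (λ _ → B.reflᵃ))

  PartialFibre-substitute : PartialFibre F′ ⟶ PartialFibre F [ σᴮ ]
  _⟶_.map     PartialFibre-substitute t = record
    { extent  = PartialPreimage.extent t
    ; element = push σ (PartialPreimage.element t)
    ; over    = λ f p → B.transᵃ (B.symᵃ F.natural)
        (B.transᵃ (B.restrict-resp (B.transᵃ (B.symᵃ (e _)) (PartialPreimage.over t f p))) B.cast-restrict)
    }
  _⟶_.cong    PartialFibre-substitute (c , m) = c , λ f p q → A.restrict-≋ (m f p q)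
  _⟶_.natural PartialFibre-substitute {e = d , _} {t} = refl , λ g p q → A.transᵃ
    (A.restrict-square {e′ = natural′ (Δ.transˣ Δ.·-id (Δ.·-shift d))} {d′ = transˣ ·-id (symˣ natural)} reflʰ)
    (A.restrict-resp (A.restrict-resp (Partial.at-irrelevant (PartialPreimage.element t) _ _ _)))

------------------------------------------------------------------------
-- Pre-model-structures

record Category (o h e : Level) : Set (lsuc (o ⊔ˡ h ⊔ˡ e)) where
  infix  4 _≈_
  infixr 9 _∘_
  field
    Obj           : Set o
    Hom           : Obj → Obj → Set h
    _≈_           : ∀ {X Y} → Hom X Y → Hom X Y → Set e
    isEquivalence : ∀ {X Y} → IsEquivalence (_≈_ {X} {Y})
    id            : ∀ {X} → Hom X X
    _∘_           : ∀ {X Y Z} → Hom Y Z → Hom X Y → Hom X Z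
    ∘-cong        : ∀ {X Y Z} {g g′ : Hom Y Z} {f f′ : Hom X Y} → g ≈ g′ → f ≈ f′ → g ∘ f ≈ g′ ∘ f′
    identityˡ     : ∀ {X Y} {f : Hom X Y} → id ∘ f ≈ f
    identityʳ     : ∀ {X Y} {f : Hom X Y} → f ∘ id ≈ f
    assoc         : ∀ {W X Y Z} {h : Hom Y Z} {g : Hom X Y} {f : Hom W X} → (h ∘ g) ∘ f ≈ h ∘ (g ∘ f)

module _ {o h e} (C : Category o h e) where
  open Category C

  MapClass : (p : Level) → Set (o ⊔ˡ h ⊔ˡ lsuc p)
  MapClass p = ∀ X Y → Hom X Y → Set p

  infixr 7 _∩_

  _∩_ : ∀ {p q} → MapClass p → MapClass q → MapClass (p ⊔ˡ q)
  (P ∩ Q) X Y f = P X Y f × Q X Y f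

  record Filler {A B X Y} (i : Hom A B) (p : Hom X Y) (u : Hom A X) (v : Hom B Y) : Set (h ⊔ˡ e) where
    field
      filler : Hom B X
      upper  : filler ∘ i ≈ u
      lower  : p ∘ filler ≈ v

  Lifts : ∀ {A B X Y} → Hom A B → Hom X Y → Set (h ⊔ˡ e)
  Lifts i p = ∀ u v → p ∘ u ≈ v ∘ i → Filler i p u v

  LLP RLP : ∀ {p} → MapClass p → MapClass (o ⊔ˡ h ⊔ˡ e ⊔ˡ p)
  LLP R A B i = ∀ X Y (p : Hom X Y) → R X Y p → Lifts i p
  RLP L X Y p = ∀ A B (i : Hom A B) → L A B i → Lifts i p

  record Factorization {X Y} (f : Hom X Y) : Set (o ⊔ˡ h ⊔ˡ e) where
    field
      mid      : Obj
      left     : Hom X mid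
      right    : Hom mid Y
      commutes : right ∘ left ≈ f

  open Factorization

  record IsWeakFactorizationSystem {p q} (L : MapClass p) (R : MapClass q) : Set (o ⊔ˡ h ⊔ˡ e ⊔ˡ p ⊔ˡ q) where
    field
      left-class  : ∀ X Y (f : Hom X Y) → L X Y f ⇔ LLP R X Y f
      right-class : ∀ X Y (f : Hom X Y) → R X Y f ⇔ RLP L X Y f
      factor      : ∀ X Y (f : Hom X Y) → Σ[ φ ∈ Factorization f ] L X (mid φ) (left φ) × R (mid φ) Y (right φ)

  record ThreeForTwo {w} (W : MapClass w) : Set (o ⊔ˡ h ⊔ˡ e ⊔ˡ w) where
    field
      composite : ∀ X Y Z (f : Hom X Y) (g : Hom Y Z) (k : Hom X Z) → g ∘ f ≈ k → W X Y f → W Y Z g → W X Z k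
      second    : ∀ X Y Z (f : Hom X Y) (g : Hom Y Z) (k : Hom X Z) → g ∘ f ≈ k → W X Y f → W X Z k → W Y Z g
      first     : ∀ X Y Z (f : Hom X Y) (g : Hom Y Z) (k : Hom X Z) → g ∘ f ≈ k → W Y Z g → W X Z k → W X Y f

  record IsPreModelStructure {c f w} (Cof : MapClass c) (Fib : MapClass f) (W : MapClass w) :
         Set (o ⊔ˡ h ⊔ˡ e ⊔ˡ c ⊔ˡ f ⊔ˡ w) where
    field
      three-for-two : ThreeForTwo W
      cof-tfib      : IsWeakFactorizationSystem Cof (Fib ∩ W)
      tcof-fib      : IsWeakFactorizationSystem (Cof ∩ W) Fib

  -- The extension of a choice of factorizations to a functor from the arrow
  -- category, of which left and right are natural transformations.
  record Functorial (φ : ∀ X Y (f : Hom X Y) → Factorization f) : Set (o ⊔ˡ h ⊔ˡ e) where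
    field
      map       : ∀ {X Y X′ Y′} (f : Hom X Y) (f′ : Hom X′ Y′) (u : Hom X X′) (v : Hom Y Y′) →
                  f′ ∘ u ≈ v ∘ f → Hom (mid (φ X Y f)) (mid (φ X′ Y′ f′))
      map-left  : ∀ {X Y X′ Y′} (f : Hom X Y) (f′ : Hom X′ Y′) (u : Hom X X′) (v : Hom Y Y′)
                  (s : f′ ∘ u ≈ v ∘ f) → map f f′ u v s ∘ left (φ X Y f) ≈ left (φ X′ Y′ f′) ∘ u
      map-right : ∀ {X Y X′ Y′} (f : Hom X Y) (f′ : Hom X′ Y′) (u : Hom X X′) (v : Hom Y Y′)
                  (s : f′ ∘ u ≈ v ∘ f) → right (φ X′ Y′ f′) ∘ map f f′ u v s ≈ v ∘ right (φ X Y f)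
      map-cong  : ∀ {X Y X′ Y′} (f : Hom X Y) (f′ : Hom X′ Y′) (u u′ : Hom X X′) (v v′ : Hom Y Y′)
                  (s : f′ ∘ u ≈ v ∘ f) (s′ : f′ ∘ u′ ≈ v′ ∘ f) →
                  u ≈ u′ → v ≈ v′ → map f f′ u v s ≈ map f f′ u′ v′ s′
      map-id    : ∀ {X Y} (f : Hom X Y) (s : f ∘ id ≈ id ∘ f) → map f f id id s ≈ id
      map-∘     : ∀ {X Y X′ Y′ X″ Y″} (f : Hom X Y) (f′ : Hom X′ Y′) (f″ : Hom X″ Y″)
                  (u : Hom X X′) (v : Hom Y Y′) (u′ : Hom X′ X″) (v′ : Hom Y′ Y″)
                  (s : f′ ∘ u ≈ v ∘ f) (s′ : f″ ∘ u′ ≈ v′ ∘ f′) (t : f″ ∘ (u′ ∘ u) ≈ (v′ ∘ v) ∘ f) →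
                  map f f″ (u′ ∘ u) (v′ ∘ v) t ≈ map f′ f″ u′ v′ s′ ∘ map f f′ u v s

------------------------------------------------------------------------
-- Fibrant cubical sets

-- A family over 𝟙 is a cubical set, and a map of families over 𝟙 is a map of
-- cubical sets. The context extension 𝟙 ▷ X is X as a base of families.

FibrantFamilies : CubicalSet ℓ → Category (lsuc ℓ) ℓ ℓ
FibrantFamilies Γ = record
  { Obj           = FibrantFamily Γ
  ; Hom           = λ A B → family A ⟶ family B
  ; _≈_           = _≈ᵐ_
  ; isEquivalence = λ {A} {B} → record
    { refl  = λ x → Family.reflᵃ (family B)
    ; sym   = λ p x → Family.symᵃ (family B) (p x)
    ; trans = λ p q x → Family.transᵃ (family B) (p x) (q x)
    }
  ; id            = idᵐ
  ; _∘_           = _∘ᵐ_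
  ; ∘-cong        = λ {_} {_} {C} {g} p q x → Family.transᵃ (family C) (_⟶_.cong g (q x)) (p _)
  ; identityˡ     = λ {_} {B} x → Family.reflᵃ (family B)
  ; identityʳ     = λ {_} {B} x → Family.reflᵃ (family B)
  ; assoc         = λ {_} {_} {_} {D} x → Family.reflᵃ (family D)
  }

FibrantCubicalSets : (ℓ : Level) → Category (lsuc ℓ) ℓ ℓ
FibrantCubicalSets ℓ = FibrantFamilies (𝟙 {ℓ})

FibrantCubicalSet : (ℓ : Level) → Set (lsuc ℓ)
FibrantCubicalSet ℓ = Category.Obj (FibrantCubicalSets ℓ)

module _ {ℓ : Level} where

  -- The total space Σ A B is a fibrant cubical set in a canonical way, but it
  -- may carry any composition structure c here: objects that differ only in
  -- their composition structure are isomorphic by the identity map.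
  data DisplayMap : MapClass (FibrantCubicalSets ℓ) (lsuc ℓ) where
    display : (A : FibrantCubicalSet ℓ) (B : FibrantFamily (𝟙 ▷ family A))
              (c : Composition (Sigma (family A) (family B))) →
              DisplayMap (fibrant (Sigma (family A) (family B)) c) A (π₁ (family A) (family B))

  Equivalence : MapClass (FibrantCubicalSets ℓ) ℓ
  Equivalence A B F = IsEquivalenceᵐ F

  TrivialDisplayMap : MapClass (FibrantCubicalSets ℓ) (lsuc ℓ)
  TrivialDisplayMap = _∩_ (FibrantCubicalSets ℓ) DisplayMap Equivalence

  Cofibration : MapClass (FibrantCubicalSets ℓ) (lsuc ℓ)
  Cofibration = LLP (FibrantCubicalSets ℓ) TrivialDisplayMap

  Fibration : MapClass (FibrantCubicalSets ℓ) (lsuc ℓ)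
  Fibration = RLP (FibrantCubicalSets ℓ) (LLP (FibrantCubicalSets ℓ) DisplayMap)

  TrivialFibration TrivialCofibration : MapClass (FibrantCubicalSets ℓ) (lsuc ℓ)
  TrivialFibration   = _∩_ (FibrantCubicalSets ℓ) Fibration Equivalence
  TrivialCofibration = _∩_ (FibrantCubicalSets ℓ) Cofibration Equivalence

------------------------------------------------------------------------
-- Uniform and functorial factorizations

-- A factorization A ⟶ Σ (y : B) E(y) ⟶ B, given in every context, together
-- with the comparison of E(F[σ]) with the substitution instance of E(F).

record DisplayFactorization (ℓ : Level) : Set (lsuc ℓ) where
  field
    middle     : {Γ : CubicalSet ℓ} {A B : Family Γ} → A ⟶ B → Family (Γ ▷ B)
    first      : {Γ : CubicalSet ℓ} {A B : Family Γ} (F : A ⟶ B) → A ⟶ Sigma B (middle F)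
    commutes   : {Γ : CubicalSet ℓ} {A B : Family Γ} (F : A ⟶ B) → π₁ B (middle F) ∘ᵐ first F ≈ᵐ F
    substitute : {Δ Γ : CubicalSet ℓ} (σ : CubicalMap Δ Γ) {A B : Family Γ}
                 (F : A ⟶ B) (F′ : A [ σ ] ⟶ B [ σ ]) → F′ ≈ᵐ F [ σ ]ᵐ →
                 middle F′ ⟶ middle F [ σ ▷⟨ B ⟩ idᵐ ]

  substitute-total : {Δ Γ : CubicalSet ℓ} (σ : CubicalMap Δ Γ) {A B : Family Γ}
                     (F : A ⟶ B) (F′ : A [ σ ] ⟶ B [ σ ]) → F′ ≈ᵐ F [ σ ]ᵐ →
                     Sigma (B [ σ ]) (middle F′) ⟶ Sigma B (middle F) [ σ ]
  substitute-total σ {B = B} F F′ e = Sigma-map σ {A = B} {B = middle F} {A′ = B [ σ ]} {B′ = middle F′}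
    idᵐ (substitute σ F F′ e)

idFactorization partialFactorization : DisplayFactorization ℓ
idFactorization = record
  { middle     = IdFibre
  ; first      = tc
  ; commutes   = λ {_} {_} {B} F x → Family.reflᵃ B
  ; substitute = IdFibre-substitute
  }
partialFactorization = record
  { middle     = PartialFibre
  ; first      = pc
  ; commutes   = λ {_} {_} {B} F x → Family.reflᵃ B
  ; substitute = PartialFibre-substitute
  }

record IsIso {Γ : CubicalSet ℓ} {A B : Family Γ} (F : A ⟶ B) : Set ℓ where
  field
    inverse  : B ⟶ A
    inverseˡ : inverse ∘ᵐ F ≈ᵐ idᵐ
    inverseʳ : F ∘ᵐ inverse ≈ᵐ idᵐ

module _ (D : DisplayFactorization ℓ) where
  open DisplayFactorization D

  -- Equality with the substitution instance along σ becomes isomorphism along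
  -- the canonical comparison maps.
  module _ {Δ Γ : CubicalSet ℓ} (σ : CubicalMap Δ Γ) (A B : FibrantFamily Γ) (F : family A ⟶ family B)
           (F′ : family A [ σ ] ⟶ family B [ σ ]) (e : F′ ≈ᵐ F [ σ ]ᵐ) where

    MiddleStable : Composition (middle F) → Composition (middle F′) → Set ℓ
    MiddleStable c c′ =
      IsIso (substitute σ F F′ e) × Preserves (substitute σ F F′ e) c′ (c [ σ ▷⟨ family B ⟩ idᵐ ]ᶜ)

    TotalStable : Composition (Sigma (family B) (middle F)) →
                  Composition (Sigma (family B [ σ ]) (middle F′)) → Set ℓ
    TotalStable c c′ = Preserves (substitute-total σ F F′ e) c′ (c [ σ ]ᶜ)

    FirstStable : Set ℓ
    FirstStable = substitute-total σ F F′ e ∘ᵐ first F′ ≈ᵐ first F [ σ ]ᵐ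

  -- Composition structures on the families E(F) and Σ B E(F) for F : A ⟶ B, in
  -- every context, stable under substitution.
  record UniformComposition : Set (lsuc ℓ) where
    field
      middle-comp   : {Γ : CubicalSet ℓ} (A B : FibrantFamily Γ) (F : family A ⟶ family B) →
                      Composition (middle F)
      total-comp    : {Γ : CubicalSet ℓ} (A B : FibrantFamily Γ) (F : family A ⟶ family B) →
                      Composition (Sigma (family B) (middle F))
      middle-stable : {Δ Γ : CubicalSet ℓ} (σ : CubicalMap Δ Γ) (A B : FibrantFamily Γ)
                      (F : family A ⟶ family B) (F′ : family A [ σ ] ⟶ family B [ σ ]) (e : F′ ≈ᵐ F [ σ ]ᵐ) →
                      MiddleStable σ A B F F′ e (middle-comp A B F) (middle-comp (A [ σ ]ᶠ) (B [ σ ]ᶠ) F′)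
      total-stable  : {Δ Γ : CubicalSet ℓ} (σ : CubicalMap Δ Γ) (A B : FibrantFamily Γ)
                      (F : family A ⟶ family B) (F′ : family A [ σ ] ⟶ family B [ σ ]) (e : F′ ≈ᵐ F [ σ ]ᵐ) →
                      TotalStable σ A B F F′ e (total-comp A B F) (total-comp (A [ σ ]ᶠ) (B [ σ ]ᶠ) F′)
      first-stable  : {Δ Γ : CubicalSet ℓ} (σ : CubicalMap Δ Γ) (A B : FibrantFamily Γ)
                      (F : family A ⟶ family B) (F′ : family A [ σ ] ⟶ family B [ σ ]) (e : F′ ≈ᵐ F [ σ ]ᵐ) →
                      FirstStable σ A B F F′ e

    factorization : (Γ : CubicalSet ℓ) (A B : FibrantFamily Γ) (F : family A ⟶ family B) →
                    Factorization (FibrantFamilies Γ) {A} {B} F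
    factorization Γ A B F = record
      { mid      = fibrant (Sigma (family B) (middle F)) (total-comp A B F)
      ; left     = first F
      ; right    = π₁ (family B) (middle F)
      ; commutes = commutes F
      }

  record IsUniformFunctorialFactorization {p q} (L : MapClass (FibrantCubicalSets ℓ) p)
         (R : MapClass (FibrantCubicalSets ℓ) q) : Set (lsuc ℓ ⊔ˡ p ⊔ˡ q) where
    field
      uniform : UniformComposition

    open UniformComposition uniform
    open Factorization

    field
      functorial : Functorial (FibrantCubicalSets ℓ) (factorization 𝟙)
      left-in    : (A B : FibrantCubicalSet ℓ) (F : family A ⟶ family B) →
                   L A (mid (factorization 𝟙 A B F)) (left (factorization 𝟙 A B F))
      right-in   : (A B : FibrantCubicalSet ℓ) (F : family A ⟶ family B) →
                   R (mid (factorization 𝟙 A B F)) B (right (factorization 𝟙 A B F))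

-- A fibrant family is contractible exactly when every partial element of it
-- extends to a total one, uniformly. In this form equivalences are easy to
-- handle: 3-for-2 and closure under retracts amount to extending in one fibre
-- after another and transporting along the paths obtained.
--
-- Faces are determined by the substitutions that make them 1, and a partial
-- face ψ on φ extends to φ ∧ ψ. Hence the family T_f of partial preimages has
-- extensions for every f, so that C_f → B is a trivial display map, and
-- a ↦ [1 ↦ a] lifts against trivial display maps since these have extensions.
-- The map tc_f lifts against display maps by transport along the contraction
-- (p(r ∧ -), φ ∨ (r = 0)) of the based identity type. A map i that lifts
-- against display maps lifts against its own factorization, hence is a strong
-- deformation retract and an equivalence; retract arguments do the rest.

module Submission where

open import Defs
open import Level using (Level; 0ℓ) renaming (suc to lsuc)
open import Algebra.Lattice.Bundles using (Lattice)
import Algebra.Lattice.Properties.Lattice as LatticeProperties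
open import Data.Bool.Base as Bool using (Bool; true; false; if_then_else_)
import Data.Bool.Properties as Bool
open import Data.Empty using (⊥; ⊥-elim)
open import Data.Fin.Base using (Fin; zero; suc)
open import Data.Fin.Properties using (_≟_)
open import Data.Nat.Base using (ℕ; zero; suc)
open import Data.Product.Base using (_×_; _,_; proj₁; proj₂; Σ-syntax; ∃-syntax)
open import Data.Sum.Base using (_⊎_; inj₁; inj₂)
open import Data.Unit.Polymorphic.Base using (tt)
open import Data.Vec.Base using (Vec; []; _∷_; lookup; tabulate)
open import Data.Vec.Properties using (lookup∘tabulate)
open import Function.Base using (_∘_; case_of_)
open import Function.Bundles using (mk⇔)
import Relation.Binary.Lattice as OrderLattice
open import Relation.Binary.PropositionalEquality.Core as ≡ using (_≡_)
open import Relation.Nullary using (¬_; yes; no)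

-- Strictness is the obstacle. A composition structure need not be the identity along a constant
-- line, so transport along a constant path returns its input only up to a path, whereas lifts must
-- commute strictly. The extent carried by an element of `Id` cures this: the path is constant
-- there, so the input itself can serve as a system on it, and at `1ₐ` the composite is forced to be
-- the input. The same device, a face on which nothing moves, keeps partial data fixed in the
-- arguments about fibres. The price is that composition in `Id`, and extension in the family of
-- partial preimages, must produce a face that is prescribed only on another face; hence the
-- analysis of faces. The second obstacle is that points are compared by setoid equality,
-- restriction maps depend on proofs of it, and every operation must be uniform and stable under
-- substitution. The relation `A ∋ x ∼[ f ] y` hides the proofs, and `Over` states uniformity and
-- stability as one law, so that one argument yields both.

private
  variable
    ℓ : Level
    I J K L : ℕ

-- Faces

-- The lattice homomorphism to the Booleans that sends all generators `(i =0)`, `(i =1)` to `false`.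
-- It respects the relation `=0∧=1`, and a face on which it is `true` is already 1, so equality with
-- 1 is decided by recursion on the expression.
isOne : Face I → Bool
isOne (i =0)  = false
isOne (i =1)  = false
isOne 0ᶠ      = false
isOne 1ᶠ      = true
isOne (φ ∧ ψ) = isOne φ Bool.∧ isOne ψ
isOne (φ ∨ ψ) = isOne φ Bool.∨ isOne ψ

isOne-cong : {φ ψ : Face I} → φ ≈ᶠ ψ → isOne φ ≡ isOne ψ
isOne-cong refl              = ≡.refl
isOne-cong (sym p)           = ≡.sym (isOne-cong p)
isOne-cong (trans p q)       = ≡.trans (isOne-cong p) (isOne-cong q)
isOne-cong (∧-cong p q)      = ≡.cong₂ Bool._∧_ (isOne-cong p) (isOne-cong q)
isOne-cong (∨-cong p q)      = ≡.cong₂ Bool._∨_ (isOne-cong p) (isOne-cong q)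
isOne-cong (∧-comm φ ψ)      = Bool.∧-comm (isOne φ) (isOne ψ)
isOne-cong (∨-comm φ ψ)      = Bool.∨-comm (isOne φ) (isOne ψ)
isOne-cong (∧-assoc φ ψ χ)   = Bool.∧-assoc (isOne φ) (isOne ψ) (isOne χ)
isOne-cong (∨-assoc φ ψ χ)   = Bool.∨-assoc (isOne φ) (isOne ψ) (isOne χ)
isOne-cong (∧-absorb-∨ φ ψ)  = Bool.∧-abs-∨ (isOne φ) (isOne ψ)
isOne-cong (∨-absorb-∧ φ ψ)  = Bool.∨-abs-∧ (isOne φ) (isOne ψ)
isOne-cong (∧-distr-∨ φ ψ χ) = Bool.∧-distribˡ-∨ (isOne φ) (isOne ψ) (isOne χ)
isOne-cong (∨-distr-∧ φ ψ χ) = Bool.∨-distribˡ-∧ (isOne φ) (isOne ψ) (isOne χ)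
isOne-cong (∧-1 φ)           = Bool.∧-identityʳ (isOne φ)
isOne-cong (∨-0 φ)           = Bool.∨-identityʳ (isOne φ)
isOne-cong (=0∧=1 i)         = ≡.refl

1∨ : (φ : Face I) → 1ᶠ ∨ φ ≈ᶠ 1ᶠ
1∨ φ = trans (∨-cong refl (sym (trans (∧-comm _ _) (∧-1 φ)))) (∨-absorb-∧ 1ᶠ φ)

∨1 : (φ : Face I) → φ ∨ 1ᶠ ≈ᶠ 1ᶠ
∨1 φ = trans (∨-comm _ _) (1∨ φ)

∧-one : {φ ψ : Face I} → φ ≈ᶠ 1ᶠ → ψ ≈ᶠ 1ᶠ → φ ∧ ψ ≈ᶠ 1ᶠ
∧-one p q = trans (∧-cong p q) (∧-1 1ᶠ)

∨-oneˡ : {φ ψ : Face I} → φ ≈ᶠ 1ᶠ → φ ∨ ψ ≈ᶠ 1ᶠ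
∨-oneˡ p = trans (∨-cong p refl) (1∨ _)

∨-oneʳ : {φ ψ : Face I} → ψ ≈ᶠ 1ᶠ → φ ∨ ψ ≈ᶠ 1ᶠ
∨-oneʳ p = trans (∨-cong refl p) (∨1 _)

isOne-sound : (φ : Face I) → isOne φ ≡ true → φ ≈ᶠ 1ᶠ
isOne-sound 1ᶠ      e = refl
isOne-sound (φ ∧ ψ) e with isOne φ in p | isOne ψ in q
... | true | true = ∧-one (isOne-sound φ p) (isOne-sound ψ q)
isOne-sound (φ ∨ ψ) e with isOne φ in p | isOne ψ in q
... | true  | _    = ∨-oneˡ (isOne-sound φ p)
... | false | true = ∨-oneʳ (isOne-sound ψ q)

opaque
  -- Because `isOne` preserves joins. This makes systems easy to build: at every substitution where
  -- `φ ∨ ψ` is 1 one of the two is already 1, so that elements need never be glued. If both are 1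
  -- the first is chosen.
  ∨-prime : (φ ψ : Face I) → φ ∨ ψ ≈ᶠ 1ᶠ → φ ≈ᶠ 1ᶠ ⊎ ψ ≈ᶠ 1ᶠ
  ∨-prime φ ψ p with isOne φ in e | isOne ψ in e′ | isOne-cong p
  ... | true  | _    | _ = inj₁ (isOne-sound φ e)
  ... | false | true | _ = inj₂ (isOne-sound ψ e′)

0≉1 : ¬ (0ᶠ {I} ≈ᶠ 1ᶠ)
0≉1 p with isOne-cong p
... | ()

∧-proj₁ : {φ ψ : Face I} → φ ∧ ψ ≈ᶠ 1ᶠ → φ ≈ᶠ 1ᶠ
∧-proj₁ {φ = φ} p with isOne φ in e | isOne-cong p
... | true | _ = isOne-sound φ e

∧-proj₂ : {φ ψ : Face I} → φ ∧ ψ ≈ᶠ 1ᶠ → ψ ≈ᶠ 1ᶠ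
∧-proj₂ p = ∧-proj₁ (trans (∧-comm _ _) p)

-- Endpoints of the interval

~-∨ : (r s : dM I) → ~ (r ∨ s) ≈ᴵ ~ r ∧ ~ s
~-∨ r s = trans (~-cong (∨-cong (sym (~-~ r)) (sym (~-~ s))))
  (trans (~-cong (sym (~-∧ (~ r) (~ s)))) (~-~ _))

~0 : ~ 0ᴵ ≈ᴵ 1ᴵ {I}
~0 = trans (sym (∧-1 _)) (trans (∧-comm _ _)
  (trans (∧-cong (sym (~-~ 1ᴵ)) refl) (trans (sym (~-∨ (~ 1ᴵ) 0ᴵ)) (trans (~-cong (∨-0 _)) (~-~ 1ᴵ)))))

~1 : ~ 1ᴵ ≈ᴵ 0ᴵ {I}
~1 = trans (~-cong (sym ~0)) (~-~ 0ᴵ)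

0∧ᴵ : (r : dM I) → 0ᴵ ∧ r ≈ᴵ 0ᴵ
0∧ᴵ r = trans (∧-cong refl (sym (trans (∨-comm _ _) (∨-0 r)))) (∧-absorb-∨ 0ᴵ r)

∧0ᴵ : (r : dM I) → r ∧ 0ᴵ ≈ᴵ 0ᴵ
∧0ᴵ r = trans (∧-comm _ _) (0∧ᴵ r)

1∧ᴵ : (r : dM I) → 1ᴵ ∧ r ≈ᴵ r
1∧ᴵ r = trans (∧-comm _ _) (∧-1 r)

0∨ᴵ : (r : dM I) → 0ᴵ ∨ r ≈ᴵ r
0∨ᴵ r = trans (∨-comm _ _) (∨-0 r)

1∨ᴵ : (r : dM I) → 1ᴵ ∨ r ≈ᴵ 1ᴵ
1∨ᴵ r = trans (∨-cong refl (sym (1∧ᴵ r))) (∨-absorb-∧ 1ᴵ r)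

∨1ᴵ : (r : dM I) → r ∨ 1ᴵ ≈ᴵ 1ᴵ
∨1ᴵ r = trans (∨-comm _ _) (1∨ᴵ r)

-- Both by recursion on the term: where the face is a join, `∨-prime` takes it apart, and a name is
-- excluded since `isOne` is `false` on its faces. With this a system on `(r = 0)` or `(r = 1)` may
-- use the equation for `r` itself.
=0-one : (r : dM I) → r =0ᶠ ≈ᶠ 1ᶠ → r ≈ᴵ 0ᴵ
=1-one : (r : dM I) → r =1ᶠ ≈ᶠ 1ᶠ → r ≈ᴵ 1ᴵ
=0-one (name i) p with isOne-cong p
... | ()
=0-one 0ᴵ       p = refl
=0-one 1ᴵ       p = ⊥-elim (0≉1 p)
=0-one (r ∧ s)  p with ∨-prime (r =0ᶠ) (s =0ᶠ) p
... | inj₁ q = trans (∧-cong (=0-one r q) refl) (0∧ᴵ s)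
... | inj₂ q = trans (∧-cong refl (=0-one s q)) (∧0ᴵ r)
=0-one (r ∨ s)  p = trans (∨-cong (=0-one r (∧-proj₁ p)) (=0-one s (∧-proj₂ p))) (∨-0 0ᴵ)
=0-one (~ r)    p = trans (~-cong (=1-one r p)) ~1
=1-one (name i) p with isOne-cong p
... | ()
=1-one 0ᴵ       p = ⊥-elim (0≉1 p)
=1-one 1ᴵ       p = refl
=1-one (r ∧ s)  p = trans (∧-cong (=1-one r (∧-proj₁ p)) (=1-one s (∧-proj₂ p))) (∧-1 1ᴵ)
=1-one (r ∨ s)  p with ∨-prime (r =1ᶠ) (s =1ᶠ) p
... | inj₁ q = trans (∨-cong (=1-one r q) refl) (1∨ᴵ s)
... | inj₂ q = trans (∨-cong refl (=1-one s q)) (∨1ᴵ r)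
=1-one (~ r)    p = trans (~-cong (=0-one r p)) ~0

=0-disjoint-=1 : {r : dM I} → r =0ᶠ ≈ᶠ 1ᶠ → r =1ᶠ ≈ᶠ 1ᶠ → ⊥
=0-disjoint-=1 {r = r} p q = 0≉1 (trans (sym (=0ᶠ∧=1ᶠ r)) (∧-one p q))

=0-intro : {r : dM I} → r ≈ᴵ 0ᴵ → r =0ᶠ ≈ᶠ 1ᶠ
=0-intro = =0-cong

=1-intro : {r : dM I} → r ≈ᴵ 1ᴵ → r =1ᶠ ≈ᶠ 1ᶠ
=1-intro = =1-cong

faceLattice : ℕ → Lattice 0ℓ 0ℓ
faceLattice I = record
  { Carrier = Face I ; _≈_ = _≈ᶠ_ ; _∨_ = _∨_ ; _∧_ = _∧_
  ; isLattice = record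
    { isEquivalence = record { refl = refl ; sym = sym ; trans = trans }
    ; ∨-comm = ∨-comm ; ∨-assoc = ∨-assoc ; ∨-cong = ∨-cong
    ; ∧-comm = ∧-comm ; ∧-assoc = ∧-assoc ; ∧-cong = ∧-cong
    ; absorptive = ∨-absorb-∧ , ∧-absorb-∨ } }

module FaceOrder {I : ℕ} where
  open OrderLattice.Lattice (LatticeProperties.∨-∧-orderTheoreticLattice (faceLattice I)) public
    using (_≤_; x∧y≤x; x∧y≤y; ∧-greatest; ∨-least; antisym; reflexive; x≤x∨y; y≤x∨y)
    renaming (refl to ≤-refl; trans to ≤-trans)

  ≤1 : {φ : Face I} → φ ≤ 1ᶠ
  ≤1 {φ} = sym (∧-1 φ)

  0≤ : {φ : Face I} → 0ᶠ ≤ φ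
  0≤ {φ} = sym (0∧ φ)

  one-mono : {φ ψ : Face I} → φ ≤ ψ → φ ≈ᶠ 1ᶠ → ψ ≈ᶠ 1ᶠ
  one-mono p q = ∧-proj₂ (trans (sym p) q)

open FaceOrder

-- Faces are determined by substitutions

[_≔_] : Fin I → dM I → I ⇒ I
[ j ≔ b ] k with k ≟ j
... | yes _ = b
... | no  _ = name k

-- χ is the face classified by f, an endomorphism that substitutes constants
-- and names for names.
record Classifies (f : I ⇒ I) (χ : Face I) : Set where
  field
    simple  : ∀ i → (f i ≡ 0ᴵ ⊎ f i ≡ 1ᴵ) ⊎ ∃[ j ] f i ≡ name j
    holds   : χ ⟨ f ⟩ᶠ ≈ᶠ 1ᶠ
    =0-subst : ∀ i → χ ∧ (i =0) ≈ᶠ χ ∧ (f i =0ᶠ)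
    =1-subst : ∀ i → χ ∧ (i =1) ≈ᶠ χ ∧ (f i =1ᶠ)

module _ {χ : Face I} {f : I ⇒ I}
         (s₀ : ∀ i → χ ∧ (i =0) ≈ᶠ χ ∧ (f i =0ᶠ))
         (s₁ : ∀ i → χ ∧ (i =1) ≈ᶠ χ ∧ (f i =1ᶠ)) where

  -- Below `χ` the substitution `f` acts as the identity. The relation `χ ∧ φ ≈ᶠ χ ∧ ψ` between `φ`
  -- and `ψ` is a lattice congruence by distributivity, so it is enough to know this for generators.
  subst-below : ∀ ψ → χ ∧ ψ ≈ᶠ χ ∧ ψ ⟨ f ⟩ᶠ
  subst-below (i =0)  = s₀ i
  subst-below (i =1)  = s₁ i
  subst-below 0ᶠ      = refl
  subst-below 1ᶠ      = refl
  subst-below (φ ∧ ψ) = trans (sym (∧-assoc _ _ _)) (trans (∧-cong (subst-below φ) refl)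
    (trans (∧-assoc _ _ _) (trans (∧-cong refl (∧-comm _ _)) (trans (sym (∧-assoc _ _ _))
      (trans (∧-cong (subst-below ψ) refl) (trans (∧-assoc _ _ _) (∧-cong refl (∧-comm _ _))))))))
  subst-below (φ ∨ ψ) = trans (∧-distr-∨ _ _ _)
    (trans (∨-cong (subst-below φ) (subst-below ψ)) (sym (∧-distr-∨ _ _ _)))

∧-idem : (φ : Face I) → φ ∧ φ ≈ᶠ φ
∧-idem φ = trans (∧-cong refl (sym (∨-absorb-∧ φ φ))) (∧-absorb-∨ φ (φ ∧ φ))

=1∧=0 : (i : Fin I) → (i =1) ∧ (i =0) ≈ᶠ 0ᶠ
=1∧=0 i = trans (∧-comm _ _) (=0∧=1 i)

module _ {χ : Face I} {f : I ⇒ I} (C : Classifies f χ) where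
  open Classifies C

  private
    -- Cuts `χ` down by a literal `λi` that `f` reads as a condition on the name `j`. Below `χ` the
    -- substitution `f` changes nothing, and below the image of `λi` under `f` neither does setting
    -- `j` to `b`; so the composite changes nothing below `χ ∧ λi`.
    extend : (λi : Face I) {b : dM I} (i j : Fin I) → f i ≡ name j → λi ⟨ f ⟩ᶠ ⟨ [ j ≔ b ] ⟩ᶠ ≈ᶠ 1ᶠ →
             (b ≡ 0ᴵ ⊎ b ≡ 1ᴵ) →
             (∀ k → λi ⟨ f ⟩ᶠ ∧ (k =0) ≈ᶠ λi ⟨ f ⟩ᶠ ∧ ([ j ≔ b ] k =0ᶠ)) →
             (∀ k → λi ⟨ f ⟩ᶠ ∧ (k =1) ≈ᶠ λi ⟨ f ⟩ᶠ ∧ ([ j ≔ b ] k =1ᶠ)) →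
             Classifies (f ⨟ [ j ≔ b ]) (χ ∧ λi)
    extend λi {b} i j e h c s₀ s₁ = record
      { simple   = λ k → simple′ k (simple k)
      ; holds    = ∧-one
          (trans (sym (⟨⟩ᶠ-⨟ χ f [ j ≔ b ])) (⟨⟩ᶠ-cong holds (reflʰ {f = [ j ≔ b ]})))
          (trans (sym (⟨⟩ᶠ-⨟ λi f [ j ≔ b ])) h)
      ; =0-subst = λ k → shift (k =0) (f k ⟨ [ j ≔ b ] ⟩ =0ᶠ) (=0ᶠ-⟨⟩ (f k) [ j ≔ b ])
      ; =1-subst = λ k → shift (k =1) (f k ⟨ [ j ≔ b ] ⟩ =1ᶠ) (=1ᶠ-⟨⟩ (f k) [ j ≔ b ])
      }
      where
      below = subst-below {χ = χ} {f} =0-subst =1-subst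

      simple′ : ∀ k → (f k ≡ 0ᴵ ⊎ f k ≡ 1ᴵ) ⊎ ∃[ j ] f k ≡ name j →
                ((f ⨟ [ j ≔ b ]) k ≡ 0ᴵ ⊎ (f ⨟ [ j ≔ b ]) k ≡ 1ᴵ) ⊎ ∃[ l ] (f ⨟ [ j ≔ b ]) k ≡ name l
      simple′ k (inj₁ (inj₁ p)) rewrite p = inj₁ (inj₁ ≡.refl)
      simple′ k (inj₁ (inj₂ p)) rewrite p = inj₁ (inj₂ ≡.refl)
      simple′ k (inj₂ (l , p)) rewrite p with l ≟ j
      ... | yes _ = inj₁ c
      ... | no  _ = inj₂ (l , ≡.refl)

      shift : ∀ ψ ψ′ → ψ ⟨ f ⟩ᶠ ⟨ [ j ≔ b ] ⟩ᶠ ≈ᶠ ψ′ → (χ ∧ λi) ∧ ψ ≈ᶠ (χ ∧ λi) ∧ ψ′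
      shift ψ ψ′ p = trans (∧-assoc _ _ _) (trans (below (λi ∧ ψ))
        (trans (∧-cong refl (trans (subst-below {χ = λi ⟨ f ⟩ᶠ} {[ j ≔ b ]} s₀ s₁ (ψ ⟨ f ⟩ᶠ)) (∧-cong refl p)))
          (trans (sym (∧-assoc _ _ _)) (∧-cong (sym (below λi)) refl))))

    at-face₀ : ∀ {i j} → f i ≡ name j → (k : Fin I) →
               ((j =0) ∧ (k =0) ≈ᶠ (j =0) ∧ ([ j ≔ 0ᴵ ] k =0ᶠ)) × ((j =0) ∧ (k =1) ≈ᶠ (j =0) ∧ ([ j ≔ 0ᴵ ] k =1ᶠ))
    at-face₀ {j = j} e k with k ≟ j
    ... | yes ≡.refl = trans (∧-idem _) (sym (∧-1 _)) , trans (=0∧=1 k) (sym (trans (∧-comm _ _) (0∧ _)))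
    ... | no _       = refl , refl

    at-face₁ : ∀ {i j} → f i ≡ name j → (k : Fin I) →
               ((j =1) ∧ (k =0) ≈ᶠ (j =1) ∧ ([ j ≔ 1ᴵ ] k =0ᶠ)) × ((j =1) ∧ (k =1) ≈ᶠ (j =1) ∧ ([ j ≔ 1ᴵ ] k =1ᶠ))
    at-face₁ {j = j} e k with k ≟ j
    ... | yes ≡.refl = trans (=1∧=0 k) (sym (trans (∧-comm _ _) (0∧ _))) , trans (∧-idem _) (sym (∧-1 _))
    ... | no _       = refl , refl

    ≔-here : (b : dM I) (j : Fin I) → [ j ≔ b ] j ≡ b
    ≔-here b j with j ≟ j
    ... | yes _ = ≡.refl
    ... | no ¬p = ⊥-elim (¬p ≡.refl)

  restrict-=0 : ∀ {i j} → f i ≡ name j → Classifies (f ⨟ [ j ≔ 0ᴵ ]) (χ ∧ (i =0))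
  restrict-=0 {i} {j} e = extend (i =0) i j e one (inj₁ ≡.refl)
    (λ k → ≡.subst (λ r → (r =0ᶠ) ∧ (k =0) ≈ᶠ (r =0ᶠ) ∧ ([ j ≔ 0ᴵ ] k =0ᶠ)) (≡.sym e) (proj₁ (at-face₀ e k)))
    (λ k → ≡.subst (λ r → (r =0ᶠ) ∧ (k =1) ≈ᶠ (r =0ᶠ) ∧ ([ j ≔ 0ᴵ ] k =1ᶠ)) (≡.sym e) (proj₂ (at-face₀ e k)))
    where
    one : (f i =0ᶠ) ⟨ [ j ≔ 0ᴵ ] ⟩ᶠ ≈ᶠ 1ᶠ
    one rewrite e | ≔-here 0ᴵ j = refl

  restrict-=1 : ∀ {i j} → f i ≡ name j → Classifies (f ⨟ [ j ≔ 1ᴵ ]) (χ ∧ (i =1))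
  restrict-=1 {i} {j} e = extend (i =1) i j e one (inj₂ ≡.refl)
    (λ k → ≡.subst (λ r → (r =1ᶠ) ∧ (k =0) ≈ᶠ (r =1ᶠ) ∧ ([ j ≔ 1ᴵ ] k =0ᶠ)) (≡.sym e) (proj₁ (at-face₁ e k)))
    (λ k → ≡.subst (λ r → (r =1ᶠ) ∧ (k =1) ≈ᶠ (r =1ᶠ) ∧ ([ j ≔ 1ᴵ ] k =1ᶠ)) (≡.sym e) (proj₂ (at-face₁ e k)))
    where
    one : (f i =1ᶠ) ⟨ [ j ≔ 1ᴵ ] ⟩ᶠ ≈ᶠ 1ᶠ
    one rewrite e | ≔-here 1ᴵ j = refl

-- Classified faces are join dense, also relative to a further face θ: this
-- makes the induction pass through conjunctions.
dense : ∀ (φ : Face I) {χ f} → Classifies f χ → ∀ θ ψ →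
        (∀ {χ′ f′} → Classifies f′ χ′ → χ′ ≤ χ → χ′ ≤ φ → χ′ ∧ θ ≤ ψ) → (χ ∧ φ) ∧ θ ≤ ψ
dense {I} (i =0) {χ} {f} C θ ψ h with Classifies.simple C i
-- If `f` sends `i` to 0 then `χ` lies below `(i = 0)` already; if to 1 then `χ ∧ (i = 0)` is 0; if
-- to a name, that name is set to 0 and `χ` shrinks to `χ ∧ (i = 0)`.
... | inj₁ (inj₁ e) = ≤-trans (∧-greatest (≤-trans (x∧y≤x _ _) (x∧y≤x _ _)) (x∧y≤y _ _))
  (h C ≤-refl (≤-trans (reflexive (sym (trans (Classifies.=0-subst C i)
    (trans (≡.subst (λ r → χ ∧ (f i =0ᶠ) ≈ᶠ χ ∧ (r =0ᶠ)) e refl) (∧-1 χ))))) (x∧y≤y _ _)))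
... | inj₁ (inj₂ e) = ≤-trans (x∧y≤x _ _) (≤-trans (reflexive (trans (Classifies.=0-subst C i)
    (≡.subst (λ r → χ ∧ (f i =0ᶠ) ≈ᶠ χ ∧ (r =0ᶠ)) e refl))) (≤-trans (x∧y≤y _ _) 0≤))
... | inj₂ (j , e)  = h (restrict-=0 C e) (x∧y≤x _ _) (x∧y≤y _ _)
dense {I} (i =1) {χ} {f} C θ ψ h with Classifies.simple C i
... | inj₁ (inj₂ e) = ≤-trans (∧-greatest (≤-trans (x∧y≤x _ _) (x∧y≤x _ _)) (x∧y≤y _ _))
  (h C ≤-refl (≤-trans (reflexive (sym (trans (Classifies.=1-subst C i)
    (trans (≡.subst (λ r → χ ∧ (f i =1ᶠ) ≈ᶠ χ ∧ (r =1ᶠ)) e refl) (∧-1 χ))))) (x∧y≤y _ _)))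
... | inj₁ (inj₁ e) = ≤-trans (x∧y≤x _ _) (≤-trans (reflexive (trans (Classifies.=1-subst C i)
    (≡.subst (λ r → χ ∧ (f i =1ᶠ) ≈ᶠ χ ∧ (r =1ᶠ)) e refl))) (≤-trans (x∧y≤y _ _) 0≤))
... | inj₂ (j , e)  = h (restrict-=1 C e) (x∧y≤x _ _) (x∧y≤y _ _)
dense 0ᶠ C θ ψ h = ≤-trans (x∧y≤x _ _) (≤-trans (x∧y≤y _ _) 0≤)
dense 1ᶠ C θ ψ h = ≤-trans (∧-greatest (≤-trans (x∧y≤x _ _) (x∧y≤x _ _)) (x∧y≤y _ _)) (h C ≤-refl ≤1)
dense (φ ∧ φ′) C θ ψ h =
  ≤-trans (reflexive (trans (∧-cong (sym (∧-assoc _ _ _)) refl) (∧-assoc _ _ _)))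
    (dense φ C (φ′ ∧ θ) ψ λ D p q → ≤-trans (reflexive (sym (∧-assoc _ _ _)))
      (dense φ′ D θ ψ λ E r s → h E (≤-trans r p) (∧-greatest (≤-trans r q) s)))
dense (φ ∨ φ′) C θ ψ h =
  ≤-trans (reflexive (trans (∧-cong (∧-distr-∨ _ _ _) refl)
    (trans (∧-comm _ _) (trans (∧-distr-∨ _ _ _) (∨-cong (∧-comm _ _) (∧-comm _ _))))))
    (∨-least (dense φ C θ ψ λ D p q → h D p (≤-trans q (x≤x∨y _ _)))
             (dense φ′ C θ ψ λ D p q → h D p (≤-trans q (y≤x∨y _ _))))

-- `dense`, started at the face 1, covers `φ` by classified faces `χ ≤ φ`. The substitution `f` that
-- classifies `χ` makes `χ`, hence `φ`, hence `ψ` equal to 1, and below `χ` the face `ψ` agrees with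
-- `ψ ⟨ f ⟩ᶠ`. Endomorphisms of `I` therefore separate faces.
≤-complete : {φ ψ : Face I} → (∀ (f : I ⇒ I) → φ ⟨ f ⟩ᶠ ≈ᶠ 1ᶠ → ψ ⟨ f ⟩ᶠ ≈ᶠ 1ᶠ) → φ ≤ ψ
≤-complete {I} {φ} {ψ} h = ≤-trans (∧-greatest (∧-greatest ≤1 ≤-refl) ≤1)
  (dense φ top 1ᶠ ψ λ {χ} {f} C _ p → ≤-trans (x∧y≤x _ _)
    (≤-trans (reflexive (trans (sym (∧-1 χ)) (trans
        (∧-cong refl (sym (h f (one-mono (sub p f) (Classifies.holds C)))))
        (sym (subst-below {χ = χ} {f} (Classifies.=0-subst C) (Classifies.=1-subst C) ψ)))))
      (x∧y≤y _ _)))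
  where
  top : Classifies idʰ 1ᶠ
  top = record
    { simple = λ i → inj₂ (i , ≡.refl) ; holds = refl
    ; =0-subst = λ i → refl ; =1-subst = λ i → refl }

  sub : ∀ {χ φ : Face I} → χ ≤ φ → (f : I ⇒ I) → χ ⟨ f ⟩ᶠ ≤ φ ⟨ f ⟩ᶠ
  sub p f = ⟨⟩ᶠ-cong p (reflʰ {f = f})

≈ᶠ-complete : {φ ψ : Face I} → (∀ (f : I ⇒ I) → φ ⟨ f ⟩ᶠ ≈ᶠ 1ᶠ → ψ ⟨ f ⟩ᶠ ≈ᶠ 1ᶠ) →
              (∀ (f : I ⇒ I) → ψ ⟨ f ⟩ᶠ ≈ᶠ 1ᶠ → φ ⟨ f ⟩ᶠ ≈ᶠ 1ᶠ) → φ ≈ᶠ ψ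
≈ᶠ-complete p q = antisym (≤-complete p) (≤-complete q)

-- Conjunction with a partial face

record PartialFace (φ : Face I) : Set where
  field
    at         : (f : I ⇒ J) → φ ⟨ f ⟩ᶠ ≈ᶠ 1ᶠ → Face J
    compatible : {f : I ⇒ J} {g : J ⇒ K} {h : I ⇒ K} {p : φ ⟨ f ⟩ᶠ ≈ᶠ 1ᶠ} {q : φ ⟨ h ⟩ᶠ ≈ᶠ 1ᶠ} →
                 f ⨟ g ≈ʰ h → at f p ⟨ g ⟩ᶠ ≈ᶠ at h q

-- Assignments of values enumerate the faces of the cube with names `I`: every name is set to 0, to
-- 1 or left alone. A partial face has infinitely many values, but those at the finitely many
-- substitutions `⟦ α ⟧` determine when it is 1, so a finite join suffices to extend it.
data Value : Set where
  zeroᵛ oneᵛ generic : Value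

value : Value → Fin I → dM I
value zeroᵛ   i = 0ᴵ
value oneᵛ    i = 1ᴵ
value generic i = name i

condition : Value → Fin I → Face I
condition zeroᵛ   i = i =0
condition oneᵛ    i = i =1
condition generic i = 1ᶠ

⟦_⟧ : Vec Value I → I ⇒ I
⟦ α ⟧ i = value (lookup α i) i

⋀ : (n : ℕ) → (Fin n → Face I) → Face I
⋀ zero    k = 1ᶠ
⋀ (suc n) k = k zero ∧ ⋀ n (k ∘ suc)

⋁ : (n : ℕ) → (Vec Value n → Face I) → Face I
⋁ zero    k = k []
⋁ (suc n) k = ⋁ n (k ∘ (zeroᵛ ∷_)) ∨ (⋁ n (k ∘ (oneᵛ ∷_)) ∨ ⋁ n (k ∘ (generic ∷_)))

face : Vec Value I → Face I
face {I} α = ⋀ I λ i → condition (lookup α i) i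

⋀-elim : ∀ n (k : Fin n → Face I) (g : I ⇒ J) → ⋀ n k ⟨ g ⟩ᶠ ≈ᶠ 1ᶠ → ∀ i → k i ⟨ g ⟩ᶠ ≈ᶠ 1ᶠ
⋀-elim (suc n) k g p zero    = ∧-proj₁ p
⋀-elim (suc n) k g p (suc i) = ⋀-elim n (k ∘ suc) g (∧-proj₂ p) i

⋀-intro : ∀ n (k : Fin n → Face I) (g : I ⇒ J) → (∀ i → k i ⟨ g ⟩ᶠ ≈ᶠ 1ᶠ) → ⋀ n k ⟨ g ⟩ᶠ ≈ᶠ 1ᶠ
⋀-intro zero    k g p = refl
⋀-intro (suc n) k g p = ∧-one (p zero) (⋀-intro n (k ∘ suc) g (p ∘ suc))

⋁-elim : ∀ n (k : Vec Value n → Face I) (g : I ⇒ J) → ⋁ n k ⟨ g ⟩ᶠ ≈ᶠ 1ᶠ → ∃[ α ] k α ⟨ g ⟩ᶠ ≈ᶠ 1ᶠ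
⋁-elim zero    k g p = [] , p
⋁-elim (suc n) k g p with ∨-prime _ _ p
... | inj₁ q = let α , r = ⋁-elim n _ g q in zeroᵛ ∷ α , r
... | inj₂ q with ∨-prime _ _ q
...   | inj₁ r = let α , s = ⋁-elim n _ g r in oneᵛ ∷ α , s
...   | inj₂ r = let α , s = ⋁-elim n _ g r in generic ∷ α , s

⋁-intro : ∀ n (k : Vec Value n → Face I) (g : I ⇒ J) α → k α ⟨ g ⟩ᶠ ≈ᶠ 1ᶠ → ⋁ n k ⟨ g ⟩ᶠ ≈ᶠ 1ᶠ
⋁-intro zero    k g []            p = p
⋁-intro (suc n) k g (zeroᵛ ∷ α)   p = ∨-oneˡ (⋁-intro n _ g α p)
⋁-intro (suc n) k g (oneᵛ ∷ α)    p = ∨-oneʳ (∨-oneˡ (⋁-intro n _ g α p))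
⋁-intro (suc n) k g (generic ∷ α) p = ∨-oneʳ (∨-oneʳ (⋁-intro n _ g α p))

-- By `=0-one` and `=1-one`, `g` takes the values that `α` prescribes. Hence anything compatible
-- with substitution has at `g` the restriction along `g` of its value at `⟦ α ⟧`.
face-fixes : (α : Vec Value I) (g : I ⇒ J) → face α ⟨ g ⟩ᶠ ≈ᶠ 1ᶠ → ⟦ α ⟧ ⨟ g ≈ʰ g
face-fixes {I} α g p i with lookup α i | ⋀-elim I (λ i → condition (lookup α i) i) g p i
... | zeroᵛ   | q = sym (=0-one (g i) q)
... | oneᵛ    | q = sym (=1-one (g i) q)
... | generic | q = refl

classify : dM J → Value
classify r = if isOne (r =0ᶠ) then zeroᵛ else if isOne (r =1ᶠ) then oneᵛ else generic

assignment : I ⇒ J → Vec Value I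
assignment g = tabulate (classify ∘ g)

assignment-face : (g : I ⇒ J) → face (assignment g) ⟨ g ⟩ᶠ ≈ᶠ 1ᶠ
assignment-face {I} g = ⋀-intro I (λ i → condition (lookup (assignment g) i) i) g holds
  where
  holds : ∀ i → condition (lookup (assignment g) i) i ⟨ g ⟩ᶠ ≈ᶠ 1ᶠ
  holds i rewrite lookup∘tabulate (classify ∘ g) i with isOne (g i =0ᶠ) in p | isOne (g i =1ᶠ) in q
  ... | true  | _     = isOne-sound (g i =0ᶠ) p
  ... | false | true  = isOne-sound (g i =1ᶠ) q
  ... | false | false = refl

-- Whether φ g = 1 depends only on which names g sends to 0 and to 1.
assignment-isOne : (g : I ⇒ J) (φ : Face I) → isOne (φ ⟨ ⟦ assignment g ⟧ ⟩ᶠ) ≡ isOne (φ ⟨ g ⟩ᶠ)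
assignment-isOne g (i =0) rewrite lookup∘tabulate (classify ∘ g) i
  with isOne (g i =0ᶠ) in p | isOne (g i =1ᶠ)
... | true  | _     = ≡.refl
... | false | true  = ≡.refl
... | false | false = ≡.refl
assignment-isOne g (i =1) rewrite lookup∘tabulate (classify ∘ g) i
  with isOne (g i =0ᶠ) in p | isOne (g i =1ᶠ) in q
... | true  | true  = ⊥-elim (=0-disjoint-=1 {r = g i} (isOne-sound (g i =0ᶠ) p) (isOne-sound (g i =1ᶠ) q))
... | true  | false = ≡.refl
... | false | true  = ≡.refl
... | false | false = ≡.refl
assignment-isOne g 0ᶠ      = ≡.refl
assignment-isOne g 1ᶠ      = ≡.refl
assignment-isOne g (φ ∧ ψ) = ≡.cong₂ Bool._∧_ (assignment-isOne g φ) (assignment-isOne g ψ)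
assignment-isOne g (φ ∨ ψ) = ≡.cong₂ Bool._∨_ (assignment-isOne g φ) (assignment-isOne g ψ)

module _ {φ : Face I} (ψ : PartialFace φ) where
  open PartialFace ψ

  opaque
    -- `b` is the outcome of the test whether `φ` is 1 at `⟦ α ⟧`, where `ψ` is to be evaluated. It
    -- is an argument, together with its equation, so that the next lemmas can split on it; a failed
    -- test contributes 0 to the join.
    disjunct : (α : Vec Value I) (b : Bool) → isOne (φ ⟨ ⟦ α ⟧ ⟩ᶠ) ≡ b → Face I
    disjunct α true  e = face α ∧ at ⟦ α ⟧ (isOne-sound (φ ⟨ ⟦ α ⟧ ⟩ᶠ) e)
    disjunct α false e = 0ᶠ

    disjunct-elim : ∀ α b e (g : I ⇒ J) → disjunct α b e ⟨ g ⟩ᶠ ≈ᶠ 1ᶠ →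
                    Σ[ p ∈ φ ⟨ g ⟩ᶠ ≈ᶠ 1ᶠ ] at g p ≈ᶠ 1ᶠ
    disjunct-elim α true e g p = q , trans (sym (compatible {p = e′} fix)) (∧-proj₂ p)
      where
      fix : ⟦ α ⟧ ⨟ g ≈ʰ g
      fix = face-fixes α g (∧-proj₁ p)
      e′ : φ ⟨ ⟦ α ⟧ ⟩ᶠ ≈ᶠ 1ᶠ
      e′ = isOne-sound (φ ⟨ ⟦ α ⟧ ⟩ᶠ) e
      q : φ ⟨ g ⟩ᶠ ≈ᶠ 1ᶠ
      q = trans (⟨⟩ᶠ-cong (refl {φ = φ}) (symʰ fix))
            (trans (sym (⟨⟩ᶠ-⨟ φ ⟦ α ⟧ g)) (⟨⟩ᶠ-cong e′ (reflʰ {f = g})))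
    disjunct-elim α false e g p = ⊥-elim (0≉1 p)

    -- The face φ ∧ ψ, for ψ defined only on φ.
    conj : Face I
    conj = ⋁ I λ α → disjunct α (isOne (φ ⟨ ⟦ α ⟧ ⟩ᶠ)) ≡.refl

    conj-elim : (g : I ⇒ J) → conj ⟨ g ⟩ᶠ ≈ᶠ 1ᶠ → Σ[ p ∈ φ ⟨ g ⟩ᶠ ≈ᶠ 1ᶠ ] at g p ≈ᶠ 1ᶠ
    conj-elim g p = let α , q = ⋁-elim I _ g p in disjunct-elim α (isOne (φ ⟨ ⟦ α ⟧ ⟩ᶠ)) ≡.refl g q

    conj-intro : (g : I ⇒ J) (p : φ ⟨ g ⟩ᶠ ≈ᶠ 1ᶠ) → at g p ≈ᶠ 1ᶠ → conj ⟨ g ⟩ᶠ ≈ᶠ 1ᶠ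
    -- The disjunct of the assignment read off from `g` is the one that is 1 along `g`. Its test
    -- succeeds since `assignment-isOne` compares `φ` at `⟦ α ⟧` with `φ` at `g`.
    conj-intro g p q = ⋁-intro I _ g α (go _ ≡.refl
      (≡.trans (assignment-isOne g φ) (isOne-cong p)))
      where
      α : Vec Value I
      α = assignment g
      go : ∀ b e → b ≡ true → disjunct α b e ⟨ g ⟩ᶠ ≈ᶠ 1ᶠ
      go true e _ = ∧-one (assignment-face g)
        (trans (compatible {q = p} (face-fixes α g (assignment-face g))) q)

-- By completeness only the substitutions that make either side 1 have to be compared, and those of
-- `conj` are known from `conj-elim` and `conj-intro`. Together with `conj-natural` this makes
-- `conj` a uniform extension of `ψ`.
conj-on : {φ : Face I} (ψ : PartialFace φ) (f : I ⇒ J) (p : φ ⟨ f ⟩ᶠ ≈ᶠ 1ᶠ) →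
          conj ψ ⟨ f ⟩ᶠ ≈ᶠ PartialFace.at ψ f p
conj-on {φ = φ} ψ f p = ≈ᶠ-complete
  (λ g q → let r , s = conj-elim ψ (f ⨟ g) (trans (sym (⟨⟩ᶠ-⨟ (conj ψ) f g)) q)
           in trans (compatible {q = r} (λ i → refl)) s)
  (λ g q → trans (⟨⟩ᶠ-⨟ (conj ψ) f g) (conj-intro ψ (f ⨟ g)
    (trans (sym (⟨⟩ᶠ-⨟ φ f g)) (⟨⟩ᶠ-cong p (reflʰ {f = g}))) (trans (sym (compatible {p = p} (λ i → refl))) q)))
  where open PartialFace ψ

conj-natural : {φ : Face I} {φ′ : Face J} {ψ : PartialFace φ} {ψ′ : PartialFace φ′} (f : I ⇒ J) →
               φ ⟨ f ⟩ᶠ ≈ᶠ φ′ →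
               (∀ {K} (g : J ⇒ K) p q → PartialFace.at ψ (f ⨟ g) p ≈ᶠ PartialFace.at ψ′ g q) →
               conj ψ ⟨ f ⟩ᶠ ≈ᶠ conj ψ′
conj-natural {φ = φ} {φ′} {ψ} {ψ′} f c m = ≈ᶠ-complete
  (λ g q → let r , s = conj-elim ψ (f ⨟ g) (trans (sym (⟨⟩ᶠ-⨟ (conj ψ) f g)) q)
               r′ = trans (sym (extent g)) r
           in conj-intro ψ′ g r′ (trans (sym (m g r r′)) s))
  (λ g q → let r , s = conj-elim ψ′ g q
               r′ = trans (extent g) r
           in trans (⟨⟩ᶠ-⨟ (conj ψ) f g) (conj-intro ψ (f ⨟ g) r′ (trans (m g r′ r) s)))
  where
  extent : ∀ {K} (g : _ ⇒ K) → φ ⟨ f ⨟ g ⟩ᶠ ≈ᶠ φ′ ⟨ g ⟩ᶠ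
  extent g = trans (sym (⟨⟩ᶠ-⨟ φ f g)) (⟨⟩ᶠ-cong c (reflʰ {f = g}))

-- Restriction as a relation

-- A ∋ x ∼[ f ] y says that y is the restriction of x along f, for some
-- identification of the points over which x and y live.

infix 4 _∋_∼[_]_ _∋_≅_

record _∋_∼[_]_ {Γ : CubicalSet ℓ} (A : Family Γ) {ρ : CubicalSet.Cell Γ I} {ρ′ : CubicalSet.Cell Γ J}
       (x : Family.Elem A ρ) (f : I ⇒ J) (y : Family.Elem A ρ′) : Set ℓ where
  constructor _,_
  open CubicalSet Γ
  open Family A
  field
    base : ρ · f ≈ ρ′
    eq   : restrict f base x ≋ y

_∋_≅_ : {Γ : CubicalSet ℓ} (A : Family Γ) {ρ ρ′ : CubicalSet.Cell Γ I} →
        Family.Elem A ρ → Family.Elem A ρ′ → Set ℓ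
A ∋ x ≅ y = A ∋ x ∼[ idʰ ] y

module Restriction {Γ : CubicalSet ℓ} (A : Family Γ) where
  open CubicalSet Γ
  open Family A
  open _∋_∼[_]_ public

  infixr 5 _▸_ _≅▸_ _∼▸_

  opaque
    res : {ρ : Cell I} {ρ′ : Cell J} {f : I ⇒ J} {e : ρ · f ≈ ρ′} {x : Elem ρ} → A ∋ x ∼[ f ] restrict f e x
    res {e = e} = e , reflᵃ

    reindex∼ : {ρ : Cell I} {ρ′ : Cell J} {f g : I ⇒ J} {x : Elem ρ} {y : Elem ρ′} →
               f ≈ʰ g → A ∋ x ∼[ f ] y → A ∋ x ∼[ g ] y
    reindex∼ c (e , p) = transˣ (·-cong reflˣ (symʰ c)) e , transᵃ (restrict-cong (symʰ c) reflᵃ) p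

    comp∼ : {ρ : Cell I} {ρ′ : Cell J} {ρ″ : Cell K} {f : I ⇒ J} {g : J ⇒ K} {h : I ⇒ K}
            {x : Elem ρ} {y : Elem ρ′} {z : Elem ρ″} →
            f ⨟ g ≈ʰ h → A ∋ x ∼[ f ] y → A ∋ y ∼[ g ] z → A ∋ x ∼[ h ] z
    comp∼ c (e , p) (d , q) = transˣ (symˣ (·-via c)) (transˣ (·-cong e reflʰ) d) ,
      transᵃ (symᵃ (restrict-via {e = e} {e′ = d} c)) (transᵃ (restrict-≋ p) q)

    -- `comp∼` solved for its second factor. Most compatibility conditions below have this form, the
    -- two elements compared being restrictions of a common one; the base equation is recovered from
    -- the other two.
    quot∼ : {ρ : Cell I} {ρ′ : Cell J} {ρ″ : Cell K} {f : I ⇒ J} {g : J ⇒ K} {h : I ⇒ K}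
            {x : Elem ρ} {y : Elem ρ′} {z : Elem ρ″} →
            f ⨟ g ≈ʰ h → A ∋ x ∼[ f ] y → A ∋ x ∼[ h ] z → A ∋ y ∼[ g ] z
    quot∼ {ρ′ = ρ′} {ρ″} {g = g} c (e , p) (d , q) = d′ ,
      transᵃ (restrict-≋ (symᵃ p)) (transᵃ (restrict-via {e = e} {e′ = d′} {e″ = d} c) q)
      where
      d′ : ρ′ · g ≈ ρ″
      d′ = transˣ (·-cong (symˣ e) reflʰ) (transˣ (·-via c) d)

    fromEq : {ρ : Cell I} {x y : Elem ρ} → x ≋ y → A ∋ x ≅ y
    fromEq p = ·-id , transᵃ restrict-id p

    toEq : {ρ : Cell I} {x y : Elem ρ} → A ∋ x ≅ y → x ≋ y
    toEq (e , p) = transᵃ (symᵃ restrict-id) p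

    toRestrict : {ρ : Cell I} {ρ′ : Cell J} {f : I ⇒ J} {e : ρ · f ≈ ρ′} {x : Elem ρ} {y : Elem ρ′} →
                 A ∋ x ∼[ f ] y → restrict f e x ≋ y
    toRestrict (e , p) = transᵃ (restrict-≋ reflᵃ) p

    _▸_ : {ρ ρ′ ρ″ : Cell I} {x : Elem ρ} {y : Elem ρ′} {z : Elem ρ″} → A ∋ x ≅ y → A ∋ y ≅ z → A ∋ x ≅ z
    _▸_ = comp∼ reflʰ

    _≅▸_ : {ρ ρ′ : Cell I} {ρ″ : Cell J} {f : I ⇒ J} {x : Elem ρ} {y : Elem ρ′} {z : Elem ρ″} →
           A ∋ x ≅ y → A ∋ y ∼[ f ] z → A ∋ x ∼[ f ] z
    _≅▸_ = comp∼ reflʰ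

    _∼▸_ : {ρ : Cell I} {ρ′ ρ″ : Cell J} {f : I ⇒ J} {x : Elem ρ} {y : Elem ρ′} {z : Elem ρ″} →
           A ∋ x ∼[ f ] y → A ∋ y ≅ z → A ∋ x ∼[ f ] z
    _∼▸_ {f = f} = comp∼ (⨟-identityʳ f)

    refl≅ : {ρ : Cell I} {x : Elem ρ} → A ∋ x ≅ x
    refl≅ = fromEq reflᵃ

    sym≅ : {ρ ρ′ : Cell I} {x : Elem ρ} {y : Elem ρ′} → A ∋ x ≅ y → A ∋ y ≅ x
    sym≅ p = quot∼ reflʰ p refl≅

    uniq : {ρ : Cell I} {ρ′ ρ″ : Cell J} {f : I ⇒ J} {x : Elem ρ} {y : Elem ρ′} {z : Elem ρ″} →
           A ∋ x ∼[ f ] y → A ∋ x ∼[ f ] z → A ∋ y ≅ z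
    uniq {f = f} = quot∼ (⨟-identityʳ f)

    at∼ : {ρ : Cell I} {φ : Face I} (u : Partial A ρ φ) {f : I ⇒ J} {g : J ⇒ K} {h : I ⇒ K} {p : φ ⟨ f ⟩ᶠ ≈ᶠ 1ᶠ}
          {q : φ ⟨ h ⟩ᶠ ≈ᶠ 1ᶠ} → f ⨟ g ≈ʰ h → A ∋ Partial.at u f p ∼[ g ] Partial.at u h q
    at∼ u c = ·-via c , Partial.compatible u c

    at≅ : {ρ : Cell I} {φ : Face I} (u : Partial A ρ φ) {f h : I ⇒ J} {p : φ ⟨ f ⟩ᶠ ≈ᶠ 1ᶠ} {q : φ ⟨ h ⟩ᶠ ≈ᶠ 1ᶠ} →
          f ≈ʰ h → A ∋ Partial.at u f p ≅ Partial.at u h q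
    at≅ u {f} c = at∼ u (transʰ {g = f} (⨟-identityʳ f) c)

    sec∼ : (s : Section A) {ρ : Cell I} {ρ′ : Cell J} {f : I ⇒ J} → ρ · f ≈ ρ′ →
           A ∋ Section.sec s ρ ∼[ f ] Section.sec s ρ′
    sec∼ s e = e , Section.natural s

module _ {Γ : CubicalSet ℓ} {A B : Family Γ} (F : A ⟶ B) where
  open CubicalSet Γ

  opaque
    map∼ : {ρ : Cell I} {ρ′ : Cell J} {f : I ⇒ J} {x : Family.Elem A ρ} {y : Family.Elem A ρ′} →
           A ∋ x ∼[ f ] y → B ∋ _⟶_.map F x ∼[ f ] _⟶_.map F y
    map∼ (e , p) = e , Family.transᵃ B (_⟶_.natural F) (_⟶_.cong F p)

module _ {Δ Γ : CubicalSet ℓ} (σ : CubicalMap Δ Γ) (A : Family Γ) where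
  private
    module Δ = CubicalSet Δ

  opaque
    below∼ : {δ : Δ.Cell I} {δ′ : Δ.Cell J} {f : I ⇒ J} {x : Family.Elem (A [ σ ]) δ} {y : Family.Elem (A [ σ ]) δ′} →
             A [ σ ] ∋ x ∼[ f ] y → A ∋ x ∼[ f ] y
    below∼ (e , p) = CubicalMap.natural′ σ e , p

    -- `A [ σ ]` has the elements and restriction maps of `A`, and by `restrict-≋` the equation
    -- between elements does not depend on the proof of the base equation. So only an equation in
    -- `Δ` has to be supplied.
    above∼ : {δ : Δ.Cell I} {δ′ : Δ.Cell J} {f : I ⇒ J} {x : Family.Elem (A [ σ ]) δ} {y : Family.Elem (A [ σ ]) δ′} →
             δ Δ.· f Δ.≈ δ′ → A ∋ x ∼[ f ] y → A [ σ ] ∋ x ∼[ f ] y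
    above∼ e p = e , Restriction.toRestrict A p

-- Partial elements

wk-one : (φ : Face I) {f : suc I ⇒ J} → φ ⟨ weaken ⨟ f ⟩ᶠ ≈ᶠ 1ᶠ → φ ⟨ weaken ⟩ᶠ ⟨ f ⟩ᶠ ≈ᶠ 1ᶠ
wk-one φ {f} p = trans (⟨⟩ᶠ-⨟ φ weaken f) p

wk-one⁻ : (φ : Face I) {f : suc I ⇒ J} → φ ⟨ weaken ⟩ᶠ ⟨ f ⟩ᶠ ≈ᶠ 1ᶠ → φ ⟨ weaken ⨟ f ⟩ᶠ ≈ᶠ 1ᶠ
wk-one⁻ φ {f} p = trans (sym (⟨⟩ᶠ-⨟ φ weaken f)) p

restrict-one : (φ : Face I) {f : I ⇒ J} {g : J ⇒ K} → φ ⟨ f ⟩ᶠ ≈ᶠ 1ᶠ → φ ⟨ f ⨟ g ⟩ᶠ ≈ᶠ 1ᶠ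
restrict-one φ {f} {g} p = trans (sym (⟨⟩ᶠ-⨟ φ f g)) (⟨⟩ᶠ-cong p (reflʰ {f = g}))

respect-one : (φ : Face I) {f g : I ⇒ J} → f ≈ʰ g → φ ⟨ f ⟩ᶠ ≈ᶠ 1ᶠ → φ ⟨ g ⟩ᶠ ≈ᶠ 1ᶠ
respect-one φ c p = trans (⟨⟩ᶠ-cong (refl {φ = φ}) (symʰ c)) p

module _ {Γ : CubicalSet ℓ} {A : Family Γ} where
  open CubicalSet Γ
  open Family A
  open Restriction A

  module _ {ρ : Cell I} {φ ψ : Face I} (u : Partial A ρ φ) (v : Partial A ρ ψ)
           (agree : ∀ {J} (f : I ⇒ J) p q → Partial.at u f p ≋ Partial.at v f q) where
    opaque
      pick : (f : I ⇒ J) → φ ⟨ f ⟩ᶠ ≈ᶠ 1ᶠ ⊎ ψ ⟨ f ⟩ᶠ ≈ᶠ 1ᶠ → Elem (ρ · f)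
      pick f (inj₁ p) = Partial.at u f p
      pick f (inj₂ q) = Partial.at v f q

      picks : {f : I ⇒ J} {g : J ⇒ K} {h : I ⇒ K} (s : φ ⟨ f ⟩ᶠ ≈ᶠ 1ᶠ ⊎ ψ ⟨ f ⟩ᶠ ≈ᶠ 1ᶠ)
              (t : φ ⟨ h ⟩ᶠ ≈ᶠ 1ᶠ ⊎ ψ ⟨ h ⟩ᶠ ≈ᶠ 1ᶠ) → f ⨟ g ≈ʰ h → A ∋ pick f s ∼[ g ] pick h t
      picks (inj₁ p) (inj₁ q) c = at∼ u c
      picks (inj₁ p) (inj₂ q) c =
          at∼ u {q = respect-one φ c (restrict-one φ p)} c ∼▸ fromEq (agree _ _ q)
      picks (inj₂ p) (inj₁ q) c =
          at∼ v {q = respect-one ψ c (restrict-one ψ p)} c ∼▸ fromEq (symᵃ (agree _ q _))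
      picks (inj₂ p) (inj₂ q) c = at∼ v c

      -- At each substitution `∨-prime` names one of `u` and `v` to evaluate. The choice may change
      -- under restriction; `agree` makes it immaterial, which is the content of the mixed cases of
      -- `picks`.
      join : Partial A ρ (φ ∨ ψ)
      Partial.at         join f p = pick f (∨-prime _ _ p)
      Partial.compatible join {p = p} {q} c = toRestrict (picks (∨-prime _ _ p) (∨-prime _ _ q) c)

      join-at₁ : (f : I ⇒ J) (p : (φ ∨ ψ) ⟨ f ⟩ᶠ ≈ᶠ 1ᶠ) (q : φ ⟨ f ⟩ᶠ ≈ᶠ 1ᶠ) → Partial.at join f p ≋ Partial.at u f q
      join-at₁ f p q = toEq (picks (∨-prime _ _ p) (inj₁ q) (⨟-identityʳ f))

      join-at₂ : (f : I ⇒ J) (p : (φ ∨ ψ) ⟨ f ⟩ᶠ ≈ᶠ 1ᶠ) (q : ψ ⟨ f ⟩ᶠ ≈ᶠ 1ᶠ) → Partial.at join f p ≋ Partial.at v f q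
      join-at₂ f p q = toEq (picks (∨-prime _ _ p) (inj₂ q) (⨟-identityʳ f))

  opaque
    agrees₀ : {ρ : Cell (suc I)} (φ : Face I) (u : Partial A ρ (φ ⟨ weaken ⟩ᶠ)) {a₀ : Elem (ρ · ι₀)} →
              (∀ {J} (f : I ⇒ J) p → A ∋ a₀ ∼[ f ] Partial.at u (ι₀ ⨟ f) p) → AgreesOn φ (u at₀) a₀
    agrees₀ φ u h f p = toRestrict (h f _ ∼▸ res)

    agrees₀⁻ : {ρ : Cell (suc I)} (φ : Face I) (u : Partial A ρ (φ ⟨ weaken ⟩ᶠ)) {a₀ : Elem (ρ · ι₀)} →
               AgreesOn φ (u at₀) a₀ → ∀ {J} (f : I ⇒ J) p → A ∋ a₀ ∼[ f ] Partial.at u (ι₀ ⨟ f) p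
    agrees₀⁻ φ u α f p = (reflˣ , α f (trans (⟨⟩ᶠ-cong (sym e) (reflʰ {f = f}))
      (trans (⟨⟩ᶠ-⨟ (φ ⟨ weaken ⟩ᶠ) ι₀ f) p))) ∼▸ (sym≅ res ▸ at≅ u λ i → refl)
      where
      e : φ ⟨ weaken ⟩ᶠ ⟨ ι₀ ⟩ᶠ ≈ᶠ φ
      e = trans (⟨⟩ᶠ-⨟ φ weaken ι₀) (⟨⟩ᶠ-id φ)

  module CompositionRules (c : Composition A) where
    open Composition c

    opaque
      comp∼-agrees : {ρ : Cell (suc I)} {φ : Face I} {u : Partial A ρ (φ ⟨ weaken ⟩ᶠ)} {a₀ : Elem (ρ · ι₀)}
                     {α : AgreesOn φ (u at₀) a₀} (f : I ⇒ J) (p : φ ⟨ weaken ⟩ᶠ ⟨ ι₁ ⨟ f ⟩ᶠ ≈ᶠ 1ᶠ) →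
                     A ∋ comp ρ φ u a₀ α ∼[ f ] Partial.at u (ι₁ ⨟ f) p
      comp∼-agrees {φ = φ} {u} {α = α} f p = (reflˣ , comp-agrees α f (trans (⟨⟩ᶠ-cong (sym e) (reflʰ {f = f}))
        (trans (⟨⟩ᶠ-⨟ (φ ⟨ weaken ⟩ᶠ) ι₁ f) p))) ∼▸ (sym≅ res ▸ at≅ u λ i → refl)
        where
        e : φ ⟨ weaken ⟩ᶠ ⟨ ι₁ ⟩ᶠ ≈ᶠ φ
        e = trans (⟨⟩ᶠ-⨟ φ weaken ι₁) (⟨⟩ᶠ-id φ)

      comp∼-natural : {ρ : Cell (suc I)} {φ : Face I} {u : Partial A ρ (φ ⟨ weaken ⟩ᶠ)} {a₀ : Elem (ρ · ι₀)}
                      {α : AgreesOn φ (u at₀) a₀}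
                      {ρ′ : Cell (suc J)} {φ′ : Face J} {u′ : Partial A ρ′ (φ′ ⟨ weaken ⟩ᶠ)} {a′ : Elem (ρ′ · ι₀)}
                      {α′ : AgreesOn φ′ (u′ at₀) a′}
                      {f : I ⇒ J} → ρ · f ⁺ ≈ ρ′ → φ ⟨ f ⟩ᶠ ≈ᶠ φ′ →
                      (∀ {K} (g : suc J ⇒ K) p q → A ∋ Partial.at u (f ⁺ ⨟ g) p ≅ Partial.at u′ g q) →
                      A ∋ a₀ ∼[ f ] a′ → A ∋ comp ρ φ u a₀ α ∼[ f ] comp ρ′ φ′ u′ a′ α′
      comp∼-natural {f = f} e c m a = ⁺-at ι₁ (⁺-ι₁ f) e ,
        comp-uniform f e c (λ g p q → toEq (sym≅ res ▸ m g _ q)) (toRestrict a)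

-- Operations over a map of bases

Operation : {Γ : CubicalSet ℓ} → Family Γ → Set ℓ
Operation {Γ = Γ} A = ∀ {I} (ρ : Cell (suc I)) (φ : Face I) (u : Partial A ρ (φ ⟨ weaken ⟩ᶠ)) (a₀ : Elem (ρ · ι₀)) →
  AgreesOn φ (u at₀) a₀ → Elem (ρ · ι₁)
  where
  open CubicalSet Γ
  open Family A

-- F over σ commutes with the operations, jointly with restriction: this
-- contains both uniformity and stability under substitution.
record Over {Δ Γ : CubicalSet ℓ} (σ : CubicalMap Δ Γ) {A′ : Family Δ} {A : Family Γ} (F : A′ ⟶ A [ σ ])
            (c′ : Operation A′) (c : Operation A) : Set ℓ where
  private
    module Δ = CubicalSet Δ
    module Γ = CubicalSet Γ
    module A′ = Family A′
    module A = Family A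
  open CubicalMap σ using () renaming (map to ∣σ∣)
  open _⟶_ F using () renaming (map to ∣F∣)
  field
    over : {δ : Δ.Cell (suc I)} {φ : Face I} {u : Partial A′ δ (φ ⟨ weaken ⟩ᶠ)} {a₀ : A′.Elem (δ Δ.· ι₀)}
           {α : AgreesOn φ (u at₀) a₀}
           {ρ : Γ.Cell (suc J)} {φ′ : Face J} {u′ : Partial A ρ (φ′ ⟨ weaken ⟩ᶠ)} {a′ : A.Elem (ρ Γ.· ι₀)}
           {α′ : AgreesOn φ′ (u′ at₀) a′}
           {f : I ⇒ J} → ∣σ∣ δ Γ.· f ⁺ Γ.≈ ρ → φ ⟨ f ⟩ᶠ ≈ᶠ φ′ →
           (∀ {K} (g : suc J ⇒ K) p q → A ∋ ∣F∣ (Partial.at u (f ⁺ ⨟ g) p) ≅ Partial.at u′ g q) →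
           A ∋ ∣F∣ a₀ ∼[ f ] a′ →
           A ∋ ∣F∣ (c′ δ φ u a₀ α) ∼[ f ] c ρ φ′ u′ a′ α′

id⁺ : idʰ {I} ⁺ ≈ʰ idʰ
id⁺ zero    = refl
id⁺ (suc i) = refl

module _ {Δ Γ : CubicalSet ℓ} {σ : CubicalMap Δ Γ} {A′ : Family Δ} {A : Family Γ} {F : A′ ⟶ A [ σ ]}
         {c′ : Composition A′} {c : Composition A} where
  private
    module Δ = CubicalSet Δ
    module Γ = CubicalSet Γ
  open Restriction A
  open Composition using (comp)

  -- Stability under `σ` is the instance of `Over` at `f = idʰ`; `id⁺` is there because `idʰ ⁺` is
  -- the identity only name by name.
  over⇒preserves : Over σ F (comp c′) (comp c) → Preserves F c′ (c [ σ ]ᶜ)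
  Preserves.preserves (over⇒preserves O) δ φ u a₀ α = toEq
    (Over.over O (Γ.transˣ (Γ.·-cong Γ.reflˣ id⁺) Γ.·-id) (⟨⟩ᶠ-id φ)
      (λ g p q → map-at g p q ▸ res)
      res ▸ res)
    where
    map-at : ∀ {K} (g : _ ⇒ K) p q → A ∋ _⟶_.map F (Partial.at u (idʰ ⁺ ⨟ g) p) ≅ _⟶_.map F (Partial.at u g q)
    map-at g p q = below∼ σ A (map∼ F (Restriction.at≅ A′ u λ { zero → refl ; (suc i) → refl }))

idˢ : {Γ : CubicalSet ℓ} → CubicalMap Γ Γ
CubicalMap.map     idˢ x = x
CubicalMap.cong    idˢ p = p
CubicalMap.natural (idˢ {Γ = Γ}) = CubicalSet.reflˣ Γ

-- Distinct from `idᵐ`: the restriction maps of `A [ idˢ ]` carry other proofs of the base equations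
-- than those of `A`.
idᵒ : {Γ : CubicalSet ℓ} {A : Family Γ} → A ⟶ A [ idˢ ]
_⟶_.map     idᵒ x = x
_⟶_.cong    idᵒ p = p
_⟶_.natural (idᵒ {A = A}) = Family.restrict-≋ A (Family.reflᵃ A)

id-over : {Γ : CubicalSet ℓ} {A : Family Γ} (c : Composition A) → Over idˢ idᵒ (Composition.comp c) (Composition.comp c)
Over.over (id-over c) = CompositionRules.comp∼-natural c

subst-over : {Δ Γ : CubicalSet ℓ} (σ : CubicalMap Δ Γ) {A : Family Γ} (c : Composition A) →
             Over σ idᵐ (Composition.comp (c [ σ ]ᶜ)) (Composition.comp c)
Over.over (subst-over σ {A} c) e k m a = sym≅ res ≅▸ CompositionRules.comp∼-natural c e k
  (λ g p q → sym≅ res ▸ m g p q) (sym≅ res ≅▸ a)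
  where open Restriction A

module _ {Γ : CubicalSet ℓ} {A : Family Γ} (op : Operation A) where
  open CubicalSet Γ
  open Family A
  open Restriction A

  -- Over the identity map, `Over` says that the operation commutes with restriction, which is
  -- `comp-uniform` up to moving casts. So a composition structure is obtained from a bare
  -- operation, agreement on the extent and one instance of the joint law.
  toComposition :
    (∀ {I} {ρ : Cell (suc I)} {φ : Face I} {u : Partial A ρ (φ ⟨ weaken ⟩ᶠ)} {a₀ : Elem (ρ · ι₀)}
       (α : AgreesOn φ (u at₀) a₀) {J} (f : I ⇒ J) p → A ∋ op ρ φ u a₀ α ∼[ f ] Partial.at u (ι₁ ⨟ f) p) →
    Over idˢ idᵒ op op → Composition A
  Composition.comp         (toComposition agrees O) = op
  Composition.comp-agrees  (toComposition agrees O) α f p = toRestrict (agrees α f _ ∼▸ res)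
  Composition.comp-uniform (toComposition agrees O) {φ = φ} {u} f e c m a = toRestrict
    (Over.over O e c (λ g p q → at≅ u {q = one g q} (λ i → refl) ▸ (res ▸ fromEq (m g _ q)))
      (_ , a))
    where
    one : ∀ {K} (g : _ ⇒ K) → _ → φ ⟨ weaken ⟩ᶠ ⟨ f ⁺ ⨟ g ⟩ᶠ ≈ᶠ 1ᶠ
    one g q = trans (sym (⟨⟩ᶠ-⨟ (φ ⟨ weaken ⟩ᶠ) (f ⁺) g)) (trans (⟨⟩ᶠ-cong (extent-⁺ φ f c) (reflʰ {f = g})) q)

over∼ : {Δ Γ : CubicalSet ℓ} (σ : CubicalMap Δ Γ) {A′ : Family Δ} {A : Family Γ} (F : A′ ⟶ A [ σ ])
        {δ : CubicalSet.Cell Δ I} {δ′ : CubicalSet.Cell Δ J} {f : I ⇒ J}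
        {x : Family.Elem A′ δ} {y : Family.Elem A′ δ′} →
        A′ ∋ x ∼[ f ] y → A ∋ _⟶_.map F x ∼[ f ] _⟶_.map F y
over∼ σ {A = A} F p = below∼ σ A (map∼ F p)

one-shift : (φ : Face I) {ψ : Face J} {f : I ⇒ J} {g : J ⇒ K} → φ ⟨ f ⟩ᶠ ≈ᶠ ψ →
            φ ⟨ f ⨟ g ⟩ᶠ ≈ᶠ 1ᶠ → ψ ⟨ g ⟩ᶠ ≈ᶠ 1ᶠ
one-shift φ {f = f} {g} c p = trans (⟨⟩ᶠ-cong (sym c) (reflʰ {f = g})) (trans (⟨⟩ᶠ-⨟ φ f g) p)

one-shift⁻ : (φ : Face I) {ψ : Face J} {f : I ⇒ J} {g : J ⇒ K} → φ ⟨ f ⟩ᶠ ≈ᶠ ψ →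
             ψ ⟨ g ⟩ᶠ ≈ᶠ 1ᶠ → φ ⟨ f ⨟ g ⟩ᶠ ≈ᶠ 1ᶠ
one-shift⁻ φ {f = f} {g} c p = trans (sym (⟨⟩ᶠ-⨟ φ f g)) (trans (⟨⟩ᶠ-cong c (reflʰ {f = g})) p)

module _ {Γ : CubicalSet ℓ} {A : Family Γ} where
  open CubicalSet Γ
  open Family A
  open Restriction A

  join∼ : {ρ : Cell I} {φ ψ : Face I} {u : Partial A ρ φ} {v : Partial A ρ ψ}
          {a : ∀ {J} (f : I ⇒ J) p q → Partial.at u f p ≋ Partial.at v f q}
          {ρ′ : Cell J} {φ′ ψ′ : Face J} {u′ : Partial A ρ′ φ′} {v′ : Partial A ρ′ ψ′}
          {a′ : ∀ {J} (f : _ ⇒ J) p q → Partial.at u′ f p ≋ Partial.at v′ f q} {f : I ⇒ J} →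
          φ ⟨ f ⟩ᶠ ≈ᶠ φ′ → ψ ⟨ f ⟩ᶠ ≈ᶠ ψ′ →
          (∀ {K} (g : J ⇒ K) p q → A ∋ Partial.at u (f ⨟ g) p ≅ Partial.at u′ g q) →
          (∀ {K} (g : J ⇒ K) p q → A ∋ Partial.at v (f ⨟ g) p ≅ Partial.at v′ g q) →
          ∀ {K} (g : J ⇒ K) p q → A ∋ Partial.at (join u v a) (f ⨟ g) p ≅ Partial.at (join u′ v′ a′) g q
  join∼ {φ = φ} {ψ} {u} {v} {a} {u′ = u′} {v′} {a′} {f} c d m n g p q = case ∨-prime _ _ q of λ
    { (inj₁ r) → let r′ = one-shift⁻ φ c r in
      fromEq (join-at₁ u v a (f ⨟ g) p r′) ▸ (m g r′ r ▸ sym≅ (fromEq (join-at₁ u′ v′ a′ g q r)))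
    ; (inj₂ r) → let r′ = one-shift⁻ ψ d r in
      fromEq (join-at₂ u v a (f ⨟ g) p r′) ▸ (n g r′ r ▸ sym≅ (fromEq (join-at₂ u′ v′ a′ g q r))) }

-- Kan filling

-- `name zero` is the fresh direction of the composition, `name (suc zero)` the direction of the
-- line to be filled. Their meet is 0 at the start of the composition and the old name at its end.
connect : suc I ⇒ suc (suc I)
connect zero    = name zero ∧ name (suc zero)
connect (suc k) = name (suc (suc k))

connect-ι₀ : connect {I} ⨟ ι₀ ≈ʰ ι₀ ⨟ weaken
connect-ι₀ zero    = 0∧ᴵ _
connect-ι₀ (suc k) = refl

connect-ι₁ : connect {I} ⨟ ι₁ ≈ʰ idʰ
connect-ι₁ zero    = 1∧ᴵ _
connect-ι₁ (suc k) = refl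

connect-⁺ : (f : I ⇒ J) → connect ⨟ f ⁺ ⁺ ≈ʰ f ⁺ ⨟ connect
connect-⁺ f zero    = refl
connect-⁺ f (suc i) = trans (≡⇒≈ᴵ (⟨⟩-⨟ (f i) weaken weaken)) (sym (≡⇒≈ᴵ (⟨⟩-⨟ (f i) weaken connect)))

connect-at-0 : (f : suc (suc I) ⇒ J) → f (suc zero) =0ᶠ ≈ᶠ 1ᶠ → ι₀ ⨟ (weaken ⨟ (weaken ⨟ f)) ≈ʰ connect ⨟ f
connect-at-0 f p zero    = sym (trans (∧-cong refl (=0-one (f (suc zero)) p)) (∧0ᴵ _))
connect-at-0 f p (suc k) = refl

connect-extent : (φ : Face I) → φ ⟨ weaken ⟩ᶠ ⟨ connect ⟩ᶠ ≈ᶠ φ ⟨ weaken ⟩ᶠ ⟨ weaken ⟩ᶠ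
connect-extent φ = trans (⟨⟩ᶠ-⨟ φ weaken connect) (sym (⟨⟩ᶠ-⨟ φ weaken weaken))

-- The filler is the composite along the connection ρ(i ∧ j), with the extra
-- face i = 0 on which the system is constantly a₀.
module Filling {Γ : CubicalSet ℓ} {A : Family Γ} (c : Composition A) where
  open CubicalSet Γ
  open Family A
  open Restriction A
  open Composition c
  open CompositionRules c

  module _ {I : ℕ} (ρ : Cell (suc I)) (φ : Face I) (u : Partial A ρ (φ ⟨ weaken ⟩ᶠ)) (a₀ : Elem (ρ · ι₀))
           (α : AgreesOn φ (u at₀) a₀) where

    fillExtent : Face (suc I)
    fillExtent = φ ⟨ weaken ⟩ᶠ ∨ (zero =0)

    opaque
      sides : Partial A (ρ · connect) (φ ⟨ weaken ⟩ᶠ ⟨ weaken ⟩ᶠ)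
      sides = reindex connect reflˣ (connect-extent φ) u

      bottom : Partial A (ρ · connect) (suc zero =0)
      Partial.at         bottom f p =
        restrict (weaken ⨟ (weaken ⨟ f)) (transˣ (·-via (connect-at-0 f p)) (symˣ ·-⨟)) a₀
      Partial.compatible bottom {f = f} {g} c =
        toRestrict (quot∼ (λ i → trans (⨟-assoc weaken (weaken ⨟ f) g i)
          (trans (⨟-assoc weaken f g (suc i)) (c (suc (suc i))))) res res)

      sides≅ : ∀ {J} {f : suc (suc I) ⇒ J} {p q} → A ∋ Partial.at sides f p ≅ Partial.at u (connect ⨟ f) q
      sides≅ = sym≅ res ▸ at≅ u λ i → refl

      bottom∼ : ∀ {J} {f : suc (suc I) ⇒ J} {p} → A ∋ a₀ ∼[ weaken ⨟ (weaken ⨟ f) ] Partial.at bottom f p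
      bottom∼ = res

      sides-bottom : ∀ {J} (f : suc (suc I) ⇒ J) p q → Partial.at sides f p ≋ Partial.at bottom f q
      sides-bottom f p q = toEq (sides≅ {q = one} ▸ sym≅ (uniq bottom∼
        (agrees₀⁻ φ u α (weaken ⨟ (weaken ⨟ f)) one′ ∼▸ at≅ u (connect-at-0 f q))))
        where
        one : φ ⟨ weaken ⟩ᶠ ⟨ connect ⨟ f ⟩ᶠ ≈ᶠ 1ᶠ
        one = one-shift⁻ (φ ⟨ weaken ⟩ᶠ) (connect-extent φ) p
        one′ : φ ⟨ weaken ⟩ᶠ ⟨ ι₀ ⨟ (weaken ⨟ (weaken ⨟ f)) ⟩ᶠ ≈ᶠ 1ᶠ
        one′ = respect-one (φ ⟨ weaken ⟩ᶠ) (symʰ (connect-at-0 f q)) one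

      box : Partial A (ρ · connect) (fillExtent ⟨ weaken ⟩ᶠ)
      box = join sides bottom sides-bottom

      base₀ : Elem (ρ · connect · ι₀)
      base₀ = restrict weaken (symˣ (transˣ (·-via connect-ι₀) (symˣ ·-⨟))) a₀

      box-sides : ∀ {J} {f : suc (suc I) ⇒ J} {p q} → φ ⟨ weaken ⟩ᶠ ⟨ weaken ⟩ᶠ ⟨ f ⟩ᶠ ≈ᶠ 1ᶠ →
                  A ∋ Partial.at box f p ≅ Partial.at u (connect ⨟ f) q
      box-sides {f = f} {p} r = fromEq (join-at₁ sides bottom sides-bottom f p r) ▸ sides≅

      box-bottom : ∀ {J} {f : suc (suc I) ⇒ J} {p} → f (suc zero) =0ᶠ ≈ᶠ 1ᶠ →
                   A ∋ a₀ ∼[ weaken ⨟ (weaken ⨟ f) ] Partial.at box f p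
      box-bottom {f = f} {p} r = bottom∼ ∼▸ sym≅ (fromEq (join-at₂ sides bottom sides-bottom f p r))

      box-agrees : AgreesOn fillExtent (box at₀) base₀
      box-agrees = agrees₀ fillExtent box λ f p → case ∨-prime _ _ p of λ
        { (inj₁ q) →
          let r = one-shift⁻ (φ ⟨ weaken ⟩ᶠ) {g = ι₀ ⨟ f} (connect-extent φ) q
              c i = trans (sym (⨟-assoc connect ι₀ f i)) (trans (⟨⟩-cong (connect-ι₀ i) (reflʰ {f = f})) (⨟-assoc ι₀ weaken f i))
          in quot∼ (λ i → refl) res (agrees₀⁻ φ u α (weaken ⨟ f) (respect-one (φ ⟨ weaken ⟩ᶠ) c r)
            ∼▸ (at≅ u (symʰ c) ▸ sym≅ (box-sides {q = r} q)))
        ; (inj₂ q) → quot∼ (λ i → refl) res (box-bottom q) }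

      fill : Elem ρ
      fill = cast (transˣ (·-via connect-ι₁) ·-id) (comp (ρ · connect) fillExtent box base₀ box-agrees)

      fill∼-agrees : ∀ {J} (f : suc I ⇒ J) p → A ∋ fill ∼[ f ] Partial.at u f p
      fill∼-agrees f p = sym≅ res ≅▸ (comp∼-agrees f (∨-oneˡ q) ∼▸
        (box-sides {q = r} q ▸ at≅ u d))
        where
        d : connect ⨟ (ι₁ ⨟ f) ≈ʰ f
        d i = trans (sym (⨟-assoc connect ι₁ f i)) (⟨⟩-cong (connect-ι₁ i) (reflʰ {f = f}))
        r : φ ⟨ weaken ⟩ᶠ ⟨ connect ⨟ (ι₁ ⨟ f) ⟩ᶠ ≈ᶠ 1ᶠ
        r = respect-one (φ ⟨ weaken ⟩ᶠ) (symʰ d) p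
        q : φ ⟨ weaken ⟩ᶠ ⟨ weaken ⟩ᶠ ⟨ ι₁ ⨟ f ⟩ᶠ ≈ᶠ 1ᶠ
        q = one-shift (φ ⟨ weaken ⟩ᶠ) (connect-extent φ) r

      fill∼-base : A ∋ fill ∼[ ι₀ ] a₀
      fill∼-base = sym≅ res ≅▸ (comp∼-agrees ι₀ (∨-oneʳ refl) ∼▸
        uniq (box-bottom refl) (reindex∼ (λ i → refl) refl≅))

module _ {Δ Γ : CubicalSet ℓ} {σ : CubicalMap Δ Γ} {A′ : Family Δ} {A : Family Γ} {F : A′ ⟶ A [ σ ]}
         {c′ : Composition A′} {c : Composition A} (O : Over σ F (Composition.comp c′) (Composition.comp c)) where
  private
    module Δ = CubicalSet Δ
    module Γ = CubicalSet Γ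
    module A′ = Family A′
    module A = Family A
    module A′R = Restriction A′
    module c = Filling c
    module c′ = Filling c′
  open CubicalMap σ using (natural) renaming (map to ∣σ∣)
  open _⟶_ F using () renaming (map to ∣F∣)
  open Restriction A

  opaque
    unfolding Filling.fill

    -- A filler is a single composition, so the law for composition at `f ⁺` applies once the two
    -- boxes correspond: on the tube by the assumption on `u`, on the additional face by that on
    -- `a₀`.
    fill-over : {δ : Δ.Cell (suc I)} {φ : Face I} {u : Partial A′ δ (φ ⟨ weaken ⟩ᶠ)} {a₀ : A′.Elem (δ Δ.· ι₀)}
                {α : AgreesOn φ (u at₀) a₀}
                {ρ : Γ.Cell (suc J)} {φ′ : Face J} {u′ : Partial A ρ (φ′ ⟨ weaken ⟩ᶠ)} {a′ : A.Elem (ρ Γ.· ι₀)}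
                {α′ : AgreesOn φ′ (u′ at₀) a′}
                {f : I ⇒ J} → ∣σ∣ δ Γ.· f ⁺ Γ.≈ ρ → φ ⟨ f ⟩ᶠ ≈ᶠ φ′ →
                (∀ {K} (g : suc J ⇒ K) p q → A ∋ ∣F∣ (Partial.at u (f ⁺ ⨟ g) p) ≅ Partial.at u′ g q) →
                A ∋ ∣F∣ a₀ ∼[ f ] a′ →
                A ∋ ∣F∣ (c′.fill δ φ u a₀ α) ∼[ f ⁺ ] c.fill ρ φ′ u′ a′ α′
    fill-over {δ = δ} {φ} {u} {a₀} {α} {ρ} {φ′} {u′} {a′} {α′} {f} e k m a =
      over∼ σ F (A′R.sym≅ A′R.res) ≅▸
      (Over.over O
        (Γ.transˣ (Γ.·-cong (Γ.symˣ natural) reflʰ)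
          (Γ.transˣ (Γ.·-via (connect-⁺ f)) (Γ.·-shift e)))
        (∨-cong (extent-⁺ φ f k) refl)
        (λ g p q → case ∨-prime _ _ q of λ
          { (inj₁ r) →
            let r′ = one-shift⁻ (φ′ ⟨ weaken ⟩ᶠ) (connect-extent φ′) r
                s = one-shift⁻ (φ ⟨ weaken ⟩ᶠ ⟨ weaken ⟩ᶠ) (extent-⁺ (φ ⟨ weaken ⟩ᶠ) (f ⁺) (extent-⁺ φ f k)) r
                d i = trans (sym (⨟-assoc connect (f ⁺ ⁺) g i))
                  (trans (⟨⟩-cong (connect-⁺ f i) (reflʰ {f = g})) (⨟-assoc (f ⁺) connect g i))
                s′ = one-shift⁻ (φ ⟨ weaken ⟩ᶠ) (connect-extent φ) s
            in over∼ σ F (A′R._▸_ (c′.box-sides δ φ u a₀ α {p = p} {q = s′} s)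
                 (A′R.at≅ u {q = respect-one (φ ⟨ weaken ⟩ᶠ) d s′} d)) ▸
               (m (connect ⨟ g) _ r′ ▸ sym≅ (c.box-sides ρ φ′ u′ a′ α′ {p = q} r))
          ; (inj₂ r) → uniq
              (reindex∼ (λ i → trans (≡⇒≈ᴵ (⟨⟩-⨟ (f i ⟨ weaken ⟩) weaken g)) (≡⇒≈ᴵ (⟨⟩-⨟ (f i) weaken (weaken ⨟ g))))
                (over∼ σ F (c′.box-bottom δ φ u a₀ α {f = f ⁺ ⁺ ⨟ g} {p = p} r)))
              (comp∼ reflʰ a (c.box-bottom ρ φ′ u′ a′ α′ r)) })
        (quot∼ (λ i → refl) (over∼ σ F A′R.res) (comp∼ reflʰ a res)) ∼▸ res)

-- Composition in Σ-types

module _ {Γ : CubicalSet ℓ} (A : Family Γ) where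
  open CubicalSet Γ
  open Family A
  open Restriction A
  private
    module ΓA = CubicalSet (Γ ▷ A)

  opaque
    cell∼ : {ρ : Cell I} {ρ′ : Cell J} {f : I ⇒ J} {x : Elem ρ} {y : Elem ρ′} →
            A ∋ x ∼[ f ] y → (ρ , x) ΓA.· f ΓA.≈ (ρ′ , y)
    cell∼ p = base p , toEq (sym≅ res ▸ uniq res p)

    cell≅ : {ρ ρ′ : Cell I} {x : Elem ρ} {y : Elem ρ′} → A ∋ x ≅ y → (ρ , x) ΓA.≈ (ρ′ , y)
    cell≅ p = transˣ (symˣ ·-id) (base p) , toRestrict p

    cell∼⁻ : {ρ : Cell I} {ρ′ : Cell J} {f : I ⇒ J} {x : Elem ρ} {y : Elem ρ′} →
             (ρ , x) ΓA.· f ΓA.≈ (ρ′ , y) → A ∋ x ∼[ f ] y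
    cell∼⁻ (e , p) = res ∼▸ (transˣ ·-id e , p)

module _ {Γ : CubicalSet ℓ} {A : Family Γ} {B : Family (Γ ▷ A)} where
  open CubicalSet Γ
  private
    module A = Family A
    module B = Family B
    module AR = Restriction A
    module BR = Restriction B

  opaque
    pair∼ : {ρ : Cell I} {ρ′ : Cell J} {f : I ⇒ J} {x : A.Elem ρ} {x′ : A.Elem ρ′}
            {y : B.Elem (ρ , x)} {y′ : B.Elem (ρ′ , x′)} →
            B ∋ y ∼[ f ] y′ → Sigma A B ∋ (x , y) ∼[ f ] (x′ , y′)
    pair∼ p = proj₁ (BR.base p) , AR.toRestrict (cell∼⁻ A (BR.base p)) , BR.toRestrict (BR.uniq BR.res p)

    snd∼ : {ρ : Cell I} {ρ′ : Cell J} {f : I ⇒ J} {x : A.Elem ρ} {x′ : A.Elem ρ′}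
           {y : B.Elem (ρ , x)} {y′ : B.Elem (ρ′ , x′)} →
           Sigma A B ∋ (x , y) ∼[ f ] (x′ , y′) → B ∋ y ∼[ f ] y′
    snd∼ (e , p , q) = BR.res BR.∼▸ (_ , q)

  fst∼ : {ρ : Cell I} {ρ′ : Cell J} {f : I ⇒ J} {x : A.Elem ρ} {x′ : A.Elem ρ′}
         {y : B.Elem (ρ , x)} {y′ : B.Elem (ρ′ , x′)} →
         Sigma A B ∋ (x , y) ∼[ f ] (x′ , y′) → A ∋ x ∼[ f ] x′
  fst∼ = map∼ (π₁ A B)

  module SigmaComposition (c : Composition A) (d : Composition B) where
    open Filling c
    private
      S = Sigma A B
      module S = Family S
      module SR = Restriction S
      module d = Composition d

    module _ {I : ℕ} (ρ : Cell (suc I)) (φ : Face I) (u : Partial S ρ (φ ⟨ weaken ⟩ᶠ)) (s₀ : S.Elem (ρ · ι₀))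
             (α : AgreesOn φ (u at₀) s₀) where

      -- A filler and not just a composite of the first components: the second components are
      -- composed along this line, so it must be known over the whole interval and be strictly `u`
      -- and `s₀` on its sides.
      line : A.Elem ρ
      line = fill ρ φ (mapₚ (π₁ A B) u) (proj₁ s₀) (mapₚ-agrees (π₁ A B) φ u s₀ α)

      opaque
        system : Partial B (ρ , line) (φ ⟨ weaken ⟩ᶠ)
        Partial.at         system f p = B.cast
          (cell≅ A (AR.uniq (fill∼-agrees ρ φ (mapₚ (π₁ A B) u) (proj₁ s₀) (mapₚ-agrees (π₁ A B) φ u s₀ α) f p) AR.res))
          (proj₂ (Partial.at u f p))
        Partial.compatible system {g = g} e = BR.toRestrict
          (BR.quot∼ reflʰ BR.res (snd∼ (SR.at∼ u e) BR.∼▸ BR.res))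

        system≅ : ∀ {J} {f : suc I ⇒ J} {p q} → B ∋ Partial.at system f p ≅ proj₂ (Partial.at u f q)
        system≅ = BR.sym≅ BR.res BR.▸ snd∼ (SR.at≅ u λ i → refl)

        start : B.Elem (ρ · ι₀ , A.restrict ι₀ reflˣ line)
        start = B.cast
          (cell≅ A (AR.uniq (fill∼-base ρ φ (mapₚ (π₁ A B) u) (proj₁ s₀) (mapₚ-agrees (π₁ A B) φ u s₀ α)) AR.res))
          (proj₂ s₀)

        start≅ : B ∋ start ≅ proj₂ s₀
        start≅ = BR.sym≅ BR.res

        start-agrees : AgreesOn φ (system at₀) start
        start-agrees = agrees₀ φ system λ f p → start≅ BR.≅▸
          (snd∼ (agrees₀⁻ φ u α f p) BR.∼▸ BR.sym≅ system≅)

      sigmaOp : S.Elem (ρ · ι₁)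
      sigmaOp = A.restrict ι₁ reflˣ line , d.comp (ρ , line) φ system start start-agrees

      sigmaOp-agrees : ∀ {J} (f : I ⇒ J) p → S ∋ sigmaOp ∼[ f ] Partial.at u (ι₁ ⨟ f) p
      sigmaOp-agrees f p = pair∼ (CompositionRules.comp∼-agrees d f p BR.∼▸ system≅)

module _ {Δ Γ : CubicalSet ℓ} {σ : CubicalMap Δ Γ}
         {A′ : Family Δ} {B′ : Family (Δ ▷ A′)} {A : Family Γ} {B : Family (Γ ▷ A)}
         {F : A′ ⟶ A [ σ ]} {G : B′ ⟶ B [ σ ▷⟨ A ⟩ F ]}
         {c′ : Composition A′} {d′ : Composition B′} {c : Composition A} {d : Composition B}
         (O : Over σ F (Composition.comp c′) (Composition.comp c))
         (P : Over (σ ▷⟨ A ⟩ F) G (Composition.comp d′) (Composition.comp d)) where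
  private
    module S′ = SigmaComposition c′ d′
    module S = SigmaComposition c d
    module BR = Restriction B

  sigma-over : Over σ (Sigma-map σ F G) S′.sigmaOp S.sigmaOp
  Over.over sigma-over {f = f} e k m a = pair∼ (Over.over P
    (cell∼ A (fill-over O e k (λ g p q → map∼ (π₁ A B) (m g p q)) (fst∼ a)))
    k
    (λ g p q → over∼ (σ ▷⟨ A ⟩ F) G (S′.system≅ _ _ _ _ _ {q = p}) BR.▸ (snd∼ (m g p q) BR.▸ BR.sym≅ (S.system≅ _ _ _ _ _)))
    (over∼ (σ ▷⟨ A ⟩ F) G (S′.start≅ _ _ _ _ _) BR.≅▸ (snd∼ a BR.∼▸ BR.sym≅ (S.start≅ _ _ _ _ _))))

idᵖ : {Γ : CubicalSet ℓ} {A : Family Γ} {B : Family (Γ ▷ A)} → B ⟶ B [ idˢ ▷⟨ A ⟩ idᵒ ]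
_⟶_.map     idᵖ x = x
_⟶_.cong    idᵖ p = p
_⟶_.natural (idᵖ {B = B}) = Family.restrict-≋ B (Family.reflᵃ B)

idᵖ-over : {Γ : CubicalSet ℓ} {A : Family Γ} {B : Family (Γ ▷ A)} (d : Composition B) →
           Over (idˢ ▷⟨ A ⟩ idᵒ) idᵖ (Composition.comp d) (Composition.comp d)
Over.over (idᵖ-over d) = CompositionRules.comp∼-natural d

opaque
  sigma-comp : {Γ : CubicalSet ℓ} {A : Family Γ} {B : Family (Γ ▷ A)} →
               Composition A → Composition B → Composition (Sigma A B)
  sigma-comp {A = A} {B} c d = toComposition S.sigmaOp
    (λ α → S.sigmaOp-agrees _ _ _ _ α)
    (record { over = Over.over (sigma-over {F = idᵒ} {G = idᵖ} {c′ = c} {d} {c} {d} (id-over c) (idᵖ-over d)) })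
    where module S = SigmaComposition c d

  sigma-comp-over : {Δ Γ : CubicalSet ℓ} {σ : CubicalMap Δ Γ}
                    {A′ : Family Δ} {B′ : Family (Δ ▷ A′)} {A : Family Γ} {B : Family (Γ ▷ A)}
                    {F : A′ ⟶ A [ σ ]} {G : B′ ⟶ B [ σ ▷⟨ A ⟩ F ]}
                    (c′ : Composition A′) (d′ : Composition B′) (c : Composition A) (d : Composition B) →
                    Over σ F (Composition.comp c′) (Composition.comp c) →
                    Over (σ ▷⟨ A ⟩ F) G (Composition.comp d′) (Composition.comp d) →
                    Over σ (Sigma-map σ F G) (Composition.comp (sigma-comp c′ d′)) (Composition.comp (sigma-comp c d))
  sigma-comp-over c′ d′ c d O P = sigma-over {c′ = c′} {d′} {c} {d} O P

-- Composition in path types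

=0-at : (r : dM I) {f : I ⇒ J} → (r =0ᶠ) ⟨ f ⟩ᶠ ≈ᶠ 1ᶠ → r ⟨ f ⟩ ≈ᴵ 0ᴵ
=0-at r {f} p = =0-one (r ⟨ f ⟩) (trans (sym (=0ᶠ-⟨⟩ r f)) p)

=1-at : (r : dM I) {f : I ⇒ J} → (r =1ᶠ) ⟨ f ⟩ᶠ ≈ᶠ 1ᶠ → r ⟨ f ⟩ ≈ᴵ 1ᴵ
=1-at r {f} p = =1-one (r ⟨ f ⟩) (trans (sym (=1ᶠ-⟨⟩ r f)) p)

=0-at⁻ : (r : dM I) {f : I ⇒ J} → r ⟨ f ⟩ ≈ᴵ 0ᴵ → (r =0ᶠ) ⟨ f ⟩ᶠ ≈ᶠ 1ᶠ
=0-at⁻ r {f} p = trans (=0ᶠ-⟨⟩ r f) (=0-intro p)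

=1-at⁻ : (r : dM I) {f : I ⇒ J} → r ⟨ f ⟩ ≈ᴵ 1ᴵ → (r =1ᶠ) ⟨ f ⟩ᶠ ≈ᶠ 1ᶠ
=1-at⁻ r {f} p = trans (=1ᶠ-⟨⟩ r f) (=1-intro p)

0≉1ᴵ : {r : dM I} → r ≈ᴵ 0ᴵ → r ≈ᴵ 1ᴵ → ⊥
0≉1ᴵ {r = r} p q = =0-disjoint-=1 {r = r} (=0-intro p) (=1-intro q)

∂ : dM I → Face I
∂ r = (r =0ᶠ) ∨ (r =1ᶠ)

∂-cong : {r : dM I} {s : dM J} {f : I ⇒ J} → r ⟨ f ⟩ ≈ᴵ s → ∂ r ⟨ f ⟩ᶠ ≈ᶠ ∂ s
∂-cong {r = r} {f = f} p = ∨-cong (trans (=0ᶠ-⟨⟩ r f) (=0-cong p)) (trans (=1ᶠ-⟨⟩ r f) (=1-cong p))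

∂-cases : (r : dM I) {f : I ⇒ J} → ∂ r ⟨ f ⟩ᶠ ≈ᶠ 1ᶠ → r ⟨ f ⟩ ≈ᴵ 0ᴵ ⊎ r ⟨ f ⟩ ≈ᴵ 1ᴵ
∂-cases r p = case ∨-prime _ _ p of λ { (inj₁ q) → inj₁ (=0-at r q) ; (inj₂ q) → inj₂ (=1-at r q) }

module _ {Γ : CubicalSet ℓ} {A : Family Γ} where
  open CubicalSet Γ
  open Family A
  open Restriction A

  sectionₚ : (s : Section A) (ρ : Cell I) (φ : Face I) → Partial A ρ φ
  Partial.at         (sectionₚ s ρ φ) f p = Section.sec s (ρ · f)
  Partial.compatible (sectionₚ s ρ φ) c   = Section.natural s

  elementₚ : {ρ : Cell I} (x : Elem ρ) (φ : Face I) → Partial A ρ φ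
  Partial.at         (elementₚ x φ) f p = restrict f reflˣ x
  Partial.compatible (elementₚ x φ) c   = toRestrict (quot∼ c res res)

  opaque
    sec≅ : (s : Section A) {ρ ρ′ : Cell I} → ρ ≈ ρ′ → A ∋ Section.sec s ρ ≅ Section.sec s ρ′
    sec≅ s e = sec∼ s (transˣ ·-id e)

  module _ {a b : Section A} {ρ : Cell I} (p : PathElem A a b ρ) where
    open PathElem p

    opaque
      path-at∼ : {f : I ⇒ J} {g : J ⇒ K} {h : I ⇒ K} {r : dM J} {s : dM K} → f ⨟ g ≈ʰ h → r ⟨ g ⟩ ≈ᴵ s →
                 A ∋ at f r ∼[ g ] at h s
      path-at∼ c d = ·-via c , compatible c d

      path-at≅ : {f h : I ⇒ J} {r s : dM J} → f ≈ʰ h → r ≈ᴵ s → A ∋ at f r ≅ at h s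
      path-at≅ {f = f} {r = r} c d = path-at∼ (transʰ {g = f} (⨟-identityʳ f) c) (trans (≡⇒≈ᴵ (⟨⟩-id r)) d)

  module _ {a b : Section A} {ρ : Cell I} {ρ′ : Cell J} {p : PathElem A a b ρ} {q : PathElem A a b ρ′} {f : I ⇒ J} where
    open PathElem

    opaque
      path∼ : ρ · f ≈ ρ′ → (∀ {K} (g : J ⇒ K) r → A ∋ at p (f ⨟ g) r ≅ at q g r) → Path A a b ∋ p ∼[ f ] q
      path∼ e h = e , λ g r → toRestrict (h g r)

      path∼⁻ : Path A a b ∋ p ∼[ f ] q → ∀ {K} (g : J ⇒ K) r → A ∋ at p (f ⨟ g) r ≅ at q g r
      path∼⁻ (e , h) g r = res ▸ fromEq (h g r)

  module PathComposition (a b : Section A) (c : Composition A) where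
    open Composition c
    open CompositionRules c
    open PathElem
    private
      P = Path A a b
      module a = Section a
      module b = Section b
      module PR = Restriction P

    module _ {I : ℕ} (ρ : Cell (suc I)) (φ : Face I) (u : Partial P ρ (φ ⟨ weaken ⟩ᶠ)) (p₀ : PathElem A a b (ρ · ι₀))
             (α : AgreesOn φ (u at₀) p₀) where

      module _ {J : ℕ} (f : I ⇒ J) (r : dM J) where
        private
          cell : {ι : ∀ {K} → suc K ⇒ K} → f ⁺ ⨟ ι ≈ʰ ι ⨟ f → ∀ {K} {g : J ⇒ K} → ρ · ι · (f ⨟ g) ≈ ρ · f ⁺ · (ι ⨟ g)
          cell {ι} c {g = g} = transˣ ·-⨟ (transˣ (·-cong reflˣ λ i → sym (path i)) (symˣ ·-⨟))
            where
            path : f ⁺ ⨟ (ι ⨟ g) ≈ʰ ι ⨟ (f ⨟ g)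
            path i = trans (sym (⨟-assoc (f ⁺) ι g i)) (trans (⟨⟩-cong (c i) (reflʰ {f = g})) (⨟-assoc ι f g i))

        -- A path consists of a value at each stage `f` and each point `r`, where `r` is any element
        -- of the interval and not just a name. Each value is a composition of its own, with `∂ r`
        -- added to the extent to pin the endpoints; that the values fit together follows from
        -- uniformity.
        boxExtent : Face J
        boxExtent = φ ⟨ f ⟩ᶠ ∨ ∂ r

        opaque
          sides : Partial A (ρ · f ⁺) (φ ⟨ f ⟩ᶠ ⟨ weaken ⟩ᶠ)
          Partial.at         sides g p = cast (transˣ ·-id (symˣ ·-⨟))
            (at (Partial.at u (f ⁺ ⨟ g) (one-shift⁻ (φ ⟨ weaken ⟩ᶠ) (extent-⁺ φ f refl) p)) idʰ (r ⟨ weaken ⨟ g ⟩))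
          Partial.compatible sides {f = g} {h} {k} d = toRestrict (quot∼ reflʰ res
            (path-at∼ (Partial.at u (f ⁺ ⨟ g) _) (λ i → sym (⟨⟩-id′ (h i))) (trans (≡⇒≈ᴵ (⟨⟩-⨟ r (weaken ⨟ g) h)) (⟨⟩-cong (refl {r = r}) (λ i → d (suc i)))) ∼▸
             (path∼⁻ (PR.at∼ u {g = h} {f ⁺ ⨟ k} (λ i → trans (⨟-assoc (f ⁺) g h i) (⟨⟩-cong (refl {r = (f ⁺) i}) d))) idʰ (r ⟨ weaken ⨟ k ⟩) ▸ res)))
            where
            ⟨⟩-id′ : ∀ {K} (s : dM K) → s ⟨ idʰ ⟩ ≈ᴵ s
            ⟨⟩-id′ s = ≡⇒≈ᴵ (⟨⟩-id s)

          sides≅ : ∀ {K} {g : suc J ⇒ K} {p q} {s} → r ⟨ weaken ⨟ g ⟩ ≈ᴵ s →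
                   A ∋ Partial.at sides g p ≅ at (Partial.at u (f ⁺ ⨟ g) q) idʰ s
          sides≅ {s = s} d = sym≅ res ▸ (path-at≅ (Partial.at u _ _) (λ i → refl) d ▸
            path∼⁻ (PR.at≅ u (λ i → refl)) idʰ s)

          end₀ : Partial A (ρ · f ⁺) ((r =0ᶠ) ⟨ weaken ⟩ᶠ)
          end₀ = sectionₚ a _ _

          end₁ : Partial A (ρ · f ⁺) ((r =1ᶠ) ⟨ weaken ⟩ᶠ)
          end₁ = sectionₚ b _ _

          apart : ∀ {K} (g : suc J ⇒ K) p q → Partial.at end₀ g p ≋ Partial.at end₁ g q
          apart g p q = ⊥-elim (0≉1ᴵ (=0-at r (wk-one⁻ (r =0ᶠ) p)) (=1-at r (wk-one⁻ (r =1ᶠ) q)))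

          ends : Partial A (ρ · f ⁺) (∂ r ⟨ weaken ⟩ᶠ)
          ends = join end₀ end₁ apart

          ends-0 : ∀ {K} {g : suc J ⇒ K} {p} → r ⟨ weaken ⨟ g ⟩ ≈ᴵ 0ᴵ → A ∋ Partial.at ends g p ≅ a.sec (ρ · f ⁺ · g)
          ends-0 {g = g} {p} d = fromEq (join-at₁ end₀ end₁ apart g p (wk-one (r =0ᶠ) {f = g} (=0-at⁻ r d)))

          ends-1 : ∀ {K} {g : suc J ⇒ K} {p} → r ⟨ weaken ⨟ g ⟩ ≈ᴵ 1ᴵ → A ∋ Partial.at ends g p ≅ b.sec (ρ · f ⁺ · g)
          ends-1 {g = g} {p} d = fromEq (join-at₂ end₀ end₁ apart g p (wk-one (r =1ᶠ) {f = g} (=1-at⁻ r d)))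

          sides-ends : ∀ {K} (g : suc J ⇒ K) p q → Partial.at sides g p ≋ Partial.at ends g q
          sides-ends g p q = case ∨-prime _ _ q of λ
            { (inj₁ s) → let d = =0-at r (wk-one⁻ (r =0ᶠ) s) in toEq
                (sides≅ {q = one} d ▸ (fromEq (at-0 (Partial.at u _ _) idʰ) ▸ (sec≅ a (transˣ ·-id (symˣ ·-⨟)) ▸ sym≅ (ends-0 d))))
            ; (inj₂ s) → let d = =1-at r (wk-one⁻ (r =1ᶠ) s) in toEq
                (sides≅ {q = one} d ▸ (fromEq (at-1 (Partial.at u _ _) idʰ) ▸ (sec≅ b (transˣ ·-id (symˣ ·-⨟)) ▸ sym≅ (ends-1 d)))) }
            where
            one : φ ⟨ weaken ⟩ᶠ ⟨ f ⁺ ⨟ g ⟩ᶠ ≈ᶠ 1ᶠ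
            one = one-shift⁻ (φ ⟨ weaken ⟩ᶠ) (extent-⁺ φ f refl) p

          box : Partial A (ρ · f ⁺) (boxExtent ⟨ weaken ⟩ᶠ)
          box = join sides ends sides-ends

          box-sides : ∀ {K} {g : suc J ⇒ K} {p q} {s} → r ⟨ weaken ⨟ g ⟩ ≈ᴵ s →
                      A ∋ Partial.at box g p ≅ at (Partial.at u (f ⁺ ⨟ g) q) idʰ s
          box-sides {g = g} {p} {q} d = fromEq (join-at₁ sides ends sides-ends g p
            (trans (⟨⟩ᶠ-cong (sym (extent-⁺ φ f refl)) (reflʰ {f = g})) (trans (⟨⟩ᶠ-⨟ (φ ⟨ weaken ⟩ᶠ) (f ⁺) g) q))) ▸ sides≅ d

          box-0 : ∀ {K} {g : suc J ⇒ K} {p} → r ⟨ weaken ⨟ g ⟩ ≈ᴵ 0ᴵ → A ∋ Partial.at box g p ≅ a.sec (ρ · f ⁺ · g)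
          box-0 {g = g} {p} d = fromEq (join-at₂ sides ends sides-ends g p (∨-oneˡ (wk-one (r =0ᶠ) {f = g} (=0-at⁻ r d)))) ▸ ends-0 d

          box-1 : ∀ {K} {g : suc J ⇒ K} {p} → r ⟨ weaken ⨟ g ⟩ ≈ᴵ 1ᴵ → A ∋ Partial.at box g p ≅ b.sec (ρ · f ⁺ · g)
          box-1 {g = g} {p} d = fromEq (join-at₂ sides ends sides-ends g p (∨-oneʳ (wk-one (r =1ᶠ) {f = g} (=1-at⁻ r d)))) ▸ ends-1 d

          box-cases : ∀ {K} (g : suc J ⇒ K) → boxExtent ⟨ weaken ⟩ᶠ ⟨ g ⟩ᶠ ≈ᶠ 1ᶠ →
                      φ ⟨ weaken ⟩ᶠ ⟨ f ⁺ ⨟ g ⟩ᶠ ≈ᶠ 1ᶠ ⊎ (r ⟨ weaken ⨟ g ⟩ ≈ᴵ 0ᴵ ⊎ r ⟨ weaken ⨟ g ⟩ ≈ᴵ 1ᴵ)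
          box-cases g p = case ∨-prime _ _ p of λ
            { (inj₁ q) → inj₁ (one-shift⁻ (φ ⟨ weaken ⟩ᶠ) (extent-⁺ φ f refl) q)
            ; (inj₂ q) → inj₂ (case ∨-prime _ _ q of λ
              { (inj₁ s) → inj₁ (=0-at r (wk-one⁻ (r =0ᶠ) s))
              ; (inj₂ s) → inj₂ (=1-at r (wk-one⁻ (r =1ᶠ) s)) }) }

          floor : Elem (ρ · f ⁺ · ι₀)
          floor = cast (symˣ (transˣ (·-via (⁺-ι₀ f)) (symˣ ·-⨟))) (at p₀ f r)

          floor≅ : A ∋ at p₀ f r ≅ floor
          floor≅ = res

          floor-agrees : AgreesOn boxExtent (box at₀) floor
          floor-agrees = agrees₀ boxExtent box λ g p →
            sym≅ floor≅ ≅▸ (path-at∼ p₀ reflʰ refl ∼▸ (case box-cases (ι₀ ⨟ g) p of λ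
              { (inj₁ q) →
                let c = λ i → trans (sym (⨟-assoc (f ⁺) ι₀ g i)) (trans (⟨⟩-cong (⁺-ι₀ f i) (reflʰ {f = g})) (⨟-assoc ι₀ f g i)) in
                path-at≅ p₀ (symʰ (⨟-identityʳ (f ⨟ g))) refl ▸
                (path∼⁻ (agrees₀⁻ φ u {a₀ = p₀} α (f ⨟ g) (respect-one (φ ⟨ weaken ⟩ᶠ) c q)) idʰ (r ⟨ g ⟩) ▸
                (path∼⁻ (PR.at≅ u (symʰ c)) idʰ (r ⟨ g ⟩) ▸ sym≅ (box-sides {q = q} refl)))
              ; (inj₂ (inj₁ d)) → path-at≅ p₀ reflʰ d ▸ (fromEq (at-0 p₀ (f ⨟ g)) ▸
                  (sec≅ a (cell (⁺-ι₀ f)) ▸ sym≅ (box-0 d)))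
              ; (inj₂ (inj₂ d)) → path-at≅ p₀ reflʰ d ▸ (fromEq (at-1 p₀ (f ⨟ g)) ▸
                  (sec≅ b (cell (⁺-ι₀ f)) ▸ sym≅ (box-1 d))) }))

          pathPoint : Elem (ρ · ι₁ · f)
          pathPoint = cast (transˣ (·-via (⁺-ι₁ f)) (symˣ ·-⨟)) (comp (ρ · f ⁺) boxExtent box floor floor-agrees)

          pathPoint≅ : A ∋ pathPoint ≅ comp (ρ · f ⁺) boxExtent box floor floor-agrees
          pathPoint≅ = sym≅ res

⁺-weaken : (r : dM I) (f : I ⇒ J) → r ⟨ weaken ⟩ ⟨ f ⁺ ⟩ ≈ᴵ r ⟨ f ⟩ ⟨ weaken ⟩
⁺-weaken r f = trans (≡⇒≈ᴵ (⟨⟩-⨟ r weaken (f ⁺))) (sym (≡⇒≈ᴵ (⟨⟩-⨟ r f weaken)))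

⁺-square : {f : I ⇒ J} {g : J ⇒ L} {f′ : I ⇒ K} {g′ : K ⇒ L} → f ⨟ g ≈ʰ f′ ⨟ g′ → f ⁺ ⨟ g ⁺ ≈ʰ f′ ⁺ ⨟ g′ ⁺
⁺-square             c zero    = refl
⁺-square {f = f} {g} {f′} {g′} c (suc i) =
  trans (⁺-weaken (f i) g) (trans (⟨⟩-cong (c i) (reflʰ {f = weaken})) (sym (⁺-weaken (f′ i) g′)))

module _ {Δ Γ : CubicalSet ℓ} {σ : CubicalMap Δ Γ} {A′ : Family Δ} {A : Family Γ} {F : A′ ⟶ A [ σ ]}
         {a′ b′ : Section A′} {a b : Section A} {c′ : Composition A′} {c : Composition A}
         (k : ∀ {I} (δ : CubicalSet.Cell Δ I) →
              Family._≋_ A (_⟶_.map F (Section.sec a′ δ)) (Section.sec a (CubicalMap.map σ δ)))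
         (l : ∀ {I} (δ : CubicalSet.Cell Δ I) →
              Family._≋_ A (_⟶_.map F (Section.sec b′ δ)) (Section.sec b (CubicalMap.map σ δ)))
         (O : Over σ F (Composition.comp c′) (Composition.comp c)) where
  private
    module Δ = CubicalSet Δ
    module Γ = CubicalSet Γ
    module C′ = PathComposition a′ b′ c′
    module C = PathComposition a b c
    module P′R = Restriction (Path A′ a′ b′)
    module A′R = Restriction A′
  open CubicalMap σ using (natural; natural′) renaming (map to ∣σ∣)
  open _⟶_ F using () renaming (map to ∣F∣)
  open Restriction A
  open PathElem

  -- `f` changes the stage of the whole composite, `g` that of a single value. With `σ` and `f` the
  -- identity this is the compatibility that makes the values a path; with `g` the identity it is
  -- uniformity and stability of the resulting operation.
  pathPoint-over :
    {δ : Δ.Cell (suc I)} {φ : Face I} {u : Partial (Path A′ a′ b′) δ (φ ⟨ weaken ⟩ᶠ)} {p₀ : PathElem A′ a′ b′ (δ Δ.· ι₀)}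
    {α : AgreesOn φ (u at₀) p₀}
    {ρ : Γ.Cell (suc J)} {φ′ : Face J} {u′ : Partial (Path A a b) ρ (φ′ ⟨ weaken ⟩ᶠ)} {p₀′ : PathElem A a b (ρ Γ.· ι₀)}
    {α′ : AgreesOn φ′ (u′ at₀) p₀′}
    {f : I ⇒ J} → ∣σ∣ δ Γ.· f ⁺ Γ.≈ ρ → φ ⟨ f ⟩ᶠ ≈ᶠ φ′ →
    (∀ {K} (g : suc J ⇒ K) p q r → A ∋ ∣F∣ (at (Partial.at u (f ⁺ ⨟ g) p) idʰ r) ≅ at (Partial.at u′ g q) idʰ r) →
    (∀ {K} (g : J ⇒ K) r → A ∋ ∣F∣ (at p₀ (f ⨟ g) r) ≅ at p₀′ g r) →
    {h : I ⇒ K} {h′ : J ⇒ L} {g : K ⇒ L} {r : dM K} {s : dM L} → h ⨟ g ≈ʰ f ⨟ h′ → r ⟨ g ⟩ ≈ᴵ s →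
    A ∋ ∣F∣ (C′.pathPoint δ φ u p₀ α h r) ∼[ g ] C.pathPoint ρ φ′ u′ p₀′ α′ h′ s
  pathPoint-over {δ = δ} {φ} {u} {p₀} {α} {ρ} {φ′} {u′} {p₀′} {α′} {f} e φ≈ m n {h} {h′} {g} {r} {s} d r≈ =
    over∼ σ F (C′.pathPoint≅ δ φ u p₀ α h r) ≅▸
    (Over.over O
      (Γ.transˣ (Γ.·-cong (Γ.symˣ natural) reflʰ) (Γ.transˣ (Γ.·-via (⁺-square d)) (Γ.·-shift e)))
      (∨-cong
        (trans (⟨⟩ᶠ-⨟ φ h g) (trans (⟨⟩ᶠ-cong (refl {φ = φ}) d)
          (trans (sym (⟨⟩ᶠ-⨟ φ f h′)) (⟨⟩ᶠ-cong φ≈ (reflʰ {f = h′})))))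
        (∂-cong {r = r} {f = g} r≈))
      (λ {M} x p q →
        let r′ = trans (sym (≡⇒≈ᴵ (⟨⟩-⨟ r weaken (g ⁺ ⨟ x))))
                   (trans (sym (≡⇒≈ᴵ (⟨⟩-⨟ (r ⟨ weaken ⟩) (g ⁺) x)))
                     (trans (⟨⟩-cong (trans (⁺-weaken r g) (⟨⟩-cong r≈ (reflʰ {f = weaken}))) (reflʰ {f = x}))
                       (≡⇒≈ᴵ (⟨⟩-⨟ s weaken x))))
            hg = λ i → trans (sym (⨟-assoc (h ⁺) (g ⁺) x i))
                   (trans (⟨⟩-cong (⁺-square d i) (reflʰ {f = x})) (⨟-assoc (f ⁺) (h′ ⁺) x i))
            cell = Γ.transˣ (Γ.symˣ natural) (Γ.transˣ (Γ.·-cong (Γ.symˣ natural) reflʰ)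
                     (Γ.transˣ (Γ.·-via hg) (Γ.transˣ (Γ.·-shift e) (Γ.symˣ Γ.·-⨟))))
        in case C.box-cases ρ φ′ u′ p₀′ α′ h′ s x q of λ
        { (inj₁ t) →
          let t′ = one-shift⁻ (φ ⟨ weaken ⟩ᶠ) {g = h′ ⁺ ⨟ x} (extent-⁺ φ f φ≈) t
              t″ = respect-one (φ ⟨ weaken ⟩ᶠ) (symʰ hg) t′
          in over∼ σ F (A′R._▸_ (C′.box-sides δ φ u p₀ α h r {p = p} {q = t″} {s = s ⟨ weaken ⨟ x ⟩} r′)
               (path∼⁻ (P′R.at≅ u {q = t′} hg) idʰ (s ⟨ weaken ⨟ x ⟩))) ▸
             (m (h′ ⁺ ⨟ x) t′ t (s ⟨ weaken ⨟ x ⟩) ▸ sym≅ (C.box-sides ρ φ′ u′ p₀′ α′ h′ s {p = q} refl))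
        ; (inj₂ (inj₁ t)) → over∼ σ F (C′.box-0 δ φ u p₀ α h r {p = p} (trans r′ t)) ▸
            (fromEq (k _) ▸ (sec≅ a cell ▸ sym≅ (C.box-0 ρ φ′ u′ p₀′ α′ h′ s {p = q} t)))
        ; (inj₂ (inj₂ t)) → over∼ σ F (C′.box-1 δ φ u p₀ α h r {p = p} (trans r′ t)) ▸
            (fromEq (l _) ▸ (sec≅ b cell ▸ sym≅ (C.box-1 ρ φ′ u′ p₀′ α′ h′ s {p = q} t))) })
      (over∼ σ F (A′R.sym≅ (C′.floor≅ δ φ u p₀ α h r)) ≅▸
        (over∼ σ F (path-at∼ p₀ d r≈) ∼▸ (n h′ s ▸ C.floor≅ ρ φ′ u′ p₀′ α′ h′ s)))
    ∼▸ sym≅ (C.pathPoint≅ ρ φ′ u′ p₀′ α′ h′ s))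

module _ {Γ : CubicalSet ℓ} {A : Family Γ} (a b : Section A) (c : Composition A) where
  open CubicalSet Γ
  open Family A
  open Restriction A
  private
    module a = Section a
    module b = Section b
    module C = PathComposition a b c
    module PR = Restriction (Path A a b)

  pathOp : Operation (Path A a b)
  pathOp ρ φ u p₀ α = record
    { at         = C.pathPoint ρ φ u p₀ α
    ; compatible = λ {_} {_} {f} {g} d s → toRestrict
        (pathPoint-over {c′ = c} {c} (λ _ → reflᵃ) (λ _ → reflᵃ) (id-over c)
          (transˣ (·-cong reflˣ id⁺) ·-id) (⟨⟩ᶠ-id φ)
          (λ g p q r → path∼⁻ (PR.at≅ u λ { zero → refl ; (suc i) → refl }) idʰ r)
          (λ g r → path-at≅ p₀ reflʰ refl) d s)
    ; at-0       = λ f → toEq (C.pathPoint≅ ρ φ u p₀ α f 0ᴵ ▸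
        (comp∼-agrees idʰ (∨-oneʳ (∨-oneˡ refl)) ▸ (C.box-0 ρ φ u p₀ α f 0ᴵ refl ▸
          sec≅ a (cell f))))
    ; at-1       = λ f → toEq (C.pathPoint≅ ρ φ u p₀ α f 1ᴵ ▸
        (comp∼-agrees idʰ (∨-oneʳ (∨-oneʳ refl)) ▸ (C.box-1 ρ φ u p₀ α f 1ᴵ refl ▸
          sec≅ b (cell f))))
    }
    where
    open CompositionRules c
    cell : ∀ {J} (f : _ ⇒ J) → ρ · f ⁺ · (ι₁ ⨟ idʰ) ≈ ρ · ι₁ · f
    cell f = transˣ (·-cong reflˣ (⨟-identityʳ ι₁)) (transˣ (·-via (⁺-ι₁ f)) (symˣ ·-⨟))

  pathOp-agrees : {ρ : Cell (suc I)} {φ : Face I} {u : Partial (Path A a b) ρ (φ ⟨ weaken ⟩ᶠ)} {p₀ : PathElem A a b (ρ · ι₀)}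
                  (α : AgreesOn φ (u at₀) p₀) (f : I ⇒ J) (p : φ ⟨ weaken ⟩ᶠ ⟨ ι₁ ⨟ f ⟩ᶠ ≈ᶠ 1ᶠ) →
                  Path A a b ∋ pathOp ρ φ u p₀ α ∼[ f ] Partial.at u (ι₁ ⨟ f) p
  pathOp-agrees {ρ = ρ} {φ} {u} {p₀} α f p = path∼ ·-⨟ λ g r →
    let q = respect-one (φ ⟨ weaken ⟩ᶠ) (λ i → sym (d g i)) (restrict-one (φ ⟨ weaken ⟩ᶠ) p) in
    C.pathPoint≅ ρ φ u p₀ α (f ⨟ g) r ▸
    (CompositionRules.comp∼-agrees c idʰ (∨-oneˡ (one-shift (φ ⟨ weaken ⟩ᶠ) (extent-⁺ φ (f ⨟ g) refl) q)) ▸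
    (C.box-sides ρ φ u p₀ α (f ⨟ g) r {q = q} (≡⇒≈ᴵ (⟨⟩-id r)) ▸
    (path∼⁻ (PR.sym≅ (PR.at≅ u {p = restrict-one (φ ⟨ weaken ⟩ᶠ) p} λ i → sym (d g i))) idʰ r ▸
     (sym≅ (path∼⁻ (PR.at∼ u {p = p} reflʰ) idʰ r) ▸ path-at≅ (Partial.at u (ι₁ ⨟ f) p) (⨟-identityʳ g) refl))))
    where
    d : ∀ {K} (g : _ ⇒ K) → (f ⨟ g) ⁺ ⨟ (ι₁ ⨟ idʰ) ≈ʰ ι₁ ⨟ f ⨟ g
    d g zero    = refl
    d g (suc i) = trans (≡⇒≈ᴵ (⟨⟩-⨟ ((f ⨟ g) i) weaken (ι₁ ⨟ idʰ))) (≡⇒≈ᴵ (⟨⟩-id _))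

module _ {Δ Γ : CubicalSet ℓ} (σ : CubicalMap Δ Γ) {A′ : Family Δ} {A : Family Γ} (F : A′ ⟶ A [ σ ])
         {a′ b′ : Section A′} {a b : Section A}
         (k : ∀ {I} (δ : CubicalSet.Cell Δ I) →
              Family._≋_ A (_⟶_.map F (Section.sec a′ δ)) (Section.sec a (CubicalMap.map σ δ)))
         (l : ∀ {I} (δ : CubicalSet.Cell Δ I) →
              Family._≋_ A (_⟶_.map F (Section.sec b′ δ)) (Section.sec b (CubicalMap.map σ δ))) where
  private
    module Δ = CubicalSet Δ
    module Γ = CubicalSet Γ
  open Restriction A
  open PathElem

  Path-mapᵐ : Path A′ a′ b′ ⟶ Path A a b [ σ ]
  _⟶_.map     Path-mapᵐ p = Path-map σ {A = A} {a = a} {b} F k l p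
  _⟶_.cong    Path-mapᵐ m = λ f r → Family.restrict-≋ A (_⟶_.cong F (m f r))
  _⟶_.natural Path-mapᵐ {f = f} {e} {p} =
    Restriction.toRestrict (Path A a b) (path∼ {p = Path-map σ {A = A} {a = a} {b} F k l p}
      {Path-map σ {A = A} {a = a} {b} F k l (restrictₗ A′ a′ b′ f e p)} (CubicalMap.natural′ σ e) (λ g r →
        sym≅ res ▸ (over∼ σ F (path∼⁻ {p = p} {restrictₗ A′ a′ b′ f e p} (Restriction.res (Path A′ a′ b′) {e = e}) g r) ▸ res)))

  path-over : {c′ : Composition A′} {c : Composition A} → Over σ F (Composition.comp c′) (Composition.comp c) →
              Over σ Path-mapᵐ (pathOp a′ b′ c′) (pathOp a b c)
  Over.over (path-over {c′} {c} O) {δ = δ} {u = u} {p₀} {f = f} e φ≈ m n = path∼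
    (Γ.transˣ (Γ.·-cong (Γ.symˣ (CubicalMap.natural σ)) reflʰ) (Γ.⁺-at ι₁ (⁺-ι₁ f) e))
    (λ g r → sym≅ res ▸ pathPoint-over {c′ = c′} {c} k l O e φ≈
      (λ g p q r → res ▸ path∼⁻ (m g p q) idʰ r)
      (λ g r → res ▸ path∼⁻ n g r)
      (⨟-identityʳ _) (≡⇒≈ᴵ (⟨⟩-id r)))

opaque
  path-comp : {Γ : CubicalSet ℓ} {A : Family Γ} (a b : Section A) → Composition A → Composition (Path A a b)
  path-comp {Γ = Γ} {A} a b c = toComposition (pathOp a b c) (λ {_} {_} {φ} {u} {p₀} α f p → pathOp-agrees a b c {φ = φ} {u} {p₀} α f p) record
    { over = λ e φ≈ m n → path∼ (CubicalSet.⁺-at Γ ι₁ (⁺-ι₁ _) e) λ g r →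
        pathPoint-over {c′ = c} {c} (λ _ → Family.reflᵃ A) (λ _ → Family.reflᵃ A) (id-over c) e φ≈
          (λ g p q r → path∼⁻ (m g p q) idʰ r) (λ g r → path∼⁻ n g r) (⨟-identityʳ _) (≡⇒≈ᴵ (⟨⟩-id r)) }

-- Composition in identity types

module _ {Γ : CubicalSet ℓ} {A : Family Γ} (a b : Section A) where
  open CubicalSet Γ
  open Family A
  open IdElem
  open PathElem using (at)

  forget : Id A a b ⟶ Path A a b
  _⟶_.map     forget       = path
  _⟶_.cong    forget       = proj₁
  _⟶_.natural forget f r   = reflᵃ

  opaque
    id∼ : {ρ : Cell I} {ρ′ : Cell J} {f : I ⇒ J} {x : IdElem A a b ρ} {y : IdElem A a b ρ′} →
          Path A a b ∋ path x ∼[ f ] path y → extent x ⟨ f ⟩ᶠ ≈ᶠ extent y → Id A a b ∋ x ∼[ f ] y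
    id∼ (e , p) c = e , (λ g r → p g r) , c

    id∼-extent : {ρ : Cell I} {ρ′ : Cell J} {f : I ⇒ J} {x : IdElem A a b ρ} {y : IdElem A a b ρ′} →
                 Id A a b ∋ x ∼[ f ] y → extent x ⟨ f ⟩ᶠ ≈ᶠ extent y
    id∼-extent (e , p , c) = c

    id≅-extent : {ρ ρ′ : Cell I} {x : IdElem A a b ρ} {y : IdElem A a b ρ′} →
                 Id A a b ∋ x ≅ y → extent x ≈ᶠ extent y
    id≅-extent {x = x} p = trans (sym (⟨⟩ᶠ-id (extent x))) (id∼-extent p)

  module IdComposition (c : Composition A) where
    private
      module IR = Restriction (Id A a b)
      module AR = Restriction A

    extents : {ρ : Cell (suc I)} {φ : Face I} → Partial (Id A a b) ρ (φ ⟨ weaken ⟩ᶠ) → PartialFace φ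
    extents {φ = φ} u = record
      { at         = λ f p → extent (Partial.at u (ι₁ ⨟ f) (wk-one φ p))
      ; compatible = λ {_} {_} {f} {g} d → id∼-extent (IR.at∼ u {g = g}
          λ i → trans (⨟-assoc ι₁ f g i) (⟨⟩-cong (refl {r = ι₁ i}) d))
      }

    -- The extent of the composite is dictated only where `φ` holds, by the partial face `ψ` of the
    -- extents of `u` at the end of the line. `φ ∧ ψ` is the least face that agrees with `ψ` on `φ`,
    -- and on it the composite path is the end of `u`, hence constant.
    idOp : Operation (Id A a b)
    idOp ρ φ u s₀ α = record
      { path     = pathOp a b c ρ φ (mapₚ forget u) (path s₀) (mapₚ-agrees forget φ u s₀ α)
      ; extent   = conj (extents {φ = φ} u)
      ; constant = λ f m r → let p , q = conj-elim (extents {φ = φ} u) f m in AR.toEq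
          (path-at≅ (pathOp a b c ρ φ (mapₚ forget u) (path s₀) (mapₚ-agrees forget φ u s₀ α)) (symʰ (⨟-identityʳ f)) refl AR.▸
          (path∼⁻ (pathOp-agrees a b c {u = mapₚ forget u} {path s₀} (mapₚ-agrees forget φ u s₀ α) f (wk-one φ p)) idʰ r AR.▸
          (AR.fromEq (constant (Partial.at u (ι₁ ⨟ f) (wk-one φ p)) idʰ (trans (⟨⟩ᶠ-id _) q) r) AR.▸
          sec≅ a (transˣ ·-id (symˣ ·-⨟)))))
      }

    idOp-agrees : {ρ : Cell (suc I)} {φ : Face I} {u : Partial (Id A a b) ρ (φ ⟨ weaken ⟩ᶠ)} {s₀ : IdElem A a b (ρ · ι₀)}
                  (α : AgreesOn φ (u at₀) s₀) (f : I ⇒ J) (p : φ ⟨ weaken ⟩ᶠ ⟨ ι₁ ⨟ f ⟩ᶠ ≈ᶠ 1ᶠ) →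
                  Id A a b ∋ idOp ρ φ u s₀ α ∼[ f ] Partial.at u (ι₁ ⨟ f) p
    idOp-agrees {φ = φ} {u} {s₀} α f p = id∼
      (pathOp-agrees a b c {u = mapₚ forget u} {path s₀} (mapₚ-agrees forget φ u s₀ α) f p)
      (trans (conj-on (extents {φ = φ} u) f (wk-one⁻ φ p)) (id≅-extent (IR.at≅ u λ i → refl)))

module _ {Δ Γ : CubicalSet ℓ} {A′ : Family Δ} {A : Family Γ} (a′ b′ : Section A′) (a b : Section A)
         (c′ : Composition A′) (c : Composition A) where
  private
    module C′ = IdComposition a′ b′ c′
    module C = IdComposition a b c

  extents-natural :
    {δ : CubicalSet.Cell Δ (suc I)} {φ : Face I} (u : Partial (Id A′ a′ b′) δ (φ ⟨ weaken ⟩ᶠ))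
    {ρ : CubicalSet.Cell Γ (suc J)} {φ′ : Face J} (u′ : Partial (Id A a b) ρ (φ′ ⟨ weaken ⟩ᶠ))
    {f : I ⇒ J} → φ ⟨ f ⟩ᶠ ≈ᶠ φ′ →
    (∀ {K} (g : suc J ⇒ K) p q → IdElem.extent (Partial.at u (f ⁺ ⨟ g) p) ≈ᶠ IdElem.extent (Partial.at u′ g q)) →
    conj (C′.extents {φ = φ} u) ⟨ f ⟩ᶠ ≈ᶠ conj (C.extents {φ = φ′} u′)
  extents-natural {φ = φ} u {φ′ = φ′} u′ {f} φ≈ m =
    conj-natural {ψ = C′.extents {φ = φ} u} {C.extents {φ = φ′} u′} f φ≈ λ g p q →
      let r = respect-one (φ ⟨ weaken ⟩ᶠ) (d g) (wk-one φ p) in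
      trans (id≅-extent a′ b′ (Restriction.at≅ (Id A′ a′ b′) u {q = r} (d g))) (m (ι₁ ⨟ g) r (wk-one φ′ q))
    where
    d : ∀ {K} (g : _ ⇒ K) → ι₁ ⨟ (f ⨟ g) ≈ʰ f ⁺ ⨟ (ι₁ ⨟ g)
    d g i = trans (sym (⨟-assoc ι₁ f g i))
      (trans (⟨⟩-cong (sym (⁺-ι₁ f i)) (reflʰ {f = g})) (⨟-assoc (f ⁺) ι₁ g i))

opaque
  unfolding path-comp

  id-comp : {Γ : CubicalSet ℓ} {A : Family Γ} (a b : Section A) → Composition A → Composition (Id A a b)
  id-comp a b c = toComposition (IdComposition.idOp a b c)
    (λ {_} {_} {φ} {u} {s₀} α f p → IdComposition.idOp-agrees a b c {φ = φ} {u} {s₀} α f p)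
    record { over = λ {_} {_} {_} {_} {u} {_} {_} {_} {_} {u′} e φ≈ m n → id∼ a b
      (Over.over (id-over (path-comp a b c)) e φ≈ (λ g p q → map∼ (forget a b) (m g p q)) (map∼ (forget a b) n))
      (extents-natural a b a b c c u u′ φ≈ λ g p q → id≅-extent a b (m g p q)) }

  Id-map-over : {Δ Γ : CubicalSet ℓ} (σ : CubicalMap Δ Γ) {A′ : Family Δ} {A : Family Γ} (F : A′ ⟶ A [ σ ])
                {a′ b′ : Section A′} {a b : Section A}
                (k : ∀ {I} (δ : CubicalSet.Cell Δ I) →
                     Family._≋_ A (_⟶_.map F (Section.sec a′ δ)) (Section.sec a (CubicalMap.map σ δ)))
                (l : ∀ {I} (δ : CubicalSet.Cell Δ I) →
                     Family._≋_ A (_⟶_.map F (Section.sec b′ δ)) (Section.sec b (CubicalMap.map σ δ)))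
                (c′ : Composition A′) (c : Composition A) → Over σ F (Composition.comp c′) (Composition.comp c) →
                Over σ (Id-map σ {A = A} {a} {b} F k l)
                  (Composition.comp (id-comp a′ b′ c′)) (Composition.comp (id-comp a b c))
  Over.over (Id-map-over σ F {a′} {b′} {a} {b} k l c′ c O) {u = u} {u′ = u′} e φ≈ m n = id∼ a b
    (Over.over (path-over σ F k l {c′} {c} O) e φ≈ (λ g p q → map∼ (forget a b) (m g p q)) (map∼ (forget a b) n))
    (extents-natural a′ b′ a b c′ c u u′ φ≈ λ g p q → id≅-extent a b (m g p q))

-- Extension of partial elements

module _ {Γ : CubicalSet ℓ} (A : Family Γ) where
  open CubicalSet Γ
  open Family A
  open Restriction A

  -- For families with a composition structure this is equivalent to contractibility.
  record Extension : Set ℓ where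
    field
      ext         : (ρ : Cell I) (φ : Face I) → Partial A ρ φ → Elem ρ
      ext-agrees  : {ρ : Cell I} {φ : Face I} (u : Partial A ρ φ) (f : I ⇒ J) (p : φ ⟨ f ⟩ᶠ ≈ᶠ 1ᶠ) →
                    A ∋ ext ρ φ u ∼[ f ] Partial.at u f p
      ext-natural : {ρ : Cell I} {φ : Face I} {u : Partial A ρ φ} {ρ′ : Cell J} {φ′ : Face J} {u′ : Partial A ρ′ φ′}
                    {f : I ⇒ J} → ρ · f ≈ ρ′ → φ ⟨ f ⟩ᶠ ≈ᶠ φ′ →
                    (∀ {K} (g : J ⇒ K) p q → A ∋ Partial.at u (f ⨟ g) p ≅ Partial.at u′ g q) →
                    A ∋ ext ρ φ u ∼[ f ] ext ρ′ φ′ u′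

module _ {Γ : CubicalSet ℓ} {A : Family Γ} where
  open CubicalSet Γ
  open Family A
  open Restriction A

  emptyₚ : {ρ : Cell I} → Partial A ρ 0ᶠ
  Partial.at         emptyₚ f p           = ⊥-elim (0≉1 p)
  Partial.compatible emptyₚ {p = p} c     = ⊥-elim (0≉1 p)

  private
    constantₚ : {ρ : Cell I} → Elem ρ → (φ : Face I) → Partial A ρ φ
    constantₚ = elementₚ

    ends-apart : {ρ : Cell I} (r : dM I) (x y : Elem ρ) → ∀ {J} (f : I ⇒ J) p q →
                 Partial.at (constantₚ x (r =0ᶠ)) f p ≋ Partial.at (constantₚ y (r =1ᶠ)) f q
    ends-apart r x y f p q = ⊥-elim (0≉1ᴵ (=0-at r p) (=1-at r q))

  opaque
    endsₚ : {ρ : Cell I} (r : dM I) (x y : Elem ρ) → Partial A ρ (∂ r)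
    endsₚ r x y = join (constantₚ x (r =0ᶠ)) (constantₚ y (r =1ᶠ)) (ends-apart r x y)

    endsₚ-0 : {ρ : Cell I} (r : dM I) (x y : Elem ρ) {f : I ⇒ J} {p : ∂ r ⟨ f ⟩ᶠ ≈ᶠ 1ᶠ} → r ⟨ f ⟩ ≈ᴵ 0ᴵ →
              A ∋ x ∼[ f ] Partial.at (endsₚ r x y) f p
    endsₚ-0 r x y {f} {p} d = res ∼▸ sym≅ (fromEq
      (join-at₁ (constantₚ x (r =0ᶠ)) (constantₚ y (r =1ᶠ)) (ends-apart r x y) f p (=0-at⁻ r d)))

    endsₚ-1 : {ρ : Cell I} (r : dM I) (x y : Elem ρ) {f : I ⇒ J} {p : ∂ r ⟨ f ⟩ᶠ ≈ᶠ 1ᶠ} → r ⟨ f ⟩ ≈ᴵ 1ᴵ →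
              A ∋ y ∼[ f ] Partial.at (endsₚ r x y) f p
    endsₚ-1 r x y {f} {p} d = res ∼▸ sym≅ (fromEq
      (join-at₂ (constantₚ x (r =0ᶠ)) (constantₚ y (r =1ᶠ)) (ends-apart r x y) f p (=1-at⁻ r d)))

  endsₚ∼ : {ρ : Cell I} {ρ′ : Cell J} {r : dM I} {s : dM J} {x y : Elem ρ} {x′ y′ : Elem ρ′} {f : I ⇒ J} →
           r ⟨ f ⟩ ≈ᴵ s → A ∋ x ∼[ f ] x′ → A ∋ y ∼[ f ] y′ →
           ∀ {K} (g : J ⇒ K) c d → A ∋ Partial.at (endsₚ r x y) (f ⨟ g) c ≅ Partial.at (endsₚ s x′ y′) g d
  endsₚ∼ {r = r} {s} {x} {y} {x′} {y′} {f} d p q g _ z =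
    let r≈ = trans (≡⇒≈ᴵ (≡.sym (⟨⟩-⨟ r f g))) (⟨⟩-cong d (reflʰ {f = g})) in
    case ∂-cases s {g} z of λ
      { (inj₁ z) → uniq (endsₚ-0 r x y (trans r≈ z)) (comp∼ reflʰ p (endsₚ-0 s x′ y′ z))
      ; (inj₂ z) → uniq (endsₚ-1 r x y (trans r≈ z)) (comp∼ reflʰ q (endsₚ-1 s x′ y′ z)) }

  module ExtensionRules (E : Extension A) where
    open Extension E

    -- Extending the two ends from `∂ r` at every `r` joins any two elements by a path, since
    -- naturality of `ext` makes the values compatible. With the extension of the empty partial
    -- element as center this contracts `A`.
    segment : {ρ : Cell I} → dM I → Elem ρ → Elem ρ → Elem ρ
    segment r x y = ext _ (∂ r) (endsₚ r x y)

    segment-0 : {ρ : Cell I} {r : dM I} {x y : Elem ρ} → r ≈ᴵ 0ᴵ → segment r x y ≋ x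
    segment-0 {r = r} {x} {y} p = toEq (ext-agrees (endsₚ r x y) idʰ (∨-oneˡ (=0-at⁻ r p′)) ▸ sym≅ (endsₚ-0 r x y p′))
      where p′ = trans (≡⇒≈ᴵ (⟨⟩-id r)) p

    segment-1 : {ρ : Cell I} {r : dM I} {x y : Elem ρ} → r ≈ᴵ 1ᴵ → segment r x y ≋ y
    segment-1 {r = r} {x} {y} p = toEq (ext-agrees (endsₚ r x y) idʰ (∨-oneʳ (=1-at⁻ r p′)) ▸ sym≅ (endsₚ-1 r x y p′))
      where p′ = trans (≡⇒≈ᴵ (⟨⟩-id r)) p

    segment∼ : {ρ : Cell I} {ρ′ : Cell J} {r : dM I} {s : dM J} {x y : Elem ρ} {x′ y′ : Elem ρ′} {f : I ⇒ J} →
               r ⟨ f ⟩ ≈ᴵ s → A ∋ x ∼[ f ] x′ → A ∋ y ∼[ f ] y′ → A ∋ segment r x y ∼[ f ] segment s x′ y′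
    segment∼ {r = r} {f = f} d p q = ext-natural (base p) (∂-cong {r = r} {f = f} d) (endsₚ∼ d p q)

    extension-center : Section A
    Section.sec     extension-center ρ           = ext ρ 0ᶠ emptyₚ
    Section.natural extension-center {e = e}     = toRestrict (ext-natural e refl λ g p q → ⊥-elim (0≉1 p))

    extension⇒contractible : Contractible A
    extension⇒contractible = record
      { center      = extension-center
      ; contraction = record
        { sec     = λ (ρ , x) → record
          { at         = λ f r → segment r (Section.sec extension-center (ρ · f)) (restrict f reflˣ x)
          ; compatible = λ c d → toRestrict (segment∼ d (sec∼ extension-center (·-via c)) (quot∼ c res res))
          ; at-0       = λ f → segment-0 refl
          ; at-1       = λ f → segment-1 refl
          }
        ; natural = λ {_} {_} {_} {_} {f} {e} g r → toRestrict (segment∼ (≡⇒≈ᴵ (⟨⟩-id r))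
            (sec≅ extension-center (·-shift (proj₁ e))) (uniq res (comp∼ reflʰ (cell∼⁻ A e) res)))
        }
      }

module _ {Γ : CubicalSet ℓ} {A : Family Γ} where
  open CubicalSet Γ
  open Family A
  open Restriction A

  makeSection : (s : ∀ {I} (ρ : Cell I) → Elem ρ) →
                (∀ {I J} {ρ : Cell I} {ρ′ : Cell J} {f : I ⇒ J} → ρ · f ≈ ρ′ → A ∋ s ρ ∼[ f ] s ρ′) → Section A
  Section.sec     (makeSection s r)         = s
  Section.natural (makeSection s r) {e = e} = toRestrict (r e)

  -- A homotopy needs only its values `D x r` at the current stage: at a later stage `D` is applied
  -- to the restriction of `x`, and the stability of `D` makes the values compatible.
  makeHomotopy : (a : Section (A [ π A ])) (D : ∀ {I} {ρ : Cell I} → Elem ρ → dM I → Elem ρ) →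
                 (∀ {I J} {ρ : Cell I} {ρ′ : Cell J} {x : Elem ρ} {x′ : Elem ρ′} {f : I ⇒ J} {r s} →
                   A ∋ x ∼[ f ] x′ → r ⟨ f ⟩ ≈ᴵ s → A ∋ D x r ∼[ f ] D x′ s) →
                 (∀ {I} {ρ : Cell I} (x : Elem ρ) → D x 0ᴵ ≋ Section.sec a (ρ , x)) →
                 (∀ {I} {ρ : Cell I} (x : Elem ρ) → D x 1ᴵ ≋ x) → Section (Path (A [ π A ]) a (var A))
  Section.sec (makeHomotopy a D D∼ D₀ D₁) (ρ , x) = record
    { at         = λ f r → D (restrict f reflˣ x) r
    ; compatible = λ c d → toRestrict (D∼ (quot∼ c res res) d)
    ; at-0       = λ f → D₀ _
    ; at-1       = λ f → D₁ _
    }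
  Section.natural (makeHomotopy a D D∼ D₀ D₁) {e = e} g r =
    toRestrict (D∼ (uniq res (comp∼ reflʰ (cell∼⁻ A e) res)) (≡⇒≈ᴵ (⟨⟩-id r)))

module _ {Γ : CubicalSet ℓ} {A B : Family Γ} where
  private
    module A = Family A
    module B = Family B
    module AR = Restriction A
    module BR = Restriction B
  open CubicalSet Γ

  makeMap : (m : ∀ {I} {ρ : Cell I} → A.Elem ρ → B.Elem ρ) →
            (∀ {I J} {ρ : Cell I} {ρ′ : Cell J} {f : I ⇒ J} {x : A.Elem ρ} {y : A.Elem ρ′} →
              A ∋ x ∼[ f ] y → B ∋ m x ∼[ f ] m y) → A ⟶ B
  _⟶_.map     (makeMap m r)   = m
  _⟶_.cong    (makeMap m r) p = BR.toEq (r (AR.fromEq p))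
  _⟶_.natural (makeMap m r)   = BR.toRestrict (r AR.res)

module _ {Γ : CubicalSet ℓ} {A A′ : Family Γ} (s : A ⟶ A′) (r : A′ ⟶ A) (rs : r ∘ᵐ s ≈ᵐ idᵐ) where
  open Restriction A

  extension-retract : Extension A′ → Extension A
  Extension.ext         (extension-retract E) ρ φ u = _⟶_.map r (Extension.ext E ρ φ (mapₚ s u))
  Extension.ext-agrees  (extension-retract E) u f p = map∼ r (Extension.ext-agrees E (mapₚ s u) f p) ∼▸ fromEq (rs _)
  Extension.ext-natural (extension-retract E) e c m = map∼ r (Extension.ext-natural E e c λ g p q → map∼ s (m g p q))

-- If H is a path from a to the identity of A, a partial element u extends as
-- soon as a(u) does: the system H(u) moves the extension of a(u) to one of u.
module _ {Γ : CubicalSet ℓ} {A : Family Γ} (c : Composition A) (a : Section (A [ π A ]))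
         (H : Section (Path (A [ π A ]) a (var A))) where
  open CubicalSet Γ
  open Family A
  open Restriction A
  private
    module a = Section a
    module H = Section H
    module ΓA = CubicalSet (Γ ▷ A)
  open Composition c
  open CompositionRules c

  module _ (base : ∀ {I} (ρ : Cell I) (φ : Face I) → Partial A ρ φ → Elem ρ)
           (base-agrees : ∀ {I J} {ρ : Cell I} {φ : Face I} (u : Partial A ρ φ) (f : I ⇒ J) (p : φ ⟨ f ⟩ᶠ ≈ᶠ 1ᶠ) →
                          A ∋ base ρ φ u ∼[ f ] a.sec (ρ · f , Partial.at u f p))
           (base-natural : ∀ {I J} {ρ : Cell I} {φ : Face I} {u : Partial A ρ φ} {ρ′ : Cell J} {φ′ : Face J}
                           {u′ : Partial A ρ′ φ′} {f : I ⇒ J} → ρ · f ≈ ρ′ → φ ⟨ f ⟩ᶠ ≈ᶠ φ′ →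
                           (∀ {K} (g : J ⇒ K) p q → A ∋ Partial.at u (f ⨟ g) p ≅ Partial.at u′ g q) →
                           A ∋ base ρ φ u ∼[ f ] base ρ′ φ′ u′) where

    private
      H∼ : {ρ : Cell I} {ρ′ : Cell J} {x : Elem ρ} {x′ : Elem ρ′} {f : I ⇒ J} {r : dM I} {s : dM J} →
           A ∋ x ∼[ f ] x′ → r ⟨ f ⟩ ≈ᴵ s →
           A ∋ PathElem.at (H.sec (ρ , x)) idʰ r ∼[ f ] PathElem.at (H.sec (ρ′ , x′)) idʰ s
      H∼ {x = x} {f = f} {s = s} p d = below∼ (π A) A (path-at∼ (H.sec _) {h = f ⨟ idʰ} (symʰ (⨟-identityʳ f)) d) ∼▸
        below∼ (π A) A (path∼⁻ (Restriction.sec∼ (Path (A [ π A ]) a (var A)) H (cell∼ A p)) idʰ s)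

    module Deformation {I : ℕ} (ρ : Cell I) (φ : Face I) (u : Partial A ρ φ) where

      opaque
        -- The composition runs over the degenerate line at `ρ`, and its direction, which `f` sends
        -- to `f zero`, serves as the coordinate of the path `H`.
        system : Partial A (ρ · weaken) (φ ⟨ weaken ⟩ᶠ)
        Partial.at         system f p =
          cast (transˣ ·-id (symˣ ·-⨟)) (PathElem.at (H.sec (_ , Partial.at u (weaken ⨟ f) (wk-one⁻ φ p))) idʰ (f zero))
        Partial.compatible system {f = f} {g} d = toRestrict (quot∼ reflʰ res
          (H∼ (at∼ u {weaken ⨟ f} {g} λ i → d (suc i)) (d zero) ∼▸ res))

        system≅ : ∀ {J} {f : suc I ⇒ J} {p} q {r} → f zero ≈ᴵ r →
                  A ∋ Partial.at system f p ≅ PathElem.at (H.sec (_ , Partial.at u (weaken ⨟ f) q)) idʰ r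
        system≅ q {r} d = sym≅ res ▸ H∼ (at≅ u λ i → refl) (trans (≡⇒≈ᴵ (⟨⟩-id _)) d)

        start : Elem (ρ · weaken · ι₀)
        start = cast (symˣ (transˣ (·-via reflʰ) ·-id)) (base ρ φ u)

        start≅ : A ∋ start ≅ base ρ φ u
        start≅ = sym≅ res

        start-agrees : AgreesOn φ (system at₀) start
        start-agrees = agrees₀ φ system λ f p → start≅ ≅▸ (base-agrees u f (wk-one⁻ φ p) ∼▸
          sym≅ (system≅ (wk-one⁻ φ p) refl ▸ (fromEq (PathElem.at-0 (H.sec _) idʰ) ▸
            below∼ (π A) A (sec≅ a ΓA.·-id))))

        result : Elem ρ
        result = cast (transˣ (·-via reflʰ) ·-id) (comp (ρ · weaken) φ system start start-agrees)

        result≅ : A ∋ result ≅ comp (ρ · weaken) φ system start start-agrees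
        result≅ = sym≅ res

    deform⇒extension : Extension A
    Extension.ext         deform⇒extension ρ φ u = Deformation.result ρ φ u
    Extension.ext-agrees  deform⇒extension {ρ = ρ} {φ} u f p = D.result≅ ≅▸ (comp∼-agrees f (wk-one φ p) ∼▸
      (D.system≅ p refl ▸ (fromEq (PathElem.at-1 (H.sec _) idʰ) ▸ sym≅ res)))
      where module D = Deformation ρ φ u
    Extension.ext-natural deform⇒extension {ρ = ρ} {φ} {u} {ρ′} {φ′} {u′} {f} e c m = D.result≅ ≅▸ (comp∼-natural
      (transˣ (·-via {f = weaken} {f ⁺} {f ⨟ weaken} reflʰ) (·-shift e)) c
      (λ g p q →
        let p′ = one-shift⁻ φ {g = weaken ⨟ g} c (wk-one⁻ φ′ q)
            d = λ i → sym (≡⇒≈ᴵ (⟨⟩-⨟ (f i) weaken g))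
        in D.system≅ {p = p} (respect-one φ d p′) refl ▸
           (H∼ (at≅ u {q = p′} (symʰ d) ▸ m (weaken ⨟ g) p′ (wk-one⁻ φ′ q)) (≡⇒≈ᴵ (⟨⟩-id _)) ▸ sym≅ (D′.system≅ {p = q} (wk-one⁻ φ′ q) refl)))
      (D.start≅ ≅▸ (base-natural e c m ∼▸ sym≅ D′.start≅)) ∼▸ sym≅ D′.result≅)
      where
      module D = Deformation ρ φ u
      module D′ = Deformation ρ′ φ′ u′

-- The case of a constant `a`: the center is defined everywhere, so it extends `a(u)` for every `u`,
-- and the deformation does the rest.
contractible⇒extension : {Γ : CubicalSet ℓ} {A : Family Γ} → Composition A → Contractible A → Extension A
contractible⇒extension {Γ = Γ} {A} c C = deform⇒extension c (center [ π A ]ˢ) contraction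
  (λ ρ φ u → Section.sec center ρ)
  (λ u f p → sec∼ center (CubicalSet.reflˣ Γ))
  (λ e _ _ → sec∼ center e)
  where
  open Contractible C
  open Restriction A

-- The family of partial preimages

module _ {Γ : CubicalSet ℓ} {A B : Family Γ} (F : A ⟶ B) where
  open CubicalSet Γ
  open PartialPreimage
  private
    module A = Family A
    module B = Family B
    module F = _⟶_ F
    module AR = Restriction A
    module BR = Restriction B
    module ΓB = CubicalSet (Γ ▷ B)
    P = PartialFibre F
    module PR = Restriction P

  opaque
    preimage∼ : {γ : ΓB.Cell I} {γ′ : ΓB.Cell J} {f : I ⇒ J} {t : Family.Elem P γ} {t′ : Family.Elem P γ′} →
                γ ΓB.· f ΓB.≈ γ′ → extent t ⟨ f ⟩ᶠ ≈ᶠ extent t′ →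
                (∀ {K} (g : J ⇒ K) p q → A ∋ Partial.at (element t) (f ⨟ g) p ≅ Partial.at (element t′) g q) →
                P ∋ t ∼[ f ] t′
    preimage∼ e c m = e , c , λ g p q → AR.toRestrict (m g _ q)

    preimage∼-extent : {γ : ΓB.Cell I} {γ′ : ΓB.Cell J} {f : I ⇒ J} {t : Family.Elem P γ} {t′ : Family.Elem P γ′} →
                       P ∋ t ∼[ f ] t′ → extent t ⟨ f ⟩ᶠ ≈ᶠ extent t′
    preimage∼-extent (_ , c , _) = c

    preimage∼-element : {γ : ΓB.Cell I} {γ′ : ΓB.Cell J} {f : I ⇒ J} {t : Family.Elem P γ} {t′ : Family.Elem P γ′} →
                        P ∋ t ∼[ f ] t′ → {g : J ⇒ K} {p : extent t ⟨ f ⨟ g ⟩ᶠ ≈ᶠ 1ᶠ} {q : extent t′ ⟨ g ⟩ᶠ ≈ᶠ 1ᶠ} →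
                        A ∋ Partial.at (element t) (f ⨟ g) p ≅ Partial.at (element t′) g q
    preimage∼-element {f = f} {t} (_ , c , m) {g} {p} {q} =
      AR.at≅ (element t) (λ i → refl) AR.▸ (AR.res AR.▸ AR.fromEq (m g (one-shift (extent t) refl p) q))

  extentsₚ : {γ : ΓB.Cell I} {φ : Face I} → Partial P γ φ → PartialFace φ
  extentsₚ t = record
    { at         = λ f p → extent (Partial.at t f p)
    ; compatible = λ {_} {_} {f} {g} d → preimage∼-extent (PR.at∼ t {f} {g} d)
    }

  module _ {I : ℕ} (γ : ΓB.Cell I) (φ : Face I) (t : Partial P γ φ) where

    opaque
      -- Where the conjunction holds, `t` is defined and its own extent there is 1, so that it
      -- contains an actual element of `A`, found at the identity substitution.
      preimageElement : Partial A (proj₁ γ) (conj (extentsₚ t))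
      Partial.at         preimageElement f m = let p , q = conj-elim (extentsₚ t) f m in
        A.cast ·-id (Partial.at (element (Partial.at t f p)) idʰ (trans (⟨⟩ᶠ-id _) q))
      Partial.compatible preimageElement {f = f} {g} {h} {p = m} {n} d =
        let p , q = conj-elim (extentsₚ t) f m
            p′ , q′ = conj-elim (extentsₚ t) h n
            q″ = trans (⟨⟩ᶠ-cong q (reflʰ {f = g})) refl
        in AR.toRestrict (AR.quot∼ reflʰ AR.res
          (AR.at∼ (element (Partial.at t f p)) {q = q″} (λ i → refl) AR.∼▸
            (AR.at≅ (element (Partial.at t f p)) {q = respect-one (extent (Partial.at t f p)) (symʰ (⨟-identityʳ g)) q″} (symʰ (⨟-identityʳ g)) AR.▸
            (preimage∼-element (PR.at∼ t d) {idʰ} {q = trans (⟨⟩ᶠ-id _) q′} AR.▸ AR.res))))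

      preimageElement≅ : (f : I ⇒ J) {m : conj (extentsₚ t) ⟨ f ⟩ᶠ ≈ᶠ 1ᶠ} {p : φ ⟨ f ⟩ᶠ ≈ᶠ 1ᶠ}
                         {q : extent (Partial.at t f p) ⟨ idʰ ⟩ᶠ ≈ᶠ 1ᶠ} →
                         A ∋ Partial.at preimageElement f m ≅ Partial.at (element (Partial.at t f p)) idʰ q
      preimageElement≅ f {m} {p} {q} = AR.sym≅ AR.res AR.▸
        preimage∼-element (PR.at≅ t λ i → refl) {idʰ}

    preimage : PartialPreimage F (proj₁ γ) (proj₂ γ)
    preimage = record
      { extent  = conj (extentsₚ t)
      ; element = preimageElement
      ; over    = λ f m → let p , q = conj-elim (extentsₚ t) f m in BR.toEq
          (map∼ F (preimageElement≅ f {m} {p} {trans (⟨⟩ᶠ-id _) q}) BR.▸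
          (BR.fromEq (over (Partial.at t f p) idʰ (trans (⟨⟩ᶠ-id _) q)) BR.▸ BR.sym≅ BR.res))
      }

  -- Extents extend by `conj-on`, and no element of `A` has to be invented: the extent obtained
  -- holds only where `t` is defined and supplies one.
  preimage-extension : Extension P
  Extension.ext         preimage-extension = preimage
  Extension.ext-agrees  preimage-extension {ρ = γ} {φ} t f p = preimage∼ ΓB.reflˣ (conj-on (extentsₚ t) f p)
    λ g m q →
      let e = preimage∼-extent (PR.at∼ t {f} {g} {p = p} {q = restrict-one φ p} reflʰ)
          q′ = respect-one (extent (Partial.at t f p)) (symʰ (⨟-identityʳ g)) q
          q″ = trans (⟨⟩ᶠ-id _) (trans (sym e) q)
      in preimageElement≅ γ φ t (f ⨟ g) {m} {restrict-one φ p} {q″} AR.▸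
         (AR.sym≅ (preimage∼-element (PR.at∼ t {f} {g} {p = p} reflʰ) {idʰ} {q′} {q″}) AR.▸
          AR.at≅ (element (Partial.at t f p)) (⨟-identityʳ g))
  Extension.ext-natural preimage-extension {ρ = γ} {φ} {t} {γ′} {φ′} {t′} {f} e c m = preimage∼ e
    (conj-natural {ψ = extentsₚ t} {extentsₚ t′} f c λ g p q →
      trans (sym (⟨⟩ᶠ-id _)) (preimage∼-extent (m g p q)))
    λ g x y →
      let p′ , q′ = conj-elim (extentsₚ t′) g y
          p = one-shift⁻ φ c p′
          q = trans (preimage∼-extent (m g p p′)) q′
          q″ = trans (⟨⟩ᶠ-id _) q′
      in preimageElement≅ γ φ t (f ⨟ g) {x} {p} {q} AR.▸
         (preimage∼-element (m g p p′) {idʰ} {q} {q″} AR.▸ AR.sym≅ (preimageElement≅ γ′ φ′ t′ g {y} {p′} {q″}))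

module _ {Γ : CubicalSet ℓ} {A : Family Γ} (E : Extension A) where
  open CubicalSet Γ
  open Family A
  open Restriction A
  open Extension E

  extensionOp : Operation A
  extensionOp ρ φ u a₀ α = ext (ρ · ι₁) φ (u at₁)

  at₁≅ : {ρ : Cell (suc I)} {φ : Face I} (u : Partial A ρ (φ ⟨ weaken ⟩ᶠ)) {f : I ⇒ J} {p : φ ⟨ f ⟩ᶠ ≈ᶠ 1ᶠ}
         {q : φ ⟨ weaken ⟩ᶠ ⟨ ι₁ ⨟ f ⟩ᶠ ≈ᶠ 1ᶠ} →
         A ∋ Partial.at (_at₁ {φ = φ} u) f p ≅ Partial.at u (ι₁ ⨟ f) q
  at₁≅ u = sym≅ res ▸ at≅ u λ i → refl

  -- A composite must agree with `u` at the end of the line, which any extension of `u at₁` does;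
  -- uniformity is `ext-natural`.
  extension⇒composition : Composition A
  extension⇒composition = toComposition extensionOp
    (λ {_} {_} {φ} {u} α f p → ext-agrees (_at₁ {φ = φ} u) f (wk-one⁻ φ p) ∼▸ at₁≅ {φ = φ} u)
    record { over = λ {_} {_} {_} {φ} {u} {_} {_} {_} {φ′} {u′} {_} {_} {f} e c m a →
      ext-natural (⁺-at ι₁ (⁺-ι₁ f) e) c λ g p q →
        let p′ = respect-one (φ ⟨ weaken ⟩ᶠ) (d f g) (wk-one φ p) in
        at₁≅ {φ = φ} u {q = wk-one φ p} ▸ (at≅ u {q = p′} (d f g) ▸ (m (ι₁ ⨟ g) p′ (wk-one φ′ q) ▸ sym≅ (at₁≅ {φ = φ′} u′))) }
    where
    d : ∀ {I J K} (f : I ⇒ J) (g : J ⇒ K) → ι₁ ⨟ (f ⨟ g) ≈ʰ f ⁺ ⨟ (ι₁ ⨟ g)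
    d f g i = trans (sym (⨟-assoc ι₁ f g i))
      (trans (⟨⟩-cong (sym (⁺-ι₁ f i)) (reflʰ {f = g})) (⨟-assoc (f ⁺) ι₁ g i))

module _ {Δ Γ : CubicalSet ℓ} (σ : CubicalMap Δ Γ) {A B : Family Γ}
         (F : A ⟶ B) (F′ : A [ σ ] ⟶ B [ σ ]) (e : F′ ≈ᵐ F [ σ ]ᵐ) where
  open PartialPreimage
  private
    module A = Family A
    module AR = Restriction A
    module B = Family B
    σᴮ : CubicalMap (Δ ▷ B [ σ ]) (Γ ▷ B)
    σᴮ = σ ▷⟨ B ⟩ idᵐ
    P = PartialFibre F
    P′ = PartialFibre F′
    module P′R = Restriction P′
    module PR = Restriction P
    module ΓB = CubicalSet (Γ ▷ B)
    G : P′ ⟶ P [ σᴮ ]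
    G = PartialFibre-substitute σ F F′ e

  preimage-over : Over σᴮ G (extensionOp (preimage-extension F′)) (extensionOp (preimage-extension F))
  Over.over preimage-over {J = J} {δ = δ} {φ} {u} {ρ = ρ} {φ′} {u′} {f = f} d c m a = preimage∼ F
    (ΓB.transˣ (ΓB.·-cong (ΓB.symˣ (CubicalMap.natural σᴮ {δ = δ})) reflʰ) (ΓB.⁺-at ι₁ (⁺-ι₁ f) d))
    (conj-natural {ψ = extentsₚ F′ v} {extentsₚ F v′} f c λ g p q →
      trans (sym (⟨⟩ᶠ-id _)) (preimage∼-extent F (related g p q)))
    λ g x y →
      let p′ , q′ = conj-elim (extentsₚ F v′) g y
          p = one-shift⁻ φ c p′
          q = trans (preimage∼-extent F (related g p p′)) q′
          q″ = trans (⟨⟩ᶠ-id _) q′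
      in AR.sym≅ AR.res AR.▸ (below∼ σ A (preimageElement≅ F′ _ φ v (f ⨟ g) {x} {p} {q}) AR.▸ (AR.res AR.▸
         (preimage∼-element F (related g p p′) {idʰ} {q} {q″} AR.▸
           AR.sym≅ (preimageElement≅ F _ φ′ v′ g {y} {p′} {q″}))))
    where
    v : Partial P′ (CubicalSet._·_ (Δ ▷ B [ σ ]) δ ι₁) φ
    v = _at₁ {φ = φ} u

    v′ : Partial P (CubicalSet._·_ (Γ ▷ B) ρ ι₁) φ′
    v′ = _at₁ {φ = φ′} u′

    related : ∀ {K} (g : J ⇒ K) p q → P ∋ _⟶_.map G (Partial.at v (f ⨟ g) p) ≅ Partial.at v′ g q
    related g p q =
      over∼ σᴮ G (P′R._▸_ (at₁≅ (preimage-extension F′) {φ = φ} u {q = wk-one φ p}) (P′R.at≅ u {q = p′} e′)) PR.▸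
      (m (ι₁ ⨟ g) p′ (wk-one φ′ q) PR.▸ PR.sym≅ (at₁≅ (preimage-extension F) {φ = φ′} u′))
      where
      e′ : ι₁ ⨟ (f ⨟ g) ≈ʰ f ⁺ ⨟ (ι₁ ⨟ g)
      e′ i = trans (sym (⨟-assoc ι₁ f g i))
        (trans (⟨⟩-cong (sym (⁺-ι₁ f i)) (reflʰ {f = g})) (⨟-assoc (f ⁺) ι₁ g i))
      p′ = respect-one (φ ⟨ weaken ⟩ᶠ) e′ (wk-one φ p)

-- Uniformity of the two factorizations

-- `F` is injective on each fibre, so congruence and naturality of the inverse can be checked after
-- applying `F`, where the inverse cancels.
pointwise-iso : {Γ : CubicalSet ℓ} {A B : Family Γ} (F : A ⟶ B)
                (inverse : ∀ {I} {ρ : CubicalSet.Cell Γ I} → Family.Elem B ρ → Family.Elem A ρ) →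
                (∀ {I} {ρ : CubicalSet.Cell Γ I} {x y : Family.Elem A ρ} →
                  Family._≋_ B (_⟶_.map F x) (_⟶_.map F y) → Family._≋_ A x y) →
                (∀ {I} {ρ : CubicalSet.Cell Γ I} (y : Family.Elem B ρ) → Family._≋_ B (_⟶_.map F (inverse y)) y) →
                IsIso F
pointwise-iso {A = A} {B} F inverse injective right = record
  { inverse  = record
    { map     = inverse
    ; cong    = λ p → injective (B.transᵃ (right _) (B.transᵃ p (B.symᵃ (right _))))
    ; natural = injective (B.transᵃ (B.symᵃ F.natural)
        (B.transᵃ (B.restrict-≋ (right _)) (B.symᵃ (right _))))
    }
  ; inverseˡ = λ x → injective (right _)
  ; inverseʳ = right
  }
  where
  module A = Family A
  module B = Family B
  module F = _⟶_ F

opaque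
  idMiddle : {Γ : CubicalSet ℓ} (A B : FibrantFamily Γ) (F : family A ⟶ family B) → Composition (IdFibre F)
  idMiddle A B F = sigma-comp (composition A [ π (family B) ]ᶜ)
    (id-comp (image F) (point F) (composition B [ π (family B) ]ᶜ [ π (family A [ π (family B) ]) ]ᶜ))

module Exchange {Δ Γ : CubicalSet ℓ} (σ : CubicalMap Δ Γ) (A B : Family Γ) where
  σᴮ : CubicalMap (Δ ▷ B [ σ ]) (Γ ▷ B)
  σᴮ = σ ▷⟨ B ⟩ idᵐ

  A′ : Family (Γ ▷ B)
  A′ = A [ π B ]

  Aσ : Family (Δ ▷ B [ σ ])
  Aσ = A [ σ ] [ π (B [ σ ]) ]

  private
    module ΓB = CubicalSet (Γ ▷ B)
    module ΓBA = CubicalSet (Γ ▷ B ▷ A′)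
    module AR = Restriction A
    module BR = Restriction B

  -- `A [ σ ] [ π ]` and `A [ π ] [ σᴮ ]` have the same elements but are not equal by computation:
  -- their restriction maps contain different proofs of the base equations.
  exchange : Aσ ⟶ A′ [ σᴮ ]
  _⟶_.map     exchange x = x
  _⟶_.cong    exchange p = p
  _⟶_.natural exchange   = Family.restrict-≋ A (Family.reflᵃ A)

  σᴮᴬ : CubicalMap (Δ ▷ B [ σ ] ▷ Aσ) (Γ ▷ B ▷ A′)
  σᴮᴬ = σᴮ ▷⟨ A′ ⟩ exchange

  exchange² : B [ σ ] [ π (B [ σ ]) ] [ π Aσ ] ⟶ B [ π B ] [ π A′ ] [ σᴮᴬ ]
  _⟶_.map     exchange² x = x
  _⟶_.cong    exchange² p = p
  _⟶_.natural exchange²   = Family.restrict-≋ B (Family.reflᵃ B)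

  -- Substituting a composition structure wraps it in casts, and the two sides are wrapped a
  -- different number of times. Each `res` adds or removes one cast, which leaves the uniformity of
  -- `c`.
  exchange-over : (c : Composition A) →
                  Over σᴮ exchange (Composition.comp (c [ σ ]ᶜ [ π (B [ σ ]) ]ᶜ)) (Composition.comp (c [ π B ]ᶜ))
  Over.over (exchange-over c) {δ = δ} {f = f} d k m a =
    above∼ (π B) A {f = f} (ΓB.transˣ (ΓB.·-cong (ΓB.symˣ (CubicalMap.natural σᴮ {δ = δ})) reflʰ) (ΓB.⁺-at ι₁ (⁺-ι₁ f) d))
      (AR.sym≅ AR.res AR.≅▸ (AR.sym≅ AR.res AR.≅▸ (CompositionRules.comp∼-natural c (proj₁ d) k
        (λ g p q → AR.sym≅ AR.res AR.▸ (AR.sym≅ AR.res AR.▸ (below∼ (π B) A (m g p q) AR.▸ AR.res)))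
        (AR.sym≅ AR.res AR.≅▸ (AR.sym≅ AR.res AR.≅▸ (below∼ (π B) A a AR.∼▸ AR.res))) AR.∼▸ AR.res)))

  below : {γ : ΓBA.Cell I} {γ′ : ΓBA.Cell J} {f : I ⇒ J} {x : Family.Elem (B [ π B ] [ π A′ ]) γ}
          {y : Family.Elem (B [ π B ] [ π A′ ]) γ′} →
          _∋_∼[_]_ (B [ π B ] [ π A′ ]) {ρ = γ} {γ′} x f y → B ∋ x ∼[ f ] y
  below p = below∼ (π B) B (below∼ (π A′) (B [ π B ]) p)

  exchange²-over : (c : Composition B) →
                   Over σᴮᴬ exchange² (Composition.comp (c [ σ ]ᶜ [ π (B [ σ ]) ]ᶜ [ π Aσ ]ᶜ))
                     (Composition.comp (c [ π B ]ᶜ [ π A′ ]ᶜ))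
  Over.over (exchange²-over c) {δ = δ} {ρ = ρ} {f = f} d k m a =
    above∼ (π A′) (B [ π B ]) {f = f} cell (above∼ (π B) B {f = f} (proj₁ cell)
      (BR.sym≅ BR.res BR.≅▸ (BR.sym≅ BR.res BR.≅▸ (BR.sym≅ BR.res BR.≅▸ (CompositionRules.comp∼-natural c (proj₁ (proj₁ d)) k
        (λ g p q → BR.sym≅ BR.res BR.▸ (BR.sym≅ BR.res BR.▸ (BR.sym≅ BR.res BR.▸ (below (m g p q) BR.▸ (BR.res BR.▸ BR.res)))))
        (BR.sym≅ BR.res BR.≅▸ (BR.sym≅ BR.res BR.≅▸ (BR.sym≅ BR.res BR.≅▸ (below a BR.∼▸ (BR.res BR.▸ BR.res)))))
        BR.∼▸ (BR.res BR.▸ BR.res))))))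
    where
    cell : ΓBA._·_ (CubicalMap.map σᴮᴬ (CubicalSet._·_ (Δ ▷ B [ σ ] ▷ Aσ) δ ι₁)) f ΓBA.≈ ΓBA._·_ ρ ι₁
    cell = ΓBA.transˣ (ΓBA.·-cong (ΓBA.symˣ (CubicalMap.natural σᴮᴬ {δ = δ})) reflʰ) (ΓBA.⁺-at ι₁ {ρ = CubicalMap.map σᴮᴬ δ} {ρ′ = ρ} (⁺-ι₁ f) d)

module _ {Δ Γ : CubicalSet ℓ} (σ : CubicalMap Δ Γ) (A B : FibrantFamily Γ) (F : family A ⟶ family B)
         (F′ : family A [ σ ] ⟶ family B [ σ ]) (e : F′ ≈ᵐ F [ σ ]ᵐ) where
  open Exchange σ (family A) (family B)

  opaque
    unfolding idMiddle

    idMiddle-over : Over σᴮ (IdFibre-substitute σ F F′ e)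
      (Composition.comp (idMiddle (A [ σ ]ᶠ) (B [ σ ]ᶠ) F′)) (Composition.comp (idMiddle A B F))
    idMiddle-over = sigma-comp-over
        (composition A [ σ ]ᶜ [ π (family B [ σ ]) ]ᶜ)
        (id-comp (image F′) (point F′) (composition B [ σ ]ᶜ [ π (family B [ σ ]) ]ᶜ [ π Aσ ]ᶜ))
        (composition A [ π (family B) ]ᶜ) (id-comp (image F) (point F) (composition B [ π (family B) ]ᶜ [ π A′ ]ᶜ))
      record { over = Over.over (exchange-over (composition A)) }
      record { over = Over.over (Id-map-over σᴮᴬ exchange² (λ (_ , x) → e x) (λ _ → Family.reflᵃ (family B))
        (composition B [ σ ]ᶜ [ π (family B [ σ ]) ]ᶜ [ π Aσ ]ᶜ) (composition B [ π (family B) ]ᶜ [ π A′ ]ᶜ)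
        (exchange²-over (composition B))) }

module _ {Δ Γ : CubicalSet ℓ} (σ : CubicalMap Δ Γ) (A B : Family Γ) (F : A ⟶ B)
         (F′ : A [ σ ] ⟶ B [ σ ]) (e : F′ ≈ᵐ F [ σ ]ᵐ) where
  open Exchange σ A B
  open IdElem
  open PathElem
  private
    module Δ = CubicalSet Δ
    module Γ = CubicalSet Γ
    module A = Family A
    module B = Family B
    module AR = Restriction A
    module BR = Restriction B
    module F = _⟶_ F
    module F′ = _⟶_ F′
    module ΔB = CubicalSet (Δ ▷ B [ σ ])
    module ΔBA = CubicalSet (Δ ▷ B [ σ ] ▷ Aσ)
    B′ = B [ σ ] [ π (B [ σ ]) ] [ π Aσ ]
    B″ = B [ π B ] [ π A′ ]
    open CubicalMap σ using () renaming (map to ∣σ∣)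

  module _ {δ : Δ.Cell I} {b : B.Elem (∣σ∣ δ)} {x : A.Elem (∣σ∣ δ)} where

    pathBack : PathElem B″ (image F) (point F) ((∣σ∣ δ , b) , x) →
               PathElem B′ (image F′) (point F′) ((δ , b) , x)
    pathBack p = record
      { at         = λ f r → B.cast (CubicalMap.natural σ) (at p f r)
      ; compatible = λ c d → BR.toRestrict (BR.quot∼ reflʰ BR.res
          (below {γ = _ , _} (path-at∼ p c d) BR.∼▸ BR.res))
      ; at-0       = λ f → B.transᵃ (B.restrict-resp (at-0 p f)) (B.transᵃ F.natural
          (B.transᵃ (F.cong A.cast-restrict) (B.symᵃ (e _))))
      ; at-1       = λ f → B.transᵃ (B.restrict-resp (at-1 p f)) B.cast-restrict
      }

    idBack : IdElem B″ (image F) (point F) ((∣σ∣ δ , b) , x) → IdElem B′ (image F′) (point F′) ((δ , b) , x)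
    idBack q = record
      { path     = pathBack (path q)
      ; extent   = extent q
      ; constant = λ f m r → B.transᵃ (B.restrict-resp (constant q f m r)) (B.transᵃ F.natural
          (B.transᵃ (F.cong A.cast-restrict) (B.symᵃ (e _))))
      }

  -- The comparison map keeps points and extents and alters paths only by casts along the naturality
  -- of `σ`; `idBack` casts in the opposite direction.
  idFibre-iso : IsIso (IdFibre-substitute σ F F′ e)
  idFibre-iso = pointwise-iso (IdFibre-substitute σ F F′ e)
    (λ (x , q) → x , idBack q)
    (λ {_} {γ} {s} {t} m →
      let n = snd∼ {B = Id B″ (image F) (point F)} {y = proj₂ (S s)} {proj₂ (S t)} (Restriction.fromEq (IdFibre F) {x = S s} {S t} m)
          c = cell≅ Aσ {ρ = γ} {γ} (Restriction.fromEq Aσ {ρ = γ} (proj₁ m))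
      in Restriction.toEq (IdFibre F′) (pair∼ {A = Aσ} {B = Id B′ (image F′) (point F′)} (id∼ (image F′) (point F′) {x = proj₂ s} {proj₂ t}
        (path∼ {A = B′} {ρ = _ , _} {_ , _} (ΔBA.transˣ ΔBA.·-id c) (λ g r →
          ΔBA.transˣ ΔBA.·-id (ΔBA.·-cong c reflʰ) ,
          BR.toRestrict (BR.res BR.▸ (below {γ = _ , _} {_ , _} (path∼⁻ (map∼ (forget (image F) (point F)) {x = proj₂ (S s)} {proj₂ (S t)} n) g r) BR.▸ BR.sym≅ BR.res))))
        (id∼-extent (image F) (point F) {x = proj₂ (S s)} {proj₂ (S t)} n))))
    (λ {_} {γ} (x , q) → Restriction.toEq (IdFibre F) (pair∼ {A = A′} {B = Id B″ (image F) (point F)} (id∼ (image F) (point F) {x = proj₂ (S (x , idBack q))} {q}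
        (path∼ {A = B″} {ρ = _ , _} {_ , _} ΓBA.·-id (λ g r →
          ΓBA.transˣ ΓBA.·-id reflΓ ,
          BR.toRestrict (BR.sym≅ BR.res BR.▸ BR.sym≅ BR.res)))
        (⟨⟩ᶠ-id (extent q)))))
    where
    S = _⟶_.map (IdFibre-substitute σ F F′ e)
    module ΓBA = CubicalSet (Γ ▷ B ▷ A′)
    reflΓ : ∀ {I} {γ : ΓBA.Cell I} → γ ΓBA.≈ γ
    reflΓ = ΓBA.reflˣ

  preimageBack : {δ : Δ.Cell I} {b : B.Elem (∣σ∣ δ)} → PartialPreimage F (∣σ∣ δ) b → PartialPreimage F′ δ b
  preimageBack t = record
    { extent  = PartialPreimage.extent t
    ; element = record
      { at         = λ f p → A.cast (CubicalMap.natural σ) (Partial.at (PartialPreimage.element t) f p)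
      ; compatible = λ c → AR.toRestrict (AR.quot∼ reflʰ AR.res (AR.at∼ (PartialPreimage.element t) c AR.∼▸ AR.res))
      }
    ; over    = λ f p → B.transᵃ (e _) (B.transᵃ (B.symᵃ F.natural)
        (B.transᵃ (B.restrict-resp (PartialPreimage.over t f p)) B.cast-restrict))
    }

  partialFibre-iso : IsIso (PartialFibre-substitute σ F F′ e)
  partialFibre-iso = pointwise-iso (PartialFibre-substitute σ F F′ e) preimageBack
    (λ (c , m) → c , λ f p q → AR.toEq (AR.res AR.▸ (AR.fromEq (m f p q) AR.▸ AR.sym≅ AR.res)))
    (λ t → refl , λ f p q → AR.toEq (AR.sym≅ AR.res AR.▸ (AR.sym≅ AR.res AR.▸ AR.at≅ (PartialPreimage.element t) λ i → refl)))

opaque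
  partialMiddle : {Γ : CubicalSet ℓ} {A B : Family Γ} (F : A ⟶ B) → Composition (PartialFibre F)
  partialMiddle F = extension⇒composition (preimage-extension F)

module _ {Δ Γ : CubicalSet ℓ} (σ : CubicalMap Δ Γ) (A B : FibrantFamily Γ) (F : family A ⟶ family B)
         (F′ : family A [ σ ] ⟶ family B [ σ ]) (e : F′ ≈ᵐ F [ σ ]ᵐ) where
  open Exchange σ (family A) (family B)
  private
    module Γ = CubicalSet Γ
    module ΓB = CubicalSet (Γ ▷ family B)
    module ΓBA = CubicalSet (Γ ▷ family B ▷ A′)
    module A = Family (family A)
    module B = Family (family B)
    module AR = Restriction (family A)
    module BR = Restriction (family B)
    module F = _⟶_ F
    B″ = family B [ π (family B) ] [ π A′ ]

  opaque
    unfolding partialMiddle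

    partialMiddle-over : Over σᴮ (PartialFibre-substitute σ F F′ e)
      (Composition.comp (partialMiddle F′)) (Composition.comp (partialMiddle F))
    partialMiddle-over = preimage-over σ F F′ e

  partialFirst-stable : FirstStable partialFactorization σ A B F F′ e
  partialFirst-stable x = Restriction.toEq (Sigma (family B) (PartialFibre F)) (pair∼ {A = family B} {B = PartialFibre F}
    (preimage∼ F {t = proj₂ (_⟶_.map G x)} {proj₂ (_⟶_.map (pc F) x)} (cell∼ (family B) (BR.fromEq (e x))) refl
      λ g p q → AR.sym≅ AR.res AR.▸ AR.uniq {f = g} AR.res AR.res))
    where
    G : family A [ σ ] ⟶ Sigma (family B) (PartialFibre F) [ σ ]
    G = DisplayFactorization.substitute-total partialFactorization σ F F′ e ∘ᵐ pc F′

  idFirst-stable : FirstStable idFactorization σ A B F F′ e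
  idFirst-stable {ρ = δ} x = Restriction.toEq (Sigma (family B) (IdFibre F)) (pair∼ {A = family B} {B = IdFibre F}
    (pair∼ {A = A′} {B = Id B″ (image F) (point F)} (id∼ (image F) (point F) {x = proj₂ (proj₂ (_⟶_.map G x))} {proj₂ (proj₂ (_⟶_.map (tc F) x))}
      (path∼ {A = B″} {p = IdElem.path (proj₂ (proj₂ (_⟶_.map G x)))} {IdElem.path (proj₂ (proj₂ (_⟶_.map (tc F) x)))} {f = idʰ} c (λ g r →
        ΓBA.transˣ ΓBA.·-id (ΓBA.·-shift {f = idʰ} {g} c) ,
        BR.toRestrict (BR.sym≅ BR.res BR.▸ (BR.fromEq (e _) BR.▸ map∼ F (AR.uniq {f = g} {x = x} AR.res AR.res)))))
      refl)))
    where
    G : family A [ σ ] ⟶ Sigma (family B) (IdFibre F) [ σ ]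
    G = DisplayFactorization.substitute-total idFactorization σ F F′ e ∘ᵐ tc F′

    c : ΓBA._·_ ((_ , _⟶_.map F′ x) , x) idʰ ΓBA.≈ ((CubicalMap.map σ δ , F.map x) , x)
    c = cell∼ A′ {ρ = _ , _} {_ , _} (cell∼ (family B) (BR.fromEq (e x)) , A.restrict-id)

module _ {Δ Γ : CubicalSet ℓ} (σ : CubicalMap Δ Γ) {A : Family Γ} {C′ : Family (Δ ▷ A [ σ ])} {C : Family (Γ ▷ A)}
         (c : Composition A) (d′ : Composition C′) (d : Composition C) (G : C′ ⟶ C [ σ ▷⟨ A ⟩ idᵐ ]) where

  total-over : Over (σ ▷⟨ A ⟩ idᵐ) G (Composition.comp d′) (Composition.comp d) →
               Over σ (Sigma-map σ {A = A} {B = C} {A′ = A [ σ ]} {B′ = C′} idᵐ G)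
                 (Composition.comp (sigma-comp (c [ σ ]ᶜ) d′)) (Composition.comp (sigma-comp c d))
  total-over = sigma-comp-over (c [ σ ]ᶜ) d′ c d (subst-over σ c)

module _ {Δ Γ : CubicalSet ℓ} (σ : CubicalMap Δ Γ) (A B : FibrantFamily Γ) (F : family A ⟶ family B)
         (F′ : family A [ σ ] ⟶ family B [ σ ]) (e : F′ ≈ᵐ F [ σ ]ᵐ) where

  partialMiddle-stable : MiddleStable partialFactorization σ A B F F′ e (partialMiddle F) (partialMiddle F′)
  partialMiddle-stable = partialFibre-iso σ (family A) (family B) F F′ e ,
      over⇒preserves (partialMiddle-over σ A B F F′ e)

  partialTotal-stable : TotalStable partialFactorization σ A B F F′ e
    (sigma-comp (composition B) (partialMiddle F)) (sigma-comp (composition B [ σ ]ᶜ) (partialMiddle F′))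
  partialTotal-stable = over⇒preserves (total-over σ (composition B) (partialMiddle F′) (partialMiddle F)
    (PartialFibre-substitute σ F F′ e) (partialMiddle-over σ A B F F′ e))

  idMiddle-stable : MiddleStable idFactorization σ A B F F′ e (idMiddle A B F) (idMiddle (A [ σ ]ᶠ) (B [ σ ]ᶠ) F′)
  idMiddle-stable = idFibre-iso σ (family A) (family B) F F′ e ,
      over⇒preserves (idMiddle-over σ A B F F′ e)

  idTotal-stable : TotalStable idFactorization σ A B F F′ e
    (sigma-comp (composition B) (idMiddle A B F)) (sigma-comp (composition B [ σ ]ᶜ) (idMiddle (A [ σ ]ᶠ) (B [ σ ]ᶠ) F′))
  idTotal-stable = over⇒preserves (total-over σ (composition B) (idMiddle (A [ σ ]ᶠ) (B [ σ ]ᶠ) F′) (idMiddle A B F)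
    (IdFibre-substitute σ F F′ e) (idMiddle-over σ A B F F′ e))

idUniform : UniformComposition (idFactorization {ℓ})
idUniform = record
  { middle-comp   = idMiddle
  ; total-comp    = λ A B F → sigma-comp (composition B) (idMiddle A B F)
  ; middle-stable = idMiddle-stable
  ; total-stable  = idTotal-stable
  ; first-stable  = λ σ A B F F′ e → idFirst-stable σ A B F F′ e
  }

partialUniform : UniformComposition (partialFactorization {ℓ})
partialUniform = record
  { middle-comp   = λ A B F → partialMiddle F
  ; total-comp    = λ A B F → sigma-comp (composition B) (partialMiddle F)
  ; middle-stable = partialMiddle-stable
  ; total-stable  = partialTotal-stable
  ; first-stable  = λ σ A B F F′ e → partialFirst-stable σ A B F F′ e
  }

-- Transport along a line in the base, the identity where the line is constant

module Transport {Γ : CubicalSet ℓ} {A : Family Γ} (c : Composition A) where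
  open CubicalSet Γ
  open Family A
  open Restriction A
  open Composition c
  open CompositionRules c

  -- Stated at all later stages, because this is what places a restriction of `a₀` in the fibre over
  -- every point of the line where `φ` holds.
  ConstantOn : Cell (suc I) → Face I → Set ℓ
  ConstantOn {I} γ φ = ∀ {J} (f : suc I ⇒ J) → φ ⟨ weaken ⨟ f ⟩ᶠ ≈ᶠ 1ᶠ → γ · ι₀ · (weaken ⨟ f) ≈ γ · f

  module _ {I : ℕ} (γ : Cell (suc I)) (φ : Face I) (k : ConstantOn γ φ) (a₀ : Elem (γ · ι₀)) where

    opaque
      stationary : Partial A γ (φ ⟨ weaken ⟩ᶠ)
      Partial.at         stationary f p = restrict (weaken ⨟ f) (k f (wk-one⁻ φ p)) a₀
      Partial.compatible stationary {f = f} {g} d = toRestrict (quot∼ (λ i → d (suc i)) res res)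

      stationary∼ : {f : suc I ⇒ J} {p : φ ⟨ weaken ⟩ᶠ ⟨ f ⟩ᶠ ≈ᶠ 1ᶠ} → A ∋ a₀ ∼[ weaken ⨟ f ] Partial.at stationary f p
      stationary∼ = res

      stationary-agrees : AgreesOn φ (stationary at₀) a₀
      stationary-agrees = agrees₀ φ stationary λ f p → stationary∼ {f = ι₀ ⨟ f}

      -- Keeping `a₀` as the system on `φ` forces the result to be `a₀` there. With extent 0 this
      -- would be ordinary transport, about which nothing strict is known.
      transport : Elem (γ · ι₁)
      transport = comp γ φ stationary a₀ stationary-agrees

      transport∼-constant : (f : I ⇒ J) → φ ⟨ f ⟩ᶠ ≈ᶠ 1ᶠ → ∀ {ρ} {x : Elem ρ} → A ∋ a₀ ∼[ f ] x → A ∋ transport ∼[ f ] x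
      transport∼-constant f p q = comp∼-agrees f (wk-one φ p) ∼▸ uniq (stationary∼ {f = ι₁ ⨟ f} {wk-one φ p}) q

  opaque
    unfolding transport

    transport∼ : {γ : Cell (suc I)} {φ : Face I} {k : ConstantOn γ φ} {a₀ : Elem (γ · ι₀)}
                 {γ′ : Cell (suc J)} {φ′ : Face J} {k′ : ConstantOn γ′ φ′} {a₀′ : Elem (γ′ · ι₀)} {f : I ⇒ J} →
                 γ · f ⁺ ≈ γ′ → φ ⟨ f ⟩ᶠ ≈ᶠ φ′ → A ∋ a₀ ∼[ f ] a₀′ →
                 A ∋ transport γ φ k a₀ ∼[ f ] transport γ′ φ′ k′ a₀′
    transport∼ {γ = γ} {φ} {k} {a₀} {γ′} {φ′} {k′} {a₀′} {f} e c a = comp∼-natural e c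
      (λ g p q → uniq (reindex∼ (λ i → ≡⇒≈ᴵ (⟨⟩-⨟ (f i) weaken g)) (stationary∼ γ φ k a₀ {f = f ⁺ ⨟ g} {p}))
        (comp∼ reflʰ a (stationary∼ γ′ φ′ k′ a₀′ {f = g} {q}))) a

-- Fibres of maps of cubical sets

module Fibres {A B : Family (𝟙 {ℓ})} (F : A ⟶ B) where
  private
    module A = Family A
    module B = Family B
    module F = _⟶_ F
  module AR = Restriction A
  module BR = Restriction B

  A′ : Family (𝟙 ▷ B)
  A′ = A [ π B ]

  B″ : Family (𝟙 ▷ B ▷ A′)
  B″ = B [ π B ] [ π A′ ]

  Pᶠ : Family (𝟙 ▷ B ▷ A′)
  Pᶠ = Path B″ (image F) (point F)

  private
    module 𝟙B = CubicalSet (𝟙 ▷ B)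
    module 𝟙BA = CubicalSet (𝟙 ▷ B ▷ A′)

  PathTo : A.Elem {I} tt → B.Elem {I} tt → Set ℓ
  PathTo x b = PathElem B″ (image F) (point F) ((tt , b) , x)

  cellᴮ : {b : B.Elem {I} tt} {b′ : B.Elem {J} tt} {f : I ⇒ J} → B ∋ b ∼[ f ] b′ → (tt , b) 𝟙B.· f 𝟙B.≈ (tt , b′)
  cellᴮ = cell∼ B

  cellᴬ : {b : B.Elem {I} tt} {b′ : B.Elem {J} tt} {x : A.Elem {I} tt} {x′ : A.Elem {J} tt} {f : I ⇒ J} →
          B ∋ b ∼[ f ] b′ → A ∋ x ∼[ f ] x′ → ((tt , b) , x) 𝟙BA.· f 𝟙BA.≈ ((tt , b′) , x′)
  cellᴬ p q = cell∼ A′ {ρ = _ , _} {_ , _} (cellᴮ p , AR.toRestrict q)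

  cellᴮ⁻ : {b : B.Elem {I} tt} {b′ : B.Elem {J} tt} {f : I ⇒ J} → (tt , b) 𝟙B.· f 𝟙B.≈ (tt , b′) → B ∋ b ∼[ f ] b′
  cellᴮ⁻ = cell∼⁻ B

  -- All cells of `𝟙` are equal, so a relation in `B″` carries the same information about elements
  -- as one in `B`. The interface to paths is phrased in `B`, which keeps the iterated contexts out
  -- of the arguments about fibres.
  below² : {γ : 𝟙BA.Cell I} {γ′ : 𝟙BA.Cell J} {f : I ⇒ J} {x : Family.Elem B″ γ} {y : Family.Elem B″ γ′} →
           _∋_∼[_]_ B″ {ρ = γ} {γ′} x f y → B ∋ x ∼[ f ] y
  below² (e , p) = tt , p

  module _ {x : A.Elem {I} tt} {b : B.Elem {I} tt} where

    mkPath : (at : ∀ {J} (f : I ⇒ J) → dM J → B.Elem {J} tt) →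
             (∀ {J K} {f : I ⇒ J} {g : J ⇒ K} {h : I ⇒ K} {r s} → f ⨟ g ≈ʰ h → r ⟨ g ⟩ ≈ᴵ s → B ∋ at f r ∼[ g ] at h s) →
             (∀ {J} (f : I ⇒ J) → B ∋ F.map x ∼[ f ] at f 0ᴵ) → (∀ {J} (f : I ⇒ J) → B ∋ b ∼[ f ] at f 1ᴵ) → PathTo x b
    mkPath at c p q = record
      { at         = at
      ; compatible = λ d e → BR.toRestrict (c d e)
      ; at-0       = λ f → BR.toEq (BR.uniq (p f) (map∼ F AR.res))
      ; at-1       = λ f → BR.toEq (BR.uniq (q f) BR.res)
      }

    along∼ : (p : PathTo x b) {f : I ⇒ J} {g : J ⇒ K} {h : I ⇒ K} {r : dM J} {s : dM K} → f ⨟ g ≈ʰ h → r ⟨ g ⟩ ≈ᴵ s →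
             B ∋ PathElem.at p f r ∼[ g ] PathElem.at p h s
    along∼ p c d = below² {γ = _ , _} (path-at∼ p c d)

    along≅ : (p : PathTo x b) {f h : I ⇒ J} {r s : dM J} → f ≈ʰ h → r ≈ᴵ s →
             B ∋ PathElem.at p f r ≅ PathElem.at p h s
    along≅ p c d = below² {γ = _ , _} (path-at≅ p c d)

    from∼ : (p : PathTo x b) (f : I ⇒ J) {r : dM J} → r ≈ᴵ 0ᴵ → B ∋ F.map x ∼[ f ] PathElem.at p f r
    from∼ p f d = map∼ F AR.res BR.∼▸ (BR.sym≅ (BR.fromEq (PathElem.at-0 p f)) BR.▸ along≅ p reflʰ (sym d))

    to∼ : (p : PathTo x b) (f : I ⇒ J) {r : dM J} → r ≈ᴵ 1ᴵ → B ∋ b ∼[ f ] PathElem.at p f r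
    to∼ p f d = BR.res BR.∼▸ (BR.sym≅ (BR.fromEq (PathElem.at-1 p f)) BR.▸ along≅ p reflʰ (sym d))

  module _ {x : A.Elem {I} tt} {b : B.Elem {I} tt} {x′ : A.Elem {J} tt} {b′ : B.Elem {J} tt}
           {p : PathTo x b} {p′ : PathTo x′ b′} {f : I ⇒ J} where

    pathTo∼ : B ∋ b ∼[ f ] b′ → A ∋ x ∼[ f ] x′ →
              (∀ {K} (g : J ⇒ K) r → B ∋ PathElem.at p (f ⨟ g) r ≅ PathElem.at p′ g r) →
              _∋_∼[_]_ Pᶠ {ρ = (tt , b) , x} {(tt , b′) , x′} p f p′
    pathTo∼ e d h = path∼ {A = B″} {ρ = _ , _} {_ , _} (cellᴬ e d) λ g r →
      𝟙BA.transˣ 𝟙BA.·-id (𝟙BA.·-shift (cellᴬ e d)) , BR.toRestrict (h g r)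

    pathTo∼⁻ : _∋_∼[_]_ Pᶠ {ρ = (tt , b) , x} {(tt , b′) , x′} p f p′ →
               ∀ {K} (g : J ⇒ K) r → B ∋ PathElem.at p (f ⨟ g) r ≅ PathElem.at p′ g r
    pathTo∼⁻ h g r = below² {γ = _ , _} {_ , _} (path∼⁻ {A = B″} {ρ = _ , _} {_ , _} h g r)

    fibre∼ : B ∋ b ∼[ f ] b′ → A ∋ x ∼[ f ] x′ →
             (∀ {K} (g : J ⇒ K) r → B ∋ PathElem.at p (f ⨟ g) r ≅ PathElem.at p′ g r) →
             _∋_∼[_]_ (Fibre F) {ρ = tt , b} {tt , b′} (x , p) f (x′ , p′)
    fibre∼ e d h = pair∼ {A = A′} {B = Pᶠ} (pathTo∼ e d h)

    fibre∼-point : _∋_∼[_]_ (Fibre F) {ρ = tt , b} {tt , b′} (x , p) f (x′ , p′) → A ∋ x ∼[ f ] x′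
    fibre∼-point h = below∼ (π B) A (fst∼ {A = A′} {B = Pᶠ} h)

    fibre∼-path : _∋_∼[_]_ (Fibre F) {ρ = tt , b} {tt , b′} (x , p) f (x′ , p′) →
                  ∀ {K} (g : J ⇒ K) r → B ∋ PathElem.at p (f ⨟ g) r ≅ PathElem.at p′ g r
    fibre∼-path h = pathTo∼⁻ (snd∼ {A = A′} {B = Pᶠ} h)

  fibreComp : Composition A → Composition B → Composition (Fibre F)
  fibreComp c d = sigma-comp (c [ π B ]ᶜ) (path-comp (image F) (point F) (d [ π B ]ᶜ [ π A′ ]ᶜ))

  equivalence⇒extension : Composition A → Composition B → IsEquivalenceᵐ F → Extension (Fibre F)
  equivalence⇒extension c d = contractible⇒extension (fibreComp c d)

  extension⇒equivalence : Extension (Fibre F) → IsEquivalenceᵐ F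
  extension⇒equivalence E = ExtensionRules.extension⇒contractible E

  fibrePartial : {b : B.Elem {I} tt} {φ : Face I}
                 (x : ∀ {J} (h : I ⇒ J) → φ ⟨ h ⟩ᶠ ≈ᶠ 1ᶠ → A.Elem {J} tt)
                 (p : ∀ {J} (h : I ⇒ J) (c : φ ⟨ h ⟩ᶠ ≈ᶠ 1ᶠ) → PathTo (x h c) (B.restrict h tt b)) →
                 (∀ {J K} {h : I ⇒ J} {m : J ⇒ K} {h′ : I ⇒ K} {c c′} → h ⨟ m ≈ʰ h′ →
                   A ∋ x h c ∼[ m ] x h′ c′ ×
                   (∀ {L} (n : K ⇒ L) r → B ∋ PathElem.at (p h c) (m ⨟ n) r ≅ PathElem.at (p h′ c′) n r)) →
                 Partial (Fibre F) (tt , b) φ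
  Partial.at         (fibrePartial x p d) h c = x h c , p h c
  Partial.compatible (fibrePartial {b = b} x p d) {f = h} {m} {h′} {c} {c′} e =
    Restriction.toRestrict (Fibre F) {ρ = tt , B.restrict h tt b} {tt , B.restrict h′ tt b} {m} {e = 𝟙B.·-via {x = tt , b} e}
      (fibre∼ {p = p h c} {p h′ c′} (BR.quot∼ e BR.res BR.res) (proj₁ (d e)) (proj₂ (d e)))

  Mid : Family (𝟙 {ℓ})
  Mid = Sigma B (IdFibre F)

  module _ {b : B.Elem {I} tt} {x : A.Elem {I} tt} {p : IdElem B″ (image F) (point F) ((tt , b) , x)}
           {b′ : B.Elem {J} tt} {x′ : A.Elem {J} tt} {p′ : IdElem B″ (image F) (point F) ((tt , b′) , x′)} {f : I ⇒ J} where
    open IdElem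

    mid∼ : B ∋ b ∼[ f ] b′ → A ∋ x ∼[ f ] x′ →
           (∀ {K} (g : J ⇒ K) r → B ∋ PathElem.at (path p) (f ⨟ g) r ≅ PathElem.at (path p′) g r) →
           extent p ⟨ f ⟩ᶠ ≈ᶠ extent p′ → Mid ∋ (b , x , p) ∼[ f ] (b′ , x′ , p′)
    mid∼ e d h c = pair∼ {A = B} {B = IdFibre F} (pair∼ {A = A′} {B = Id B″ (image F) (point F)}
      (id∼ (image F) (point F) {x = p} {p′} (pathTo∼ {p = path p} {path p′} e d h) c))

    module _ (h : Mid ∋ (b , x , p) ∼[ f ] (b′ , x′ , p′)) where
      private
        h′ : _∋_∼[_]_ (IdFibre F) {ρ = tt , b} {tt , b′} (x , p) f (x′ , p′)
        h′ = snd∼ {A = B} {B = IdFibre F} h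

        h″ : _∋_∼[_]_ (Id B″ (image F) (point F)) {ρ = (tt , b) , x} {(tt , b′) , x′} p f p′
        h″ = snd∼ {A = A′} {B = Id B″ (image F) (point F)} h′

      mid∼-target : B ∋ b ∼[ f ] b′
      mid∼-target = fst∼ {A = B} {B = IdFibre F} h

      mid∼-source : A ∋ x ∼[ f ] x′
      mid∼-source = below∼ (π B) A (fst∼ {A = A′} {B = Id B″ (image F) (point F)} h′)

      mid∼-path : ∀ {K} (g : J ⇒ K) r → B ∋ PathElem.at (path p) (f ⨟ g) r ≅ PathElem.at (path p′) g r
      mid∼-path = pathTo∼⁻ {p = path p} {path p′} (map∼ (forget (image F) (point F)) {x = p} {p′} h″)

      mid∼-extent : extent p ⟨ f ⟩ᶠ ≈ᶠ extent p′
      mid∼-extent = id∼-extent (image F) (point F) {x = p} {p′} h″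

-- Equivalences satisfy 3-for-2

module Slide {X Y Z : Family (𝟙 {ℓ})} (f : X ⟶ Y) (g : Y ⟶ Z) (c : Composition Y) (d : Composition Z) where
  private
    module X = Family X
    module Y = Family Y
    module Z = Family Z
    module f = Fibres f
    module g = Fibres g
    module XR = Restriction X
    module YR = Restriction Y
    module ZR = Restriction Z
    module 𝟙ZY = CubicalSet (𝟙 ▷ Z ▷ g.A′)
    pathComp : Composition g.Pᶠ
    pathComp = path-comp (image g) (point g) (d [ π Z ]ᶜ [ π g.A′ ]ᶜ)
    module T = Transport pathComp
    module PR = Restriction g.Pᶠ
  open PathElem

  -- A path q from g y to z is transported along a path r ending at y, back to
  -- the point r(l); nothing moves on a face φ where r is constant after l.
  module _ {I : ℕ} {x : X.Elem {I} tt} {y : Y.Elem {I} tt} {z : Z.Elem {I} tt} (r : f.PathTo x y) (q : g.PathTo y z)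
           (l : dM I) (φ : Face I)
           (k : ∀ {J} (h : I ⇒ J) → φ ⟨ h ⟩ᶠ ≈ᶠ 1ᶠ → ∀ s → Y ∋ y ∼[ h ] at r h (l ⟨ h ⟩ ∨ s)) where

    -- Composition goes from 0 to 1 while `r` has to be followed backwards, hence the `~`: at `ι₀`
    -- the coordinate is `l ∨ 1`, the end `y` of `r`, and at `ι₁` it is `l`.
    track : Y.Elem {suc I} tt
    track = at r weaken (l ⟨ weaken ⟩ ∨ ~ name zero)

    line : 𝟙ZY.Cell (suc I)
    line = (tt , Z.restrict weaken tt z) , track

    track∼ : {h : suc I ⇒ J} {s : dM J} → l ⟨ weaken ⨟ h ⟩ ∨ ~ h zero ≈ᴵ s → Y ∋ track ∼[ h ] at r (weaken ⨟ h) s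
    track∼ {h = h} e = f.along∼ r reflʰ (trans (∨-cong (≡⇒≈ᴵ (⟨⟩-⨟ l weaken h)) refl) e)

    line-start : ((tt , z) , y) 𝟙ZY.· idʰ 𝟙ZY.≈ line 𝟙ZY.· ι₀
    line-start = g.cellᴬ (ZR.comp∼ reflʰ ZR.res ZR.res)
      (f.to∼ r idʰ (trans (∨-cong refl ~0) (∨1ᴵ (l ⟨ weaken ⨟ ι₀ ⟩))) YR.∼▸ (YR.uniq (track∼ refl) YR.res))

    line-end : line 𝟙ZY.· ι₁ 𝟙ZY.≈ ((tt , z) , at r idʰ l)
    line-end = g.cellᴬ (ZR.quot∼ {f = weaken} {h = idʰ} reflʰ ZR.res ZR.refl≅)
      (track∼ (trans (∨-cong (≡⇒≈ᴵ (⟨⟩-id l)) ~1) (∨-0 l)))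

    line-constant : T.ConstantOn line φ
    line-constant h p = 𝟙ZY.transˣ (𝟙ZY.symˣ (𝟙ZY.·-shift line-start)) (g.cellᴬ
      (ZR.comp∼ reflʰ ZR.res ZR.res)
      (k (weaken ⨟ h) p (~ h zero) YR.∼▸ YR.uniq (track∼ refl) YR.res))

    opaque
      slide : g.PathTo (at r idʰ l) z
      slide = Family.restrict g.Pᶠ idʰ (𝟙ZY.transˣ 𝟙ZY.·-id line-end)
        (T.transport line φ line-constant (Family.restrict g.Pᶠ idʰ line-start q))

      slide-constant : (h : I ⇒ J) → φ ⟨ h ⟩ᶠ ≈ᶠ 1ᶠ → ∀ s → Z ∋ at slide h s ≅ at q h s
      slide-constant h p s = slide≅ (⨟-identityʳ h) ZR.▸ (g.pathTo∼⁻ {p = slide} {restricted} moved idʰ s ZR.▸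
          (ZR.sym≅ (g.pathTo∼⁻ {p = q} {restricted} (PR.res {x = q}) idʰ s) ZR.▸ g.along≅ q (⨟-identityʳ h) refl))
        where
        slide≅ : ∀ {J} {h h′ : I ⇒ J} {s} → h′ ≈ʰ h → Z ∋ at slide h s ≅ at slide h′ s
        slide≅ e = g.along≅ slide (symʰ e) refl

        restricted : Family.Elem g.Pᶠ (((tt , z) , y) 𝟙ZY.· h)
        restricted = Family.restrict g.Pᶠ {ρ = (tt , z) , y} {((tt , z) , y) 𝟙ZY.· h} h 𝟙ZY.reflˣ q

        moved : _∋_∼[_]_ g.Pᶠ {ρ = (tt , z) , at r idʰ l} {((tt , z) , y) 𝟙ZY.· h} slide h restricted
        moved = PR.sym≅ PR.res PR.≅▸ T.transport∼-constant line φ line-constant (Family.restrict g.Pᶠ idʰ line-start q) h p {x = restricted} (PR.quot∼ {x = q} {z = restricted} reflʰ (PR.res {x = q}) (PR.res {x = q}))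

  module _ {x : X.Elem {I} tt} {y : Y.Elem {I} tt} {z : Z.Elem {I} tt} {r : f.PathTo x y} {q : g.PathTo y z}
           {l : dM I} {φ : Face I} {k : ∀ {J} (h : I ⇒ J) → φ ⟨ h ⟩ᶠ ≈ᶠ 1ᶠ → ∀ s → Y ∋ y ∼[ h ] at r h (l ⟨ h ⟩ ∨ s)}
           {x′ : X.Elem {J} tt} {y′ : Y.Elem {J} tt} {z′ : Z.Elem {J} tt} {r′ : f.PathTo x′ y′} {q′ : g.PathTo y′ z′}
           {l′ : dM J} {φ′ : Face J} {k′ : ∀ {K} (h : J ⇒ K) → φ′ ⟨ h ⟩ᶠ ≈ᶠ 1ᶠ → ∀ s → Y ∋ y′ ∼[ h ] at r′ h (l′ ⟨ h ⟩ ∨ s)}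
           {h : I ⇒ J} where

    opaque
      unfolding slide

      slide∼ : Z ∋ z ∼[ h ] z′ → Y ∋ y ∼[ h ] y′ →
               (∀ {K} (m : J ⇒ K) s → Y ∋ at r (h ⨟ m) s ≅ at r′ m s) →
               (∀ {K} (m : J ⇒ K) s → Z ∋ at q (h ⨟ m) s ≅ at q′ m s) →
               l ⟨ h ⟩ ≈ᴵ l′ → φ ⟨ h ⟩ᶠ ≈ᶠ φ′ →
               ∀ {K} (m : J ⇒ K) s → Z ∋ at (slide r q l φ k) (h ⨟ m) s ≅ at (slide r′ q′ l′ φ′ k′) m s
      slide∼ zs ys rs qs ls φs = g.pathTo∼⁻ {p = slide r q l φ k} {slide r′ q′ l′ φ′ k′}
        (PR.sym≅ PR.res PR.≅▸ (T.transport∼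
          (g.cellᴬ (ZR.quot∼ {f = weaken} {h = h ⨟ weaken} reflʰ ZR.res (ZR.comp∼ reflʰ zs ZR.res))
            (track∼ r q l φ k refl YR.∼▸ (f.along≅ r reflʰ (trans (∨-cong (trans (≡⇒≈ᴵ (≡.sym (⟨⟩-⨟ l h weaken))) (⟨⟩-cong ls reflʰ)) refl) refl) YR.▸ rs weaken _)))
          φs
          (PR.quot∼ {f = idʰ} {h} {h} {x = q} reflʰ (PR.res {x = q}) (PR.comp∼ {g = idʰ} {y = q′} (⨟-identityʳ h) (g.pathTo∼ {p = q} {q′} zs ys qs) (PR.res {x = q′}))) PR.∼▸ PR.res))

module _ {A B : Family (𝟙 {ℓ})} (F : A ⟶ B) where
  private
    module F = Fibres F
    module B = Family B
    module BR = Restriction B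

  constantPath : {x : Family.Elem A {I} tt} {b : B.Elem {I} tt} → B ∋ _⟶_.map F x ≅ b → F.PathTo x b
  constantPath {b = b} p = F.mkPath (λ f r → B.restrict f tt b)
    (λ c d → BR.quot∼ c BR.res BR.res) (λ f → p BR.≅▸ BR.res) (λ f → BR.res)

module _ {A A′ B : Family (𝟙 {ℓ})} (F : A ⟶ B) (F′ : A′ ⟶ B) (H : A ⟶ A′) (e : F′ ∘ᵐ H ≈ᵐ F) where
  private
    module F = Fibres F
    module F′ = Fibres F′
    module AR = Restriction A
    module BR = Restriction B

  retarget : {x : Family.Elem A {I} tt} {b : Family.Elem B {I} tt} → F.PathTo x b → F′.PathTo (_⟶_.map H x) b
  retarget p = F′.mkPath (PathElem.at p) (F.along∼ p) (λ f → BR.fromEq (e _) BR.≅▸ F.from∼ p f refl) (λ f → F.to∼ p f refl)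

  fibreMap : Fibre F ⟶ Fibre F′
  _⟶_.map     fibreMap (x , p) = _⟶_.map H x , retarget p
  _⟶_.cong    fibreMap {ρ = _ , b} {x , p} {x′ , p′} m =
    let n = Restriction.fromEq (Fibre F) {x = x , p} {x′ , p′} m in
    Restriction.toEq (Fibre F′) (F′.fibre∼ {p = retarget p} {retarget p′} (F.cellᴮ⁻ {b = b} {b} (CubicalSet.·-id (𝟙 ▷ B)))
      (map∼ H (F.fibre∼-point {p = p} {p′} n)) (F.fibre∼-path {p = p} {p′} n))
  _⟶_.natural fibreMap {ρ = _ , b} {_ , b′} {f} {c} {x , p} =
    Restriction.toRestrict (Fibre F′) {ρ = tt , b} {tt , b′} {f} {e = c} (F′.fibre∼ {p = retarget p} {retarget (proj₂ (Family.restrict (Fibre F) f c (x , p)))} (F.cellᴮ⁻ {b = b} {b′} c)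
      (map∼ H (F.fibre∼-point {p = p} n)) (F.fibre∼-path {p = p} n))
    where n = Restriction.res (Fibre F) {e = c} {x , p}

-- 3-for-2: composites

module Composite {X Y Z : Family (𝟙 {ℓ})} (f : X ⟶ Y) (g : Y ⟶ Z) (k : X ⟶ Z) (e : g ∘ᵐ f ≈ᵐ k)
         (c : Composition Y) (d : Composition Z) where
  private
    module X = Family X
    module Y = Family Y
    module Z = Family Z
    module f = Fibres f
    module g = Fibres g
    module k = Fibres k
    module XR = Restriction X
    module YR = Restriction Y
    module ZR = Restriction Z
    module FfR = Restriction (Fibre f)
  open PathElem
  open Slide f g c d

  module Along (Ef : Extension (Fibre f)) (Eg : Extension (Fibre g)) where
    private
      module Ef = Extension Ef
      module Eg = Extension Eg
      Fk = Fibre k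
      module KR = Restriction Fk

    module _ {I : ℕ} (z : Z.Elem {I} tt) (φ : Face I) (u : Partial Fk (tt , z) φ) where

      opaque
        yq : Family.Elem (Fibre g) (tt , z)
        yq = Eg.ext (tt , z) φ (mapₚ (fibreMap k g f e) u)

        y : Y.Elem {I} tt
        y = proj₁ yq

        q : g.PathTo y z
        q = proj₂ yq

        yq-agrees : (h : I ⇒ J) (p : φ ⟨ h ⟩ᶠ ≈ᶠ 1ᶠ) →
                    Y ∋ y ∼[ h ] _⟶_.map f (proj₁ (Partial.at u h p)) ×
                    (∀ {K} (m : J ⇒ K) s → Z ∋ at q (h ⨟ m) s ≅ at (proj₂ (Partial.at u h p)) m s)
        yq-agrees h p = g.fibre∼-point {p = q} n , g.fibre∼-path {p = q} n
          where
          n : _∋_∼[_]_ (Fibre g) {ρ = tt , z} {tt , Z.restrict h tt z} (y , q) h (_⟶_.map (fibreMap k g f e) (Partial.at u h p))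
          n = Eg.ext-agrees (mapₚ (fibreMap k g f e) u) h p

      -- `y` extends the images under `f` of the given points. So on `φ` it is strictly `f` of the
      -- given point, and a constant path makes that point an element of the fibre over `y`.
      over-y : Partial (Fibre f) (tt , y) φ
      over-y = f.fibrePartial (λ h p → proj₁ (Partial.at u h p))
        (λ h p → constantPath f (YR.uniq (proj₁ (yq-agrees h p)) YR.res))
        (λ {_} {_} {h} {m} {h′} {p} {p′} b →
          k.fibre∼-point {p = proj₂ (Partial.at u h p)} {proj₂ (Partial.at u h′ p′)} (KR.at∼ u b) ,
          (λ m′ r → YR.uniq (YR.comp∼ (λ i → trans (sym (⨟-assoc h m m′ i)) (⟨⟩-cong (b i) reflʰ)) YR.res YR.res) (YR.comp∼ reflʰ YR.res YR.res)))

      opaque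
        xr : Family.Elem (Fibre f) (tt , y)
        xr = Ef.ext (tt , y) φ over-y

        x : X.Elem {I} tt
        x = proj₁ xr

        r : f.PathTo x y
        r = proj₂ xr

        xr-agrees : (h : I ⇒ J) (p : φ ⟨ h ⟩ᶠ ≈ᶠ 1ᶠ) →
                    X ∋ x ∼[ h ] proj₁ (Partial.at u h p) ×
                    (∀ {K} (m : J ⇒ K) s → Y ∋ at r (h ⨟ m) s ≅ Y.restrict m tt (Y.restrict h tt y))
        xr-agrees h p = f.fibre∼-point {p = r} {proj₂ (Partial.at over-y h p)} n , f.fibre∼-path {p = r} {proj₂ (Partial.at over-y h p)} n
          where
          n : _∋_∼[_]_ (Fibre f) {ρ = tt , y} {tt , Y.restrict h tt y} (x , r) h (Partial.at over-y h p)
          n = Ef.ext-agrees over-y h p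

      stays : ∀ {J} (h : I ⇒ J) → φ ⟨ h ⟩ᶠ ≈ᶠ 1ᶠ → ∀ s → Y ∋ y ∼[ h ] at r h (0ᴵ ⟨ h ⟩ ∨ s)
      stays h p s = YR.comp∼ (⨟-identityʳ h) YR.res YR.res YR.∼▸
        (YR.sym≅ (proj₂ (xr-agrees h p) idʰ (0ᴵ ∨ s)) YR.▸ f.along≅ r (⨟-identityʳ h) refl)

      opaque
        -- With `l = 0ᴵ` the path `q` slides back to the very beginning of `r`, the point `f x`, and
        -- so becomes a path from `k x`. On `φ` the path `r` is constant, since it extends constant
        -- paths, and `κ` is still the given path.
        κ : g.PathTo (at r idʰ 0ᴵ) z
        κ = slide r q 0ᴵ φ stays

        κ-agrees : (h : I ⇒ J) (p : φ ⟨ h ⟩ᶠ ≈ᶠ 1ᶠ) → ∀ s → Z ∋ at κ h s ≅ at q h s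
        κ-agrees = slide-constant r q 0ᴵ φ stays

      path-k : k.PathTo x z
      path-k = k.mkPath (at κ) (g.along∼ κ)
        (λ h → ZR.sym≅ (ZR.fromEq (e _)) ZR.≅▸ (map∼ g (f.from∼ r idʰ refl) ZR.≅▸ g.from∼ κ h refl))
        (λ h → g.to∼ κ h refl)

    module _ {z : Z.Elem {I} tt} {φ : Face I} {u : Partial Fk (tt , z) φ}
             {z′ : Z.Elem {J} tt} {φ′ : Face J} {u′ : Partial Fk (tt , z′) φ′} {h : I ⇒ J}
             (zs : Z ∋ z ∼[ h ] z′) (φs : φ ⟨ h ⟩ᶠ ≈ᶠ φ′)
             (us : ∀ {K} (m : J ⇒ K) p p′ → _∋_∼[_]_ Fk {ρ = tt , Z.restrict (h ⨟ m) tt z} {tt , Z.restrict m tt z′}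
                     (Partial.at u (h ⨟ m) p) idʰ (Partial.at u′ m p′)) where

      opaque
        unfolding yq

        yq-natural : Y ∋ y z φ u ∼[ h ] y z′ φ′ u′ ×
                     (∀ {K} (m : J ⇒ K) s → Z ∋ at (q z φ u) (h ⨟ m) s ≅ at (q z′ φ′ u′) m s)
        yq-natural = g.fibre∼-point {p = q z φ u} {q z′ φ′ u′} n , g.fibre∼-path {p = q z φ u} {q z′ φ′ u′} n
          where
          n : _∋_∼[_]_ (Fibre g) {ρ = tt , z} {tt , z′} (yq z φ u) h (yq z′ φ′ u′)
          n = Eg.ext-natural (g.cellᴮ zs) φs (λ m p p′ → map∼ (fibreMap k g f e) (us m p p′))

      opaque
        unfolding xr

        xr-natural : X ∋ x z φ u ∼[ h ] x z′ φ′ u′ ×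
                     (∀ {K} (m : J ⇒ K) s → Y ∋ at (r z φ u) (h ⨟ m) s ≅ at (r z′ φ′ u′) m s)
        xr-natural = f.fibre∼-point {p = r z φ u} {r z′ φ′ u′} n , f.fibre∼-path {p = r z φ u} {r z′ φ′ u′} n
          where
          n : _∋_∼[_]_ (Fibre f) {ρ = tt , y z φ u} {tt , y z′ φ′ u′} (xr z φ u) h (xr z′ φ′ u′)
          n = Ef.ext-natural (f.cellᴮ (proj₁ yq-natural)) φs λ m p p′ →
            f.fibre∼ {p = proj₂ (Partial.at (over-y z φ u) (h ⨟ m) p)} {proj₂ (Partial.at (over-y z′ φ′ u′) m p′)}
              (YR.uniq YR.res (YR.comp∼ reflʰ (proj₁ yq-natural) YR.res))
              (k.fibre∼-point {p = proj₂ (Partial.at u (h ⨟ m) p)} {proj₂ (Partial.at u′ m p′)} (us m p p′))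
              (λ l s → YR.uniq (YR.comp∼ (⨟-assoc h m l) YR.res YR.res)
                (YR.comp∼ reflʰ (proj₁ yq-natural) (YR.comp∼ reflʰ YR.res YR.res)))

      opaque
        unfolding κ

        κ-natural : ∀ {K} (m : J ⇒ K) s → Z ∋ at (κ z φ u) (h ⨟ m) s ≅ at (κ z′ φ′ u′) m s
        κ-natural = slide∼ zs (proj₁ yq-natural) (proj₂ xr-natural) (proj₂ yq-natural) refl φs

    composite-extension : Extension Fk
    Extension.ext composite-extension (_ , z) φ u = x z φ u , path-k z φ u
    Extension.ext-agrees composite-extension {ρ = _ , z} {φ} u h p =
      k.fibre∼ {p = path-k z φ u} {proj₂ (Partial.at u h p)} ZR.res (proj₁ (xr-agrees z φ u h p))
        (λ m s → κ-agrees z φ u (h ⨟ m) (restrict-one φ p) s ZR.▸ proj₂ (yq-agrees z φ u h p) m s)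
    Extension.ext-natural composite-extension {ρ = _ , z} {φ} {u} {_ , z′} {φ′} {u′} c φs us =
      k.fibre∼ {p = path-k z φ u} {path-k z′ φ′ u′} (k.cellᴮ⁻ {b = z} {z′} c)
        (proj₁ (xr-natural {u = u} {u′ = u′} zs φs us)) (κ-natural {u = u} {u′ = u′} zs φs us)
      where zs = k.cellᴮ⁻ {b = z} {z′} c

-- 3-for-2: the first of two factors

module LeftFactor {X Y Z : Family (𝟙 {ℓ})} (f : X ⟶ Y) (g : Y ⟶ Z) (k : X ⟶ Z) (e : g ∘ᵐ f ≈ᵐ k)
         (Eg : Extension (Fibre g)) (Ek : Extension (Fibre k)) where
  private
    module X = Family X
    module Y = Family Y
    module Z = Family Z
    module f = Fibres f
    module g = Fibres g
    module k = Fibres k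
    module XR = Restriction X
    module YR = Restriction Y
    module ZR = Restriction Z
    module Eg = Extension Eg
    module Ek = Extension Ek
    Ff = Fibre f
    Fg = Fibre g
    Fk = Fibre k
    module FfR = Restriction Ff
    module FgR = Restriction Fg
    ∣g∣ : ∀ {I} → Y.Elem {I} tt → Z.Elem {I} tt
    ∣g∣ = _⟶_.map g
  open PathElem

  g-path : {x : X.Elem {I} tt} {y : Y.Elem {I} tt} {z : Z.Elem {I} tt} → f.PathTo x y → Z ∋ ∣g∣ y ≅ z → k.PathTo x z
  g-path p d = k.mkPath (λ m s → ∣g∣ (at p m s)) (λ c d → map∼ g (f.along∼ p c d))
    (λ m → ZR.sym≅ (ZR.fromEq (e _)) ZR.≅▸ map∼ g (f.from∼ p m refl))
    (λ m → ZR.sym≅ d ZR.≅▸ map∼ g (f.to∼ p m refl))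

  -- The part of a path p that remains after r, as an element of the fibre of g.
  tail : {x : X.Elem {I} tt} {y : Y.Elem {I} tt} {z : Z.Elem {I} tt} (p : f.PathTo x y) (r : dM I) → Z ∋ ∣g∣ y ≅ z →
         g.PathTo (at p idʰ r) z
  tail p r d = g.mkPath (λ m s → ∣g∣ (at p m (r ⟨ m ⟩ ∨ s)))
    (λ {_} {_} {h} {m} {h′} c s≈ → map∼ g (f.along∼ p c (∨-cong
      (trans (≡⇒≈ᴵ (⟨⟩-⨟ r h m)) (⟨⟩-cong (refl {r = r}) c)) s≈)))
    (λ m → map∼ g (f.along∼ p reflʰ (sym (∨-0 _))))
    (λ m → ZR.sym≅ d ZR.≅▸ map∼ g (f.to∼ p m (∨1ᴵ _)))

  tail∼ : {x : X.Elem {I} tt} {y : Y.Elem {I} tt} {z : Z.Elem {I} tt} {p : f.PathTo x y} {r : dM I} {d : Z ∋ ∣g∣ y ≅ z}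
          {x′ : X.Elem {J} tt} {y′ : Y.Elem {J} tt} {z′ : Z.Elem {J} tt} {p′ : f.PathTo x′ y′} {r′ : dM J}
          {d′ : Z ∋ ∣g∣ y′ ≅ z′} {m : I ⇒ J} →
          (∀ {K} (n : J ⇒ K) s → Y ∋ at p (m ⨟ n) s ≅ at p′ n s) → r ⟨ m ⟩ ≈ᴵ r′ →
          Y ∋ at p idʰ r ∼[ m ] at p′ idʰ r′ ×
          (∀ {K} (n : J ⇒ K) s → Z ∋ at (tail p r d) (m ⨟ n) s ≅ at (tail p′ r′ d′) n s)
  tail∼ {p = p} {r} {p′ = p′} {r′} {m = m} ps rs =
    (f.along∼ p {h = m ⨟ idʰ} (symʰ (⨟-identityʳ m)) rs YR.∼▸ ps idʰ r′) ,
    λ n s → map∼ g (f.along≅ p reflʰ (∨-cong (trans (≡⇒≈ᴵ (≡.sym (⟨⟩-⨟ r m n))) (⟨⟩-cong rs (reflʰ {f = n}))) refl) YR.▸ ps n _)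

  module _ {I : ℕ} (y : Y.Elem {I} tt) (φ : Face I) (u : Partial Ff (tt , y) φ) where

    private
      uˣ : ∀ {J} (h : I ⇒ J) → φ ⟨ h ⟩ᶠ ≈ᶠ 1ᶠ → X.Elem {J} tt
      uˣ h p = proj₁ (Partial.at u h p)

      uᵖ : ∀ {J} (h : I ⇒ J) (p : φ ⟨ h ⟩ᶠ ≈ᶠ 1ᶠ) → f.PathTo (uˣ h p) (Y.restrict h tt y)
      uᵖ h p = proj₂ (Partial.at u h p)

      u∼ : {h : I ⇒ J} {m : J ⇒ K} {h′ : I ⇒ K} {p : φ ⟨ h ⟩ᶠ ≈ᶠ 1ᶠ} {p′ : φ ⟨ h′ ⟩ᶠ ≈ᶠ 1ᶠ} → h ⨟ m ≈ʰ h′ →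
           X ∋ uˣ h p ∼[ m ] uˣ h′ p′ × (∀ {L} (n : K ⇒ L) s → Y ∋ at (uᵖ h p) (m ⨟ n) s ≅ at (uᵖ h′ p′) n s)
      u∼ {h = h} {m} {h′} {p} {p′} c = f.fibre∼-point {p = uᵖ h p} {uᵖ h′ p′} n , f.fibre∼-path {p = uᵖ h p} {uᵖ h′ p′} n
        where
        n : _∋_∼[_]_ Ff {ρ = tt , Y.restrict h tt y} {tt , Y.restrict h′ tt y} (Partial.at u h p) m (Partial.at u h′ p′)
        n = FfR.at∼ u c

      gy : ∀ {J} (h : I ⇒ J) → Z ∋ ∣g∣ (Y.restrict h tt y) ≅ Z.restrict h tt (∣g∣ y)
      gy h = ZR.uniq (map∼ g YR.res) ZR.res

    over-gy : Partial Fk (tt , ∣g∣ y) φ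
    over-gy = k.fibrePartial uˣ (λ h p → g-path (uᵖ h p) (gy h))
      (λ c → proj₁ (u∼ c) , λ n s → map∼ g (proj₂ (u∼ c) n s))

    opaque
      xq : Family.Elem Fk (tt , ∣g∣ y)
      xq = Ek.ext (tt , ∣g∣ y) φ over-gy

      x : X.Elem {I} tt
      x = proj₁ xq

      q : k.PathTo x (∣g∣ y)
      q = proj₂ xq

      xq-agrees : (h : I ⇒ J) (p : φ ⟨ h ⟩ᶠ ≈ᶠ 1ᶠ) →
                  X ∋ x ∼[ h ] uˣ h p × (∀ {K} (m : J ⇒ K) s → Z ∋ at q (h ⨟ m) s ≅ ∣g∣ (at (uᵖ h p) m s))
      xq-agrees h p = k.fibre∼-point {p = q} {proj₂ (Partial.at over-gy h p)} n , k.fibre∼-path {p = q} {proj₂ (Partial.at over-gy h p)} n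
        where
        n : _∋_∼[_]_ Fk {ρ = tt , ∣g∣ y} {tt , Z.restrict h tt (∣g∣ y)} (x , q) h (Partial.at over-gy h p)
        n = Ek.ext-agrees over-gy h p

    -- Two points of the fibre of `g` over `g y`, one found through the fibre of `k`, the other
    -- trivial. What is missing is a path from `f x` to `y`; it is the projection of a path from
    -- `e₀` to `e₁`, and in the fibre of `g` such paths can be had by extension.
    e₀ e₁ : Family.Elem Fg (tt , ∣g∣ y)
    e₀ = _⟶_.map f x , retarget k g f e q
    e₁ = y , constantPath g ZR.refl≅

    module _ {J : ℕ} (h : I ⇒ J) (r : dM J) where

      base : CubicalSet.Cell (𝟙 ▷ Z) J
      base = tt , Z.restrict h tt (∣g∣ y)

      E₀ E₁ : Family.Elem Fg base
      E₀ = Family.restrict Fg {ρ = tt , ∣g∣ y} {base} h (CubicalSet.reflˣ (𝟙 ▷ Z) {x = base}) e₀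
      E₁ = Family.restrict Fg {ρ = tt , ∣g∣ y} {base} h (CubicalSet.reflˣ (𝟙 ▷ Z) {x = base}) e₁

      one : ∀ {K} {m : J ⇒ K} → φ ⟨ h ⟩ᶠ ⟨ m ⟩ᶠ ≈ᶠ 1ᶠ → φ ⟨ h ⨟ m ⟩ᶠ ≈ᶠ 1ᶠ
      one = one-shift⁻ φ refl

      gyʰ : ∀ {K} (m : J ⇒ K) → Z ∋ ∣g∣ (Y.restrict (h ⨟ m) tt y) ≅ Z.restrict m tt (Z.restrict h tt (∣g∣ y))
      gyʰ m = gy (h ⨟ m) ZR.▸ ZR.uniq ZR.res (ZR.comp∼ reflʰ ZR.res ZR.res)

      -- On `φ` the path from `e₀` to `e₁` must project to the given path `p`. So its point at `r`
      -- is `p(r)`, joined to `g y` by the rest of `g p` after `r`: all of `g p` at `r = 0`, as in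
      -- `e₀`, and a constant path at `r = 1`, as in `e₁`.
      tails : Partial Fg base (φ ⟨ h ⟩ᶠ)
      tails = g.fibrePartial (λ m p → at (uᵖ (h ⨟ m) (one p)) idʰ (r ⟨ m ⟩))
        (λ m p → tail (uᵖ (h ⨟ m) (one p)) (r ⟨ m ⟩) (gyʰ m))
        (λ {_} {_} {m} {n} {m′} {p} {p′} c → tail∼ {p = uᵖ (h ⨟ m) (one p)} {r ⟨ m ⟩} {gyʰ m} {p′ = uᵖ (h ⨟ m′) (one p′)} {r ⟨ m′ ⟩} {gyʰ m′}
          (proj₂ (u∼ (λ i → trans (⨟-assoc h m n i) (⟨⟩-cong (refl {r = h i}) c))))
          (trans (≡⇒≈ᴵ (⟨⟩-⨟ r m n)) (⟨⟩-cong (refl {r = r}) c)))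

      ends : Partial Fg base (∂ r)
      ends = endsₚ r E₀ E₁

      private
        relate : ∀ {K} {a : Y.Elem {I} tt} {a′ : Y.Elem {K} tt} {p : g.PathTo a (∣g∣ y)} (m : J ⇒ K)
                 {p′ : g.PathTo a′ (Z.restrict m tt (Z.restrict h tt (∣g∣ y)))} →
                 Y ∋ a ∼[ h ⨟ m ] a′ → (∀ {L} (n : K ⇒ L) s → Z ∋ at p (h ⨟ m ⨟ n) s ≅ at p′ n s) →
                 _∋_∼[_]_ Fg {ρ = tt , ∣g∣ y} {tt , Z.restrict m tt (Z.restrict h tt (∣g∣ y))} (a , p) (h ⨟ m) (a′ , p′)
        relate {p = p} m {p′} = g.fibre∼ {p = p} {p′} (ZR.comp∼ reflʰ ZR.res ZR.res)

        E₀∼ : _∋_∼[_]_ Fg {ρ = tt , ∣g∣ y} {base} e₀ h E₀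
        E₀∼ = FgR.res {ρ = tt , ∣g∣ y} {base} {x = e₀}

        E₁∼ : _∋_∼[_]_ Fg {ρ = tt , ∣g∣ y} {base} e₁ h E₁
        E₁∼ = FgR.res {ρ = tt , ∣g∣ y} {base} {x = e₁}

      opaque
        tails-ends : ∀ {K} (m : J ⇒ K) p p′ → Family._≋_ Fg (Partial.at tails m p) (Partial.at ends m p′)
        tails-ends {K} m p p′ = case ∂-cases r {m} p′ of λ
          { (inj₁ d) → FgR.toEq (FgR.uniq
              (relate {p = proj₂ e₀} m {proj₂ (Partial.at tails m p)}
                (map∼ f (proj₁ (xq-agrees (h ⨟ m) (one p))) YR.∼▸ f.from∼ (uᵖ (h ⨟ m) (one p)) idʰ d)
                (λ n s → proj₂ (xq-agrees (h ⨟ m) (one p)) n s ZR.▸ map∼ g (f.along≅ (uᵖ (h ⨟ m) (one p)) reflʰ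
                  (sym (trans (∨-cong (⟨⟩-cong d (reflʰ {f = n})) refl) (0∨ᴵ s))))))
              (FgR.comp∼ reflʰ E₀∼ (endsₚ-0 r E₀ E₁ d)))
          ; (inj₂ d) → FgR.toEq (FgR.uniq
              (relate {p = proj₂ e₁} m {proj₂ (Partial.at tails m p)}
                (YR.res YR.∼▸ f.to∼ (uᵖ (h ⨟ m) (one p)) idʰ d)
                (λ n s → ZR.uniq ZR.res (map∼ g (YR.comp∼ reflʰ YR.res (f.to∼ (uᵖ (h ⨟ m) (one p)) n
                  (trans (∨-cong (⟨⟩-cong d (reflʰ {f = n})) refl) (1∨ᴵ s)))))))
              (FgR.comp∼ reflʰ E₁∼ (endsₚ-1 r E₀ E₁ d))) }

      system : Partial Fg base (φ ⟨ h ⟩ᶠ ∨ ∂ r)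
      system = join tails ends tails-ends

      opaque
        midpoint : Family.Elem Fg base
        midpoint = Eg.ext base (φ ⟨ h ⟩ᶠ ∨ ∂ r) system

        midpoint-0 : r ≈ᴵ 0ᴵ → Y ∋ _⟶_.map f x ∼[ h ] proj₁ midpoint
        midpoint-0 d = g.fibre∼-point {p = proj₂ e₀} {proj₂ midpoint} (E₀∼ FgR.∼▸ FgR.sym≅ (
          Eg.ext-agrees system idʰ (∨-oneʳ (∨-oneˡ (=0-at⁻ r d′))) FgR.▸
          (FgR.fromEq (join-at₂ tails ends tails-ends idʰ _ (∨-oneˡ (=0-at⁻ r d′))) FgR.▸ FgR.sym≅ (endsₚ-0 r E₀ E₁ d′))))
          where
          d′ : r ⟨ idʰ ⟩ ≈ᴵ 0ᴵ
          d′ = trans (≡⇒≈ᴵ (⟨⟩-id r)) d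

        midpoint-1 : r ≈ᴵ 1ᴵ → Y ∋ y ∼[ h ] proj₁ midpoint
        midpoint-1 d = g.fibre∼-point {p = proj₂ e₁} {proj₂ midpoint} (E₁∼ FgR.∼▸ FgR.sym≅ (
          Eg.ext-agrees system idʰ (∨-oneʳ (∨-oneʳ (=1-at⁻ r d′))) FgR.▸
          (FgR.fromEq (join-at₂ tails ends tails-ends idʰ _ (∨-oneʳ (=1-at⁻ r d′))) FgR.▸ FgR.sym≅ (endsₚ-1 r E₀ E₁ d′))))
          where
          d′ : r ⟨ idʰ ⟩ ≈ᴵ 1ᴵ
          d′ = trans (≡⇒≈ᴵ (⟨⟩-id r)) d

        midpoint-φ : (p : φ ⟨ h ⟩ᶠ ≈ᶠ 1ᶠ) → Y ∋ proj₁ midpoint ≅ at (uᵖ h p) idʰ r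
        midpoint-φ p = g.fibre∼-point {p = proj₂ midpoint} {proj₂ (Partial.at tails idʰ p′)}
          (Eg.ext-agrees system idʰ (∨-oneˡ p′) FgR.▸ FgR.fromEq (join-at₁ tails ends tails-ends idʰ _ p′))
          YR.▸ YR.sym≅ (f.along≅ (uᵖ h p) {h = idʰ ⨟ idʰ} reflʰ (sym (≡⇒≈ᴵ (⟨⟩-id r))) YR.▸
            proj₂ (u∼ {h = h} {idʰ} {p = p} {one p′} reflʰ) idʰ _)
          where
          p′ : φ ⟨ h ⟩ᶠ ⟨ idʰ ⟩ᶠ ≈ᶠ 1ᶠ
          p′ = trans (⟨⟩ᶠ-id _) p

  module _ {y : Y.Elem {I} tt} {φ : Face I} {u : Partial Ff (tt , y) φ}
           {y′ : Y.Elem {J} tt} {φ′ : Face J} {u′ : Partial Ff (tt , y′) φ′} {h₀ : I ⇒ J}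
           (ys : Y ∋ y ∼[ h₀ ] y′) (φs : φ ⟨ h₀ ⟩ᶠ ≈ᶠ φ′)
           (us : ∀ {K} (m : J ⇒ K) p p′ → _∋_∼[_]_ Ff {ρ = tt , Y.restrict (h₀ ⨟ m) tt y} {tt , Y.restrict m tt y′}
                   (Partial.at u (h₀ ⨟ m) p) idʰ (Partial.at u′ m p′)) where

    private
      us′ : ∀ {K} (m : J ⇒ K) {h : I ⇒ K} (c : h ≈ʰ h₀ ⨟ m) p p′ → X ∋ proj₁ (Partial.at u h p) ≅ proj₁ (Partial.at u′ m p′) ×
           (∀ {L} (n : K ⇒ L) s → Y ∋ at (proj₂ (Partial.at u h p)) n s ≅ at (proj₂ (Partial.at u′ m p′)) n s)
      us′ m {h} c p p′ = f.fibre∼-point {p = proj₂ (Partial.at u h p)} {proj₂ (Partial.at u′ m p′)} n ,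
        f.fibre∼-path {p = proj₂ (Partial.at u h p)} {proj₂ (Partial.at u′ m p′)} n
        where
        n : _∋_∼[_]_ Ff {ρ = tt , Y.restrict h tt y} {tt , Y.restrict m tt y′} (Partial.at u h p) idʰ (Partial.at u′ m p′)
        n = FfR._▸_ {ρ′ = tt , Y.restrict (h₀ ⨟ m) tt y} (FfR.at≅ u {q = respect-one φ c p} c) (us m (respect-one φ c p) p′)

    opaque
      unfolding xq

      xq-natural : X ∋ x y φ u ∼[ h₀ ] x y′ φ′ u′ × (∀ {K} (m : J ⇒ K) s → Z ∋ at (q y φ u) (h₀ ⨟ m) s ≅ at (q y′ φ′ u′) m s)
      xq-natural = k.fibre∼-point {p = q y φ u} {q y′ φ′ u′} n , k.fibre∼-path {p = q y φ u} {q y′ φ′ u′} n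
        where
        n : _∋_∼[_]_ Fk {ρ = tt , ∣g∣ y} {tt , ∣g∣ y′} (xq y φ u) h₀ (xq y′ φ′ u′)
        n = Ek.ext-natural (k.cellᴮ (map∼ g ys)) φs λ m p p′ →
          k.fibre∼ {p = proj₂ (Partial.at (over-gy y φ u) (h₀ ⨟ m) p)} {proj₂ (Partial.at (over-gy y′ φ′ u′) m p′)}
            (ZR.uniq ZR.res (ZR.comp∼ reflʰ (map∼ g ys) ZR.res))
            (proj₁ (us′ m (λ i → refl) p p′)) (λ n s → map∼ g (proj₂ (us′ m (λ i → refl) p p′) n s))

    opaque
      unfolding midpoint

      -- The stage `h₀` of the data and the stage `m` of a single value vary independently: with
      -- `h₀` the identity this is compatibility of the path, with `m` the identity naturality of
      -- the extension.
      midpoint∼ : {h : I ⇒ K} {h′ : J ⇒ L} {m : K ⇒ L} {r : dM K} {r′ : dM L} → h ⨟ m ≈ʰ h₀ ⨟ h′ → r ⟨ m ⟩ ≈ᴵ r′ →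
                  Y ∋ proj₁ (midpoint y φ u h r) ∼[ m ] proj₁ (midpoint y′ φ′ u′ h′ r′)
      midpoint∼ {h = h} {h′} {m} {r} {r′} c d = g.fibre∼-point {p = proj₂ (midpoint y φ u h r)} {proj₂ (midpoint y′ φ′ u′ h′ r′)}
        (Eg.ext-natural {u = system y φ u h r} {u′ = system y′ φ′ u′ h′ r′} (g.cellᴮ zs) φs′
          (join∼ {a = tails-ends y φ u h r} {a′ = tails-ends y′ φ′ u′ h′ r′} φs″ (∂-cong {r = r} {f = m} d)
            (λ n p p′ →
              let c′ = λ i → trans (sym (⨟-assoc h m n i)) (trans (⟨⟩-cong (c i) (reflʰ {f = n})) (⨟-assoc h₀ h′ n i))
                  t = tail∼ {p = proj₂ (Partial.at u (h ⨟ (m ⨟ n)) (one-shift⁻ φ refl p))} {r ⟨ m ⨟ n ⟩} {gyʰ y φ u h r (m ⨟ n)}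
                        {p′ = proj₂ (Partial.at u′ (h′ ⨟ n) (one-shift⁻ φ′ refl p′))} {r′ ⟨ n ⟩} {gyʰ y′ φ′ u′ h′ r′ n} {m = idʰ} (proj₂ (us′ (h′ ⨟ n) c′ (one-shift⁻ φ refl p) (one-shift⁻ φ′ refl p′)))
                        (trans (≡⇒≈ᴵ (⟨⟩-id _)) (trans (≡⇒≈ᴵ (≡.sym (⟨⟩-⨟ r m n))) (⟨⟩-cong d (reflʰ {f = n}))))
              in g.fibre∼ {p = proj₂ (Partial.at (tails y φ u h r) (m ⨟ n) p)} {proj₂ (Partial.at (tails y′ φ′ u′ h′ r′) n p′)}
                (ZR.uniq ZR.res (ZR.comp∼ reflʰ zs ZR.res)) (proj₁ t) (proj₂ t))
            (endsₚ∼ d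
              (FgR.quot∼ c (FgR.res {ρ = tt , ∣g∣ y} {base y φ u h r} {x = e₀ y φ u}) (FgR.comp∼ reflʰ
                (g.fibre∼ {p = proj₂ (e₀ y φ u)} {proj₂ (e₀ y′ φ′ u′)} (map∼ g ys) (map∼ f (proj₁ xq-natural)) (proj₂ xq-natural))
                (FgR.res {ρ = tt , ∣g∣ y′} {base y′ φ′ u′ h′ r′} {x = e₀ y′ φ′ u′})))
              (FgR.quot∼ c (FgR.res {ρ = tt , ∣g∣ y} {base y φ u h r} {x = e₁ y φ u}) (FgR.comp∼ reflʰ
                (g.fibre∼ {p = proj₂ (e₁ y φ u)} {proj₂ (e₁ y′ φ′ u′)} (map∼ g ys) ys (λ n s → ZR.uniq ZR.res (ZR.comp∼ reflʰ (map∼ g ys) ZR.res)))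
                (FgR.res {ρ = tt , ∣g∣ y′} {base y′ φ′ u′ h′ r′} {x = e₁ y′ φ′ u′}))))))
        where
        zs : Z ∋ Z.restrict h tt (∣g∣ y) ∼[ m ] Z.restrict h′ tt (∣g∣ y′)
        zs = ZR.quot∼ c ZR.res (ZR.comp∼ reflʰ (map∼ g ys) ZR.res)
        φs″ : φ ⟨ h ⟩ᶠ ⟨ m ⟩ᶠ ≈ᶠ φ′ ⟨ h′ ⟩ᶠ
        φs″ = trans (⟨⟩ᶠ-⨟ φ h m) (trans (⟨⟩ᶠ-cong (refl {φ = φ}) c)
          (trans (sym (⟨⟩ᶠ-⨟ φ h₀ h′)) (⟨⟩ᶠ-cong φs (reflʰ {f = h′}))))
        φs′ : (φ ⟨ h ⟩ᶠ ∨ ∂ r) ⟨ m ⟩ᶠ ≈ᶠ φ′ ⟨ h′ ⟩ᶠ ∨ ∂ r′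
        φs′ = ∨-cong φs″ (∂-cong {r = r} {f = m} d)

  leftFactor-extension : Extension Ff
  Extension.ext leftFactor-extension (_ , y) φ u = x y φ u , f.mkPath (λ h r → proj₁ (midpoint y φ u h r))
    (λ c d → midpoint∼ {u = u} {u′ = u} YR.refl≅ (⟨⟩ᶠ-id φ) (λ m p p′ → FfR.at≅ u reflʰ) c d)
    (λ h → midpoint-0 y φ u h 0ᴵ refl) (λ h → midpoint-1 y φ u h 1ᴵ refl)
  Extension.ext-agrees leftFactor-extension {ρ = _ , y} {φ} u h p =
    f.fibre∼ {p = proj₂ (Extension.ext leftFactor-extension (tt , y) φ u)} {proj₂ (Partial.at u h p)} YR.res (proj₁ (xq-agrees y φ u h p))
      (λ m s → midpoint-φ y φ u (h ⨟ m) s (restrict-one φ p) YR.▸ (YR.sym≅ (f.fibre∼-path {p = proj₂ (Partial.at u h p)}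
        {proj₂ (Partial.at u (h ⨟ m) (restrict-one φ p))} (FfR.at∼ u reflʰ) idʰ s) YR.▸
        f.along≅ (proj₂ (Partial.at u h p)) (⨟-identityʳ m) refl))
  Extension.ext-natural leftFactor-extension {ρ = _ , y} {φ} {u} {_ , y′} {φ′} {u′} c φs us =
    f.fibre∼ {p = proj₂ (Extension.ext leftFactor-extension (tt , y) φ u)} {proj₂ (Extension.ext leftFactor-extension (tt , y′) φ′ u′)}
      ys (proj₁ (xq-natural {u = u} {u′ = u′} ys φs us))
      (λ m s → midpoint∼ {u = u} {u′ = u′} ys φs us (⨟-identityʳ _) (≡⇒≈ᴵ (⟨⟩-id s)))
    where ys = f.cellᴮ⁻ {b = y} {y′} c

-- 3-for-2: the second of two factors

module RightFactor {X Y Z : Family (𝟙 {ℓ})} (f : X ⟶ Y) (g : Y ⟶ Z) (k : X ⟶ Z) (e : g ∘ᵐ f ≈ᵐ k)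
         (c : Composition Y) (d : Composition Z) (Ef : Extension (Fibre f)) (Ek : Extension (Fibre k)) where
  private
    module X = Family X
    module Y = Family Y
    module Z = Family Z
    module f = Fibres f
    module g = Fibres g
    module k = Fibres k
    module XR = Restriction X
    module YR = Restriction Y
    module ZR = Restriction Z
    module Ek = Extension Ek
    Ff = Fibre f
    Fg = Fibre g
    Fk = Fibre k
    module FgR = Restriction Fg
    center = ExtensionRules.extension-center Ef
    module 𝟙Z = CubicalSet (𝟙 ▷ Z)
    module 𝟙ZF = CubicalSet (𝟙 ▷ Z ▷ Fg)
  open PathElem
  open Slide f g c d

  preimageOf : Y.Elem {I} tt → X.Elem {I} tt
  preimageOf y = proj₁ (Section.sec center (tt , y))

  pathOf : (y : Y.Elem {I} tt) → f.PathTo (preimageOf y) y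
  pathOf y = proj₂ (Section.sec center (tt , y))

  center∼ : {y : Y.Elem {I} tt} {y′ : Y.Elem {J} tt} {h : I ⇒ J} → Y ∋ y ∼[ h ] y′ →
            X ∋ preimageOf y ∼[ h ] preimageOf y′ × (∀ {K} (m : J ⇒ K) s → Y ∋ at (pathOf y) (h ⨟ m) s ≅ at (pathOf y′) m s)
  center∼ {y = y} {y′} {h} p = f.fibre∼-point {p = pathOf y} {pathOf y′} n , f.fibre∼-path {p = pathOf y} {pathOf y′} n
    where
    n : _∋_∼[_]_ Ff {ρ = tt , y} {tt , y′} (Section.sec center (tt , y)) h (Section.sec center (tt , y′))
    n = Restriction.sec∼ Ff center (f.cellᴮ p)

  module _ {z : Z.Elem {I} tt} {y : Y.Elem {I} tt} (q : g.PathTo y z) (l : dM I) where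

    stays : ∀ {J} (h : I ⇒ J) → (l =1ᶠ) ⟨ h ⟩ᶠ ≈ᶠ 1ᶠ → ∀ s → Y ∋ y ∼[ h ] at (pathOf y) h (l ⟨ h ⟩ ∨ s)
    stays h p s = f.to∼ (pathOf y) h (trans (∨-cong (=1-at l p) refl) (1∨ᴵ s))

    -- The face on which nothing moves is `l =1ᶠ`, where `pathOf y` has reached `y`. This is why the
    -- homotopy ends strictly at the identity.
    slid : g.PathTo (at (pathOf y) idʰ l) z
    slid = slide (pathOf y) q l (l =1ᶠ) stays

  -- A point of the fibre of g moves, along the chosen path to it, from a point in the image of f.
  drag : {z : Z.Elem {I} tt} → Family.Elem Fg (tt , z) → dM I → Family.Elem Fg (tt , z)
  drag (y , q) l = at (pathOf y) idʰ l , slid q l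

  drag∼ : {z : Z.Elem {I} tt} {z′ : Z.Elem {J} tt} {v : Family.Elem Fg (tt , z)} {v′ : Family.Elem Fg (tt , z′)}
          {l : dM I} {l′ : dM J} {h : I ⇒ J} →
          _∋_∼[_]_ Fg {ρ = tt , z} {tt , z′} v h v′ → l ⟨ h ⟩ ≈ᴵ l′ → Z ∋ z ∼[ h ] z′ →
          _∋_∼[_]_ Fg {ρ = tt , z} {tt , z′} (drag v l) h (drag v′ l′)
  drag∼ {v = y , q} {y′ , q′} {l} {l′} {h} p ls zs = g.fibre∼ {p = slid q l} {slid q′ l′} zs
    (f.along∼ (pathOf y) {h = h ⨟ idʰ} (symʰ (⨟-identityʳ h)) ls YR.∼▸ proj₂ (center∼ ys) idʰ l′)
    (slide∼ zs ys (proj₂ (center∼ ys)) (g.fibre∼-path {p = q} {q′} p) ls (trans (=1ᶠ-⟨⟩ l h) (=1-cong ls)))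
    where ys = g.fibre∼-point {p = q} {q′} p

  drag-1 : {z : Z.Elem {I} tt} (v : Family.Elem Fg (tt , z)) → _∋_∼[_]_ Fg {ρ = tt , z} {tt , z} (drag v 1ᴵ) idʰ v
  drag-1 (y , q) = g.fibre∼ {p = slid q 1ᴵ} {q} ZR.refl≅
    (YR.sym≅ (f.to∼ (pathOf y) idʰ refl))
    (λ h s → slide-constant (pathOf y) q 1ᴵ (1ᴵ =1ᶠ) (stays q 1ᴵ) h refl s)

  dragged : Section (Fg [ π Fg ])
  Section.sec     dragged (_ , v) = drag v 0ᴵ
  Section.natural dragged {ρ = (_ , z) , v} {(_ , z′) , v′} {f = h} {p} =
    FgR.toRestrict {ρ = tt , z} {tt , z′} {h} {CubicalMap.natural′ (π Fg) {δ = (tt , z) , v} {(tt , z′) , v′} p} (drag∼ {v = v} {v′} (cell∼⁻ Fg p) refl (g.cellᴮ⁻ {b = z} {z′} (proj₁ p)))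

  homotopy : Section (Path (Fg [ π Fg ]) dragged (var Fg))
  homotopy = makeHomotopy dragged drag
    (λ { {ρ = _ , z} {_ , z′} {v} {v′} p s → drag∼ {v = v} {v′} p s (g.cellᴮ⁻ {b = z} {z′} (FgR.base p)) })
    (λ { {ρ = _ , z} v → Family.reflᵃ Fg {ρ = tt , z} {drag v 0ᴵ} })
    (λ { {ρ = _ , z} v → FgR.toEq {ρ = tt , z} {drag v 1ᴵ} {v} (drag-1 v) })

  module _ {I : ℕ} (z : Z.Elem {I} tt) (φ : Face I) (u : Partial Fg (tt , z) φ) where

    private
      uʸ : ∀ {J} (h : I ⇒ J) → φ ⟨ h ⟩ᶠ ≈ᶠ 1ᶠ → Y.Elem {J} tt
      uʸ h p = proj₁ (Partial.at u h p)

      uᵖ : ∀ {J} (h : I ⇒ J) (p : φ ⟨ h ⟩ᶠ ≈ᶠ 1ᶠ) → g.PathTo (uʸ h p) (Z.restrict h tt z)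
      uᵖ h p = proj₂ (Partial.at u h p)

      u∼ : {h : I ⇒ J} {m : J ⇒ K} {h′ : I ⇒ K} {p : φ ⟨ h ⟩ᶠ ≈ᶠ 1ᶠ} {p′ : φ ⟨ h′ ⟩ᶠ ≈ᶠ 1ᶠ} → h ⨟ m ≈ʰ h′ →
           _∋_∼[_]_ Fg {ρ = tt , Z.restrict h tt z} {tt , Z.restrict h′ tt z} (Partial.at u h p) m (Partial.at u h′ p′)
      u∼ c = FgR.at∼ u c

    k-path : ∀ {J} (h : I ⇒ J) (p : φ ⟨ h ⟩ᶠ ≈ᶠ 1ᶠ) → k.PathTo (preimageOf (uʸ h p)) (Z.restrict h tt z)
    k-path h p = k.mkPath (at (slid (uᵖ h p) 0ᴵ)) (g.along∼ (slid (uᵖ h p) 0ᴵ))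
      (λ m → ZR.sym≅ (ZR.fromEq (e _)) ZR.≅▸ (map∼ g (f.from∼ (pathOf (uʸ h p)) idʰ refl) ZR.≅▸ g.from∼ (slid (uᵖ h p) 0ᴵ) m refl))
      (λ m → g.to∼ (slid (uᵖ h p) 0ᴵ) m refl)

    over-z : Partial Fk (tt , z) φ
    over-z = k.fibrePartial (λ h p → preimageOf (uʸ h p)) k-path
      (λ {_} {_} {h} {m} {h′} {p} {p′} c →
        proj₁ (center∼ (g.fibre∼-point {p = uᵖ h p} {uᵖ h′ p′} (u∼ c))) ,
        g.fibre∼-path {p = slid (uᵖ h p) 0ᴵ} {slid (uᵖ h′ p′) 0ᴵ}
          (drag∼ {v = Partial.at u h p} {Partial.at u h′ p′} (u∼ c) refl (ZR.quot∼ c ZR.res ZR.res)))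

    base : Family.Elem Fg (tt , z)
    base = _⟶_.map (fibreMap k g f e) (Ek.ext (tt , z) φ over-z)

    -- At 0 a dragged point is strictly `f` of the chosen preimage, so it comes from an element of
    -- the fibre of `k`, namely the preimage with `k-path`. Extending there and mapping back to the
    -- fibre of `g` therefore extends the dragged points.
    base-agrees : (h : I ⇒ J) (p : φ ⟨ h ⟩ᶠ ≈ᶠ 1ᶠ) →
                  _∋_∼[_]_ Fg {ρ = tt , z} {tt , Z.restrict h tt z} base h (drag (Partial.at u h p) 0ᴵ)
    base-agrees h p = FgR._∼▸_ {ρ′ = tt , Z.restrict h tt z} {y = _⟶_.map (fibreMap k g f e) (Partial.at over-z h p)}
      (map∼ (fibreMap k g f e) {x = Ek.ext (tt , z) φ over-z} (Ek.ext-agrees over-z h p))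
      (g.fibre∼ {p = retarget k g f e (k-path h p)} {slid (uᵖ h p) 0ᴵ} ZR.refl≅
        (f.from∼ (pathOf (uʸ h p)) idʰ refl) (λ m s → ZR.refl≅))

  -- The fibre of `g` need not be a strict retract of that of `k`; it is merely deformed by `drag`
  -- into the image of that fibre. Hence the extension found there is corrected along the
  -- deformation.
  rightFactor-extension : Extension Fg
  rightFactor-extension = deform⇒extension (g.fibreComp c d) dragged homotopy
    (λ (_ , z) φ u → base z φ u)
    (λ { {ρ = _ , z} {φ} u h p → base-agrees z φ u h p })
    (λ { {ρ = _ , z} {φ} {u} {_ , z′} {φ′} {u′} {h} b φs us → map∼ (fibreMap k g f e)
      {x = Ek.ext (tt , z) φ (over-z z φ u)} {Ek.ext (tt , z′) φ′ (over-z z′ φ′ u′)}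
      (Ek.ext-natural b φs λ m p p′ → k.fibre∼ {p = k-path z φ u (h ⨟ m) p} {k-path z′ φ′ u′ m p′}
        (ZR.uniq ZR.res (ZR.comp∼ reflʰ (g.cellᴮ⁻ {b = z} {z′} b) ZR.res))
        (proj₁ (center∼ (g.fibre∼-point {p = proj₂ (Partial.at u (h ⨟ m) p)} {proj₂ (Partial.at u′ m p′)} (us m p p′))))
        (g.fibre∼-path {p = slid (proj₂ (Partial.at u (h ⨟ m) p)) 0ᴵ} {slid (proj₂ (Partial.at u′ m p′)) 0ᴵ}
          (drag∼ {v = Partial.at u (h ⨟ m) p} {Partial.at u′ m p′} (us m p p′) refl
            (ZR.uniq ZR.res (ZR.comp∼ reflʰ (g.cellᴮ⁻ {b = z} {z′} b) ZR.res))))) })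

equivalence-3-for-2 : ThreeForTwo (FibrantCubicalSets ℓ) Equivalence
equivalence-3-for-2 = record
  { composite = λ X Y Z f g k e wf wg → Fibres.extension⇒equivalence k (Composite.Along.composite-extension f g k e
      (composition Y) (composition Z)
      (Fibres.equivalence⇒extension f (composition X) (composition Y) wf)
      (Fibres.equivalence⇒extension g (composition Y) (composition Z) wg))
  ; second    = λ X Y Z f g k e wf wk → Fibres.extension⇒equivalence g (RightFactor.rightFactor-extension f g k e
      (composition Y) (composition Z)
      (Fibres.equivalence⇒extension f (composition X) (composition Y) wf)
      (Fibres.equivalence⇒extension k (composition X) (composition Z) wk))
  ; first     = λ X Y Z f g k e wg wk → Fibres.extension⇒equivalence f (LeftFactor.leftFactor-extension f g k e
      (Fibres.equivalence⇒extension g (composition Y) (composition Z) wg)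
      (Fibres.equivalence⇒extension k (composition X) (composition Z) wk))
  }

-- A section d of π₁ with d ∘ F = tc exhibits F as a strong deformation retract.
module Retract {A B : Family (𝟙 {ℓ})} (F : A ⟶ B) (c : Composition B) (d : B ⟶ Sigma B (IdFibre F))
               (dF : d ∘ᵐ F ≈ᵐ tc F) (πd : π₁ B (IdFibre F) ∘ᵐ d ≈ᵐ idᵐ) where
  private
    module A = Family A
    module B = Family B
    module F = Fibres F
    module AR = Restriction A
    module BR = Restriction B
    module PR = Restriction F.Pᶠ
    module 𝟙BA = CubicalSet (𝟙 ▷ B ▷ F.A′)
    pathComp : Composition F.Pᶠ
    pathComp = path-comp (image F) (point F) (c [ π B ]ᶜ [ π F.A′ ]ᶜ)
    module C = Composition pathComp
    module CR = CompositionRules pathComp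
    ∣F∣ : ∀ {I} → A.Elem {I} tt → B.Elem {I} tt
    ∣F∣ = _⟶_.map F
  open PathElem

  back : B.Elem {I} tt → A.Elem {I} tt
  back b = proj₁ (proj₂ (_⟶_.map d b))

  private
    raw : (b : B.Elem {I} tt) → F.PathTo (back b) (proj₁ (_⟶_.map d b))
    raw b = IdElem.path (proj₂ (proj₂ (_⟶_.map d b)))

  trail : (b : B.Elem {I} tt) → F.PathTo (back b) b
  trail b = F.mkPath (at (raw b)) (F.along∼ (raw b)) (λ f → F.from∼ (raw b) f refl)
    (λ f → BR.sym≅ (BR.fromEq (πd b)) BR.≅▸ F.to∼ (raw b) f refl)

  module _ {b : B.Elem {I} tt} {b′ : B.Elem {J} tt} {f : I ⇒ J} (p : B ∋ b ∼[ f ] b′) where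

    back∼ : A ∋ back b ∼[ f ] back b′
    back∼ = F.mid∼-source {p = proj₂ (proj₂ (_⟶_.map d b))} {p′ = proj₂ (proj₂ (_⟶_.map d b′))} (map∼ d p)

    trail∼ : ∀ {K} (g : J ⇒ K) r → B ∋ at (trail b) (f ⨟ g) r ≅ at (trail b′) g r
    trail∼ = F.mid∼-path {p = proj₂ (proj₂ (_⟶_.map d b))} {p′ = proj₂ (proj₂ (_⟶_.map d b′))} (map∼ d p)

  back-F : (x : A.Elem {I} tt) → A ∋ back (∣F∣ x) ≅ x
  back-F x = F.mid∼-source {p = proj₂ (proj₂ (_⟶_.map d (∣F∣ x)))} {p′ = proj₂ (proj₂ (_⟶_.map (tc F) x))} (Restriction.fromEq F.Mid (dF x))

  trail-F : (x : A.Elem {I} tt) (f : I ⇒ J) (r : dM J) → B ∋ ∣F∣ x ∼[ f ] at (trail (∣F∣ x)) f r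
  trail-F x f r = map∼ F AR.res BR.∼▸ BR.sym≅ (F.mid∼-path {p = proj₂ (proj₂ (_⟶_.map d (∣F∣ x)))}
    {p′ = proj₂ (proj₂ (_⟶_.map (tc F) x))} (Restriction.fromEq F.Mid (dF x)) f r)

  module _ {I : ℕ} {b : B.Elem {I} tt} {x : A.Elem {I} tt} (p : F.PathTo x b) (j : dM I) where

    -- A contraction of the fibre over `b` has to lead from `back b` to `x`. Applying `back` along
    -- `p` in reverse does so strictly, because `p(1) = b` and `back (p(0)) = back (F x) = x`.
    source : A.Elem {I} tt
    source = back (at p idʰ (~ j))

    -- The path that belongs to `source` starts as the trail of `p(~ j)`, which ends at `p(~ j)`
    -- instead of `b`. Composition in the path type then moves this endpoint along the rest of `p`.
    moving : B.Elem {suc I} tt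
    moving = at p weaken (~ (j ⟨ weaken ⟩) ∨ name zero)

    line : 𝟙BA.Cell (suc I)
    line = (tt , moving) , A.restrict weaken tt source

    moving∼ : {h : suc I ⇒ J} {s : dM J} → ~ (j ⟨ weaken ⨟ h ⟩) ∨ h zero ≈ᴵ s → B ∋ moving ∼[ h ] at p (weaken ⨟ h) s
    moving∼ {h = h} e = F.along∼ p reflʰ (trans (∨-cong (~-cong (≡⇒≈ᴵ (⟨⟩-⨟ j weaken h))) refl) e)

    source∼ : {h : I ⇒ J} {s : dM J} → ~ (j ⟨ h ⟩) ≈ᴵ s → A ∋ source ∼[ h ] back (at p h s)
    source∼ {h = h} e = back∼ (F.along∼ p {h = h} reflʰ e)

    resting : {h : suc I ⇒ J} → A ∋ source ∼[ weaken ⨟ h ] A.restrict h tt (A.restrict weaken tt source)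
    resting = AR.comp∼ reflʰ AR.res AR.res

    module _ {J} (h : suc I ⇒ J) where

      goal : CubicalSet.Cell (𝟙 ▷ B ▷ F.A′) J
      goal = (tt , B.restrict h tt moving) , A.restrict h tt (A.restrict weaken tt source)

      -- At `j = 0` the endpoint is `b` throughout, so the trail of `b` can stay as it is; it is the
      -- path of the center.
      side₀ : j ⟨ weaken ⨟ h ⟩ ≈ᴵ 0ᴵ → Family.Elem F.Pᶠ goal
      side₀ e = F.mkPath (λ n s → at (trail b) (weaken ⨟ h ⨟ n) s)
        (λ {_} {_} {n} {m} {n′} k l → F.along∼ (trail b) (λ i → trans (⨟-assoc (weaken ⨟ h) n m i) (⟨⟩-cong (refl {r = h (suc i)}) k)) l)
        (λ n → BR.quot∼ reflʰ (map∼ F (back∼ (F.to∼ p (weaken ⨟ h) refl) AR.∼▸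
          AR.uniq (source∼ {h = weaken ⨟ h} (trans (~-cong e) ~0)) (resting {h = h}))) (F.from∼ (trail b) (weaken ⨟ h ⨟ n) refl))
        (λ n → BR.quot∼ reflʰ (F.to∼ p (weaken ⨟ h) refl BR.∼▸
          BR.uniq (moving∼ {h = h} (trans (∨-cong (trans (~-cong e) ~0) refl) (1∨ᴵ _))) BR.res) (F.to∼ (trail b) (weaken ⨟ h ⨟ n) refl))

      -- At `j = 1` the endpoint runs through all of `p`, followed by `p` cut off at the running
      -- coordinate `i`, that is `p(i ∧ s)`. For `i = 0` this is constant at `F x`, as is the trail
      -- of `F x` by `trail-F`; for `i = 1` it is `p`, where the contraction must end.
      side₁ : j ⟨ weaken ⨟ h ⟩ ≈ᴵ 1ᴵ → Family.Elem F.Pᶠ goal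
      side₁ e = F.mkPath (λ n s → at p (weaken ⨟ h ⨟ n) (h zero ⟨ n ⟩ ∧ s))
        (λ {_} {_} {n} {m} {n′} k l → F.along∼ p (λ i → trans (⨟-assoc (weaken ⨟ h) n m i) (⟨⟩-cong (refl {r = h (suc i)}) k))
          (∧-cong (trans (≡⇒≈ᴵ (⟨⟩-⨟ (h zero) n m)) (⟨⟩-cong (refl {r = h zero}) k)) l))
        (λ n → BR.quot∼ reflʰ (map∼ F (AR.sym≅ (back-F x) AR.≅▸ (back∼ (F.from∼ p (weaken ⨟ h) refl) AR.∼▸
          AR.uniq (source∼ {h = weaken ⨟ h} (trans (~-cong e) ~1)) (resting {h = h})))) (F.from∼ p (weaken ⨟ h ⨟ n) (∧0ᴵ _)))
        (λ n → BR.uniq BR.res (moving∼ {h = h} (trans (∨-cong (trans (~-cong e) ~1) refl) (0∨ᴵ _))) BR.≅▸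
          F.along∼ p reflʰ (sym (∧-1 _)))

    start : Family.Elem F.Pᶠ (goal ι₀)
    start = F.mkPath (at (trail (at p idʰ (~ j)))) (F.along∼ (trail (at p idʰ (~ j))))
      (λ n → map∼ F (AR.uniq resting AR.refl≅) BR.≅▸ F.from∼ (trail (at p idʰ (~ j))) n refl)
      (λ n → BR.uniq BR.res (moving∼ (trans (∨-0 _) (~-cong (≡⇒≈ᴵ (⟨⟩-id j))))) BR.≅▸ F.to∼ (trail (at p idʰ (~ j))) n refl)

    goal∼ : {h : suc I ⇒ J} {m : J ⇒ K} {h′ : suc I ⇒ K} → h ⨟ m ≈ʰ h′ →
            B ∋ proj₂ (proj₁ (goal h)) ∼[ m ] proj₂ (proj₁ (goal h′)) × A ∋ proj₂ (goal h) ∼[ m ] proj₂ (goal h′)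
    goal∼ c = BR.quot∼ c BR.res BR.res , AR.quot∼ c AR.res AR.res

    opaque
      start-0 : {f : I ⇒ J} (e : j ⟨ f ⟩ ≈ᴵ 0ᴵ) → _∋_∼[_]_ F.Pᶠ {ρ = goal ι₀} {goal (ι₀ ⨟ f)} start f (side₀ (ι₀ ⨟ f) e)
      start-0 {f = f} e = F.pathTo∼ {p = start} {side₀ (ι₀ ⨟ f) e} (proj₁ (goal∼ {h = ι₀} reflʰ)) (proj₂ (goal∼ {h = ι₀} reflʰ))
        λ n s → trail∼ (F.along∼ p {h = f} reflʰ (trans (~-cong e) ~0)) n s BR.▸ BR.sym≅ (trail∼ (F.to∼ p f refl) n s)

      start-1 : {f : I ⇒ J} (e : j ⟨ f ⟩ ≈ᴵ 1ᴵ) → _∋_∼[_]_ F.Pᶠ {ρ = goal ι₀} {goal (ι₀ ⨟ f)} start f (side₁ (ι₀ ⨟ f) e)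
      start-1 {f = f} e = F.pathTo∼ {p = start} {side₁ (ι₀ ⨟ f) e} (proj₁ (goal∼ {h = ι₀} reflʰ)) (proj₂ (goal∼ {h = ι₀} reflʰ))
        λ n s → trail∼ (F.along∼ p {h = f} reflʰ (trans (~-cong e) ~1)) n s BR.▸ (BR.sym≅ (trail∼ (F.from∼ p f refl) n s) BR.▸
          BR.uniq (trail-F x (f ⨟ n) s) (F.from∼ p (f ⨟ n) (0∧ᴵ s)))

  module _ {b : B.Elem {I} tt} {x : A.Elem {I} tt} {p : F.PathTo x b} {j : dM I}
           {b′ : B.Elem {J} tt} {x′ : A.Elem {J} tt} {p′ : F.PathTo x′ b′} {j′ : dM J} {f : I ⇒ J}
           (bs : B ∋ b ∼[ f ] b′) (ps : ∀ {K} (g : J ⇒ K) r → B ∋ at p (f ⨟ g) r ≅ at p′ g r)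
           (js : j ⟨ f ⟩ ≈ᴵ j′) where

    p∼ : {h : I ⇒ K} {m : K ⇒ L} {h′ : J ⇒ L} {r : dM K} {r′ : dM L} → h ⨟ m ≈ʰ f ⨟ h′ → r ⟨ m ⟩ ≈ᴵ r′ → B ∋ at p h r ∼[ m ] at p′ h′ r′
    p∼ {h′ = h′} {r′ = r′} c d = F.along∼ p c d BR.∼▸ ps h′ r′

    source-natural : A ∋ source p j ∼[ f ] source p′ j′
    source-natural = back∼ (p∼ (λ i → sym (≡⇒≈ᴵ (⟨⟩-id (f i)))) (~-cong js))

    moving-natural : B ∋ moving p j ∼[ f ⁺ ] moving p′ j′
    moving-natural = p∼ reflʰ (∨-cong (~-cong (trans (⁺-weaken j f) (⟨⟩-cong js reflʰ))) refl)

    goal-natural : {h : suc I ⇒ K} {m : K ⇒ L} {h′ : suc J ⇒ L} → h ⨟ m ≈ʰ f ⁺ ⨟ h′ →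
                   B ∋ proj₂ (proj₁ (goal p j h)) ∼[ m ] proj₂ (proj₁ (goal p′ j′ h′)) × A ∋ proj₂ (goal p j h) ∼[ m ] proj₂ (goal p′ j′ h′)
    goal-natural c = BR.quot∼ c BR.res (BR.comp∼ reflʰ moving-natural BR.res) ,
      AR.quot∼ c AR.res (AR.comp∼ reflʰ (AR.quot∼ {f = weaken} {f ⁺} {f ⨟ weaken} reflʰ AR.res (AR.comp∼ reflʰ source-natural AR.res)) AR.res)

    private
      whole : {h : suc I ⇒ K} {m : K ⇒ L} {h′ : suc J ⇒ L} → h ⨟ m ≈ʰ f ⁺ ⨟ h′ → {M : ℕ} (n : L ⇒ M) →
              weaken ⨟ h ⨟ (m ⨟ n) ≈ʰ f ⨟ (weaken ⨟ h′ ⨟ n)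
      whole {h = h} {m} {h′} c n i = trans (≡⇒≈ᴵ (≡.sym (⟨⟩-⨟ (h (suc i)) m n)))
        (trans (⟨⟩-cong (trans (c (suc i)) (≡⇒≈ᴵ (⟨⟩-⨟ (f i) weaken h′))) (reflʰ {f = n})) (≡⇒≈ᴵ (⟨⟩-⨟ (f i) (weaken ⨟ h′) n)))

    opaque
      side₀-natural : {h : suc I ⇒ K} {m : K ⇒ L} {h′ : suc J ⇒ L} → h ⨟ m ≈ʰ f ⁺ ⨟ h′ → ∀ e e′ →
                      _∋_∼[_]_ F.Pᶠ {ρ = goal p j h} {goal p′ j′ h′} (side₀ p j h e) m (side₀ p′ j′ h′ e′)
      side₀-natural {h = h} {m} {h′} c e e′ = F.pathTo∼ {p = side₀ p j h e} {side₀ p′ j′ h′ e′} (proj₁ (goal-natural {h = h} {m} {h′} c)) (proj₂ (goal-natural {h = h} {m} {h′} c))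
        λ n s → F.along≅ (trail b) (whole {h = h} {m} {h′} c n) refl BR.▸ trail∼ bs (weaken ⨟ h′ ⨟ n) s

      side₁-natural : {h : suc I ⇒ K} {m : K ⇒ L} {h′ : suc J ⇒ L} → h ⨟ m ≈ʰ f ⁺ ⨟ h′ → ∀ e e′ →
                      _∋_∼[_]_ F.Pᶠ {ρ = goal p j h} {goal p′ j′ h′} (side₁ p j h e) m (side₁ p′ j′ h′ e′)
      side₁-natural {h = h} {m} {h′} c e e′ = F.pathTo∼ {p = side₁ p j h e} {side₁ p′ j′ h′ e′} (proj₁ (goal-natural {h = h} {m} {h′} c)) (proj₂ (goal-natural {h = h} {m} {h′} c))
        λ n s → F.along≅ p (whole {h = h} {m} {h′} c n) (∧-cong (trans (≡⇒≈ᴵ (≡.sym (⟨⟩-⨟ (h zero) m n))) (⟨⟩-cong (c zero) (reflʰ {f = n}))) refl) BR.▸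
          ps (weaken ⨟ h′ ⨟ n) (h′ zero ⟨ n ⟩ ∧ s)

      start-natural : _∋_∼[_]_ F.Pᶠ {ρ = goal p j ι₀} {goal p′ j′ ι₀} (start p j) f (start p′ j′)
      start-natural = F.pathTo∼ {p = start p j} {start p′ j′} (proj₁ (goal-natural {h = ι₀} {f} {ι₀} square)) (proj₂ (goal-natural {h = ι₀} {f} {ι₀} square))
        λ n s → trail∼ (p∼ (λ i → sym (≡⇒≈ᴵ (⟨⟩-id (f i)))) (~-cong js)) n s
        where
        square : ι₀ ⨟ f ≈ʰ f ⁺ ⨟ ι₀
        square = symʰ (⁺-ι₀ f)

  module _ {I : ℕ} {b : B.Elem {I} tt} {x : A.Elem {I} tt} (p : F.PathTo x b) (j : dM I) where

    private
      at-0′ : ∀ {J} {h : suc I ⇒ J} → (j =0ᶠ) ⟨ weaken ⟩ᶠ ⟨ h ⟩ᶠ ≈ᶠ 1ᶠ → j ⟨ weaken ⨟ h ⟩ ≈ᴵ 0ᴵ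
      at-0′ {h = h} c = =0-at j (wk-one⁻ (j =0ᶠ) {h} c)

      at-1′ : ∀ {J} {h : suc I ⇒ J} → (j =1ᶠ) ⟨ weaken ⟩ᶠ ⟨ h ⟩ᶠ ≈ᶠ 1ᶠ → j ⟨ weaken ⨟ h ⟩ ≈ᴵ 1ᴵ
      at-1′ {h = h} c = =1-at j (wk-one⁻ (j =1ᶠ) {h} c)

      same : ∀ {J K} {h : suc I ⇒ J} {m : J ⇒ K} {h′ : suc I ⇒ K} → h ⨟ m ≈ʰ h′ → h ⨟ m ≈ʰ idʰ ⁺ ⨟ h′
      same c zero    = c zero
      same c (suc i) = c (suc i)

      ps : ∀ {K} (g : I ⇒ K) r → B ∋ at p (idʰ ⨟ g) r ≅ at p g r
      ps g r = F.along≅ p reflʰ refl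

    U₀ : Partial F.Pᶠ (line p j) ((j =0ᶠ) ⟨ weaken ⟩ᶠ)
    Partial.at         U₀ h c = side₀ p j h (at-0′ c)
    Partial.compatible U₀ {f = h} {m} {h′} {c} {c′} e = PR.toRestrict {ρ = goal p j h} {goal p j h′} {m} {𝟙BA.·-via {x = line p j} e}
      (side₀-natural {p = p} {j} {p′ = p} {j} BR.refl≅ ps (≡⇒≈ᴵ (⟨⟩-id j)) {h = h} {m} {h′} (same {h = h} {m} {h′} e) (at-0′ c) (at-0′ c′))

    U₁ : Partial F.Pᶠ (line p j) ((j =1ᶠ) ⟨ weaken ⟩ᶠ)
    Partial.at         U₁ h c = side₁ p j h (at-1′ c)
    Partial.compatible U₁ {f = h} {m} {h′} {c} {c′} e = PR.toRestrict {ρ = goal p j h} {goal p j h′} {m} {𝟙BA.·-via {x = line p j} e}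
      (side₁-natural {p = p} {j} {p′ = p} {j} BR.refl≅ ps (≡⇒≈ᴵ (⟨⟩-id j)) {h = h} {m} {h′} (same {h = h} {m} {h′} e) (at-1′ c) (at-1′ c′))

    U₀-U₁ : ∀ {J} (h : suc I ⇒ J) c c′ → Family._≋_ F.Pᶠ (Partial.at U₀ h c) (Partial.at U₁ h c′)
    U₀-U₁ h c c′ = ⊥-elim (0≉1ᴵ (at-0′ c) (at-1′ c′))

    U : Partial F.Pᶠ (line p j) (∂ j ⟨ weaken ⟩ᶠ)
    U = join U₀ U₁ U₀-U₁

    opaque
      start-agrees : AgreesOn (∂ j) (_at₀ {φ = ∂ j} U) (start p j)
      start-agrees = agrees₀ (∂ j) U λ h c → case ∨-prime _ _ c of λ
        { (inj₁ c′) → start-0 p j (at-0′ c′) PR.∼▸ PR.sym≅ (PR.fromEq (join-at₁ U₀ U₁ U₀-U₁ (ι₀ ⨟ h) c c′))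
        ; (inj₂ c′) → start-1 p j (at-1′ c′) PR.∼▸ PR.sym≅ (PR.fromEq (join-at₂ U₀ U₁ U₀-U₁ (ι₀ ⨟ h) c c′)) }

    end : 𝟙BA._·_ (line p j) ι₁ 𝟙BA.≈ ((tt , b) , source p j)
    end = F.cellᴬ (moving∼ p j (∨1ᴵ _) BR.∼▸ BR.sym≅ (F.to∼ p idʰ refl)) (AR.quot∼ {f = weaken} {h = idʰ} reflʰ AR.res AR.refl≅)

    opaque
      composed : Family.Elem F.Pᶠ (goal p j ι₁)
      composed = C.comp (line p j) (∂ j) U (start p j) start-agrees

      contracting : F.PathTo (source p j) b
      contracting = Family.restrict F.Pᶠ {ρ = goal p j ι₁} idʰ (𝟙BA.transˣ (𝟙BA.·-id {x = goal p j ι₁}) end) composed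

      contracting≅ : _∋_∼[_]_ F.Pᶠ {ρ = goal p j ι₁} {(tt , b) , source p j} composed idʰ contracting
      contracting≅ = PR.res {ρ = goal p j ι₁} {(tt , b) , source p j} {x = composed}

      contracting-0 : j ≈ᴵ 0ᴵ → (h : I ⇒ J) → ∀ s → B ∋ at contracting h s ≅ at (trail b) h s
      contracting-0 e h s = F.pathTo∼⁻ {p = contracting} {side₀ p j (ι₁ ⨟ idʰ) (at-0′ one)}
        (PR._▸_ {ρ = _ , _} {goal p j ι₁} {goal p j (ι₁ ⨟ idʰ)} (PR.sym≅ {ρ = goal p j ι₁} {x = composed} {contracting} contracting≅)
          (PR._▸_ {ρ = goal p j ι₁} {goal p j (ι₁ ⨟ idʰ)} {goal p j (ι₁ ⨟ idʰ)} (CR.comp∼-agrees {u = U} idʰ (∨-oneˡ one))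
            (PR.fromEq (join-at₁ U₀ U₁ U₀-U₁ (ι₁ ⨟ idʰ) (∨-oneˡ one) one)))) h s BR.▸ F.along≅ (trail b) (λ i → refl) refl
        where
        one : (j =0ᶠ) ⟨ weaken ⟩ᶠ ⟨ ι₁ ⨟ idʰ ⟩ᶠ ≈ᶠ 1ᶠ
        one = wk-one (j =0ᶠ) {f = ι₁ ⨟ idʰ} (=0-at⁻ j (trans (≡⇒≈ᴵ (⟨⟩-id j)) e))

      contracting-1 : j ≈ᴵ 1ᴵ → (h : I ⇒ J) → ∀ s → B ∋ at contracting h s ≅ at p h s
      contracting-1 e h s = F.pathTo∼⁻ {p = contracting} {side₁ p j (ι₁ ⨟ idʰ) (at-1′ one)}
        (PR._▸_ {ρ = _ , _} {goal p j ι₁} {goal p j (ι₁ ⨟ idʰ)} (PR.sym≅ {ρ = goal p j ι₁} {x = composed} {contracting} contracting≅)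
          (PR._▸_ {ρ = goal p j ι₁} {goal p j (ι₁ ⨟ idʰ)} {goal p j (ι₁ ⨟ idʰ)} (CR.comp∼-agrees {u = U} idʰ (∨-oneʳ one))
            (PR.fromEq (join-at₂ U₀ U₁ U₀-U₁ (ι₁ ⨟ idʰ) (∨-oneʳ one) one)))) h s BR.▸ F.along≅ p (λ i → refl) (1∧ᴵ s)
        where
        one : (j =1ᶠ) ⟨ weaken ⟩ᶠ ⟨ ι₁ ⨟ idʰ ⟩ᶠ ≈ᶠ 1ᶠ
        one = wk-one (j =1ᶠ) {f = ι₁ ⨟ idʰ} (=1-at⁻ j (trans (≡⇒≈ᴵ (⟨⟩-id j)) e))

  contraction-point : {b : B.Elem {I} tt} → Family.Elem (Fibre F) (tt , b) → dM I → Family.Elem (Fibre F) (tt , b)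
  contraction-point (x , p) j = source p j , contracting p j

  opaque
    unfolding contracting

    contraction-point∼ : {b : B.Elem {I} tt} {v : Family.Elem (Fibre F) (tt , b)} {j : dM I}
                         {b′ : B.Elem {J} tt} {v′ : Family.Elem (Fibre F) (tt , b′)} {j′ : dM J} {f : I ⇒ J} →
                         B ∋ b ∼[ f ] b′ → _∋_∼[_]_ (Fibre F) {ρ = tt , b} {tt , b′} v f v′ → j ⟨ f ⟩ ≈ᴵ j′ →
                         _∋_∼[_]_ (Fibre F) {ρ = tt , b} {tt , b′} (contraction-point v j) f (contraction-point v′ j′)
    contraction-point∼ {b = b} {x , p} {j} {b′} {x′ , p′} {j′} {f} bs vs js = F.fibre∼ {p = contracting p j} {contracting p′ j′} bs
      (source-natural {p = p} {j} {p′ = p′} {j′} bs ps js)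
      (F.pathTo∼⁻ {p = contracting p j} {contracting p′ j′}
        (PR.quot∼ {ρ = goal p j ι₁} {(tt , b) , source p j} {(tt , b′) , source p′ j′} {f = idʰ} {f} {f} {composed p j} {contracting p j} {contracting p′ j′}
          reflʰ (contracting≅ p j)
          (PR._∼▸_ {ρ = goal p j ι₁} {goal p′ j′ ι₁} {(tt , b′) , source p′ j′} {x = composed p j} {composed p′ j′} {contracting p′ j′}
            (CR.comp∼-natural {u = U p j} {u′ = U p′ j′} line∼ (∂-cong {r = j} {f = f} js)
              (join∼ {a = U₀-U₁ p j} {a′ = U₀-U₁ p′ j′}
                (extent-⁺ (j =0ᶠ) f (trans (=0ᶠ-⟨⟩ j f) (=0-cong js))) (extent-⁺ (j =1ᶠ) f (trans (=1ᶠ-⟨⟩ j f) (=1-cong js)))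
                (λ g c c′ → side₀-natural {p = p} {j} {p′ = p′} {j′} bs ps js {h = f ⁺ ⨟ g} {idʰ} {g} (λ i → ≡⇒≈ᴵ (⟨⟩-id _)) _ _)
                (λ g c c′ → side₁-natural {p = p} {j} {p′ = p′} {j′} bs ps js {h = f ⁺ ⨟ g} {idʰ} {g} (λ i → ≡⇒≈ᴵ (⟨⟩-id _)) _ _))
              (start-natural {p = p} {j} {p′ = p′} {j′} bs ps js))
            (contracting≅ p′ j′))))
      where
      ps : ∀ {K} (g : _ ⇒ K) r → B ∋ at p (f ⨟ g) r ≅ at p′ g r
      ps = F.fibre∼-path {p = p} {p′} vs

      line∼ : 𝟙BA._·_ (line p j) (f ⁺) 𝟙BA.≈ line p′ j′
      line∼ = F.cellᴬ (moving-natural {p = p} {j} {p′ = p′} {j′} bs ps js)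
        (AR.quot∼ {f = weaken} {f ⁺} {f ⨟ weaken} reflʰ AR.res (AR.comp∼ reflʰ (source-natural {p = p} {j} {p′ = p′} {j′} bs ps js) AR.res))

module _ {A B : Family (𝟙 {ℓ})} (F : A ⟶ B) (c : Composition B) (d : B ⟶ Sigma B (IdFibre F))
         (dF : d ∘ᵐ F ≈ᵐ tc F) (πd : π₁ B (IdFibre F) ∘ᵐ d ≈ᵐ idᵐ) where
  private
    module F = Fibres F
    module A = Family A
    module B = Family B
    module AR = Restriction A
    module BR = Restriction B
    Ff = Fibre F
    module FR = Restriction Ff
  open Retract F c d dF πd

  private
    retract-center : Section Ff
    retract-center = makeSection (λ (_ , b) → back b , trail b)
      (λ { {ρ = _ , b} {_ , b′} e → F.fibre∼ {p = trail b} {trail b′} (F.cellᴮ⁻ {b = b} {b′} e)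
        (back∼ (F.cellᴮ⁻ {b = b} {b′} e)) (trail∼ (F.cellᴮ⁻ {b = b} {b′} e)) })

  retract⇒equivalence : IsEquivalenceᵐ F
  retract⇒equivalence = record
    { center      = retract-center
    ; contraction = makeHomotopy (retract-center [ π Ff ]ˢ) contraction-point
        (λ { {ρ = _ , b} {_ , b′} {v} {v′} p s → contraction-point∼ {v = v} {v′ = v′} (F.cellᴮ⁻ {b = b} {b′} (FR.base p)) p s })
        (λ { {ρ = _ , b} (x , p) → FR.toEq {ρ = tt , b} {contraction-point (x , p) 0ᴵ} {back b , trail b}
          (F.fibre∼ {p = contracting p 0ᴵ} {trail b} BR.refl≅
            (back∼ (BR.sym≅ (F.to∼ p idʰ ~0))) (contracting-0 p 0ᴵ refl)) })
        (λ { {ρ = _ , b} (x , p) → FR.toEq {ρ = tt , b} {contraction-point (x , p) 1ᴵ} {x , p}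
          (F.fibre∼ {p = contracting p 1ᴵ} {p} BR.refl≅
            (AR._▸_ (back∼ (BR.sym≅ (F.from∼ p idʰ ~1))) (back-F x)) (contracting-1 p 1ᴵ refl)) })
    }

-- Lifting tc against display maps

module Contract {A B : Family (𝟙 {ℓ})} (F : A ⟶ B) where
  private
    module F = Fibres F
    module A = Family A
    module B = Family B
    module AR = Restriction A
    module BR = Restriction B
    module MR = Restriction F.Mid
  open PathElem
  open IdElem

  IdTo : A.Elem {I} tt → B.Elem {I} tt → Set ℓ
  IdTo x b = IdElem F.B″ (image F) (point F) ((tt , b) , x)

  -- The contraction of the based identity type: (p , φ) restricted to [0, r].
  initial : {x : A.Elem {I} tt} {b : B.Elem {I} tt} (p : IdTo x b) (r : dM I) → IdTo x (at (path p) idʰ r)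
  initial {x = x} p r = record
    { path     = F.mkPath (λ f s → at (path p) f (r ⟨ f ⟩ ∧ s))
        (λ {_} {_} {f} {g} c d → F.along∼ (path p) c (∧-cong (trans (≡⇒≈ᴵ (⟨⟩-⨟ r f g)) (⟨⟩-cong (refl {r = r}) c)) d))
        (λ f → F.from∼ (path p) f (∧0ᴵ _))
        (λ f → F.along∼ (path p) reflʰ (sym (∧-1 _)))
    ; extent   = extent p ∨ (r =0ᶠ)
    ; constant = λ f m s → case ∨-prime _ _ m of λ
        { (inj₁ q) → constant p f q _
        ; (inj₂ q) → BR.toEq (BR.uniq (F.from∼ (path p) f (trans (∧-cong (=0-at r q) refl) (0∧ᴵ s))) (map∼ F AR.res)) }
    }

  contract : Family.Elem F.Mid {I} tt → dM I → Family.Elem F.Mid {I} tt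
  contract (b , x , p) r = at (path p) idʰ r , x , initial p r

  contract∼ : {e : Family.Elem F.Mid {I} tt} {e′ : Family.Elem F.Mid {J} tt} {f : I ⇒ J} {r : dM I} {r′ : dM J} →
              F.Mid ∋ e ∼[ f ] e′ → r ⟨ f ⟩ ≈ᴵ r′ → F.Mid ∋ contract e r ∼[ f ] contract e′ r′
  contract∼ {e = b , x , p} {b′ , x′ , p′} {f} {r} {r′} m d = F.mid∼ {p = initial p r} {p′ = initial p′ r′}
    (F.along∼ (path p) (λ i → sym (≡⇒≈ᴵ (⟨⟩-id (f i)))) d BR.∼▸ ps idʰ r′)
    (F.mid∼-source {p = p} {p′ = p′} m)
    (λ g s → F.along≅ (path p) reflʰ (∧-cong (trans (≡⇒≈ᴵ (≡.sym (⟨⟩-⨟ r f g))) (⟨⟩-cong d (reflʰ {f = g}))) refl) BR.▸ ps g _)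
    (∨-cong (F.mid∼-extent {p = p} {p′ = p′} m) (trans (=0ᶠ-⟨⟩ r f) (=0-cong d)))
    where
    ps : ∀ {K} (g : _ ⇒ K) s → B ∋ at (path p) (f ⨟ g) s ≅ at (path p′) g s
    ps = F.mid∼-path {p = p} {p′ = p′} m

  contract-1 : (e : Family.Elem F.Mid {I} tt) → F.Mid ∋ contract e 1ᴵ ≅ e
  contract-1 (b , x , p) = F.mid∼ {p = initial p 1ᴵ} {p′ = p} (BR.sym≅ (F.to∼ (path p) idʰ refl)) AR.refl≅
    (λ g s → F.along≅ (path p) reflʰ (1∧ᴵ s)) (trans (⟨⟩ᶠ-id _) (∨-0 _))

  -- Where `p` is constant or `r` is 0, the shortened path is constant at `F x` and its extent is 1,
  -- which are the data of `tc F x`. The face `(r = 0)` was added to the extent so that the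
  -- contraction starts there strictly.
  contract-still : {b : B.Elem {I} tt} {x : A.Elem {I} tt} (p : IdTo x b) (r : dM I) → extent p ∨ (r =0ᶠ) ≈ᶠ 1ᶠ →
                   F.Mid ∋ _⟶_.map (tc F) x ≅ contract (b , x , p) r
  contract-still {b = b} {x} p r c = F.mid∼ {p = proj₂ (proj₂ (_⟶_.map (tc F) x))} {p′ = initial p r}
    (map∼ F AR.refl≅ BR.▸ (map∼ F AR.res BR.▸ (still idʰ 1ᴵ BR.▸ F.along≅ (path p) reflʰ (trans (∧-1 _) (≡⇒≈ᴵ (⟨⟩-id r))))))
    AR.refl≅ still (sym c)
    where
    still : ∀ {K} (g : _ ⇒ K) s → B ∋ _⟶_.map F (A.restrict g tt x) ≅ at (path (initial p r)) g s
    still g s = BR.sym≅ (BR.fromEq (constant (initial p r) g (trans (⟨⟩ᶠ-cong c (reflʰ {f = g})) refl) s))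

module LiftTc {A B : Family (𝟙 {ℓ})} (F : A ⟶ B) {X : Family (𝟙 {ℓ})} {Y : Family (𝟙 ▷ X)} (c : Composition Y)
              (u : A ⟶ Sigma X Y) (v : Fibres.Mid F ⟶ X) (sq : π₁ X Y ∘ᵐ u ≈ᵐ v ∘ᵐ tc F) where
  open Contract F
  private
    module F = Fibres F
    module A = Family A
    module X = Family X
    module Y = Family Y
    module M = Family F.Mid
    module AR = Restriction A
    module XR = Restriction X
    module YR = Restriction Y
    module MR = Restriction F.Mid
    module 𝟙X = CubicalSet (𝟙 ▷ X)
    module T = Transport c
    ∣v∣ : ∀ {I} → M.Elem {I} tt → X.Elem {I} tt
    ∣v∣ = _⟶_.map v

  cellˣ : {x : X.Elem {I} tt} {x′ : X.Elem {J} tt} {f : I ⇒ J} → X ∋ x ∼[ f ] x′ → (tt , x) 𝟙X.· f 𝟙X.≈ (tt , x′)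
  cellˣ = cell∼ X

  module _ {I : ℕ} {b : Family.Elem B {I} tt} {a : A.Elem {I} tt} (p : IdTo a b) where

    private
      e : M.Elem {I} tt
      e = b , a , p

      φ : Face I
      φ = IdElem.extent p

    top : M.Elem {suc I} tt
    top = contract (M.restrict weaken tt e) (name zero)

    line : 𝟙X.Cell (suc I)
    line = tt , ∣v∣ top

    top∼ : {h : suc I ⇒ J} {e′ : M.Elem {J} tt} {r : dM J} → F.Mid ∋ e ∼[ weaken ⨟ h ] e′ → h zero ≈ᴵ r →
           F.Mid ∋ top ∼[ h ] contract e′ r
    top∼ m d = contract∼ (MR.quot∼ reflʰ MR.res m) d

    line-start : (tt , ∣v∣ (_⟶_.map (tc F) a)) 𝟙X.· idʰ 𝟙X.≈ line 𝟙X.· ι₀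
    line-start = cellˣ (map∼ v (contract-still p 0ᴵ (∨1 _)) XR.▸
      XR.uniq (map∼ v (top∼ {h = ι₀} {e} MR.refl≅ refl)) XR.res)

    line-end : line 𝟙X.· ι₁ 𝟙X.≈ (tt , ∣v∣ e)
    line-end = cellˣ (map∼ v (top∼ {h = ι₁} {e} MR.refl≅ refl MR.∼▸ contract-1 e))

    line-still : {h : suc I ⇒ J} → φ ⟨ weaken ⨟ h ⟩ᶠ ≈ᶠ 1ᶠ → X ∋ ∣v∣ (_⟶_.map (tc F) a) ∼[ weaken ⨟ h ] X.restrict h tt (∣v∣ top)
    line-still {h = h} q = map∼ v (map∼ (tc F) AR.res MR.∼▸
      contract-still (proj₂ (proj₂ (M.restrict (weaken ⨟ h) tt e))) (h zero) (∨-oneˡ q)) XR.∼▸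
      XR.uniq (map∼ v (top∼ {h = h} MR.res refl)) XR.res

    line-constant : T.ConstantOn line φ
    line-constant h q = 𝟙X.transˣ (𝟙X.symˣ (𝟙X.·-shift {f = idʰ} {weaken ⨟ h} line-start)) (cellˣ (line-still {h = h} q))

    start-cell : (tt , proj₁ (_⟶_.map u a)) 𝟙X.· idʰ 𝟙X.≈ line 𝟙X.· ι₀
    start-cell = 𝟙X.transˣ (𝟙X.·-cong (𝟙X.transˣ (𝟙X.symˣ 𝟙X.·-id) (cellˣ (XR.fromEq (sq a)))) reflʰ) line-start

    opaque
      start : Y.Elem (line 𝟙X.· ι₀)
      start = Y.restrict idʰ start-cell (proj₂ (_⟶_.map u a))

      start≅ : Y ∋ proj₂ (_⟶_.map u a) ≅ start
      start≅ = YR.res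

      lifted : Y.Elem (tt , ∣v∣ e)
      lifted = Y.restrict idʰ (𝟙X.transˣ 𝟙X.·-id line-end) (T.transport line φ line-constant start)

      lifted≅ : Y ∋ T.transport line φ line-constant start ≅ lifted
      lifted≅ = YR.res

  diagonal : F.Mid ⟶ Sigma X Y
  diagonal = makeMap (λ e → ∣v∣ e , lifted (proj₂ (proj₂ e)))
    (λ { {f = f} {b , a , p} {b′ , a′ , p′} m → pair∼ (YR.sym≅ (lifted≅ p) YR.≅▸ (T.transport∼
        (cellˣ (map∼ v (contract∼ (MR.quot∼ {f = weaken} {f ⁺} {f ⨟ weaken} reflʰ MR.res (MR.comp∼ reflʰ m MR.res)) refl)))
        (F.mid∼-extent {p = p} {p′ = p′} m)
        (YR.sym≅ (start≅ p) YR.≅▸ (snd∼ (map∼ u (F.mid∼-source {p = p} {p′ = p′} m)) YR.∼▸ start≅ p′)) YR.∼▸ lifted≅ p′)) })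

  upper : diagonal ∘ᵐ tc F ≈ᵐ u
  upper a = Restriction.toEq (Sigma X Y) (pair∼ {A = X} {B = Y} {x = ∣v∣ (_⟶_.map (tc F) a)} {y = lifted p} {y′ = proj₂ (_⟶_.map u a)}
    -- The extent of the identity proof in `tc F a` is 1, so transport returns the element given by
    -- `u a` strictly.
    (YR.sym≅ (lifted≅ p) YR.▸ T.transport∼-constant (line p) 1ᶠ (line-constant p) (start p) idʰ refl (YR.sym≅ (start≅ p))))
    where p = proj₂ (proj₂ (_⟶_.map (tc F) a))

  lower : π₁ X Y ∘ᵐ diagonal ≈ᵐ v
  lower e = X.reflᵃ

tc-lifts : {A B : FibrantCubicalSet ℓ} (F : family A ⟶ family B) (cM : Composition (Sigma (family B) (IdFibre F))) →
           LLP (FibrantCubicalSets ℓ) DisplayMap A (fibrant (Sigma (family B) (IdFibre F)) cM) (tc F)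
tc-lifts F cM _ _ _ (display X Y c) u v sq = record { filler = diagonal ; upper = upper ; lower = lower }
  where open LiftTc F (composition Y) u v sq

-- Trivial display maps

module LiftPc {A B : Family (𝟙 {ℓ})} (F : A ⟶ B) {X : Family (𝟙 {ℓ})} {Y : Family (𝟙 ▷ X)} (E : Extension Y)
              (u : A ⟶ Sigma X Y) (v : Sigma B (PartialFibre F) ⟶ X) (sq : π₁ X Y ∘ᵐ u ≈ᵐ v ∘ᵐ pc F) where
  open PartialPreimage
  open Extension E
  private
    module A = Family A
    module B = Family B
    module X = Family X
    module Y = Family Y
    M = Sigma B (PartialFibre F)
    module M = Family M
    module AR = Restriction A
    module BR = Restriction B
    module XR = Restriction X
    module YR = Restriction Y
    module MR = Restriction M
    module 𝟙X = CubicalSet (𝟙 ▷ X)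
    ∣u∣ : ∀ {I} → A.Elem {I} tt → Family.Elem (Sigma X Y) {I} tt
    ∣u∣ = _⟶_.map u
    ∣v∣ : ∀ {I} → M.Elem {I} tt → X.Elem {I} tt
    ∣v∣ = _⟶_.map v

  module _ {I : ℕ} {b : B.Elem {I} tt} (t : PartialPreimage F tt b) where

    -- On its extent `t` is a total element `a`, and `over` identifies `b` with `F a`, so `(b , t)`
    -- becomes `pc F a` there. Thus `u` prescribes the lift on the extent, and the extension
    -- supplies the rest.
    on-extent : (f : I ⇒ J) (p : extent t ⟨ f ⟩ᶠ ≈ᶠ 1ᶠ) → M ∋ (b , t) ∼[ f ] _⟶_.map (pc F) (Partial.at (element t) f p)
    on-extent f p = pair∼ {A = B} {B = PartialFibre F} (preimage∼ F {t = t} {proj₂ (_⟶_.map (pc F) (Partial.at (element t) f p))}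
      (cell∼ B (BR.res BR.∼▸ BR.sym≅ (BR.fromEq (over t f p)))) p
      λ g q _ → AR.uniq (AR.at∼ (element t) {p = p} {q} reflʰ) AR.res)

    value-cell : (f : I ⇒ J) (p : extent t ⟨ f ⟩ᶠ ≈ᶠ 1ᶠ) →
                 (tt , proj₁ (∣u∣ (Partial.at (element t) f p))) 𝟙X.· idʰ 𝟙X.≈ (tt , X.restrict f tt (∣v∣ (b , t)))
    value-cell f p = cell∼ X (XR.fromEq (sq _) XR.▸ XR.uniq (map∼ v (on-extent f p)) XR.res)

    values : Partial Y (tt , ∣v∣ (b , t)) (extent t)
    Partial.at         values f p = Y.restrict idʰ (value-cell f p) (proj₂ (∣u∣ (Partial.at (element t) f p)))
    Partial.compatible values {p = p} {q} d =
      YR.toRestrict (YR.quot∼ reflʰ YR.res (snd∼ (map∼ u (AR.at∼ (element t) {p = p} {q} d)) YR.∼▸ YR.res))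

  diagonal : M ⟶ Sigma X Y
  diagonal = makeMap (λ (b , t) → ∣v∣ (b , t) , ext (tt , ∣v∣ (b , t)) (extent t) (values t))
    (λ { {f = f} {b , t} {b′ , t′} m →
      let n = snd∼ {A = B} {B = PartialFibre F} m in
      pair∼ (ext-natural {u = values t} {u′ = values t′} (cell∼ X (map∼ v m)) (preimage∼-extent F {t = t} {t′} n)
        λ g p q → YR.sym≅ YR.res YR.▸ (snd∼ (map∼ u (preimage∼-element F {t = t} {t′} n {g} {p} {q})) YR.▸ YR.res)) })

  upper : diagonal ∘ᵐ pc F ≈ᵐ u
  upper a = Restriction.toEq (Sigma X Y) (pair∼ {A = X} {B = Y} {x = ∣v∣ (_⟶_.map (pc F) a)} {y = proj₂ (_⟶_.map diagonal (_⟶_.map (pc F) a))} {y′ = proj₂ (∣u∣ a)}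
    -- The extent of `pc F a` is 1, so the extension is forced to be the element given by `u a`.
    (ext-agrees (values (proj₂ (_⟶_.map (pc F) a))) idʰ refl YR.▸ (YR.sym≅ YR.res YR.▸
      snd∼ (map∼ u (AR.sym≅ AR.res)))))

  lower : π₁ X Y ∘ᵐ diagonal ≈ᵐ v
  lower e = X.reflᵃ

module _ {X : Family (𝟙 {ℓ})} {Y : Family (𝟙 ▷ X)} where
  private
    P = π₁ X Y
    module F = Fibres P
    module X = Family X
    module Y = Family Y
    module XR = Restriction X
    module YR = Restriction Y
    module FR = Restriction (Fibre P)
    module 𝟙X = CubicalSet (𝟙 ▷ X)
    S : ∀ {I} → Set ℓ
    S {I} = Family.Elem (Sigma X Y) {I} tt
  open PathElem

  module _ (E : Extension Y) where
    open Extension E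

    private
      empty : (x : X.Elem {I} tt) → Y.Elem (tt , x)
      empty x = ext (tt , x) 0ᶠ emptyₚ

      empty∼ : {x : X.Elem {I} tt} {x′ : X.Elem {J} tt} {f : I ⇒ J} → X ∋ x ∼[ f ] x′ → Y ∋ empty x ∼[ f ] empty x′
      empty∼ p = ext-natural (cell∼ X p) refl λ g q _ → ⊥-elim (0≉1 q)

      middle : Section (Fibre P)
      middle = makeSection (λ (_ , x) → (x , empty x) , constantPath P XR.refl≅)
        (λ { {ρ = _ , x} {_ , x′} {f} e → let xs = F.cellᴮ⁻ {b = x} {x′} e in
          F.fibre∼ {p = constantPath P XR.refl≅} {constantPath P XR.refl≅} xs (pair∼ (empty∼ xs))
            (λ g r → XR.uniq XR.res (XR.comp∼ reflʰ xs XR.res)) })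

    module _ {I : ℕ} {x : X.Elem {I} tt} (s : S {I}) (p : F.PathTo s x) (j : dM I) where

      place : X.Elem {I} tt
      place = at p idʰ (~ j)

      on-1 : Partial Y (tt , place) (j =1ᶠ)
      Partial.at         on-1 f c = Y.restrict f (cell∼ X (F.from∼ p f refl XR.∼▸
        XR.uniq (F.along∼ p reflʰ (trans (~-cong (=1-at j c)) ~1)) XR.res)) (proj₂ s)
      Partial.compatible on-1 d = YR.toRestrict (YR.quot∼ d YR.res YR.res)

      -- The point runs along `p` backwards, from `x` at `j = 0` to the point of `s` at `j = 1`, and
      -- its element of `Y` is extended from the single face `(j = 1)`. At `j = 0` this face is 0
      -- and the extension is `empty x`, the element of the center.
      shrunk : S {I}
      shrunk = place , ext (tt , place) (j =1ᶠ) on-1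

      shrunk-path : F.PathTo shrunk x
      shrunk-path = F.mkPath (λ f r → at p f (~ (j ⟨ f ⟩) ∨ r))
        (λ {_} {_} {f} {g} c d → F.along∼ p c (∨-cong (~-cong (trans (≡⇒≈ᴵ (⟨⟩-⨟ j f g)) (⟨⟩-cong (refl {r = j}) c))) d))
        (λ f → F.along∼ p reflʰ (sym (∨-0 _)))
        (λ f → F.to∼ p f (∨1ᴵ _))

    extension⇒π₁-equivalence : IsEquivalenceᵐ P
    extension⇒π₁-equivalence = record
      { center      = middle
      ; contraction = makeHomotopy (middle [ π (Fibre P) ]ˢ) (λ (s , p) j → shrunk s p j , shrunk-path s p j)
          (λ { {ρ = _ , x} {_ , x′} {s , p} {s′ , p′} {f} {j} {j′} m d →
            let ps = F.fibre∼-path {p = p} {p′} m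
                pl = F.along∼ p {h = f ⨟ idʰ} (λ i → sym (≡⇒≈ᴵ (⟨⟩-id (f i)))) (~-cong d) XR.∼▸ ps idʰ (~ j′)
            in F.fibre∼ {p = shrunk-path s p j} {shrunk-path s′ p′ j′} (F.cellᴮ⁻ {b = x} {x′} (FR.base m))
              (pair∼ (ext-natural {u = on-1 s p j} {u′ = on-1 s′ p′ j′} (cell∼ X pl) (trans (=1ᶠ-⟨⟩ j f) (=1-cong d))
                λ g c c′ → YR.uniq YR.res (YR.comp∼ reflʰ (snd∼ (F.fibre∼-point {p = p} {p′} m)) YR.res)))
              (λ g r → F.along≅ p reflʰ (∨-cong (~-cong (trans (≡⇒≈ᴵ (≡.sym (⟨⟩-⨟ j f g))) (⟨⟩-cong d (reflʰ {f = g})))) refl) XR.▸ ps g _) })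
          (λ { {ρ = _ , x} (s , p) → FR.toEq {ρ = tt , x} {shrunk s p 0ᴵ , shrunk-path s p 0ᴵ} {(x , empty x) , constantPath P XR.refl≅}
            (F.fibre∼ {p = shrunk-path s p 0ᴵ} {constantPath P XR.refl≅} XR.refl≅
              (pair∼ (ext-natural {u = on-1 s p 0ᴵ} {u′ = emptyₚ} (cell∼ X (XR.sym≅ (F.to∼ p idʰ ~0))) refl λ g c _ → ⊥-elim (0≉1 c)))
              (λ g r → XR.uniq (F.to∼ p g (trans (∨-cong ~0 refl) (1∨ᴵ r))) XR.res)) })
          (λ { {ρ = _ , x} (s , p) → FR.toEq {ρ = tt , x} {shrunk s p 1ᴵ , shrunk-path s p 1ᴵ} {s , p}
            (F.fibre∼ {p = shrunk-path s p 1ᴵ} {p} XR.refl≅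
              (pair∼ (ext-agrees (on-1 s p 1ᴵ) idʰ refl YR.▸ YR.sym≅ YR.res))
              (λ g r → F.along≅ p reflʰ (trans (∨-cong ~1 refl) (0∨ᴵ r)))) })
      }

  module _ (c : Composition Y) (E : Extension (Fibre P)) where
    private
      module E = Extension E
      module T = Transport c

    module _ {I : ℕ} (x : X.Elem {I} tt) (φ : Face I) (u : Partial Y (tt , x) φ) where

      over-x : Partial (Fibre P) (tt , x) φ
      over-x = F.fibrePartial (λ h q → X.restrict h tt x , Partial.at u h q) (λ h q → constantPath P XR.refl≅)
        (λ {_} {_} {h} {m} {h′} d → pair∼ (YR.at∼ u d) , λ n r →
          XR.uniq (XR.comp∼ (λ i → trans (sym (⨟-assoc h m n i)) (⟨⟩-cong (d i) (reflʰ {f = n}))) XR.res XR.res) (XR.comp∼ reflʰ XR.res XR.res))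

      opaque
        extended : Family.Elem (Fibre P) (tt , x)
        extended = E.ext (tt , x) φ over-x

        s : S {I}
        s = proj₁ extended

        p : F.PathTo s x
        p = proj₂ extended

        agrees : (h : I ⇒ J) (q : φ ⟨ h ⟩ᶠ ≈ᶠ 1ᶠ) →
                 Sigma X Y ∋ s ∼[ h ] (X.restrict h tt x , Partial.at u h q) ×
                 (∀ {K} (m : J ⇒ K) r → X ∋ at p (h ⨟ m) r ≅ X.restrict m tt (X.restrict h tt x))
        agrees h q = F.fibre∼-point {p = p} {constantPath P XR.refl≅} n , F.fibre∼-path {p = p} {constantPath P XR.refl≅} n
          where
          n : _∋_∼[_]_ (Fibre P) {ρ = tt , x} {tt , X.restrict h tt x} (s , p) h (Partial.at over-x h q)
          n = E.ext-agrees over-x h q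

      line : 𝟙X.Cell (suc I)
      line = tt , at p weaken (name zero)

      line-start : (tt , proj₁ s) 𝟙X.· idʰ 𝟙X.≈ line 𝟙X.· ι₀
      line-start = cell∼ X (F.from∼ p idʰ refl XR.∼▸ XR.uniq (F.along∼ p {f = weaken} {ι₀} {idʰ} reflʰ refl) XR.res)

      line-end : line 𝟙X.· ι₁ 𝟙X.≈ (tt , x)
      line-end = cell∼ X (F.along∼ p {f = weaken} {ι₁} {idʰ} reflʰ refl XR.∼▸ XR.sym≅ (F.to∼ p idʰ refl))

      line-constant : T.ConstantOn line φ
      line-constant h q = 𝟙X.transˣ (𝟙X.symˣ (𝟙X.·-shift {f = idʰ} {weaken ⨟ h} line-start)) (cell∼ X
        (F.from∼ p (weaken ⨟ h) refl XR.∼▸ (F.along≅ p (λ i → sym (≡⇒≈ᴵ (⟨⟩-id (h (suc i))))) refl XR.▸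
          (proj₂ (agrees (weaken ⨟ h) q) idʰ 0ᴵ XR.▸ (XR.sym≅ (proj₂ (agrees (weaken ⨟ h) q) idʰ (h zero)) XR.▸
            (F.along≅ p (λ i → ≡⇒≈ᴵ (⟨⟩-id (h (suc i)))) refl XR.▸ XR.uniq (F.along∼ p reflʰ refl) XR.res))))))

      opaque
        start : Y.Elem (line 𝟙X.· ι₀)
        start = Y.restrict idʰ line-start (proj₂ s)

        start≅ : Y ∋ proj₂ s ≅ start
        start≅ = YR.res

        corrected : Y.Elem (tt , x)
        corrected = Y.restrict idʰ (𝟙X.transˣ 𝟙X.·-id line-end) (T.transport line φ line-constant start)

        corrected≅ : Y ∋ T.transport line φ line-constant start ≅ corrected
        corrected≅ = YR.res

    opaque
      unfolding extended

      extended-natural : {x : X.Elem {I} tt} {φ : Face I} {u : Partial Y (tt , x) φ} {x′ : X.Elem {J} tt} {φ′ : Face J}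
        {u′ : Partial Y (tt , x′) φ′} {f : I ⇒ J} → X ∋ x ∼[ f ] x′ → φ ⟨ f ⟩ᶠ ≈ᶠ φ′ →
        (∀ {K} (g : J ⇒ K) q q′ → Y ∋ Partial.at u (f ⨟ g) q ≅ Partial.at u′ g q′) →
        Sigma X Y ∋ s x φ u ∼[ f ] s x′ φ′ u′ × (∀ {K} (m : J ⇒ K) r → X ∋ at (p x φ u) (f ⨟ m) r ≅ at (p x′ φ′ u′) m r)
      extended-natural {x = x} {φ} {u} {x′} {φ′} {u′} {f} xs φs us =
        F.fibre∼-point {p = p x φ u} {p x′ φ′ u′} n , F.fibre∼-path {p = p x φ u} {p x′ φ′ u′} n
        where
        n : _∋_∼[_]_ (Fibre P) {ρ = tt , x} {tt , x′} (extended x φ u) f (extended x′ φ′ u′)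
        n = E.ext-natural (F.cellᴮ xs) φs λ g q q′ → F.fibre∼ {p = constantPath P XR.refl≅} {constantPath P XR.refl≅}
          (XR.uniq XR.res (XR.comp∼ reflʰ xs XR.res)) (pair∼ (us g q q′))
          (λ m r → XR.uniq (XR.comp∼ (⨟-assoc f g m) XR.res XR.res) (XR.comp∼ reflʰ xs (XR.comp∼ reflʰ XR.res XR.res)))

    -- Extending in the fibre of `π₁`, with constant paths on `φ`, gives an element over a point
    -- joined to `x` only by a path. Transport along this path brings it over `x`, and fixes it on
    -- `φ`, where the path is constant.
    π₁-equivalence⇒extension : Extension Y
    Extension.ext         π₁-equivalence⇒extension (_ , x) φ u = corrected x φ u
    Extension.ext-agrees  π₁-equivalence⇒extension {ρ = _ , x} {φ} u h q = YR.sym≅ (corrected≅ x φ u) YR.≅▸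
      T.transport∼-constant (line x φ u) φ (line-constant x φ u) (start x φ u) h q
        (YR.sym≅ (start≅ x φ u) YR.≅▸ snd∼ (proj₁ (agrees x φ u h q)))
    Extension.ext-natural π₁-equivalence⇒extension {ρ = _ , x} {φ} {u} {_ , x′} {φ′} {u′} {f} e φs us =
      let n = extended-natural {u = u} {u′ = u′} (F.cellᴮ⁻ {b = x} {x′} e) φs us in
      YR.sym≅ (corrected≅ x φ u) YR.≅▸ (T.transport∼
        (cell∼ X (F.along∼ (p x φ u) {h = f ⨟ weaken} reflʰ refl XR.∼▸ proj₂ n weaken (name zero)))
        φs
        (YR.sym≅ (start≅ x φ u) YR.≅▸ (snd∼ (proj₁ n) YR.∼▸ start≅ x′ φ′ u′)) YR.∼▸ corrected≅ x′ φ′ u′)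

-- Functoriality of the two factorizations

module IdSquare {X Y X′ Y′ : Family (𝟙 {ℓ})} (f : X ⟶ Y) (f′ : X′ ⟶ Y′) (u : X ⟶ X′) (v : Y ⟶ Y′)
                (s : f′ ∘ᵐ u ≈ᵐ v ∘ᵐ f) where
  private
    module F = Fibres f
    module F′ = Fibres f′
    module YR = Restriction Y
    module Y′R = Restriction Y′
    module X′R = Restriction X′
    open Contract using (IdTo)
  open PathElem
  open IdElem

  -- The extent can be kept: on it the path is constant at `f x`, so its image is constant at
  -- `v (f x)`, which is `f′ (u x)` because the square commutes.
  onPath : {x : Family.Elem X {I} tt} {y : Family.Elem Y {I} tt} →
           IdTo f x y → IdTo f′ (_⟶_.map u x) (_⟶_.map v y)
  onPath p = record
    { path     = F′.mkPath (λ h r → _⟶_.map v (at (path p) h r)) (λ c d → map∼ v (F.along∼ (path p) c d))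
        (λ h → Y′R.fromEq (s _) Y′R.≅▸ map∼ v (F.from∼ (path p) h refl)) (λ h → map∼ v (F.to∼ (path p) h refl))
    ; extent   = extent p
    ; constant = λ h m r → Y′R.toEq (map∼ v (YR.fromEq (constant p h m r)) Y′R.▸
        (Y′R.sym≅ (Y′R.fromEq (s _)) Y′R.▸ map∼ f′ (X′R.uniq (map∼ u (Restriction.res X)) X′R.res)))
    }

  onMid : F.Mid ⟶ F′.Mid
  onMid = makeMap (λ (y , x , p) → _⟶_.map v y , _⟶_.map u x , onPath p)
    (λ { {x = y , x , p} {y′ , x′ , p′} m → F′.mid∼ {p = onPath p} {p′ = onPath p′}
      (map∼ v (F.mid∼-target {p = p} {p′ = p′} m)) (map∼ u (F.mid∼-source {p = p} {p′ = p′} m))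
      (λ g r → map∼ v (F.mid∼-path {p = p} {p′ = p′} m g r)) (F.mid∼-extent {p = p} {p′ = p′} m) })

idFunctorial : Functorial (FibrantCubicalSets ℓ) (UniformComposition.factorization idUniform 𝟙)
idFunctorial = record
  { map       = λ f f′ u v s → IdSquare.onMid f f′ u v s
  ; map-left  = λ {_} {_} {X′} {Y′} f f′ u v s x → Restriction.toEq (Fibres.Mid f′)
      (Fibres.mid∼ f′ {p = IdSquare.onPath f f′ u v s (proj₂ (proj₂ (_⟶_.map (tc f) x)))} {p′ = proj₂ (proj₂ (_⟶_.map (tc f′) (_⟶_.map u x)))}
        (Restriction.sym≅ (family Y′) (Restriction.fromEq (family Y′) (s x))) (Restriction.refl≅ (family X′))
        (λ g r → Restriction._▸_ (family Y′) (Restriction.sym≅ (family Y′) (Restriction.fromEq (family Y′) (s _)))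
          (map∼ f′ (Restriction.uniq (family X′) (map∼ u (Restriction.res _)) (Restriction.res (family X′)))))
        refl)
  ; map-right = λ {_} {_} {_} {Y′} f f′ u v s e → Family.reflᵃ (family Y′)
  ; map-cong  = λ {_} {_} {X′} {Y′} f f′ u u′ v v′ s s′ us vs (y , x , p) → Restriction.toEq (Fibres.Mid f′)
      (Fibres.mid∼ f′ {p = IdSquare.onPath f f′ u v s p} {p′ = IdSquare.onPath f f′ u′ v′ s′ p}
        (Restriction.fromEq (family Y′) (vs y)) (Restriction.fromEq (family X′) (us x))
        (λ g r → Restriction.fromEq (family Y′) (vs _)) (⟨⟩ᶠ-id _))
  ; map-id    = λ {X} {Y} f s (y , x , p) → Restriction.toEq (Fibres.Mid f)
      (Fibres.mid∼ f {p = IdSquare.onPath f f idᵐ idᵐ s p} {p′ = p}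
        (Restriction.refl≅ (family Y)) (Restriction.refl≅ (family X))
        (λ g r → Restriction.refl≅ (family Y)) (⟨⟩ᶠ-id _))
  ; map-∘     = λ {_} {_} {_} {_} {X″} {Y″} f f′ f″ u v u′ v′ s s′ t (y , x , p) → Restriction.toEq (Fibres.Mid f″)
      (Fibres.mid∼ f″ {p = IdSquare.onPath f f″ (u′ ∘ᵐ u) (v′ ∘ᵐ v) t p} {p′ = IdSquare.onPath f′ f″ u′ v′ s′ (IdSquare.onPath f f′ u v s p)}
        (Restriction.refl≅ (family Y″)) (Restriction.refl≅ (family X″))
        (λ g r → Restriction.refl≅ (family Y″)) (⟨⟩ᶠ-id _))
  }

module PartialSquare {X Y X′ Y′ : Family (𝟙 {ℓ})} (f : X ⟶ Y) (f′ : X′ ⟶ Y′) (u : X ⟶ X′) (v : Y ⟶ Y′)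
                     (s : f′ ∘ᵐ u ≈ᵐ v ∘ᵐ f) where
  open PartialPreimage
  private
    module Y′R = Restriction Y′
    module YR = Restriction Y

  onPartial : {y : Family.Elem Y {I} tt} → PartialPreimage f tt y → PartialPreimage f′ tt (_⟶_.map v y)
  onPartial t = record
    { extent  = extent t
    ; element = mapₚ u (element t)
    ; over    = λ h p → Y′R.toEq (Y′R.fromEq (s _) Y′R.▸ (map∼ v (YR.fromEq (over t h p)) Y′R.▸
        Y′R.uniq (map∼ v YR.res) Y′R.res))
    }

  onMid : Sigma Y (PartialFibre f) ⟶ Sigma Y′ (PartialFibre f′)
  onMid = makeMap (λ (y , t) → _⟶_.map v y , onPartial t)
    (λ { {x = y , t} {y′ , t′} m →
      let n = snd∼ {A = Y} {B = PartialFibre f} m in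
      pair∼ {A = Y′} {B = PartialFibre f′} (preimage∼ f′ {t = onPartial t} {onPartial t′}
        (cell∼ Y′ (map∼ v (fst∼ {A = Y} {B = PartialFibre f} m))) (preimage∼-extent f {t = t} {t′} n)
        λ g p q → map∼ u (preimage∼-element f {t = t} {t′} n {g} {p} {q})) })

module _ {X Y : Family (𝟙 {ℓ})} (f : X ⟶ Y) where
  open PartialPreimage

  partial≈ : {y y′ : Family.Elem Y {I} tt} {t : PartialPreimage f tt y} {t′ : PartialPreimage f tt y′} →
             Y ∋ y ≅ y′ → extent t ≈ᶠ extent t′ →
             (∀ {K} (g : I ⇒ K) p q → X ∋ Partial.at (element t) g p ≅ Partial.at (element t′) g q) →
             Family._≋_ (Sigma Y (PartialFibre f)) (y , t) (y′ , t′)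
  partial≈ {t = t} {t′} p c m = Restriction.toEq (Sigma Y (PartialFibre f)) (pair∼ {A = Y} {B = PartialFibre f}
    (preimage∼ f {t = t} {t′} (cell∼ Y p) (trans (⟨⟩ᶠ-id _) c) m))

partialFunctorial : Functorial (FibrantCubicalSets ℓ) (UniformComposition.factorization partialUniform 𝟙)
partialFunctorial = record
  { map       = λ f f′ u v s → PartialSquare.onMid f f′ u v s
  ; map-left  = λ {_} {_} {X′} {Y′} f f′ u v s x → partial≈ f′
      {t = PartialSquare.onPartial f f′ u v s (proj₂ (_⟶_.map (pc f) x))} {proj₂ (_⟶_.map (pc f′) (_⟶_.map u x))}
      (Restriction.sym≅ (family Y′) (Restriction.fromEq (family Y′) (s x))) refl
      (λ g p q → Restriction.uniq (family X′) (map∼ u (Restriction.res _)) (Restriction.res (family X′)))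
  ; map-right = λ {_} {_} {_} {Y′} f f′ u v s e → Family.reflᵃ (family Y′)
  ; map-cong  = λ {_} {_} {X′} {Y′} f f′ u u′ v v′ s s′ us vs (y , t) → partial≈ f′
      {t = PartialSquare.onPartial f f′ u v s t} {PartialSquare.onPartial f f′ u′ v′ s′ t}
      (Restriction.fromEq (family Y′) (vs y)) refl
      (λ g p q → Restriction._▸_ (family X′) (Restriction.fromEq (family X′) (us _))
        (map∼ u′ (Restriction.at≅ _ (PartialPreimage.element t) reflʰ)))
  ; map-id    = λ {X} {Y} f s (y , t) → partial≈ f {t = PartialSquare.onPartial f f idᵐ idᵐ s t} {t}
      (Restriction.refl≅ (family Y)) refl (λ g p q → Restriction.at≅ (family X) (PartialPreimage.element t) reflʰ)
  ; map-∘     = λ {_} {_} {_} {_} {X″} {Y″} f f′ f″ u v u′ v′ s s′ t (y , e) → partial≈ f″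
      {t = PartialSquare.onPartial f f″ (u′ ∘ᵐ u) (v′ ∘ᵐ v) t e} {PartialSquare.onPartial f′ f″ u′ v′ s′ (PartialSquare.onPartial f f′ u v s e)}
      (Restriction.refl≅ (family Y″)) refl
      (λ g p q → map∼ (u′ ∘ᵐ u) (Restriction.at≅ _ (PartialPreimage.element e) reflʰ))
  }

-- The pre-model-structure

module _ {ℓ : Level} where
  private
    𝒞 = FibrantCubicalSets ℓ
    DisplayLifting : MapClass 𝒞 (lsuc ℓ)
    DisplayLifting = LLP 𝒞 DisplayMap
    Obj = FibrantCubicalSet ℓ
  open UniformComposition

  idMid partialMid : (A B : Obj) → family A ⟶ family B → Obj
  idMid A B F = fibrant (Sigma (family B) (IdFibre F)) (total-comp idUniform A B F)
  partialMid A B F = fibrant (Sigma (family B) (PartialFibre F)) (total-comp partialUniform A B F)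

  id-display : (A B : Obj) (F : family A ⟶ family B) → DisplayMap (idMid A B F) B (π₁ (family B) (IdFibre F))
  id-display A B F = display B (fibrant (IdFibre F) (idMiddle A B F)) (total-comp idUniform A B F)

  partial-display : (A B : Obj) (F : family A ⟶ family B) →
                    DisplayMap (partialMid A B F) B (π₁ (family B) (PartialFibre F))
  partial-display A B F = display B (fibrant (PartialFibre F) (partialMiddle F)) (total-comp partialUniform A B F)

  tc-displayLifting : (A B : Obj) (F : family A ⟶ family B) → DisplayLifting A (idMid A B F) (tc F)
  tc-displayLifting A B F = tc-lifts {A = A} {B} F (total-comp idUniform A B F)

  display⇒fibration : ∀ {X Y p} → DisplayMap {ℓ} X Y p → Fibration X Y p
  display⇒fibration d A B i L = L _ _ _ d

  displayLifting⇒cofibration : ∀ {A B i} → DisplayLifting A B i → Cofibration A B i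
  displayLifting⇒cofibration L X Y p (d , _) = L X Y p d

  displayLifting⇒equivalence : ∀ {A B i} → DisplayLifting A B i → Equivalence A B i
  displayLifting⇒equivalence {A} {B} {i} L = retract⇒equivalence i (composition B) filler upper lower
    where open Filler (L _ _ _ (id-display A B i) (tc i) idᵐ (λ x → Family.reflᵃ (family B)))

  displayLifting⇒trivialCofibration : ∀ {A B i} → DisplayLifting A B i → TrivialCofibration A B i
  displayLifting⇒trivialCofibration L = displayLifting⇒cofibration L , displayLifting⇒equivalence L

  module _ {A B : Obj} (F : family A ⟶ family B) where

    tc-equivalence : Equivalence A (idMid A B F) (tc F)
    tc-equivalence = displayLifting⇒equivalence (tc-displayLifting A B F)

    -- F = π₁ ∘ tc, so that π₁ is an equivalence when F is.
    id-trivialDisplay : Equivalence A B F → TrivialDisplayMap (idMid A B F) B (π₁ (family B) (IdFibre F))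
    id-trivialDisplay w = id-display A B F , ThreeForTwo.second equivalence-3-for-2 A (idMid A B F) B (tc F)
      (π₁ (family B) (IdFibre F)) F (λ x → Family.reflᵃ (family B)) tc-equivalence w

  -- `r`, a lift of `i` against the second half of its own factorization, exhibits `i` as a retract
  -- of `tc i`, and `l` is the lift that `tc i` has. A cofibration is tested only against trivial
  -- display maps; `w` makes the second half one of these by 3-for-2.
  trivialCofibration⇒displayLifting : ∀ {A B i} → TrivialCofibration A B i → DisplayLifting A B i
  trivialCofibration⇒displayLifting {A} {B} {i} (cof , w) X Y p d u v sq = record
    { filler = filler l ∘ᵐ filler r
    ; upper  = λ x → Family.transᵃ (family X) (_⟶_.cong (filler l) (upper r x)) (upper l x)
    ; lower  = λ b → Family.transᵃ (family Y) (lower l _) (_⟶_.cong v (lower r b))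
    }
    where
    open Filler
    r = cof _ _ _ (id-trivialDisplay {A} {B} i w) (tc i) idᵐ (λ x → Family.reflᵃ (family B))
    l = tc-displayLifting A B i X Y p d u (v ∘ᵐ π₁ (family B) (IdFibre i)) sq

  -- The retract argument on the other side: lifting `p` against `tc p` exhibits `p` as a retract of
  -- the second half of its factorization, a trivial display map by 3-for-2, against which
  -- cofibrations lift by definition.
  cofibration-lifts : ∀ {A B i X Y p} → Cofibration A B i → TrivialFibration X Y p → Lifts 𝒞 {A} {B} {X} {Y} i p
  cofibration-lifts {A} {B} {i} {X} {Y} {p} cof (fib , w) u v sq = record
    { filler = filler l ∘ᵐ filler m
    ; upper  = λ x → Family.transᵃ (family X) (_⟶_.cong (filler l) (upper m x)) (upper l (_⟶_.map u x))
    ; lower  = λ b → Family.transᵃ (family Y) (lower l _) (lower m b)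
    }
    where
    open Filler
    l = fib _ _ _ (tc-displayLifting X Y p) idᵐ (π₁ (family Y) (IdFibre p)) (λ x → Family.reflᵃ (family Y))
    m = cof _ _ _ (id-trivialDisplay {X} {Y} p w) (tc p ∘ᵐ u) v sq

  module _ (A B : Obj) (F : family A ⟶ family B) where
    private
      P = π₁ (family B) (PartialFibre F)

    partial-equivalence : Equivalence (partialMid A B F) B P
    partial-equivalence = extension⇒π₁-equivalence (preimage-extension F)

    pc-cofibration : Cofibration A (partialMid A B F) (pc F)
    pc-cofibration _ _ _ (display X Y c , w) u v sq = record { filler = diagonal ; upper = upper ; lower = lower }
      where
      open LiftPc F (π₁-equivalence⇒extension (composition Y)
        (Fibres.equivalence⇒extension (π₁ (family X) (family Y)) c (composition X) w)) u v sq

    -- Lifting against `pc F` makes `F` a retract, over `B`, of the equivalence `P`. So the fibres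
    -- of `F` are retracts of those of `P`, and a partial element is extended by sending it there
    -- and its extension back.
    cofibrationLifting⇒equivalence : RLP 𝒞 Cofibration A B F → Equivalence A B F
    cofibrationLifting⇒equivalence L = Fibres.extension⇒equivalence F (extension-retract into back
      (λ { {ρ = _ , b} (x , p) → Restriction.toEq (Fibre F) {ρ = tt , b} {_⟶_.map back (_⟶_.map into (x , p))} {x , p}
        (Fibres.fibre∼ F {p = proj₂ (_⟶_.map back (_⟶_.map into (x , p)))} {p} (Restriction.refl≅ (family B))
          (Restriction.fromEq (family A) (upper x)) (λ g r → Restriction.refl≅ (family B))) })
      (Fibres.equivalence⇒extension P (total-comp partialUniform A B F) (composition B) partial-equivalence))
      where
      open Filler (L A (partialMid A B F) (pc F) pc-cofibration idᵐ P (λ x → Family.reflᵃ (family B)))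
      into : Fibre F ⟶ Fibre P
      into = fibreMap F P (pc F) (λ x → Family.reflᵃ (family B))

      back : Fibre P ⟶ Fibre F
      back = fibreMap P F filler lower

  cof-tfib-wfs : IsWeakFactorizationSystem 𝒞 Cofibration TrivialFibration
  cof-tfib-wfs = record
    { left-class  = λ A B i → mk⇔ (λ cof X Y p tf → cofibration-lifts cof tf)
        (λ L X Y p (d , w) → L X Y p (display⇒fibration d , w))
    ; right-class = λ X Y p → mk⇔ (λ tf A B i cof → cofibration-lifts cof tf)
        (λ L → (λ A B i D → L A B i (displayLifting⇒cofibration D)) , cofibrationLifting⇒equivalence X Y p L)
    ; factor      = λ A B F → factorization partialUniform 𝟙 A B F , pc-cofibration A B F ,
        display⇒fibration (partial-display A B F) , partial-equivalence A B F
    }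

  tcof-fib-wfs : IsWeakFactorizationSystem 𝒞 TrivialCofibration Fibration
  tcof-fib-wfs = record
    { left-class  = λ A B i → mk⇔ (λ tc X Y p fib → fib A B i (trivialCofibration⇒displayLifting tc))
        (λ L → displayLifting⇒trivialCofibration λ X Y p d → L X Y p (display⇒fibration d))
    ; right-class = λ X Y p → mk⇔ (λ fib A B i tc → fib A B i (trivialCofibration⇒displayLifting tc))
        (λ L A B i D → L A B i (displayLifting⇒trivialCofibration D))
    ; factor      = λ A B F → factorization idUniform 𝟙 A B F ,
        displayLifting⇒trivialCofibration (tc-displayLifting A B F) , display⇒fibration (id-display A B F)
    }

theorem4 : (ℓ : Level) →
    IsPreModelStructure (FibrantCubicalSets ℓ) Cofibration Fibration Equivalence
    × IsUniformFunctorialFactorization (idFactorization {ℓ}) TrivialCofibration Fibration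
    × IsUniformFunctorialFactorization (partialFactorization {ℓ}) Cofibration TrivialFibration
theorem4 ℓ =
  record { three-for-two = equivalence-3-for-2 ; cof-tfib = cof-tfib-wfs ; tcof-fib = tcof-fib-wfs } ,
  record
  { uniform    = idUniform
  ; functorial = idFunctorial
  ; left-in    = λ A B F → displayLifting⇒trivialCofibration (tc-displayLifting A B F)
  ; right-in   = λ A B F → display⇒fibration (id-display A B F)
  } ,
  record
  { uniform    = partialUniform
  ; functorial = partialFunctorial
  ; left-in    = pc-cofibration
  ; right-in   = λ A B F → display⇒fibration (partial-display A B F) , partial-equivalence A B F
  }
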